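{- Let $G$ be a quasi $4$-connected graph with $G\notin\mathcal G_6\cup\mathcal A$. Then there exists a $(G,\{\Pi,K\})$-chain of quasi $4$-connected graphs $G_0,G_1,\dots,G_t$ such that, for each $i=1,\dots,t$, either $\|G_i\|=\|G_{i-1}\|-1$ or $G_i=O_3(G_{i-1})$.
   Context: All graphs are finite; $|G|,\|G\|$ are numbers of vertices and edges. A separation of $G=(V,E)$ is a pair of subgraphs $G_1=(V_1,E_1)$, $G_2=(V_2,E_2)$ with $G_1\cup G_2=G$, $E_1\cap E_2=\emptyset$, $V_1\ne V\ne V_2$; a $k$-separation if $|V_1\cap V_2|=k$. $G$ is $3$-connected iff simple, $|G|>3$, with no $1$- or $2$-separation. $G$ is quasi $4$-connected if it is $3$-connected and every $3$-separation $(G_1,G_2)$ satisfies $\min\{|G_1|,|G_2|\}\le 4$. A $(G,\mathcal H)$-chain is a sequence $G_0=G,\dots,G_t\in\mathcal H$ with each $G_i$ a minor of $G_{i-1}$. $\mathcal G_6$ is the set of $3$-connected graphs with at most six vertices. For $n\ge3$, $L_n$ consists of paths $x_1\cdots x_n$, $y_1\cdots y_n$ and edges $x_iy_i$; $A_n=L_n+x_1x_n+y_1y_n$, $A_n'=L_n+x_1y_n+y_1x_n$; $\mathcal A=\{A_n,A_n':n\ge4\}$. The pyramid $\Pi$ has vertices $a,b,c,d,p,q,r$ and edges $ab,bc,ca,pa,pb,pd,qb,qc,qd,rc,ra,rd$. The kite $K$ has vertices $a,b,c,d,e,f,g$ and edges $ab,ac,bc,ad,af,bg,be,cf,cg,de,dg,ef$.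 Operation $O_3$: if $w$ is a vertex with $N(w)=\{x,y,z\}$, $xz,yz\in E(G)$, $xy\notin E(G)$, $d(x),d(y)\ge4$ and $d(z)\ge5$, then $O_3(G)=G/xw\backslash wz$, i.e. contract $xw$ and delete one of the resulting parallel edges to $z$. -}

module Defs where

open import Data.Bool using (Bool; true; false; _∧_; _∨_; not; if_then_else_)
open import Data.Bool.Properties using (∨-comm)
open import Data.Nat using (ℕ; zero; suc; _+_; _∸_; _≤_; _<_; _≡ᵇ_; _<ᵇ_)
open import Data.Fin using (Fin; toℕ)
import Data.Fin as Fin
open import Data.Fin.Subset using (Subset; _∈_; _∉_; _∩_; ∣_∣)
open import Data.List using (List; []; _∷_; _++_; map; upTo; allFin)
open import Data.Nat.ListAction using (sum)
open import Data.Bool.ListAction using (any)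
open import Data.Maybe using (Maybe; just; nothing; maybe)
open import Data.Product using (Σ; _×_; _,_; proj₁; proj₂; ∃)
open import Data.Sum using (_⊎_)
open import Relation.Nullary using (¬_; does)
open import Relation.Binary.PropositionalEquality using (_≡_; _≢_; refl; cong; cong₂; trans)
open import Function.Bundles using (_↔_; Inverse)

record Graph : Set where
  field
    n     : ℕ
    adj   : Fin n → Fin n → Bool
    sym   : ∀ u v → adj u v ≡ adj v u
    irref : ∀ u → adj u u ≡ false
open Graph public

edgeCount : Graph → ℕ
edgeCount G =
  sum (map (λ u → sum (map (λ v → if adj G u v ∧ (toℕ u <ᵇ toℕ v) then 1 else 0)
                           (allFin (n G))))
           (allFin (n G)))

degree : (G : Graph) → Fin (n G) → ℕ
degree G w = sum (map (λ v → if adj G w v then 1 else 0) (allFin (n G)))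

-- Separations.  A separation (G₁,G₂) with G₁ ∪ G₂ = G, E₁ ∩ E₂ = ∅ is
-- determined by vertex sets V₁,V₂ with V₁ ∪ V₂ = V, V₁ ≠ V ≠ V₂, such that
-- every edge of G lies in G₁ (both ends in V₁) or in G₂ (both ends in V₂);
-- the edge sets E₁,E₂ are then obtained by assigning each edge to one side.

record Separation (G : Graph) : Set where
  field
    V₁ V₂  : Subset (n G)
    cover  : ∀ v → v ∈ V₁ ⊎ v ∈ V₂
    edges  : ∀ u v → adj G u v ≡ true → (u ∈ V₁ × v ∈ V₁) ⊎ (u ∈ V₂ × v ∈ V₂)
    V₁≠V   : ¬ (∀ v → v ∈ V₁)
    V₂≠V   : ¬ (∀ v → v ∈ V₂)
open Separation public

order : {G : Graph} → Separation G → ℕ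
order S = ∣ V₁ S ∩ V₂ S ∣

ThreeConnected : Graph → Set
ThreeConnected G =
  3 < n G × (∀ (S : Separation G) → order S ≢ 1 × order S ≢ 2)

Quasi4Connected : Graph → Set
Quasi4Connected G =
  ThreeConnected G ×
  (∀ (S : Separation G) → order S ≡ 3 → ∣ V₁ S ∣ ≤ 4 ⊎ ∣ V₂ S ∣ ≤ 4)

_≅_ : Graph → Graph → Set
G ≅ H = Σ (Fin (n G) ↔ Fin (n H)) λ f →
          ∀ u v → adj H (Inverse.to f u) (Inverse.to f v) ≡ adj G u v

-- Minors, via models: each vertex h of H gets a nonempty branch set
-- {g | φ g ≡ just h} in G (pairwise disjoint by construction) inducing a
-- connected subgraph, and each edge of H is realised by an edge of G
-- between the corresponding branch sets.

data Walk (G : Graph) (p : Fin (n G) → Bool) : Fin (n G) → Fin (n G) → Set where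
  here : ∀ {u} → p u ≡ true → Walk G p u u
  step : ∀ {u w v} → p u ≡ true → adj G u w ≡ true → Walk G p w v → Walk G p u v

_≼_ : Graph → Graph → Set
H ≼ G =
  Σ (Fin (n G) → Maybe (Fin (n H))) λ φ →
    let inB : Fin (n H) → Fin (n G) → Bool
        inB h g = maybe (λ h′ → does (h′ Fin.≟ h)) false (φ g)
    in (∀ h → ∃ λ g → φ g ≡ just h)
     × (∀ h g g′ → φ g ≡ just h → φ g′ ≡ just h → Walk G (inB h) g g′)
     × (∀ h h′ → adj H h h′ ≡ true →
          Σ (Fin (n G)) λ g → Σ (Fin (n G)) λ g′ →
            φ g ≡ just h × φ g′ ≡ just h′ × adj G g g′ ≡ true)

-- (Simple) contraction of the edge xw: H ≅ G/xw with parallel edges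
-- identified.  Given by a surjection f : V(G) → V(H) identifying exactly
-- x and w, with a ~ b in H iff a ≠ b and some edge of G maps onto ab.

ContractsTo : (G : Graph) → Fin (n G) → Fin (n G) → Graph → Set
ContractsTo G x w H =
  Σ (Fin (n G) → Fin (n H)) λ f →
      (∀ a → ∃ λ u → f u ≡ a)
    × f x ≡ f w
    × (∀ u v → f u ≡ f v → u ≡ v ⊎ ((u ≡ x ⊎ u ≡ w) × (v ≡ x ⊎ v ≡ w)))
    × (∀ a b → adj H a b ≡ true →
         a ≢ b × (Σ (Fin (n G)) λ u → Σ (Fin (n G)) λ v →
                    f u ≡ a × f v ≡ b × adj G u v ≡ true))
    × (∀ a b → a ≢ b → (Σ (Fin (n G)) λ u → Σ (Fin (n G)) λ v →
                    f u ≡ a × f v ≡ b × adj G u v ≡ true) → adj H a b ≡ true)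

-- Operation O₃:  H = O₃(G) = G/xw \ wz  (up to isomorphism).  Since
-- N(w) = {x,y,z} and z is the only common neighbour of x and w, deleting
-- one of the two parallel edges to z from G/xw gives exactly the simple
-- contraction of xw.
O3Step : Graph → Graph → Set
O3Step G H =
  Σ (Fin (n G)) λ w → Σ (Fin (n G)) λ x → Σ (Fin (n G)) λ y → Σ (Fin (n G)) λ z →
      x ≢ y × x ≢ z × y ≢ z
    × (∀ v → adj G w v ≡ true → v ≡ x ⊎ v ≡ y ⊎ v ≡ z)
    × adj G w x ≡ true × adj G w y ≡ true × adj G w z ≡ true
    × adj G x z ≡ true × adj G y z ≡ true × adj G x y ≡ false
    × 4 ≤ degree G x × 4 ≤ degree G y × 5 ≤ degree G z
    × ContractsTo G x w H

private
  ≡ᵇ-sym : ∀ a b → (a ≡ᵇ b) ≡ (b ≡ᵇ a)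
  ≡ᵇ-sym zero zero = refl
  ≡ᵇ-sym zero (suc b) = refl
  ≡ᵇ-sym (suc a) zero = refl
  ≡ᵇ-sym (suc a) (suc b) = ≡ᵇ-sym a b

  ≡ᵇ-refl : ∀ a → (a ≡ᵇ a) ≡ true
  ≡ᵇ-refl zero = refl
  ≡ᵇ-refl (suc a) = ≡ᵇ-refl a

  isEdge : ℕ → ℕ → ℕ × ℕ → Bool
  isEdge u v (a , b) = ((a ≡ᵇ u) ∧ (b ≡ᵇ v)) ∨ ((a ≡ᵇ v) ∧ (b ≡ᵇ u))

  mem : List (ℕ × ℕ) → ℕ → ℕ → Bool
  mem es u v = any (isEdge u v) es

  mem-sym : ∀ es u v → mem es u v ≡ mem es v u
  mem-sym [] u v = refl
  mem-sym ((a , b) ∷ es) u v =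
    cong₂ _∨_ (∨-comm ((a ≡ᵇ u) ∧ (b ≡ᵇ v)) ((a ≡ᵇ v) ∧ (b ≡ᵇ u))) (mem-sym es u v)

  fadj : (m : ℕ) → List (ℕ × ℕ) → Fin m → Fin m → Bool
  fadj m es u v = not (toℕ u ≡ᵇ toℕ v) ∧ mem es (toℕ u) (toℕ v)

fromEdges : (m : ℕ) → List (ℕ × ℕ) → Graph
fromEdges m es = record
  { n = m
  ; adj = fadj m es
  ; sym = λ u v → cong₂ _∧_ (cong not (≡ᵇ-sym (toℕ u) (toℕ v))) (mem-sym es (toℕ u) (toℕ v))
  ; irref = λ u → cong (λ t → not t ∧ mem es (toℕ u) (toℕ u)) (≡ᵇ-refl (toℕ u))
  }

-- Pyramid Π: a b c d p q r = 0 1 2 3 4 5 6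
Pyramid : Graph
Pyramid = fromEdges 7
  ( (0 , 1) ∷ (1 , 2) ∷ (2 , 0) ∷ (4 , 0) ∷ (4 , 1) ∷ (4 , 3)
  ∷ (5 , 1) ∷ (5 , 2) ∷ (5 , 3) ∷ (6 , 2) ∷ (6 , 0) ∷ (6 , 3) ∷ [])

-- Kite K: a b c d e f g = 0 1 2 3 4 5 6
Kite : Graph
Kite = fromEdges 7
  ( (0 , 1) ∷ (0 , 2) ∷ (1 , 2) ∷ (0 , 3) ∷ (0 , 5) ∷ (1 , 6)
  ∷ (1 , 4) ∷ (2 , 5) ∷ (2 , 6) ∷ (3 , 4) ∷ (3 , 6) ∷ (4 , 5) ∷ [])

-- Ladder L_m on 2m vertices: x_{i+1} = i, y_{i+1} = m + i  (0 ≤ i < m)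
ladderEdges : ℕ → List (ℕ × ℕ)
ladderEdges m =
     map (λ i → (i , suc i)) (upTo (m ∸ 1))
  ++ map (λ i → (m + i , m + suc i)) (upTo (m ∸ 1))
  ++ map (λ i → (i , m + i)) (upTo m)

Aₙ : ℕ → Graph
Aₙ m = fromEdges (m + m) ((0 , m ∸ 1) ∷ (m , m + (m ∸ 1)) ∷ ladderEdges m)

A′ₙ : ℕ → Graph
A′ₙ m = fromEdges (m + m) ((0 , m + (m ∸ 1)) ∷ (m , m ∸ 1) ∷ ladderEdges m)

In𝒢₆ : Graph → Set
In𝒢₆ G = ThreeConnected G × n G ≤ 6

In𝒜 : Graph → Set
In𝒜 G = Σ ℕ λ m → 4 ≤ m × (G ≅ Aₙ m ⊎ G ≅ A′ₙ m)

{-# OPTIONS --safe #-}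
module Submission where

open import Defs hiding (here; step) renaming (sym to adj-sym)
open import Data.Bool using (Bool; true; false; _∧_; _∨_; not; if_then_else_; T)
import Data.Bool.Properties as 𝔹
open import Data.Nat using (ℕ; zero; suc; _+_; _∸_; _*_; _≤_; _<_; _≡ᵇ_; _<ᵇ_; z≤n; s≤s)
import Data.Nat.Properties as ℕ
open import Data.Fin using (Fin; zero; suc; toℕ)
open import Data.Fin.Properties using (_≟_; any?; all?; injective⇒≤)
import Data.Fin.Properties as FinP
open import Data.Fin.Subset using (Subset; ∣_∣; _∩_; _∪_; ⁅_⁆) renaming (_∈_ to _∈ˢ_; _∉_ to _∉ˢ_; _⊆_ to _⊆ˢ_; _⊂_ to _⊂ˢ_)
import Data.Fin.Subset.Properties as Sub
open import Data.List using (List; []; _∷_; length; allFin; map; upTo; tabulate; _++_)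
open import Data.List.Membership.Propositional using (_∈_; _∉_)
import Data.List.Membership.DecPropositional as DecMem
import Data.List.Membership.Propositional.Properties as ListP
open import Data.Bool.ListAction using (any)
open import Data.List.Relation.Unary.Any using (Any; here; there)
import Data.List.Relation.Unary.Any as Any
open import Data.List.Relation.Unary.All using (All; []; _∷_)
import Data.List.Relation.Unary.All as All
open import Data.Maybe using (Maybe; just; nothing; maybe)
open import Data.Product using (Σ; Σ-syntax; ∃; ∃₂; _×_; _,_; proj₁; proj₂; swap)
open import Data.Sum using (_⊎_; inj₁; inj₂; [_,_]′)
open import Data.Unit using (tt)
open import Data.Empty using (⊥; ⊥-elim)
open import Data.Vec using (Vec; []; _∷_; lookup)
import Data.Vec as Vec
import Data.Vec.Properties as VecP
open import Function using (_∘_; id; case_of_)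
open import Function.Bundles using (_↔_; Inverse; mk↔ₛ′)
open import Relation.Nullary using (¬_; Dec; yes; no; does)
open import Relation.Nullary.Decidable using (_×-dec_; _⊎-dec_; ¬?; dec-true; dec-false; map′)
open import Relation.Unary using (Decidable)
open import Relation.Binary.PropositionalEquality
import Data.List.Properties as ListPr
open import Algebra.Properties.CommutativeMonoid.Sum ℕ.+-0-commutativeMonoid using (sum; sum-cong-≗; sum-remove; ∑-distrib-+; ∑-comm; sum-replicate-zero)
open import Data.Fin using (punchIn; punchOut)
import Data.Nat.ListAction as ListSum
open import Data.Nat.Solver using (module +-*-Solver)
open import Relation.Nullary.Decidable using (_→-dec_)
open import Data.List using (concatMap; filterᵇ)
open import Data.Fin.Patterns using (0F; 1F; 2F; 3F; 4F; 5F; 6F)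
open import Data.Unit using (⊤)
open import Relation.Nullary.Decidable using (_→-dec_; from-yes; toWitness)
import Data.Product.Properties as ProductP
open import Relation.Nullary.Decidable using (_→-dec_; from-yes)

-- For graphs with at least seven vertices quasi 4-connectivity means minimum degree at least three
-- together with the absence of a set of at most three vertices that leaves two vertices on each
-- side; this is `Good`. The chain is built by induction on the number of vertices and then of
-- edges. With at least eight vertices, either some step leads to a smaller good graph, or the graph
-- belongs to 𝒜 (`reduce`).
--
-- If a cubic vertex `w` lies in a triangle, the edges among its neighbours decide: with one such
-- edge, the edge from `w` to the third neighbour lies in no triangle and is contracted; with two,
-- `O₃` applies; with three, `w` and its neighbours form a K₄ and an edge not at `w` can be deleted.
-- If there are triangles but none has a cubic vertex, some edge of any given triangle can be
-- deleted: the separations that would forbid all three deletions cross each other, and their sides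
-- become so small that there are at most seven vertices (`triangle`). If there is no triangle, an
-- edge can be contracted unless its two ends lie in a common 4-cut with two vertices on each side.
--
-- There remain triangle-free graphs in which every edge lies in such a 4-cut. Shrinking a side of a
-- cut leads to a side with two vertices, or directly to a square with two cubic vertices
-- (`descend`). The square grows to four consecutive rungs of a ladder (`P⇒strip`), these extend
-- rung by rung (`extend`), and by finiteness the ladder closes up, straight or twisted, and
-- contains all vertices. So the graph is in 𝒜 (`ladder`).
--
-- The hypothesis excludes 𝒜 only for the given graph. Members of 𝒜 are cubic, however, and each
-- step with at least eight vertices leaves a vertex of degree at least four (`Rich`), so 𝒜 is never
-- met later.
--
-- On seven vertices, a good graph with a cubic vertex contains a spanning pyramid or kite, by a
-- finite search; an edge outside the copy may be deleted until the copy is the whole graph. Without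
-- cubic vertices the complement has maximum degree two, and an edge that is not bridged by a path
-- of length three in the complement can be deleted.

pattern 0th = here refl
pattern 1st = there (here refl)
pattern 2nd = there (there (here refl))
pattern 3rd = there (there (there (here refl)))
pattern 4th = there (there (there (there (here refl))))
pattern 5th = there (there (there (there (there (here refl)))))

Two : {A : Set} → (A → Set) → Set
Two P = ∃₂ λ p q → p ≢ q × P p × P q

Two-map : {A : Set} {P Q : A → Set} → (∀ {v} → P v → Q v) → Two P → Two Q
Two-map f (p , q , p≢q , Pp , Pq) = p , q , p≢q , f Pp , f Pq

drop₂ : ∀ {A : Set} {p a b : A} → p ∈ a ∷ b ∷ [] → ∃ λ s → ∀ {v} → v ∈ a ∷ b ∷ [] → v ≢ p → v ∈ s ∷ []
drop₂ 0th = _ , λ { 0th ne → ⊥-elim (ne refl) ; (there m) ne → m }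
drop₂ 1st = _ , λ { 0th ne → 0th ; 1st ne → ⊥-elim (ne refl) }

drop₃ : ∀ {A : Set} {p a b c : A} → p ∈ a ∷ b ∷ c ∷ [] → ∃₂ λ s t →
  (∀ {v} → v ∈ a ∷ b ∷ c ∷ [] → v ≢ p → v ∈ s ∷ t ∷ []) × (∀ {v} → v ∈ s ∷ t ∷ [] → v ∈ a ∷ b ∷ c ∷ [])
drop₃ 0th = _ , _ , (λ { 0th ne → ⊥-elim (ne refl) ; (there m) ne → m }) , there
drop₃ 1st = _ , _ , (λ { 0th ne → 0th ; 1st ne → ⊥-elim (ne refl) ; 2nd ne → 1st }) , λ { 0th → 0th ; 1st → 2nd }
drop₃ 2nd = _ , _ , (λ { 0th ne → 0th ; 1st ne → 1st ; 2nd ne → ⊥-elim (ne refl) }) , λ { 0th → 0th ; 1st → 1st }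

drop₄ : ∀ {A : Set} {p a b c d : A} → p ∈ a ∷ b ∷ c ∷ d ∷ [] → ∃ λ s → ∃₂ λ t u →
  ∀ {v} → v ∈ a ∷ b ∷ c ∷ d ∷ [] → v ≢ p → v ∈ s ∷ t ∷ u ∷ []
drop₄ 0th = _ , _ , _ , λ { 0th ne → ⊥-elim (ne refl) ; (there m) ne → m }
drop₄ {a = a} (there m) with drop₃ m
... | s , t , keep , _ = a , s , t , λ { (here e) ne → here e ; (there i) ne → there (keep i ne) }

-- Adjacency, the working form of quasi 4-connectivity, and 4-cuts.

Adj : (G : Graph) → Fin (n G) → Fin (n G) → Set
Adj G u v = adj G u v ≡ true

Nb : (G : Graph) → Fin (n G) → List (Fin (n G)) → Set
Nb G v L = ∀ {w} → Adj G v w → w ∈ L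

-- For at least 7 vertices this is quasi 4-connectivity: minimum degree at least 3, and
-- no separator of at most three vertices leaves two vertices on each side.
record Good (G : Graph) : Set₁ where
  field
    big   : 7 ≤ n G
    nbr   : ∀ v a b → ∃ λ w → Adj G v w × w ∉ a ∷ b ∷ []
    noSep : ∀ {P : Fin (n G) → Set} → Decidable P → ∀ a b c →
            (∀ {u v} → P u → Adj G u v → P v ⊎ v ∈ a ∷ b ∷ c ∷ []) →
            Two (λ v → P v × v ∉ a ∷ b ∷ c ∷ []) →
            Two (λ v → ¬ P v × v ∉ a ∷ b ∷ c ∷ []) → ⊥
open Good

data Side : Set where
  lo mid hi : Side

_≟ˢ_ : (a b : Side) → Dec (a ≡ b)
lo  ≟ˢ lo  = yes refl
lo  ≟ˢ mid = no λ ()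
lo  ≟ˢ hi  = no λ ()
mid ≟ˢ lo  = no λ ()
mid ≟ˢ mid = yes refl
mid ≟ˢ hi  = no λ ()
hi  ≟ˢ lo  = no λ ()
hi  ≟ˢ mid = no λ ()
hi  ≟ˢ hi  = yes refl

opp : Side → Side
opp lo  = hi
opp mid = mid
opp hi  = lo

opp-opp : ∀ s → opp (opp s) ≡ s
opp-opp lo  = refl
opp-opp mid = refl
opp-opp hi  = refl

opp-move : ∀ {s t} → opp s ≡ t → s ≡ opp t
opp-move {s} refl = sym (opp-opp s)

clash : {A : Set} {s t : Side} {x : Side} → x ≡ s → x ≡ t → s ≢ t → A
clash p q ne = ⊥-elim (ne (trans (sym p) q))

lo≢mid : lo ≢ mid
lo≢mid ()
lo≢hi : lo ≢ hi
lo≢hi ()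
mid≢hi : mid ≢ hi
mid≢hi ()
mid≢lo : mid ≢ lo
mid≢lo ()
hi≢lo : hi ≢ lo
hi≢lo ()
hi≢mid : hi ≢ mid
hi≢mid ()

-- A colouring of the vertices separating lo from hi by the four vertices e, f, g, h,
-- with at least two vertices on both sides.
record Cut₄ (G : Graph) (e f g h : Fin (n G)) : Set where
  field
    κ   : Fin (n G) → Side
    κe  : κ e ≡ mid
    κf  : κ f ≡ mid
    κg  : κ g ≡ mid
    κh  : κ h ≡ mid
    cov : ∀ {v} → κ v ≡ mid → v ∈ e ∷ f ∷ g ∷ h ∷ []
    cut : ∀ {u v} → κ u ≡ lo → κ v ≡ hi → ¬ Adj G u v
    los : Two (λ v → κ v ≡ lo)
    his : Two (λ v → κ v ≡ hi)

-- Only two of the four cut vertices are named: when an edge `e f` is contracted, a 3-separator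
-- through the merged vertex pulls back to such a cut.
FourSep : (G : Graph) → Fin (n G) → Fin (n G) → Set
FourSep G e f = ∃₂ (Cut₄ G e f)

module On (G : Graph) where
  V : Set
  V = Fin (n G)

  infix 4 _~_
  _~_ : V → V → Set
  u ~ v = Adj G u v

  ~sym : ∀ {u v} → u ~ v → v ~ u
  ~sym {u} {v} e = trans (adj-sym G v u) e

  ~≢ : ∀ {u v} → u ~ v → u ≢ v
  ~≢ {u} e refl with trans (sym e) (irref G u)
  ... | ()

  _~?_ : ∀ u v → Dec (u ~ v)
  u ~? v = adj G u v 𝔹.≟ true

  _∈?_ : (v : V) (L : List V) → Dec (v ∈ L)
  _∈?_ = DecMem._∈?_ _≟_

  ≢-by : ∀ {A : Set} {a b : A} {u v : V} (κ : V → A) → κ u ≡ a → κ v ≡ b → a ≢ b → u ≢ v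
  ≢-by κ p q ne refl = ne (trans (sym p) q)

  covers? : ∀ v L → Nb G v L ⊎ (∃ λ w → v ~ w × w ∉ L)
  covers? v L with any? (λ w → (v ~? w) ×-dec ¬? (w ∈? L))
  ... | yes p = inj₂ p
  ... | no ¬p = inj₁ λ {w} e → case w ∈? L of λ where
    (yes m) → m
    (no ¬m) → ⊥-elim (¬p (w , e , ¬m))

  fresh : (L : List V) → length L < n G → ∃ λ v → v ∉ L
  fresh L l< with any? (λ v → ¬? (v ∈? L))
  ... | yes p = p
  ... | no ¬p = ⊥-elim (ℕ.<⇒≱ l< (injective⇒≤ {f = λ v → Any.index (mem v)} inj))
    where
    mem : ∀ v → v ∈ L
    mem v with v ∈? L
    ... | yes m = m
    ... | no ¬m = ⊥-elim (¬p (v , ¬m))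
    at : ∀ {v} (M : List V) (m : v ∈ M) → Data.List.lookup M (Any.index m) ≡ v
    at (_ ∷ _) (here refl) = refl
    at (_ ∷ M) (there m) = at M m
    inj : ∀ {u v} → Any.index (mem u) ≡ Any.index (mem v) → u ≡ v
    inj {u} {v} eq = trans (sym (at L (mem u))) (trans (cong (Data.List.lookup L) eq) (at L (mem v)))

  -- This symmetry and the three swaps below reduce later case analyses to one representative per
  -- orbit.
  flip : ∀ {e f g h} → Cut₄ G e f g h → Cut₄ G e f g h
  flip F =
      let
          open Cut₄ F
      in record
           { κ = opp ∘ κ
           ; κe = cong opp κe ; κf = cong opp κf ; κg = cong opp κg ; κh = cong opp κh
           ; cov = cov ∘ opp-move
           ; cut = λ p q a → cut (opp-move q) (opp-move p) (~sym a)
           ; los = Two-map (cong opp) his ; his = Two-map (cong opp) los }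

  swap-ef : ∀ {e f g h} → Cut₄ G e f g h → Cut₄ G f e g h
  swap-ef F =
      let
          open Cut₄ F
      in record
           { κ = κ ; κe = κf ; κf = κe ; κg = κg ; κh = κh
           ; cov = λ p → case cov p of λ { 0th → 1st ; 1st → 0th ; 2nd → 2nd ; 3rd → 3rd }
           ; cut = cut ; los = los ; his = his }

  swap-gh : ∀ {e f g h} → Cut₄ G e f g h → Cut₄ G e f h g
  swap-gh F =
      let
          open Cut₄ F
      in record
           { κ = κ ; κe = κe ; κf = κf ; κg = κh ; κh = κg
           ; cov = λ p → case cov p of λ { 0th → 0th ; 1st → 1st ; 2nd → 3rd ; 3rd → 2nd }
           ; cut = cut ; los = los ; his = his }

  swap-fg : ∀ {e f g h} → Cut₄ G e f g h → Cut₄ G e g f h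
  swap-fg F =
      let
          open Cut₄ F
      in record
           { κ = κ ; κe = κe ; κf = κg ; κg = κf ; κh = κh
           ; cov = λ p → case cov p of λ { 0th → 0th ; 1st → 2nd ; 2nd → 1st ; 3rd → 3rd }
           ; cut = cut ; los = los ; his = his }

-- Graphs given by edge lists.

isEdge′ : ℕ → ℕ → ℕ × ℕ → Bool
isEdge′ u v (a , b) = ((a ≡ᵇ u) ∧ (b ≡ᵇ v)) ∨ ((a ≡ᵇ v) ∧ (b ≡ᵇ u))

Linked : List (ℕ × ℕ) → ℕ → ℕ → Set
Linked es a b = (a , b) ∈ es ⊎ (b , a) ∈ es

∧-true : ∀ {a b} → a ∧ b ≡ true → a ≡ true × b ≡ true
∧-true {true} {true} _ = refl , refl

∨-true : ∀ {a b} → a ∨ b ≡ true → a ≡ true ⊎ b ≡ true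
∨-true {true} _ = inj₁ refl
∨-true {false} e = inj₂ e

≡ᵇ-sound : ∀ {a b} → (a ≡ᵇ b) ≡ true → a ≡ b
≡ᵇ-sound {a} {b} e = ℕ.≡ᵇ⇒≡ a b (subst T (sym e) tt)

≡ᵇ-refl′ : ∀ a → (a ≡ᵇ a) ≡ true
≡ᵇ-refl′ zero = refl
≡ᵇ-refl′ (suc a) = ≡ᵇ-refl′ a

iff-≡ : ∀ {a b} → (a ≡ true → b ≡ true) → (b ≡ true → a ≡ true) → a ≡ b
iff-≡ {true} {true} f g = refl
iff-≡ {false} {false} f g = refl
iff-≡ {true} {false} f g = sym (f refl)
iff-≡ {false} {true} f g = g refl

any-sound : ∀ u v es → any (isEdge′ u v) es ≡ true → Linked es u v
any-sound u v ((a , b) ∷ es) e with ∨-true {isEdge′ u v (a , b)} e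
... | inj₂ e = Data.Sum.map there there (any-sound u v es e)
... | inj₁ e with ∨-true {(a ≡ᵇ u) ∧ (b ≡ᵇ v)} e
... | inj₁ e with ∧-true {a ≡ᵇ u} e
... | p , q with ≡ᵇ-sound {a} p | ≡ᵇ-sound {b} q
... | refl | refl = inj₁ 0th
any-sound u v ((a , b) ∷ es) _ | inj₁ _ | inj₂ e with ∧-true {a ≡ᵇ v} e
... | p , q with ≡ᵇ-sound {a} p | ≡ᵇ-sound {b} q
... | refl | refl = inj₂ 0th

any-complete : ∀ u v es → Linked es u v → any (isEdge′ u v) es ≡ true
any-complete u v (_ ∷ es) (inj₁ 0th) rewrite ≡ᵇ-refl′ u | ≡ᵇ-refl′ v = refl
any-complete u v (_ ∷ es) (inj₂ 0th) rewrite ≡ᵇ-refl′ u | ≡ᵇ-refl′ v | 𝔹.∨-zeroʳ ((v ≡ᵇ u) ∧ (u ≡ᵇ v)) = refl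
any-complete u v (p ∷ es) (inj₁ (there m)) rewrite any-complete u v es (inj₁ m) = 𝔹.∨-zeroʳ (isEdge′ u v p)
any-complete u v (p ∷ es) (inj₂ (there m)) rewrite any-complete u v es (inj₂ m) = 𝔹.∨-zeroʳ (isEdge′ u v p)

-- `isEdge′` has the body of the edge test that the statement keeps private, so adjacency in
-- `fromEdges` unfolds to it and becomes membership in the edge list.
fromEdges-sound : ∀ {N es} (u v : Fin N) → Adj (fromEdges N es) u v → Linked es (toℕ u) (toℕ v)
fromEdges-sound {es = es} u v e = any-sound (toℕ u) (toℕ v) es (proj₂ (∧-true {not (toℕ u ≡ᵇ toℕ v)} e))

fromEdges-complete : ∀ {N es} (u v : Fin N) → u ≢ v → Linked es (toℕ u) (toℕ v) → Adj (fromEdges N es) u v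
fromEdges-complete {es = es} u v u≢v l = cong₂ _∧_ ne (any-complete (toℕ u) (toℕ v) es l)
  where
  ne : not (toℕ u ≡ᵇ toℕ v) ≡ true
  ne with toℕ u ≡ᵇ toℕ v in e
  ... | false = refl
  ... | true = ⊥-elim (u≢v (FinP.toℕ-injective (≡ᵇ-sound e)))

-- Repetition-free lists, and the finite search on seven labelled vertices.

data Fresh {A : Set} : List A → Set where
  []  : Fresh []
  _∷_ : ∀ {x L} → x ∉ L → Fresh L → Fresh (x ∷ L)

fresh-injective : ∀ {A : Set} {L : List A} → Fresh L → ∀ {i j} → Data.List.lookup L i ≡ Data.List.lookup L j → i ≡ j
fresh-injective (x∉ ∷ fr) {zero} {zero} e = refl
fresh-injective (x∉ ∷ fr) {suc i} {suc j} e = cong suc (fresh-injective fr e)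
fresh-injective {L = x ∷ L} (x∉ ∷ fr) {zero} {suc j} e = ⊥-elim (x∉ (subst (_∈ L) (sym e) (ListP.∈-lookup j)))
fresh-injective {L = x ∷ L} (x∉ ∷ fr) {suc i} {zero} e = ⊥-elim (x∉ (subst (_∈ L) e (ListP.∈-lookup i)))

fresh-length : ∀ {m} {L : List (Fin m)} → Fresh L → length L ≤ m
fresh-length fr = injective⇒≤ (fresh-injective fr)

fresh-covers : ∀ {m} {L : List (Fin m)} → Fresh L → length L ≡ m → ∀ v → v ∈ L
fresh-covers {L = L} fr len v with DecMem._∈?_ _≟_ v L
... | yes p = p
... | no ¬p = ⊥-elim (ℕ.1+n≰n (ℕ.≤-trans (fresh-length (¬p ∷ fr)) (ℕ.≤-reflexive (sym len))))

∉[] : ∀ {A : Set} {x : A} → x ∉ []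
∉[] ()

_,,_ : ∀ {A : Set} {x y : A} {L} → x ≢ y → x ∉ L → x ∉ y ∷ L
(ne ,, x∉) (here e) = ne e
(ne ,, x∉) (there m) = x∉ m
infixr 4 _,,_

-- Upper triangular matrices, encoding the adjacency of a graph row by row.
Tri : ℕ → Set
Tri zero = ⊤
Tri (suc m) = Vec Bool m × Tri m

entry : ∀ {m} → Tri m → Fin m → Fin m → Bool
entry (r , M) zero zero = false
entry (r , M) zero (suc j) = lookup r j
entry (r , M) (suc i) zero = lookup r i
entry (r , M) (suc i) (suc j) = entry M i j

triangular : ∀ {m} → (Fin m → Fin m → Bool) → Tri m
triangular {zero} t = tt
triangular {suc m} t = Vec.tabulate (λ j → t zero (suc j)) , triangular (λ i j → t (suc i) (suc j))

entry-triangular : ∀ {m} (t : Fin m → Fin m → Bool) → (∀ i j → t i j ≡ t j i) → (∀ i → t i i ≡ false) →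
  ∀ i j → entry (triangular t) i j ≡ t i j
entry-triangular t sy ir zero zero = sym (ir zero)
entry-triangular t sy ir zero (suc j) = VecP.lookup∘tabulate (λ j → t zero (suc j)) j
entry-triangular t sy ir (suc i) zero = trans (VecP.lookup∘tabulate (λ j → t zero (suc j)) i) (sy zero (suc i))
entry-triangular t sy ir (suc i) (suc j) = entry-triangular (λ i j → t (suc i) (suc j)) (λ i j → sy (suc i) (suc j)) (λ i → ir (suc i)) i j

every : ∀ m → (Vec Bool m → Bool) → Bool
every zero P = P []
every (suc m) P = every m (λ v → P (true ∷ v)) ∧ every m (λ v → P (false ∷ v))

every-sound : ∀ m (P : Vec Bool m → Bool) → every m P ≡ true → ∀ v → P v ≡ true
every-sound zero P e [] = e
every-sound (suc m) P e (true ∷ v) = every-sound m _ (proj₁ (∧-true e)) v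
every-sound (suc m) P e (false ∷ v) = every-sound m _ (proj₂ (∧-true {every m (λ v → P (true ∷ v))} e)) v

any-witness : ∀ {A : Set} (P : A → Bool) L → any P L ≡ true → ∃ λ x → x ∈ L × P x ≡ true
any-witness P (x ∷ L) e with ∨-true {P x} e
... | inj₁ p = x , 0th , p
... | inj₂ q = let y , m , p = any-witness P L q in y , there m , p

all-holds : ∀ {A : Set} (P : A → Bool) L → Data.Bool.ListAction.all P L ≡ true → ∀ {x} → x ∈ L → P x ≡ true
all-holds P (x ∷ L) e 0th = proj₁ (∧-true e)
all-holds P (x ∷ L) e (there m) = all-holds P L (proj₂ (∧-true {P x} e)) m

Edge₇ : Set
Edge₇ = Fin 7 × Fin 7

Four₇ : Set
Four₇ = Fin 7 × Fin 7 × Fin 7 × Fin 7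

Five₇ : Set
Five₇ = Fin 7 × Fin 7 × Fin 7 × Fin 7 × Fin 7

Obstruction : Set
Obstruction = Four₇ ⊎ Five₇

Map₇ : Set
Map₇ = Vec (Fin 7) 7

pyramid-edges kite-edges : List Edge₇
pyramid-edges = (0F , 1F) ∷ (1F , 2F) ∷ (2F , 0F) ∷ (4F , 0F) ∷ (4F , 1F) ∷ (4F , 3F) ∷ (5F , 1F) ∷ (5F , 2F) ∷ (5F , 3F) ∷ (6F , 2F) ∷ (6F , 0F) ∷ (6F , 3F) ∷ []
kite-edges = (0F , 1F) ∷ (0F , 2F) ∷ (1F , 2F) ∷ (0F , 3F) ∷ (0F , 5F) ∷ (1F , 6F) ∷ (1F , 4F) ∷ (2F , 5F) ∷ (2F , 6F) ∷ (3F , 4F) ∷ (3F , 6F) ∷ (4F , 5F) ∷ []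

orders : {A : Set} → A → A → A → List (A × A × A)
orders a b c = (a , b , c) ∷ (a , c , b) ∷ (b , a , c) ∷ (b , c , a) ∷ (c , a , b) ∷ (c , b , a) ∷ []

image : List Edge₇ → Map₇ → Map₇ × List Edge₇
image E π = π , map (λ (a , b) → lookup π a , lookup π b) E

-- All images of a map under the permutations of {1,2,3} and of {4,5,6}.
images : Map₇ → List Map₇
images π = concatMap (λ (a , b , c) → map (λ (d , e , f) → Vec.map (lookup (0F ∷ a ∷ b ∷ c ∷ d ∷ e ∷ f ∷ [])) π) (orders 4F 5F 6F)) (orders 1F 2F 3F)

-- Vertex 0 is the cubic vertex, with neighbours 4, 5, 6. There is one seed for each orbit of cubic
-- vertices of the target that 0 may represent: `d` and `q` in the pyramid, `e` and `g` in the kite.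
-- The relabellings fix 0.
pyramid-maps kite-maps : List Map₇
pyramid-maps = images (1F ∷ 2F ∷ 3F ∷ 0F ∷ 4F ∷ 5F ∷ 6F ∷ []) ++ images (1F ∷ 4F ∷ 5F ∷ 6F ∷ 2F ∷ 0F ∷ 3F ∷ [])
kite-maps = images (1F ∷ 4F ∷ 2F ∷ 5F ∷ 0F ∷ 6F ∷ 3F ∷ []) ++ images (1F ∷ 4F ∷ 5F ∷ 6F ∷ 2F ∷ 3F ∷ 0F ∷ [])

pairs : List (Fin 7) → List Edge₇
pairs [] = []
pairs (x ∷ L) = map (x ,_) L ++ pairs L

without : List (Fin 7) → List (Fin 7) → List (Fin 7)
without A = filterᵇ (λ v → not (any (λ w → does (v ≟ w)) A))

labels : List (Fin 7)
labels = allFin 7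

-- No edge joins i, j to k, l.
against : Edge₇ → List Obstruction
against (i , j) = map (λ (k , l) → inj₁ (i , j , k , l)) (pairs (without (i ∷ j ∷ []) labels))

-- The vertex i has degree at most 2.
sparse : Fin 7 → List Obstruction
sparse i =
    let rest : List (Fin 7) → List Obstruction
        rest = λ where
          (p ∷ q ∷ r ∷ s ∷ []) → inj₂ (i , p , q , r , s) ∷ []
          _ → []
    in concatMap (λ (k , l) → rest (without (i ∷ k ∷ l ∷ []) labels)) (pairs (without (i ∷ []) labels))

-- Grouped by the last row of the table that they read: the first three lists can be tested as soon
-- as rows 1, 2 or 3 are chosen, the last one needs the full table.
obstructions₁ obstructions₂ obstructions₃ obstructions₆ : List Obstruction
obstructions₁ = sparse 1F
obstructions₂ = sparse 2F ++ against (1F , 2F)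
obstructions₃ = sparse 3F ++ against (1F , 3F) ++ against (2F , 3F)
obstructions₆ = concatMap against (pairs labels)

embeds : Tri 7 → Map₇ × List Edge₇ → Bool
embeds M (π , E) = Data.Bool.ListAction.all (λ (a , b) → entry M a b) E

blocks : Tri 7 → Obstruction → Bool
blocks M (inj₁ (i , j , k , l)) = not (entry M i k ∨ (entry M i l ∨ (entry M j k ∨ entry M j l)))
blocks M (inj₂ (i , j , k , l , m)) = not (entry M i j ∨ (entry M i k ∨ (entry M i l ∨ entry M i m)))

matrix : Vec Bool 5 → Vec Bool 4 → Vec Bool 3 → Vec Bool 2 → Vec Bool 1 → Tri 7
matrix r₁ r₂ r₃ r₄ r₅ = (false ∷ false ∷ false ∷ true ∷ true ∷ true ∷ []) , r₁ , r₂ , r₃ , r₄ , r₅ , [] , tt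

-- Rows not yet chosen are filled with `false`; the obstructions tested at this stage do not read
-- them.
matrix₁ : Vec Bool 5 → Tri 7
matrix₁ r₁ = matrix r₁ (false ∷ false ∷ false ∷ false ∷ []) (false ∷ false ∷ false ∷ []) (false ∷ false ∷ []) (false ∷ [])

matrix₂ : Vec Bool 5 → Vec Bool 4 → Tri 7
matrix₂ r₁ r₂ = matrix r₁ r₂ (false ∷ false ∷ false ∷ []) (false ∷ false ∷ []) (false ∷ [])

matrix₃ : Vec Bool 5 → Vec Bool 4 → Vec Bool 3 → Tri 7
matrix₃ r₁ r₂ r₃ = matrix r₁ r₂ r₃ (false ∷ false ∷ []) (false ∷ [])

-- Rows of the matrix are added one by one, discarding partial matrices that are already blocked.
-- The tables are parameters, so that each of them is evaluated only once in the proof of checked.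
module Search (Ps Ks : List (Map₇ × List Edge₇)) (O₁ O₂ O₃ O₆ : List Obstruction) where
  goal : Tri 7 → Bool
  goal M = any (embeds M) Ps ∨ (any (embeds M) Ks ∨ any (blocks M) O₆)

  check₃ : Vec Bool 5 → Vec Bool 4 → Vec Bool 3 → Bool
  check₃ r₁ r₂ r₃ = any (blocks (matrix₃ r₁ r₂ r₃)) O₃ ∨ every 2 (λ r₄ → every 1 (λ r₅ → goal (matrix r₁ r₂ r₃ r₄ r₅)))

  check₂ : Vec Bool 5 → Vec Bool 4 → Bool
  check₂ r₁ r₂ = any (blocks (matrix₂ r₁ r₂)) O₂ ∨ every 3 (check₃ r₁ r₂)

  check₁ : Vec Bool 5 → Bool
  check₁ r₁ = any (blocks (matrix₁ r₁)) O₁ ∨ every 4 (check₂ r₁)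

  check : Bool
  check = every 5 check₁

-- Holds by evaluation: every table with the given row 0 contains a pyramid or a kite, or is
-- obstructed.
checked : Search.check (map (image pyramid-edges) pyramid-maps) (map (image kite-edges) kite-maps)
  obstructions₁ obstructions₂ obstructions₃ obstructions₆ ≡ true
checked = refl

-- Counting edges; deletion and contraction of an edge.

[_]₁ : Bool → ℕ
[ b ]₁ = if b then 1 else 0

abstract
  ∑ : ∀ {m} → (Fin m → ℕ) → ℕ
  ∑ = sum

  ∑-cong : ∀ {m} {f g : Fin m → ℕ} → (∀ u → f u ≡ g u) → ∑ f ≡ ∑ g
  ∑-cong = sum-cong-≗

  ∑-+ : ∀ {m} {f g : Fin m → ℕ} → ∑ (λ u → f u + g u) ≡ ∑ f + ∑ g
  ∑-+ {f = f} {g} = ∑-distrib-+ f g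

  ∑-swap : ∀ {l m} {f : Fin l → Fin m → ℕ} → ∑ (λ u → ∑ (f u)) ≡ ∑ (λ v → ∑ (λ u → f u v))
  ∑-swap {f = f} = ∑-comm f

  ∑-remove : ∀ {m} (w : Fin (suc m)) {f : Fin (suc m) → ℕ} → ∑ f ≡ f w + ∑ (λ u → f (punchIn w u))
  ∑-remove w {f} = sum-remove {i = w} f

  ∑-zero : ∀ {m} {f : Fin m → ℕ} → (∀ u → f u ≡ 0) → ∑ f ≡ 0
  ∑-zero {m} z = trans (sum-cong-≗ z) (sum-replicate-zero m)

  ∑-at : ∀ {m} (y : Fin m) {f : Fin m → ℕ} → (∀ u → u ≢ y → f u ≡ 0) → ∑ f ≡ f y
  ∑-at {suc m} zero {f} z = trans (cong (f zero +_) (∑-zero λ u → z (suc u) λ ())) (ℕ.+-identityʳ _)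
  ∑-at {suc m} (suc y) {f} z = trans (cong (_+ sum (f ∘ suc)) (z zero λ ()))
    (∑-at y λ u ne → z (suc u) (ne ∘ FinP.suc-injective))

  list-∑ : ∀ {m} (f : Fin m → ℕ) → ListSum.sum (map f (allFin m)) ≡ ∑ f
  list-∑ f = trans (cong ListSum.sum (ListPr.map-tabulate id f)) (go f)
    where
    go : ∀ {m} (f : Fin m → ℕ) → ListSum.sum (tabulate f) ≡ sum f
    go {zero} f = refl
    go {suc m} f = cong (f zero +_) (go (f ∘ suc))

-- Ordered adjacent pairs: unlike `edgeCount`, this sum does not refer to the order of the vertices,
-- so it splits well when a vertex is removed.
arcs : Graph → ℕ
arcs G = ∑ λ u → ∑ λ v → [ adj G u v ]₁

edgeCount-sum : ∀ G → edgeCount G ≡ ∑ λ u → ∑ λ v → [ adj G u v ∧ (toℕ u <ᵇ toℕ v) ]₁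
edgeCount-sum G = trans (list-∑ _) (∑-cong λ u → list-∑ _)

arcs≡2edges : ∀ G → arcs G ≡ edgeCount G + edgeCount G
arcs≡2edges G = begin
  arcs G                                             ≡⟨ ∑-cong (λ u → trans (∑-cong (split′ u)) (∑-+)) ⟩
  ∑ (λ u → ∑ (λ v → up u v) + ∑ (λ v → up v u)) ≡⟨ ∑-+ ⟩
  ∑ (λ u → ∑ (λ v → up u v)) + ∑ (λ u → ∑ (λ v → up v u)) ≡⟨ cong (∑ (λ u → ∑ (λ v → up u v)) +_) (∑-swap) ⟩
  ∑ (λ u → ∑ (λ v → up u v)) + ∑ (λ u → ∑ (λ v → up u v)) ≡⟨ cong₂ _+_ (edgeCount-sum G) (edgeCount-sum G) ⟨
  edgeCount G + edgeCount G ∎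
  where
  open ≡-Reasoning
  up : Fin (n G) → Fin (n G) → ℕ
  up u v = [ adj G u v ∧ (toℕ u <ᵇ toℕ v) ]₁
  tri : ∀ a b → a ≢ b → (a <ᵇ b) ≡ not (b <ᵇ a)
  tri zero zero ne = ⊥-elim (ne refl)
  tri zero (suc b) ne = refl
  tri (suc a) zero ne = refl
  tri (suc a) (suc b) ne = tri a b (ne ∘ cong suc)
  split′ : ∀ u v → [ adj G u v ]₁ ≡ up u v + up v u
  split′ u v rewrite adj-sym G v u with adj G u v in e
  ... | false = refl
  ... | true rewrite tri (toℕ u) (toℕ v) (λ eq → On.~≢ G e (FinP.toℕ-injective eq)) with toℕ v <ᵇ toℕ u
  ... | true = refl
  ... | false = refl

halve : ∀ {a b} → a + a + 2 ≡ b + b → a + 1 ≡ b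
halve {a} {b} eq =
    let
        open ≡-Reasoning
    in ℕ.*-cancelˡ-≡ (a + 1) b 2 (begin
         2 * (a + 1)   ≡⟨ ℕ.*-distribˡ-+ 2 a 1 ⟩
         2 * a + 2     ≡⟨ cong (λ z → a + z + 2) (ℕ.+-identityʳ a) ⟩
         a + a + 2     ≡⟨ eq ⟩
         b + b         ≡⟨ cong (b +_) (ℕ.+-identityʳ b) ⟨
         2 * b         ∎)

edges-from-arcs : ∀ H G → arcs H + 2 ≡ arcs G → edgeCount H + 1 ≡ edgeCount G
edges-from-arcs H G eq = halve (trans (cong (_+ 2) (sym (arcs≡2edges H))) (trans eq (arcs≡2edges G)))

is : ∀ {m} → Fin m → Fin m → Bool
is u v = does (u ≟ v)

is-refl : ∀ {m} (u : Fin m) → is u u ≡ true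
is-refl u = dec-true (u ≟ u) refl

is-sound : ∀ {m} {u v : Fin m} → is u v ≡ true → u ≡ v
is-sound {u = u} {v} e with u ≟ v
... | yes p = p
is-sound () | no _

module Delete (G : Graph) (x y : Fin (n G)) where
  open On G
  hit : V → V → Bool
  hit u v = (is u x ∧ is v y) ∨ (is u y ∧ is v x)

  hit-sym : ∀ u v → hit u v ≡ hit v u
  hit-sym u v rewrite 𝔹.∧-comm (is u x) (is v y) | 𝔹.∧-comm (is u y) (is v x) = 𝔹.∨-comm (is v y ∧ is u x) (is v x ∧ is u y)

  del : Graph
  del = record
    { n = n G ; adj = λ u v → adj G u v ∧ not (hit u v)
    ; sym = λ u v → cong₂ _∧_ (adj-sym G u v) (cong not (hit-sym u v))
    ; irref = λ u → cong (_∧ not (hit u u)) (irref G u) }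

  hit-sound : ∀ {u v} → hit u v ≡ true → (u ≡ x × v ≡ y) ⊎ (u ≡ y × v ≡ x)
  hit-sound {u} {v} e with ∨-true {is u x ∧ is v y} e
  ... | inj₁ e = let a , b = ∧-true {is u x} e in inj₁ (is-sound a , is-sound b)
  ... | inj₂ e = let a , b = ∧-true {is u y} e in inj₂ (is-sound a , is-sound b)

  del-⊆ : ∀ {u v} → Adj del u v → u ~ v
  del-⊆ {u} {v} e = proj₁ (∧-true {adj G u v} e)

  del-keeps : ∀ {u v} → u ~ v → ¬ ((u ≡ x × v ≡ y) ⊎ (u ≡ y × v ≡ x)) → Adj del u v
  del-keeps {u} {v} e no-hit with hit u v in h
  ... | true = ⊥-elim (no-hit (hit-sound {u} {v} h))
  ... | false rewrite e = refl

  del-edges : x ~ y → edgeCount del + 1 ≡ edgeCount G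
  del-edges xy = edges-from-arcs del G (sym (begin
    arcs G ≡⟨ ∑-cong (λ u → trans (∑-cong (parts u)) (∑-+)) ⟩
    ∑ (λ u → ∑ (λ v → [ adj del u v ]₁) + ∑ (λ v → [ hit u v ]₁)) ≡⟨ ∑-+ ⟩
    arcs del + ∑ (λ u → ∑ (λ v → [ hit u v ]₁)) ≡⟨ cong (arcs del +_) hits ⟩
    arcs del + 2 ∎))
    where
    open ≡-Reasoning
    x≢y : x ≢ y
    x≢y = ~≢ xy
    adj-hit : ∀ u v → hit u v ≡ true → adj G u v ≡ true
    adj-hit u v h with hit-sound {u} {v} h
    ... | inj₁ (refl , refl) = xy
    ... | inj₂ (refl , refl) = ~sym xy
    parts : ∀ u v → [ adj G u v ]₁ ≡ [ adj G u v ∧ not (hit u v) ]₁ + [ hit u v ]₁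
    parts u v with hit u v in h
    ... | true rewrite adj-hit u v h = refl
    ... | false with adj G u v
    ... | true = refl
    ... | false = refl
    pair : V → V → V → V → Bool
    pair a b u v = is u a ∧ is v b
    one : ∀ a b → ∑ (λ u → ∑ (λ v → [ pair a b u v ]₁)) ≡ 1
    one a b = trans (∑-at a (λ u ne → ∑-zero λ v → cong (λ t → [ t ∧ is v b ]₁) (dec-false (u ≟ a) ne)))
      (trans (∑-at b (λ v ne → trans (cong (λ t → [ is a a ∧ t ]₁) (dec-false (v ≟ b) ne)) (cong [_]₁ (𝔹.∧-zeroʳ (is a a)))))
        (cong₂ (λ s t → [ s ∧ t ]₁) (is-refl a) (is-refl b)))
    apart : ∀ u v → [ hit u v ]₁ ≡ [ pair x y u v ]₁ + [ pair y x u v ]₁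
    apart u v with u ≟ x | u ≟ y
    ... | yes refl | yes refl = ⊥-elim (x≢y refl)
    ... | no _ | no _ = refl
    ... | no _ | yes _ = refl
    ... | yes _ | no _ with is v y
    ... | true = refl
    ... | false = refl
    hits : ∑ (λ u → ∑ (λ v → [ hit u v ]₁)) ≡ 2
    hits = trans (∑-cong (λ u → trans (∑-cong (apart u)) (∑-+)))
      (trans (∑-+) (cong₂ _+_ (one x y) (one y x)))

-- In `edges-1` the ends have no common neighbour, hence no parallel edges arise and only the
-- contracted edge is lost.
record Contraction (G : Graph) (x w : Fin (n G)) : Set where
  field
    H        : Graph
    size     : suc (n H) ≡ n G
    contract : ContractsTo G x w H
    edges-1  : Adj G x w → (∀ {v} → Adj G x v → ¬ Adj G w v) → edgeCount H + 1 ≡ edgeCount G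

-- The vertex `w` is removed by renumbering along `punchIn`, and its edges are handed over to `x`;
-- `f` is the quotient map.
module Punch (m : ℕ) (A : Fin (suc m) → Fin (suc m) → Bool) (A-sym : ∀ u v → A u v ≡ A v u)
  (A-irr : ∀ u → A u u ≡ false) (x w : Fin (suc m)) (x≢w : x ≢ w) where
  G : Graph
  G = record { n = suc m ; adj = A ; sym = A-sym ; irref = A-irr }
  open On G

  ι : Fin m → V
  ι = punchIn w

  raw : Fin m → Fin m → Bool
  raw a b = A (ι a) (ι b) ∨ ((is (ι a) x ∧ A w (ι b)) ∨ (is (ι b) x ∧ A w (ι a)))

  raw-sym : ∀ a b → raw a b ≡ raw b a
  raw-sym a b = cong₂ _∨_ (A-sym (ι a) (ι b)) (𝔹.∨-comm (is (ι a) x ∧ A w (ι b)) (is (ι b) x ∧ A w (ι a)))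

  is-sym : ∀ (a b : Fin m) → is a b ≡ is b a
  is-sym a b with a ≟ b | b ≟ a
  ... | yes _ | yes _ = refl
  ... | no _ | no _ = refl
  ... | yes p | no ne = ⊥-elim (ne (sym p))
  ... | no ne | yes p = ⊥-elim (ne (sym p))

  H : Graph
  H = record
    { n = m ; adj = λ a b → not (is a b) ∧ raw a b
    ; sym = λ a b → cong₂ (λ s t → not s ∧ t) (is-sym a b) (raw-sym a b)
    ; irref = λ a → cong (λ t → not t ∧ raw a a) (is-refl a) }

  w≢x : w ≢ x
  w≢x = x≢w ∘ sym

  f : V → Fin m
  f u with w ≟ u
  ... | yes _ = punchOut w≢x
  ... | no w≢u = punchOut w≢u

  f-ι : ∀ a → f (ι a) ≡ a
  f-ι a with w ≟ ι a
  ... | yes e = ⊥-elim (FinP.punchInᵢ≢i w a (sym e))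
  ... | no ne = trans (FinP.punchOut-cong w {i≢j = ne} {i≢k = FinP.punchInᵢ≢i w a ∘ sym} refl) (FinP.punchOut-punchIn w)

  ι-f : ∀ {u} → u ≢ w → ι (f u) ≡ u
  ι-f {u} ne with w ≟ u
  ... | yes e = ⊥-elim (ne (sym e))
  ... | no w≢u = FinP.punchIn-punchOut w≢u

  ι-f-w : ι (f w) ≡ x
  ι-f-w with w ≟ w
  ... | yes _ = FinP.punchIn-punchOut w≢x
  ... | no ne = ⊥-elim (ne refl)

  f-injective : ∀ {u v} → u ≢ w → v ≢ w → f u ≡ f v → u ≡ v
  f-injective p q e = trans (sym (ι-f p)) (trans (cong ι e) (ι-f q))

  f-w : f x ≡ f w
  f-w = FinP.punchIn-injective w _ _ (trans (ι-f x≢w) (sym ι-f-w))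

  contract : ContractsTo G x w H
  contract = f , (λ a → ι a , f-ι a) , f-w , fibres , sound , complete
    where
    fibres : ∀ u v → f u ≡ f v → u ≡ v ⊎ ((u ≡ x ⊎ u ≡ w) × (v ≡ x ⊎ v ≡ w))
    fibres u v e with u ≟ w | v ≟ w
    ... | yes refl | yes refl = inj₁ refl
    ... | no p | no q = inj₁ (f-injective p q e)
    ... | yes refl | no q = inj₂ (inj₂ refl , inj₁ (f-injective q x≢w (trans (sym e) (sym f-w))))
    ... | no p | yes refl = inj₂ (inj₁ (f-injective p x≢w (trans e (sym f-w))) , inj₂ refl)
    sound : ∀ a b → adj H a b ≡ true → a ≢ b × (Σ V λ u → Σ V λ v → f u ≡ a × f v ≡ b × A u v ≡ true)
    sound a b e with ∧-true {not (is a b)} e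
    ... | p , q = a≢b , witness
      where
      a≢b : a ≢ b
      a≢b refl with trans (sym p) (cong not (is-refl a))
      ... | ()
      witness : Σ V λ u → Σ V λ v → f u ≡ a × f v ≡ b × A u v ≡ true
      witness with ∨-true {A (ι a) (ι b)} q
      ... | inj₁ e = ι a , ι b , f-ι a , f-ι b , e
      ... | inj₂ q with ∨-true {is (ι a) x ∧ A w (ι b)} q
      ... | inj₁ q = let s , t = ∧-true {is (ι a) x} q in
                     w , ι b , trans (sym f-w) (trans (cong f (sym (is-sound {u = ι a} s))) (f-ι a)) , f-ι b , t
      ... | inj₂ q = let s , t = ∧-true {is (ι b) x} q in
                     ι a , w , f-ι a , trans (sym f-w) (trans (cong f (sym (is-sound {u = ι b} s))) (f-ι b)) , trans (A-sym (ι a) w) t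
    complete : ∀ a b → a ≢ b → (Σ V λ u → Σ V λ v → f u ≡ a × f v ≡ b × A u v ≡ true) → adj H a b ≡ true
    complete a b a≢b (u , v , refl , refl , e) = cong₂ _∧_ (cong not (dec-false (f u ≟ f v) a≢b)) (edge u v e a≢b)
      where
      edge : ∀ u v → A u v ≡ true → f u ≢ f v → raw (f u) (f v) ≡ true
      edge u v e ne with u ≟ w | v ≟ w
      ... | yes refl | yes refl = ⊥-elim (ne refl)
      ... | no p | no q rewrite ι-f p | ι-f q | e = refl
      ... | yes refl | no q rewrite ι-f q | ι-f-w | is-refl x | e = 𝔹.∨-zeroʳ (A x v)
      ... | no p | yes refl rewrite ι-f p | ι-f-w | is-refl x | trans (A-sym w u) e =
        trans (cong (A u x ∨_) (𝔹.∨-zeroʳ (is u x ∧ A w x))) (𝔹.∨-zeroʳ (A u x))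

  -- `d` is the degree of `w`, and `inner` counts the ordered adjacent pairs that avoid `w`.
  d : ℕ
  d = ∑ λ b → [ A w (ι b) ]₁
  inner : ℕ
  inner = ∑ λ a → ∑ λ b → [ A (ι a) (ι b) ]₁

  arcs-G : arcs G ≡ d + (d + inner)
  arcs-G =
      let
          open ≡-Reasoning
          row : V → ℕ
          row u = ∑ λ v → [ A u v ]₁
      in begin
           arcs G ≡⟨ ∑-remove w ⟩
           row w + ∑ (λ a → row (ι a)) ≡⟨ cong₂ _+_ (trans (∑-remove w) (cong (λ t → [ t ]₁ + d) (A-irr w)))
                                          (trans (∑-cong (λ a → ∑-remove w)) (∑-+)) ⟩
           d + (∑ (λ a → [ A (ι a) w ]₁) + inner) ≡⟨ cong (λ t → d + (t + inner)) (∑-cong (λ a → cong [_]₁ (A-sym (ι a) w))) ⟩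
           d + (d + inner) ∎

  module Count (xw : x ~ w) (none : ∀ {v} → x ~ v → ¬ w ~ v) where
    extra : Fin m → Fin m → ℕ
    extra a b = [ is (ι a) x ∧ (A w (ι b) ∧ not (is (ι b) x)) ]₁

    d′ : ℕ
    d′ = ∑ λ b → [ A w (ι b) ∧ not (is (ι b) x) ]₁

    d≡ : d ≡ d′ + 1
    d≡ = trans (∑-cong split′) (trans (∑-+) (cong (d′ +_)
      (trans (∑-at (f x) (λ b ne → cong [_]₁ (dec-false (ι b ≟ x) λ e → ne (trans (sym (f-ι b)) (cong f e)))))
             (cong [_]₁ (dec-true (ι (f x) ≟ x) (ι-f x≢w))))))
      where
      split′ : ∀ b → [ A w (ι b) ]₁ ≡ [ A w (ι b) ∧ not (is (ι b) x) ]₁ + [ is (ι b) x ]₁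
      split′ b with ι b ≟ x
      ... | yes e rewrite e | ~sym xw = refl
      ... | no _ with A w (ι b)
      ... | true = refl
      ... | false = refl

    extras : ∑ (λ a → ∑ (extra a)) ≡ d′
    extras = trans (∑-at (f x) (λ a ne → ∑-zero λ b → cong (λ t → [ t ∧ (A w (ι b) ∧ not (is (ι b) x)) ]₁)
                (dec-false (ι a ≟ x) λ e → ne (trans (sym (f-ι a)) (cong f e)))))
             (∑-cong λ b → cong (λ t → [ t ∧ (A w (ι b) ∧ not (is (ι b) x)) ]₁) (dec-true (ι (f x) ≟ x) (ι-f x≢w)))

    ι-inj : ∀ {a b} → ι a ≡ ι b → a ≡ b
    ι-inj {a} {b} e = trans (sym (f-ι a)) (trans (cong f e) (f-ι b))

    -- The old edges at `x` and those inherited from `w` are disjoint, as there is no common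
    -- neighbour; so the indicators add up.
    cell : ∀ a b → [ adj H a b ]₁ ≡ [ A (ι a) (ι b) ]₁ + (extra a b + extra b a)
    cell a b with a ≟ b
    ... | yes refl rewrite A-irr (ι a) with is (ι a) x
    ... | true rewrite 𝔹.∧-zeroʳ (A w (ι a)) = refl
    ... | false = refl
    cell a b | no a≢b with ι a ≟ x | ι b ≟ x
    ... | yes p | yes q = ⊥-elim (a≢b (ι-inj (trans p (sym q))))
    ... | no _ | no _ with A (ι a) (ι b)
    ... | true = refl
    ... | false = refl
    cell a b | no a≢b | yes p | no _ with A (ι a) (ι b) in e | A w (ι b) in e′
    ... | true | true = ⊥-elim (none (subst (_~ ι b) p e) e′)
    ... | true | false = refl
    ... | false | true = refl
    ... | false | false = refl
    cell a b | no a≢b | no _ | yes q with A (ι a) (ι b) in e | A w (ι a) in e′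
    ... | true | true = ⊥-elim (none (subst (_~ ι a) q (~sym e)) e′)
    ... | true | false = refl
    ... | false | true = refl
    ... | false | false = refl

    arcs-H : arcs H ≡ inner + (d′ + d′)
    arcs-H =
        let
            open ≡-Reasoning
        in begin
             arcs H ≡⟨ ∑-cong (λ a → trans (∑-cong (cell a)) (trans (∑-+) (cong (∑ (λ b → [ A (ι a) (ι b) ]₁) +_) (∑-+)))) ⟩
             ∑ (λ a → ∑ (λ b → [ A (ι a) (ι b) ]₁) + (∑ (extra a) + ∑ (λ b → extra b a))) ≡⟨ ∑-+ ⟩
             inner + ∑ (λ a → ∑ (extra a) + ∑ (λ b → extra b a)) ≡⟨ cong (inner +_) (∑-+) ⟩
             inner + (∑ (λ a → ∑ (extra a)) + ∑ (λ a → ∑ (λ b → extra b a))) ≡⟨ cong (λ t → inner + (∑ (λ a → ∑ (extra a)) + t)) (∑-swap) ⟩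
             inner + (∑ (λ a → ∑ (extra a)) + ∑ (λ a → ∑ (extra a))) ≡⟨ cong (λ t → inner + (t + t)) extras ⟩
             inner + (d′ + d′) ∎

    edges-1 : edgeCount H + 1 ≡ edgeCount G
    edges-1 =
        let
            open ≡-Reasoning
            open +-*-Solver
            arith : ∀ i e → i + (e + e) + 2 ≡ (e + 1) + ((e + 1) + i)
            arith = solve 2 (λ i e → i :+ (e :+ e) :+ con 2 := (e :+ con 1) :+ ((e :+ con 1) :+ i)) refl
        in edges-from-arcs H G (begin
             arcs H + 2 ≡⟨ cong (_+ 2) arcs-H ⟩
             inner + (d′ + d′) + 2 ≡⟨ arith inner d′ ⟩
             (d′ + 1) + ((d′ + 1) + inner) ≡⟨ cong (λ t → t + (t + inner)) d≡ ⟨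
             d + (d + inner) ≡⟨ arcs-G ⟨
             arcs G ∎)

contraction : ∀ G (x w : Fin (n G)) → x ≢ w → Contraction G x w
contraction record { n = suc m ; adj = A ; sym = A-sym ; irref = A-irr } x w x≢w = record
  { H = P.H ; size = refl ; contract = P.contract ; edges-1 = P.Count.edges-1 }
  where module P = Punch m A A-sym A-irr x w x≢w

-- Reading off the search: spanning copies of the pyramid and the kite.

true≢false : true ≡ false → ⊥
true≢false ()

Distinct₄ : ∀ {m} → Fin m → Fin m → Fin m → Fin m → Set
Distinct₄ i j k l = i ≢ j × k ≢ l × i ≢ k × i ≢ l × j ≢ k × j ≢ l

distinct₄? : ∀ {m} (i j k l : Fin m) → Dec (Distinct₄ i j k l)
distinct₄? i j k l = ¬? (i ≟ j) ×-dec (¬? (k ≟ l) ×-dec (¬? (i ≟ k) ×-dec (¬? (i ≟ l) ×-dec (¬? (j ≟ k) ×-dec ¬? (j ≟ l)))))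

Distinct₅ : ∀ {m} → Fin m → Fin m → Fin m → Fin m → Fin m → Set
Distinct₅ i j k l p = (i ≢ j × i ≢ k × i ≢ l × i ≢ p) × Distinct₄ j k l p

distinct₅? : ∀ {m} (i j k l p : Fin m) → Dec (Distinct₅ i j k l p)
distinct₅? i j k l p = (¬? (i ≟ j) ×-dec (¬? (i ≟ k) ×-dec (¬? (i ≟ l) ×-dec ¬? (i ≟ p)))) ×-dec distinct₄? j k l p

Injective₇ : Map₇ → Set
Injective₇ π = ∀ i j → lookup π i ≡ lookup π j → i ≡ j

injective₇? : ∀ π → Dec (Injective₇ π)
injective₇? π = all? λ i → all? λ j → (lookup π i ≟ lookup π j) →-dec (i ≟ j)

pyramids-injective : All Injective₇ pyramid-maps
pyramids-injective = from-yes (All.all? injective₇? pyramid-maps)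

kites-injective : All Injective₇ kite-maps
kites-injective = from-yes (All.all? injective₇? kite-maps)

Spread : Obstruction → Set
Spread (inj₁ (i , j , k , l)) = Distinct₄ i j k l
Spread (inj₂ (i , j , k , l , p)) = Distinct₅ i j k l p

spread? : Decidable Spread
spread? (inj₁ (i , j , k , l)) = distinct₄? i j k l
spread? (inj₂ (i , j , k , l , p)) = distinct₅? i j k l p

data Outcome (M : Tri 7) : Set where
  copied : ∀ {E} → E ≡ pyramid-edges ⊎ E ≡ kite-edges → ∀ π → Injective₇ π →
    (∀ {a b} → (a , b) ∈ E → entry M (lookup π a) (lookup π b) ≡ true) → Outcome M
  four : ∀ i j k l → Distinct₄ i j k l → entry M i k ≡ false → entry M i l ≡ false →
    entry M j k ≡ false → entry M j l ≡ false → Outcome M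
  five : ∀ i j k l m → Distinct₅ i j k l m → entry M i j ≡ false → entry M i k ≡ false →
    entry M i l ≡ false → entry M i m ≡ false → Outcome M

not-or : ∀ {x y} → not (x ∨ y) ≡ true → x ≡ false × not y ≡ true
not-or {false} p = refl , p

not-true : ∀ {x} → not x ≡ true → x ≡ false
not-true {false} _ = refl

bad-outcome : ∀ M {L} → All Spread L → any (blocks M) L ≡ true → Outcome M
bad-outcome M {L} ds p with any-witness (blocks M) L p
... | inj₁ (i , j , k , l) , m , q =
  let ik , q₁ = not-or {entry M i k} q
      il , q₂ = not-or {entry M i l} q₁
      jk , q₃ = not-or {entry M j k} q₂
  in four i j k l (All.lookup ds m) ik il jk (not-true q₃)
... | inj₂ (i , j , k , l , o) , m , q =
  let ij , q₁ = not-or {entry M i j} q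
      ik , q₂ = not-or {entry M i k} q₁
      il , q₃ = not-or {entry M i l} q₂
  in five i j k l o (All.lookup ds m) ij ik il (not-true q₃)

copied-outcome : ∀ M {E maps} → E ≡ pyramid-edges ⊎ E ≡ kite-edges → All Injective₇ maps →
  any (embeds M) (map (image E) maps) ≡ true → Outcome M
copied-outcome M {E} {maps} which injs p with any-witness (embeds M) (map (image E) maps) p
... | _ , m , q with ListP.∈-map⁻ (image E) m
... | π , m′ , refl = copied which π (All.lookup injs m′)
  (λ e → all-holds (λ (a , b) → entry M a b) _ q (ListP.∈-map⁺ (λ (a , b) → lookup π a , lookup π b) e))

-- Stated for arbitrary tables of maps and obstructions. The hypotheses `partial₁` to `partial₃` say
-- that the filling of an unfinished table does not influence the obstructions of that stage.
module Sound {ps ks : List Map₇} {O₁ O₂ O₃ O₆ : List Obstruction}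
  (ps-injective : All Injective₇ ps) (ks-injective : All Injective₇ ks)
  (p₁ : All Spread O₁) (p₂ : All Spread O₂) (p₃ : All Spread O₃) (p₆ : All Spread O₆)
  (partial₁ : ∀ r₁ r₂ r₃ r₄ r₅ → any (blocks (matrix₁ r₁)) O₁ ≡ any (blocks (matrix r₁ r₂ r₃ r₄ r₅)) O₁)
  (partial₂ : ∀ r₁ r₂ r₃ r₄ r₅ → any (blocks (matrix₂ r₁ r₂)) O₂ ≡ any (blocks (matrix r₁ r₂ r₃ r₄ r₅)) O₂)
  (partial₃ : ∀ r₁ r₂ r₃ r₄ r₅ → any (blocks (matrix₃ r₁ r₂ r₃)) O₃ ≡ any (blocks (matrix r₁ r₂ r₃ r₄ r₅)) O₃) where
  open Search (map (image pyramid-edges) ps) (map (image kite-edges) ks) O₁ O₂ O₃ O₆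

  goal-outcome : ∀ M → goal M ≡ true → Outcome M
  goal-outcome M p =
    [ copied-outcome M (inj₁ refl) ps-injective , (λ p →
    [ copied-outcome M (inj₂ refl) ks-injective , bad-outcome M p₆ ]′ (∨-true {any (embeds M) (map (image kite-edges) ks)} {any (blocks M) O₆} p)) ]′
    (∨-true {any (embeds M) (map (image pyramid-edges) ps)} {any (embeds M) (map (image kite-edges) ks) ∨ any (blocks M) O₆} p)

  check-outcome : Search.check (map (image pyramid-edges) ps) (map (image kite-edges) ks) O₁ O₂ O₃ O₆ ≡ true → ∀ r₁ r₂ r₃ r₄ r₅ → Outcome (matrix r₁ r₂ r₃ r₄ r₅)
  check-outcome p r₁ r₂ r₃ r₄ r₅ =
      let rest : Vec Bool 2 → Bool
          rest r₄ = every 1 (λ r₅ → goal (matrix r₁ r₂ r₃ r₄ r₅))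
          M : Tri 7
          M = matrix r₁ r₂ r₃ r₄ r₅
      in [ bad-outcome M p₁ ∘ trans (sym (partial₁ r₁ r₂ r₃ r₄ r₅)) , (λ q →
           [ bad-outcome M p₂ ∘ trans (sym (partial₂ r₁ r₂ r₃ r₄ r₅)) , (λ q →
           [ bad-outcome M p₃ ∘ trans (sym (partial₃ r₁ r₂ r₃ r₄ r₅)) , (λ q →
             goal-outcome M (every-sound 1 (λ r₅ → goal (matrix r₁ r₂ r₃ r₄ r₅)) (every-sound 2 rest q r₄) r₅)) ]′
           (∨-true {any (blocks (matrix₃ r₁ r₂ r₃)) O₃} {every 2 rest} (every-sound 3 (check₃ r₁ r₂) q r₃))) ]′
           (∨-true {any (blocks (matrix₂ r₁ r₂)) O₂} {every 3 (check₃ r₁ r₂)} (every-sound 4 (check₂ r₁) q r₂))) ]′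
           (∨-true {any (blocks (matrix₁ r₁)) O₁} {every 4 (check₂ r₁)} (every-sound 5 check₁ p r₁))

outcome₇ : ∀ M → proj₁ M ≡ false ∷ false ∷ false ∷ true ∷ true ∷ true ∷ [] → Outcome M
outcome₇ (_ , r₁ , r₂ , r₃ , r₄ , r₅ , [] , tt) refl = Sound.check-outcome pyramids-injective kites-injective
  (from-yes (All.all? spread? obstructions₁)) (from-yes (All.all? spread? obstructions₂))
  (from-yes (All.all? spread? obstructions₃)) (from-yes (All.all? spread? obstructions₆))
  (λ _ _ _ _ _ → refl) (λ _ _ _ _ _ → refl) (λ _ _ _ _ _ → refl) checked r₁ r₂ r₃ r₄ r₅

module Listed (A : Fin 7 → Fin 7 → Bool) (E : List Edge₇) where
  _∈E? : ∀ e → Dec (e ∈ E)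
  e ∈E? = DecMem._∈?_ (ProductP.≡-dec _≟_ _≟_) e E

  adj? : ∀ i j → Dec (A i j ≡ true)
  adj? i j = A i j 𝔹.≟ true

  Listed : Set
  Listed = ∀ i j → A i j ≡ true → (i , j) ∈ E ⊎ (j , i) ∈ E

  listed? : Dec Listed
  listed? = all? λ i → all? λ j → adj? i j →-dec (((i , j) ∈E?) ⊎-dec ((j , i) ∈E?))

  Exact : Set
  Exact = All (λ (i , j) → A i j ≡ true) E

  exact? : Dec Exact
  exact? = All.all? (λ (i , j) → adj? i j) E

  Degrees : Set
  Degrees = ∀ i j k → ∃ λ l → A i l ≡ true × l ≢ j × l ≢ k

  degrees? : Dec Degrees
  degrees? = all? λ i → all? λ j → all? λ k → any? λ l → adj? i l ×-dec (¬? (l ≟ j) ×-dec ¬? (l ≟ k))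

  Joined : Set
  Joined = ∀ i j k l → Distinct₄ i j k l → A i k ≡ true ⊎ A i l ≡ true ⊎ A j k ≡ true ⊎ A j l ≡ true

  joined? : Dec Joined
  joined? = all? λ i → all? λ j → all? λ k → all? λ l → distinct₄? i j k l →-dec
    (adj? i k ⊎-dec (adj? i l ⊎-dec (adj? j k ⊎-dec adj? j l)))

-- `degs` (degree at least three) and `joined` (an edge between any two disjoint pairs) survive the
-- addition of edges, and on seven vertices they imply `Good`.
record Shape : Set where
  field
    A      : Fin 7 → Fin 7 → Bool
    A-sym  : ∀ i j → A i j ≡ A j i
    E      : List Edge₇
    listed : Listed.Listed A E
    exact  : Listed.Exact A E
    degs   : Listed.Degrees A E
    joined : Listed.Joined A E

pyramid-shape : Shape
pyramid-shape =
    let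
        open Listed (adj Pyramid) pyramid-edges
    in record
         { A = adj Pyramid ; A-sym = adj-sym Pyramid ; E = pyramid-edges
         ; listed = from-yes listed? ; exact = from-yes exact? ; degs = from-yes degrees? ; joined = from-yes joined? }

kite-shape : Shape
kite-shape =
    let
        open Listed (adj Kite) kite-edges
    in record
         { A = adj Kite ; A-sym = adj-sym Kite ; E = kite-edges
         ; listed = from-yes listed? ; exact = from-yes exact? ; degs = from-yes degrees? ; joined = from-yes joined? }

record Copy (G : Graph) (E : List Edge₇) : Set where
  field
    h     : Fin 7 → Fin (n G)
    inj   : ∀ {i j} → h i ≡ h j → i ≡ j
    onE   : ∀ {i j} → (i , j) ∈ E → Adj G (h i) (h j)

module InCopy (S : Shape) (G : Graph) (n≡7 : n G ≡ 7) (C : Copy G (Shape.E S)) where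
  open Shape S
  open Copy C
  open On G

  h-edge : ∀ i j → A i j ≡ true → h i ~ h j
  h-edge i j e with listed i j e
  ... | inj₁ m = onE m
  ... | inj₂ m = ~sym (onE m)

  onto : ∀ v → ∃ λ i → h i ≡ v
  onto v with any? (λ i → h i ≟ v)
  ... | yes p = p
  ... | no ¬p = ⊥-elim (ℕ.1+n≰n (ℕ.≤-trans (injective⇒≤ {f = g} g-inj) (ℕ.≤-reflexive n≡7)))
    where
    g : Fin 8 → V
    g zero = v
    g (suc i) = h i
    g-inj : ∀ {i j} → g i ≡ g j → i ≡ j
    g-inj {zero} {zero} e = refl
    g-inj {zero} {suc j} e = ⊥-elim (¬p (j , sym e))
    g-inj {suc i} {zero} e = ⊥-elim (¬p (i , e))
    g-inj {suc i} {suc j} e = cong suc (inj e)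

  -- Two vertices on each side of a 3-separator would be two disjoint pairs without an edge between
  -- them, already excluded inside the copy by `joined`.
  copy-good : Good G
  copy-good = record { big = ℕ.≤-reflexive (sym n≡7) ; nbr = nbr′ ; noSep = noSep′ }
    where
    nbr′ : ∀ v a b → ∃ λ w → v ~ w × w ∉ a ∷ b ∷ []
    nbr′ v a b with onto v | onto a | onto b
    ... | i , refl | j , refl | k , refl with degs i j k
    ... | l , e , l≢j , l≢k = h l , h-edge i l e , λ { (here p) → l≢j (inj p) ; (there (here p)) → l≢k (inj p) }
    noSep′ : ∀ {P : V → Set} → Decidable P → ∀ a b c →
      (∀ {u v} → P u → u ~ v → P v ⊎ v ∈ a ∷ b ∷ c ∷ []) →
      Two (λ v → P v × v ∉ a ∷ b ∷ c ∷ []) → Two (λ v → ¬ P v × v ∉ a ∷ b ∷ c ∷ []) → ⊥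
    noSep′ {P} P? a b c cl (p , q , p≢q , (Pp , p∉) , (Pq , q∉)) (r , s , r≢s , (¬Pr , r∉) , (¬Ps , s∉))
      with onto p | onto q | onto r | onto s
    ... | i , refl | j , refl | k , refl | l , refl = go (joined i j k l
        ((λ { refl → p≢q refl }) , (λ { refl → r≢s refl }) , (λ { refl → ¬Pr Pp }) , (λ { refl → ¬Ps Pp }) , (λ { refl → ¬Pr Pq }) , (λ { refl → ¬Ps Pq })))
      where
      no-edge : ∀ i k → P (h i) → ¬ P (h k) → h k ∉ a ∷ b ∷ c ∷ [] → A i k ≡ true → ⊥
      no-edge i k p ¬q q∉ e with cl p (h-edge i k e)
      ... | inj₁ q = ¬q q
      ... | inj₂ m = q∉ m
      go : A i k ≡ true ⊎ A i l ≡ true ⊎ A j k ≡ true ⊎ A j l ≡ true → ⊥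
      go (inj₁ e) = no-edge i k Pp ¬Pr r∉ e
      go (inj₂ (inj₁ e)) = no-edge i l Pp ¬Ps s∉ e
      go (inj₂ (inj₂ (inj₁ e))) = no-edge j k Pq ¬Pr r∉ e
      go (inj₂ (inj₂ (inj₂ e))) = no-edge j l Pq ¬Ps s∉ e

  Exact : Set
  Exact = Σ (V ↔ Fin 7) λ f → ∀ u v → A (Inverse.to f u) (Inverse.to f v) ≡ adj G u v

  Spare : Set
  Spare = ∃ λ i → ∃ λ j → A i j ≡ false × h i ~ h j

  exact-or-spare : Exact ⊎ Spare
  exact-or-spare with any? (λ i → any? λ j → (A i j 𝔹.≟ false) ×-dec (h i ~? h j))
  ... | yes s = inj₂ s
  ... | no ¬s = inj₁ (mk↔ₛ′ to h (λ i → inj (proj₂ (onto (h i)))) (λ v → proj₂ (onto v)) ,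
      λ u v → trans (same (to u) (to v)) (cong₂ (adj G) (proj₂ (onto u)) (proj₂ (onto v))))
    where
    to : V → Fin 7
    to v = proj₁ (onto v)
    same : ∀ i j → A i j ≡ adj G (h i) (h j)
    same i j = iff-≡ (h-edge i j) back
      where
      back : h i ~ h j → A i j ≡ true
      back e with A i j in k
      ... | true = refl
      ... | false = ⊥-elim (¬s (i , j , k , e))

Deletable : Graph → Set₁
Deletable G = Σ (Fin (n G)) λ x → Σ (Fin (n G)) λ y → Adj G x y × Good (Delete.del G x y)

-- Deleting an edge outside the spanning copy keeps the copy, which makes the smaller graph good.
copy-result : (S : Shape) (G : Graph) (n≡7 : n G ≡ 7) (C : Copy G (Shape.E S)) → InCopy.Exact S G n≡7 C ⊎ Deletable G
copy-result S G n≡7 C with InCopy.exact-or-spare S G n≡7 C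
... | inj₁ e = inj₁ e
... | inj₂ (i , j , Aij , hij) =
    let
        open Copy C
        open Shape S
        open Delete G (h i) (h j)
        keep : ∀ {a b} → (a , b) ∈ E → Adj del (h a) (h b)
        keep {a} {b} m =
            let Aab : A a b ≡ true
                Aab = All.lookup exact m
                spare : a ≡ i → b ≡ j → ⊥
                spare = λ where
                  refl refl → true≢false (trans (sym Aab) Aij)
                spare′ : a ≡ j → b ≡ i → ⊥
                spare′ = λ where
                  refl refl → true≢false (trans (sym (trans (A-sym i j) Aab)) Aij)
            in del-keeps {h a} {h b} (onE m) λ where
                 (inj₁ (p , q)) → spare (inj p) (inj q)
                 (inj₂ (p , q)) → spare′ (inj p) (inj q)
    in inj₂ (h i , h j , hij , InCopy.copy-good S del n≡7 record { h = h ; inj = inj ; onE = keep })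

-- Equivalence of `Good` and quasi 4-connectivity on at least seven vertices.

∣∪∣≤ : ∀ {m} (p q : Subset m) → ∣ p ∪ q ∣ ≤ ∣ p ∣ + ∣ q ∣
∣∪∣≤ [] [] = z≤n
∣∪∣≤ (true ∷ p) (true ∷ q) = s≤s (ℕ.≤-trans (∣∪∣≤ p q) (ℕ.+-monoʳ-≤ ∣ p ∣ (ℕ.n≤1+n ∣ q ∣)))
∣∪∣≤ (true ∷ p) (false ∷ q) = s≤s (∣∪∣≤ p q)
∣∪∣≤ (false ∷ p) (true ∷ q) = ℕ.≤-trans (s≤s (∣∪∣≤ p q)) (ℕ.≤-reflexive (sym (ℕ.+-suc ∣ p ∣ ∣ q ∣)))
∣∪∣≤ (false ∷ p) (false ∷ q) = ∣∪∣≤ p q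

covered-card : ∀ {m} (p : Subset m) L → (∀ {v} → v ∈ˢ p → v ∈ L) → ∣ p ∣ ≤ length L
covered-card {m} p L sub = ℕ.≤-trans (Sub.p⊆q⇒∣p∣≤∣q∣ {p = p} {q = union L} (λ v∈ → into L (sub v∈))) (card L)
  where
  union : List (Fin m) → Subset m
  union [] = Data.Fin.Subset.⊥
  union (x ∷ L) = ⁅ x ⁆ ∪ union L
  into : ∀ {v} L → v ∈ L → v ∈ˢ union L
  into (x ∷ L) 0th = Sub.x∈p∪q⁺ (inj₁ (Sub.x∈⁅x⁆ x))
  into (x ∷ L) (there m) = Sub.x∈p∪q⁺ (inj₂ (into L m))
  card : ∀ L → ∣ union L ∣ ≤ length L
  card [] = ℕ.≤-reflexive (Sub.∣⊥∣≡0 m)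
  card (x ∷ L) = ℕ.≤-trans (∣∪∣≤ ⁅ x ⁆ (union L)) (ℕ.+-mono-≤ (ℕ.≤-reflexive (Sub.∣⁅x⁆∣≡1 x)) (card L))

elements : ∀ {m} (p : Subset m) → ∃ λ L → length L ≡ ∣ p ∣ × (∀ {v} → v ∈ˢ p → v ∈ L) × (∀ {v} → v ∈ L → v ∈ˢ p)
elements [] = [] , refl , (λ ()) , λ ()
elements (s ∷ p) with elements p
elements (true ∷ p) | L , len , to , from =
  zero ∷ map suc L , cong suc (trans (ListPr.length-map suc L) len) ,
  (λ { Vec.here → 0th ; (Vec.there m) → there (ListP.∈-map⁺ suc (to m)) }) ,
  λ { 0th → Vec.here ; (there m) → case ListP.∈-map⁻ suc m of λ { (_ , m′ , refl) → Vec.there (from m′) } }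
elements (false ∷ p) | L , len , to , from =
  map suc L , trans (ListPr.length-map suc L) len ,
  (λ { (Vec.there m) → ListP.∈-map⁺ suc (to m) }) ,
  λ m → case ListP.∈-map⁻ suc m of λ { (_ , m′ , refl) → Vec.there (from m′) }

collect : ∀ {m} {P : Fin m → Set} → Decidable P → Subset m
collect P? = Vec.tabulate (does ∘ P?)

collect⁺ : ∀ {m} {P : Fin m → Set} (P? : Decidable P) {v} → P v → v ∈ˢ collect P?
collect⁺ P? {v} p = VecP.lookup⇒[]= v _ (trans (VecP.lookup∘tabulate _ v) (dec-true (P? v) p))

collect⁻ : ∀ {m} {P : Fin m → Set} (P? : Decidable P) {v} → v ∈ˢ collect P? → P v
collect⁻ P? {v} v∈ with P? v | trans (sym (VecP.lookup∘tabulate (does ∘ P?) v)) (VecP.[]=⇒lookup v∈)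
... | yes p | _ = p
... | no _ | ()

-- The sides are `P` and its complement, both enlarged by `L`. The list may repeat vertices, so its
-- length only bounds the order from above.
module FromList (G : Graph) {P : Fin (n G) → Set} (P? : Decidable P) (L : List (Fin (n G)))
  (closed : ∀ {u v} → P u → Adj G u v → P v ⊎ v ∈ L)
  {x y : Fin (n G)} (Px : P x) (x∉ : x ∉ L) (¬Py : ¬ P y) (y∉ : y ∉ L) where
  open On G

  In₁? : Decidable (λ v → P v ⊎ v ∈ L)
  In₁? v = P? v ⊎-dec (v ∈? L)
  In₂? : Decidable (λ v → ¬ P v ⊎ v ∈ L)
  In₂? v = ¬? (P? v) ⊎-dec (v ∈? L)

  separation : Separation G
  separation = record
    { V₁ = collect In₁? ; V₂ = collect In₂?
    ; cover = λ v → case P? v of λ where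
        (yes p) → inj₁ (collect⁺ In₁? (inj₁ p))
        (no ¬p) → inj₂ (collect⁺ In₂? (inj₁ ¬p))
    ; edges = λ u v e → ends u v e (P? u) (P? v)
    ; V₁≠V = λ all → [ ¬Py , y∉ ]′ (collect⁻ In₁? (all y))
    ; V₂≠V = λ all → [ (λ ¬p → ¬p Px) , x∉ ]′ (collect⁻ In₂? (all x)) }
    where
    ends : ∀ u v → u ~ v → Dec (P u) → Dec (P v) →
      (u ∈ˢ collect In₁? × v ∈ˢ collect In₁?) ⊎ (u ∈ˢ collect In₂? × v ∈ˢ collect In₂?)
    ends u v e (yes p) (yes q) = inj₁ (collect⁺ In₁? (inj₁ p) , collect⁺ In₁? (inj₁ q))
    ends u v e (no ¬p) (no ¬q) = inj₂ (collect⁺ In₂? (inj₁ ¬p) , collect⁺ In₂? (inj₁ ¬q))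
    ends u v e (yes p) (no ¬q) with closed p e
    ... | inj₁ q = ⊥-elim (¬q q)
    ... | inj₂ m = inj₁ (collect⁺ In₁? (inj₁ p) , collect⁺ In₁? (inj₂ m))
    ends u v e (no ¬p) (yes q) with closed q (~sym e)
    ... | inj₁ p = ⊥-elim (¬p p)
    ... | inj₂ m = inj₁ (collect⁺ In₁? (inj₂ m) , collect⁺ In₁? (inj₁ q))

  I : Subset (n G)
  I = collect In₁? ∩ collect In₂?

  I⁺ : ∀ {v} → v ∈ L → v ∈ˢ I
  I⁺ m = Sub.x∈p∩q⁺ (collect⁺ In₁? (inj₂ m) , collect⁺ In₂? (inj₂ m))

  I⁻ : ∀ {v} → v ∈ˢ I → v ∈ L
  I⁻ v∈ with Sub.x∈p∩q⁻ (collect In₁?) (collect In₂?) v∈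
  ... | a , b with collect⁻ In₁? a | collect⁻ In₂? b
  ... | inj₂ m | _ = m
  ... | _ | inj₂ m = m
  ... | inj₁ p | inj₁ ¬p = ⊥-elim (¬p p)

  order≤ : order separation ≤ length L
  order≤ = covered-card I L I⁻

  order>0 : ∀ {a} → a ∈ L → 0 < order separation
  order>0 {a} m = ℕ.≤-trans (ℕ.≤-reflexive (sym (Sub.∣⁅x⁆∣≡1 a)))
    (Sub.p⊆q⇒∣p∣≤∣q∣ λ v∈ → subst (_∈ˢ I) (sym (Sub.x∈⁅y⁆⇒x≡y a v∈)) (I⁺ m))

  -- Two strict inclusions: the separator, the separator with `a`, and the side, which also contains
  -- `b`.
  big-side : ∀ {k} (p : Subset (n G)) → order separation ≡ k → (∀ {v} → v ∈ˢ I → v ∈ˢ p) → Two (λ v → v ∈ˢ p × v ∉ L) → suc k < ∣ p ∣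
  big-side p refl sub (a , b , a≢b , (a∈ , a∉) , (b∈ , b∉)) =
      let I⊂ : I ⊂ˢ (I ∪ ⁅ a ⁆)
          I⊂ = (λ v∈ → Sub.x∈p∪q⁺ (inj₁ v∈)) , a , Sub.x∈p∪q⁺ (inj₂ (Sub.x∈⁅x⁆ a)) , a∉ ∘ I⁻
          ⊂p : (I ∪ ⁅ a ⁆) ⊂ˢ p
          ⊂p = (λ v∈ → [ sub , (λ m → subst (_∈ˢ p) (sym (Sub.x∈⁅y⁆⇒x≡y a m)) a∈) ]′ (Sub.x∈p∪q⁻ I ⁅ a ⁆ v∈))
             , b , b∈ , λ m → [ b∉ ∘ I⁻ , (λ m → a≢b (sym (Sub.x∈⁅y⁆⇒x≡y a m))) ]′ (Sub.x∈p∪q⁻ I ⁅ a ⁆ m)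
      in ℕ.<-≤-trans (s≤s (Sub.p⊂q⇒∣p∣<∣q∣ I⊂)) (Sub.p⊂q⇒∣p∣<∣q∣ ⊂p)

quasi⇒good : ∀ G → Quasi4Connected G → 7 ≤ n G → Good G
quasi⇒good G ((_ , conn₃) , quasi) 7≤n = record { big = 7≤n ; nbr = nbr′ ; noSep = noSep′ }
  where
  open On G
  low : (S : Separation G) → 0 < order S → order S ≤ 2 → ⊥
  low S p q with order S | conn₃ S
  low S p q | 1 | c , _ = c refl
  low S p q | 2 | _ , c = c refl
  low S p (s≤s (s≤s ())) | suc (suc (suc _)) | _

  nbr′ : ∀ v a b → ∃ λ w → v ~ w × w ∉ a ∷ b ∷ []
  nbr′ v a b with covers? v (a ∷ b ∷ [])
  ... | inj₂ found = found
  ... | inj₁ N = ⊥-elim (bad (away a) (away b))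
    where
    w₀ : ∃ λ w → w ∉ v ∷ []
    w₀ = fresh (v ∷ []) (ℕ.<-≤-trans (s≤s (s≤s z≤n)) 7≤n)
    -- An entry equal to `v` is replaced by some other vertex, so that the separator does not
    -- contain `v`. Entries that are neighbours of `v` are unchanged.
    away : ∀ c → ∃ λ c′ → c′ ≢ v × (c ≢ v → c ≡ c′)
    away c with c ≟ v
    ... | no ne = c , ne , λ _ → refl
    ... | yes e = proj₁ w₀ , (λ e′ → proj₂ w₀ (here e′)) , λ ne → ⊥-elim (ne e)
    bad : (∃ λ c′ → c′ ≢ v × (a ≢ v → a ≡ c′)) → (∃ λ c′ → c′ ≢ v × (b ≢ v → b ≡ c′)) → ⊥
    bad (a′ , a′≢ , ea) (b′ , b′≢ , eb) = low separation (order>0 0th) order≤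
      where
      y : ∃ λ y → y ∉ v ∷ a′ ∷ b′ ∷ []
      y = fresh (v ∷ a′ ∷ b′ ∷ []) (ℕ.<-≤-trans (s≤s (s≤s (s≤s (s≤s z≤n)))) 7≤n)
      closed : ∀ {u w} → u ≡ v → u ~ w → w ≡ v ⊎ w ∈ a′ ∷ b′ ∷ []
      closed refl e with N e
      ... | 0th = inj₂ (here (ea (~≢ e ∘ sym)))
      ... | 1st = inj₂ (there (here (eb (~≢ e ∘ sym))))
      v∉ : v ∉ a′ ∷ b′ ∷ []
      v∉ 0th = a′≢ refl
      v∉ 1st = b′≢ refl
      open FromList G (_≟ v) (a′ ∷ b′ ∷ []) closed {v} {proj₁ y} refl v∉ (λ e → proj₂ y (here e)) (λ m → proj₂ y (there m))

  noSep′ : ∀ {P : V → Set} → Decidable P → ∀ a b c →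
    (∀ {u v} → P u → u ~ v → P v ⊎ v ∈ a ∷ b ∷ c ∷ []) →
    Two (λ v → P v × v ∉ a ∷ b ∷ c ∷ []) → Two (λ v → ¬ P v × v ∉ a ∷ b ∷ c ∷ []) → ⊥
  noSep′ {P} P? a b c cl ps@(x , _ , _ , (Px , x∉) , _) qs@(y , _ , _ , (¬Py , y∉) , _) =
      let
          open FromList G P? (a ∷ b ∷ c ∷ []) cl Px x∉ ¬Py y∉
          five₁ : order separation ≡ 3 → 4 < ∣ V₁ separation ∣
          five₁ eq = big-side (V₁ separation) eq (proj₁ ∘ Sub.x∈p∩q⁻ (collect In₁?) (collect In₂?))
            (Two-map (λ (p , ∉) → collect⁺ In₁? (inj₁ p) , ∉) ps)
          five₂ : order separation ≡ 3 → 4 < ∣ V₂ separation ∣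
          five₂ eq = big-side (V₂ separation) eq (proj₂ ∘ Sub.x∈p∩q⁻ (collect In₁?) (collect In₂?))
            (Two-map (λ (p , ∉) → collect⁺ In₂? (inj₁ p) , ∉) qs)
          cases : order separation < 3 ⊎ order separation ≡ 3 → ⊥
          cases = λ where
            (inj₁ (s≤s lt)) → low separation (order>0 0th) lt
            (inj₂ eq) → [ ℕ.<⇒≱ (five₁ eq) , ℕ.<⇒≱ (five₂ eq) ]′ (quasi separation eq)
      in cases (ℕ.m≤n⇒m<n∨m≡n order≤)

-- Minimum degree three turns a separation of order at most two into one forbidden by `noSep`. For
-- order three, a side with a single vertex off the separator has four vertices, and otherwise
-- `noSep` applies.
good⇒quasi : ∀ G → Good G → Quasi4Connected G
good⇒quasi G good = (ℕ.≤-trans (s≤s (s≤s (s≤s (s≤s z≤n)))) (big good) , λ S → (λ eq → low S (ℕ.≤-trans (ℕ.≤-reflexive eq) (s≤s z≤n))) , λ eq → low S (ℕ.≤-reflexive eq))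
                   , three
  where
  open On G
  module _ (S : Separation G) where
    Only₁ : V → Set
    Only₁ v = v ∉ˢ V₂ S
    Only₂ : V → Set
    Only₂ v = v ∉ˢ V₁ S
    Only₁? : Decidable Only₁
    Only₁? v = ¬? (Sub._∈?_ v (V₂ S))
    Only₂? : Decidable Only₂
    Only₂? v = ¬? (Sub._∈?_ v (V₁ S))
    some₁ : ∃ Only₁
    some₁ with any? Only₁?
    ... | yes p = p
    ... | no ¬p = ⊥-elim (V₂≠V S λ v → case Sub._∈?_ v (V₂ S) of λ where
      (yes m) → m
      (no ∉) → ⊥-elim (¬p (v , ∉)))
    some₂ : ∃ Only₂
    some₂ with any? Only₂?
    ... | yes p = p
    ... | no ¬p = ⊥-elim (V₁≠V S λ v → case Sub._∈?_ v (V₁ S) of λ where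
      (yes m) → m
      (no ∉) → ⊥-elim (¬p (v , ∉)))
    in₁ : ∀ {v} → Only₁ v → v ∈ˢ V₁ S
    in₁ {v} ∉ = [ id , (λ m → ⊥-elim (∉ m)) ]′ (cover S v)
    in₂ : ∀ {v} → Only₂ v → v ∈ˢ V₂ S
    in₂ {v} ∉ = [ (λ m → ⊥-elim (∉ m)) , id ]′ (cover S v)

    closed₁ : ∀ {u v} → Only₁ u → u ~ v → Only₁ v ⊎ v ∈ˢ V₁ S ∩ V₂ S
    closed₁ {u} {v} o e with edges S u v e
    ... | inj₂ (m , _) = ⊥-elim (o m)
    ... | inj₁ (_ , m) with Sub._∈?_ v (V₂ S)
    ... | yes m′ = inj₂ (Sub.x∈p∩q⁺ (m , m′))
    ... | no ∉ = inj₁ ∉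

    closed₂ : ∀ {u v} → Only₂ u → u ~ v → Only₂ v ⊎ v ∈ˢ V₁ S ∩ V₂ S
    closed₂ {u} {v} o e with edges S u v e
    ... | inj₁ (m , _) = ⊥-elim (o m)
    ... | inj₂ (_ , m) with Sub._∈?_ v (V₁ S)
    ... | yes m′ = inj₂ (Sub.x∈p∩q⁺ (m′ , m))
    ... | no ∉ = inj₁ ∉

    impossible : ∀ a b c → (∀ {v} → v ∈ˢ V₁ S ∩ V₂ S → v ∈ a ∷ b ∷ c ∷ []) →
      (∀ {v} → v ∈ a ∷ b ∷ c ∷ [] → v ∈ˢ V₁ S ∩ V₂ S) → Two Only₁ → Two Only₂ → ⊥
    impossible a b c to from t₁ t₂ = noSep good Only₁? a b c
      (λ o e → Data.Sum.map₂ to (closed₁ o e))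
      (Two-map (λ o → o , λ m → o (proj₂ (Sub.x∈p∩q⁻ _ _ (from m)))) t₁)
      (Two-map (λ o → (λ o′ → o′ (in₂ o)) , λ m → o (proj₁ (Sub.x∈p∩q⁻ _ _ (from m)))) t₂)

    -- A vertex off the separator has a third neighbour, which is again off the separator and on the
    -- same side; so each side has two such vertices.
    small : ∀ a b → (∀ {v} → v ∈ˢ V₁ S ∩ V₂ S → v ∈ a ∷ b ∷ []) →
      (∀ {v} → v ∈ a ∷ b ∷ [] → v ∈ˢ V₁ S ∩ V₂ S) → ⊥
    small a b to from = impossible a b b (dup ∘ to) (from ∘ dup⁻) (grow₁ some₁) (grow₂ some₂)
      where
      dup : ∀ {v} → v ∈ a ∷ b ∷ [] → v ∈ a ∷ b ∷ b ∷ []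
      dup 0th = 0th
      dup 1st = 1st
      dup⁻ : ∀ {v} → v ∈ a ∷ b ∷ b ∷ [] → v ∈ a ∷ b ∷ []
      dup⁻ 0th = 0th
      dup⁻ 1st = 1st
      dup⁻ 2nd = 1st
      grow₁ : ∃ Only₁ → Two Only₁
      grow₁ (p , o) with nbr good p a b
      ... | w , e , ∉ with closed₁ o e
      ... | inj₁ o′ = p , w , ~≢ e , o , o′
      ... | inj₂ m = ⊥-elim (∉ (to m))
      grow₂ : ∃ Only₂ → Two Only₂
      grow₂ (p , o) with nbr good p a b
      ... | w , e , ∉ with closed₂ o e
      ... | inj₁ o′ = p , w , ~≢ e , o , o′
      ... | inj₂ m = ⊥-elim (∉ (to m))

    low : order S ≤ 2 → ⊥
    low le with elements (V₁ S ∩ V₂ S)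
    ... | [] , len , to , from with some₁
    ... | p , o with nbr good p p p
    ... | w , e , _ with closed₁ o e
    ... | inj₂ m = case to m of λ ()
    ... | inj₁ o′ with some₂
    ... | q , o₂ with nbr good q q q
    ... | w₂ , e₂ , _ with closed₂ o₂ e₂
    ... | inj₂ m = case to m of λ ()
    ... | inj₁ o₂′ with nbr good p p w
    ... | w′ , e′ , new with closed₁ o e′
    ... | inj₂ m = case to m of λ ()
    ... | inj₁ o″ =
        let ne : ∀ {z} → z ≢ p → z ∉ p ∷ p ∷ p ∷ []
            ne = λ where
              q 0th → q refl
              q 1st → q refl
              q 2nd → q refl
        -- The separator is empty, so the vertex `p` of the first side plays its part; `w` and `w′`
        -- remain on that side.
        in noSep good Only₁? p p p (λ a b → inj₁ ([ id , (λ m → case to m of λ ()) ]′ (closed₁ a b)))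
             (w , w′ , (λ { refl → new 1st }) , (o′ , ne (~≢ e ∘ sym)) , (o″ , ne (~≢ e′ ∘ sym)))
             (q , w₂ , ~≢ e₂ , ((λ a → a (in₂ o₂)) , ne (λ { refl → o (in₂ o₂) })) , ((λ a → a (in₂ o₂′)) , ne (λ { refl → o (in₂ o₂′) })))
    low le | a ∷ [] , len , to , from = small a a (λ m → there (to m)) (λ { 0th → from 0th ; 1st → from 0th })
    low le | a ∷ b ∷ [] , len , to , from = small a b to from
    low le | a ∷ b ∷ c ∷ L , len , to , from = ℕ.<⇒≱ (s≤s (s≤s (s≤s z≤n))) (ℕ.≤-trans (ℕ.≤-reflexive len) le)

    side₁ : ∀ L → length L ≡ 3 → (∀ {v} → v ∈ˢ V₁ S ∩ V₂ S → v ∈ L) → ∣ V₁ S ∣ ≤ 4 ⊎ Two Only₁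
    side₁ L len to with some₁
    ... | p , o with any? (λ w → Only₁? w ×-dec ¬? (w ≟ p))
    ... | yes (w , o′ , w≢p) = inj₂ (w , p , w≢p , o′ , o)
    ... | no ¬w = inj₁ (ℕ.≤-trans (covered-card (V₁ S) (p ∷ L) λ {v} m → case Sub._∈?_ v (V₂ S) of λ where
        (yes m′) → there (to (Sub.x∈p∩q⁺ (m , m′)))
        (no ∉) → case v ≟ p of λ where
          (yes e) → here e
          (no ne) → ⊥-elim (¬w (v , ∉ , ne))) (ℕ.≤-reflexive (cong suc len)))

    side₂ : ∀ L → length L ≡ 3 → (∀ {v} → v ∈ˢ V₁ S ∩ V₂ S → v ∈ L) → ∣ V₂ S ∣ ≤ 4 ⊎ Two Only₂
    side₂ L len to with some₂
    ... | p , o with any? (λ w → Only₂? w ×-dec ¬? (w ≟ p))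
    ... | yes (w , o′ , w≢p) = inj₂ (w , p , w≢p , o′ , o)
    ... | no ¬w = inj₁ (ℕ.≤-trans (covered-card (V₂ S) (p ∷ L) λ {v} m → case Sub._∈?_ v (V₁ S) of λ where
        (yes m′) → there (to (Sub.x∈p∩q⁺ (m′ , m)))
        (no ∉) → case v ≟ p of λ where
          (yes e) → here e
          (no ne) → ⊥-elim (¬w (v , ∉ , ne))) (ℕ.≤-reflexive (cong suc len)))

    three : order S ≡ 3 → ∣ V₁ S ∣ ≤ 4 ⊎ ∣ V₂ S ∣ ≤ 4
    three eq with elements (V₁ S ∩ V₂ S)
    ... | L , len , to , from with side₁ L (trans len eq) to | side₂ L (trans len eq) to
    ... | inj₁ a | _ = inj₁ a
    ... | _ | inj₁ b = inj₂ b
    ... | inj₂ t₁ | inj₂ t₂ with L | trans len eq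
    ... | a ∷ b ∷ c ∷ [] | refl = ⊥-elim (impossible a b c to from t₁ t₂)

-- Deciding whether cuts exist.

Two? : ∀ {m} {P : Fin m → Set} → Decidable P → Dec (Two P)
Two? P? = any? λ p → any? λ q → ¬? (p ≟ q) ×-dec (P? p ×-dec P? q)

vec-search : ∀ m {R : Vec Side m → Set} → Decidable R → Dec (∃ R)
vec-search zero R? = map′ ([] ,_) (λ { ([] , r) → r }) (R? [])
vec-search (suc m) R? = map′
  (λ { (inj₁ (v , r)) → lo ∷ v , r ; (inj₂ (inj₁ (v , r))) → mid ∷ v , r ; (inj₂ (inj₂ (v , r))) → hi ∷ v , r })
  (λ { (lo ∷ v , r) → inj₁ (v , r) ; (mid ∷ v , r) → inj₂ (inj₁ (v , r)) ; (hi ∷ v , r) → inj₂ (inj₂ (v , r)) })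
  (vec-search m (R? ∘ (lo ∷_)) ⊎-dec (vec-search m (R? ∘ (mid ∷_)) ⊎-dec vec-search m (R? ∘ (hi ∷_))))

-- Vectors of colours are enumerated in place of colourings; `respects` carries the property along
-- pointwise equality.
search : ∀ {m} {R : (Fin m → Side) → Set} → (∀ κ → Dec (R κ)) →
  (∀ {κ κ′} → (∀ v → κ v ≡ κ′ v) → R κ → R κ′) → Dec (∃ R)
search {m} R? respects = map′ (λ (v , r) → lookup v , r)
  (λ (κ , r) → Vec.tabulate κ , respects (λ v → sym (VecP.lookup∘tabulate κ v)) r)
  (vec-search m (R? ∘ lookup))

-- A separation of G minus the edge xy, by three vertices, into parts with at least two vertices each.
record DelSep (G : Graph) (x y : Fin (n G)) : Set where
  field
    κ     : Fin (n G) → Side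
    a b c : Fin (n G)
    κx    : κ x ≡ lo
    κy    : κ y ≡ hi
    κa    : κ a ≡ mid
    κb    : κ b ≡ mid
    κc    : κ c ≡ mid
    cov   : ∀ {v} → κ v ≡ mid → v ∈ a ∷ b ∷ c ∷ []
    cut   : ∀ {u v} → κ u ≡ lo → κ v ≡ hi → Adj G u v → u ≡ x × v ≡ y
    los   : ∃ λ v → v ≢ x × κ v ≡ lo
    his   : ∃ λ v → v ≢ y × κ v ≡ hi

module Decide (G : Graph) where
  open On G

  fourSep? : ∀ e f → Dec (FourSep G e f)
  fourSep? e f =
      let
          R : (V → Side) → Set
          R κ = ∃₂ λ g h → (κ e ≡ mid × κ f ≡ mid × κ g ≡ mid × κ h ≡ mid) ×
            (∀ v → κ v ≡ mid → v ∈ e ∷ f ∷ g ∷ h ∷ []) × (∀ u v → κ u ≡ lo → κ v ≡ hi → ¬ u ~ v) ×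
            Two (λ v → κ v ≡ lo) × Two (λ v → κ v ≡ hi)
          R? : ∀ κ → Dec (R κ)
          R? κ = any? λ g → any? λ h →
            ((κ e ≟ˢ mid) ×-dec ((κ f ≟ˢ mid) ×-dec ((κ g ≟ˢ mid) ×-dec (κ h ≟ˢ mid)))) ×-dec
            (all? (λ v → (κ v ≟ˢ mid) →-dec (v ∈? (e ∷ f ∷ g ∷ h ∷ []))) ×-dec
            (all? (λ u → all? λ v → (κ u ≟ˢ lo) →-dec ((κ v ≟ˢ hi) →-dec ¬? (u ~? v))) ×-dec
            (Two? (λ v → κ v ≟ˢ lo) ×-dec Two? (λ v → κ v ≟ˢ hi))))
          respects : ∀ {κ κ′} → (∀ v → κ v ≡ κ′ v) → R κ → R κ′
          respects = λ {κ} {κ′} eq (g , h , (pe , pf , pg , ph) , cv , ct , l , u) →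
              let mv : ∀ {v s} → κ v ≡ s → κ′ v ≡ s
                  mv p = trans (sym (eq _)) p
                  bk : ∀ {v s} → κ′ v ≡ s → κ v ≡ s
                  bk p = trans (eq _) p
              in g , h , (mv pe , mv pf , mv pg , mv ph) , (λ v p → cv v (bk p)) , (λ u v p q → ct u v (bk p) (bk q)) ,
                   Two-map mv l , Two-map mv u
          to : ∃ R → FourSep G e f
          to = λ where
            (κ , g , h , (pe , pf , pg , ph) , cv , ct , l , u) → g , h , record
              { κ = κ ; κe = pe ; κf = pf ; κg = pg ; κh = ph ; cov = cv _ ; cut = ct _ _ ; los = l ; his = u }
          from : FourSep G e f → ∃ R
          from = λ where
            (g , h , F) →
                let
                    open Cut₄ F
                in κ , g , h , (κe , κf , κg , κh) , (λ _ → cov) , (λ _ _ → cut) , los , his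
      in map′ to from (search R? respects)

  delSep? : ∀ x y → Dec (DelSep G x y)
  delSep? x y =
      let
          R : (V → Side) → Set
          R κ = (∃ λ a → ∃ λ b → ∃ λ c → (κ a ≡ mid × κ b ≡ mid × κ c ≡ mid) × (∀ v → κ v ≡ mid → v ∈ a ∷ b ∷ c ∷ [])) ×
            (κ x ≡ lo × κ y ≡ hi) × (∀ u v → κ u ≡ lo → κ v ≡ hi → u ~ v → u ≡ x × v ≡ y) ×
            (∃ λ v → v ≢ x × κ v ≡ lo) × (∃ λ v → v ≢ y × κ v ≡ hi)
          R? : ∀ κ → Dec (R κ)
          R? κ = (any? λ a → any? λ b → any? λ c →
              ((κ a ≟ˢ mid) ×-dec ((κ b ≟ˢ mid) ×-dec (κ c ≟ˢ mid))) ×-dec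
              all? (λ v → (κ v ≟ˢ mid) →-dec (v ∈? (a ∷ b ∷ c ∷ [])))) ×-dec
            (((κ x ≟ˢ lo) ×-dec (κ y ≟ˢ hi)) ×-dec
            (all? (λ u → all? λ v → (κ u ≟ˢ lo) →-dec ((κ v ≟ˢ hi) →-dec ((u ~? v) →-dec ((u ≟ x) ×-dec (v ≟ y))))) ×-dec
            (any? (λ v → ¬? (v ≟ x) ×-dec (κ v ≟ˢ lo)) ×-dec any? (λ v → ¬? (v ≟ y) ×-dec (κ v ≟ˢ hi)))))
          respects : ∀ {κ κ′} → (∀ v → κ v ≡ κ′ v) → R κ → R κ′
          respects = λ {κ} {κ′} eq ((a , b , c , (pa , pb , pc) , cv) , (px , py) , ct , (l , ln , lk) , (u , un , uk)) →
              let mv : ∀ {v s} → κ v ≡ s → κ′ v ≡ s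
                  mv p = trans (sym (eq _)) p
                  bk : ∀ {v s} → κ′ v ≡ s → κ v ≡ s
                  bk p = trans (eq _) p
              in (a , b , c , (mv pa , mv pb , mv pc) , λ v p → cv v (bk p)) , (mv px , mv py) , (λ u v p q → ct u v (bk p) (bk q)) ,
                   (l , ln , mv lk) , (u , un , mv uk)
          to : ∃ R → DelSep G x y
          to = λ where
            (κ , (a , b , c , (pa , pb , pc) , cv) , (px , py) , ct , l , u) → record
              { κ = κ ; a = a ; b = b ; c = c ; κx = px ; κy = py ; κa = pa ; κb = pb ; κc = pc ; cov = cv _ ; cut = ct _ _ ; los = l ; his = u }
          from : DelSep G x y → ∃ R
          from D =
              let
                  open DelSep D
              in κ , (a , b , c , (κa , κb , κc) , (λ _ → cov)) , (κx , κy) , (λ _ _ → cut) , los , his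
      in map′ to from (search R? respects)

-- Degree conditions and reduction steps.

Deg₄ : (G : Graph) → Fin (n G) → Set
Deg₄ G v = ∀ a b c → ¬ Nb G v (a ∷ b ∷ c ∷ [])

-- The invariant that keeps the chain away from 𝒜, whose members are cubic. Degree four is phrased
-- as the failure of every triple to cover the neighbourhood.
Rich : Graph → Set
Rich G = ∃ (Deg₄ G)

module Colouring {X : Set} (P Q : X → Set) (P? : Decidable P) (Q? : Decidable Q) where
  -- Q is the separator, P the lo side.
  abstract
    colour : X → Side
    colour v with Q? v | P? v
    ... | yes _ | _ = mid
    ... | no _ | yes _ = lo
    ... | no _ | no _ = hi

    colour-mid : ∀ {v} → Q v → colour v ≡ mid
    colour-mid {v} q with Q? v | P? v
    ... | yes _ | _ = refl
    ... | no ¬q | _ = ⊥-elim (¬q q)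

    colour-mid⁻ : ∀ {v} → colour v ≡ mid → Q v
    colour-mid⁻ {v} e with Q? v | P? v
    ... | yes q | _ = q
    colour-mid⁻ {v} () | no _ | yes _
    colour-mid⁻ {v} () | no _ | no _

    colour-lo : ∀ {v} → P v → ¬ Q v → colour v ≡ lo
    colour-lo {v} p ¬q with Q? v | P? v
    ... | yes q | _ = ⊥-elim (¬q q)
    ... | no _ | yes _ = refl
    ... | no _ | no ¬p = ⊥-elim (¬p p)

    colour-lo⁻ : ∀ {v} → colour v ≡ lo → P v × ¬ Q v
    colour-lo⁻ {v} e with Q? v | P? v
    colour-lo⁻ {v} () | yes q | _
    ... | no ¬q | yes p = p , ¬q
    colour-lo⁻ {v} () | no _ | no _

    colour-hi : ∀ {v} → ¬ P v → ¬ Q v → colour v ≡ hi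
    colour-hi {v} ¬p ¬q with Q? v | P? v
    ... | yes q | _ = ⊥-elim (¬q q)
    ... | no _ | yes p = ⊥-elim (¬p p)
    ... | no _ | no _ = refl

    colour-hi⁻ : ∀ {v} → colour v ≡ hi → ¬ P v × ¬ Q v
    colour-hi⁻ {v} e with Q? v | P? v
    colour-hi⁻ {v} () | yes q | _
    colour-hi⁻ {v} () | no _ | yes _
    ... | no ¬q | no ¬p = ¬p , ¬q

-- `smaller` is the lexicographic measure of the induction: fewer vertices, or equally many vertices
-- and one edge less.
record Reduction (G : Graph) : Set₁ where
  field
    H       : Graph
    good-H  : Good H
    rich-H  : Rich H
    minor   : H ≼ G
    step    : edgeCount H + 1 ≡ edgeCount G ⊎ O3Step G H
    smaller : suc (n H) ≡ n G ⊎ (n H ≡ n G × edgeCount H + 1 ≡ edgeCount G)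

degree-cover : ∀ G v → ∃ λ L → length L ≡ degree G v × Nb G v L
degree-cover G v = let L , len , all = go (allFin (n G)) in L , len , λ e → all (ListP.∈-allFin _) e
  where
  go : ∀ xs → ∃ λ L → length L ≡ ListSum.sum (map (λ w → if adj G v w then 1 else 0) xs) × (∀ {w} → w ∈ xs → Adj G v w → w ∈ L)
  go [] = [] , refl , λ ()
  go (x ∷ xs) with go xs | adj G v x in e
  ... | L , len , all | true = x ∷ L , cong suc len , λ { (here p) _ → here p ; (there m) a → there (all m a) }
  ... | L , len , all | false = L , len , λ { 0th a → case trans (sym e) a of λ () ; (there m) a → all m a }

Deg₅ : (G : Graph) → Fin (n G) → Set
Deg₅ G v = ∀ a b c d → ¬ Nb G v (a ∷ b ∷ c ∷ d ∷ [])

-- Translates the covering form of the condition into the numerical one of `O3Step`: the neighbours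
-- form a list whose length is the degree.
degree≥4 : ∀ G v → Deg₄ G v → 4 ≤ degree G v
degree≥4 G v v₄ with 4 ℕ.≤? degree G v
... | yes p = p
... | no ¬p with degree-cover G v
... | L , len , N = ⊥-elim (short L (ℕ.≤-trans (ℕ.≤-reflexive len) (ℕ.≤-pred (ℕ.≰⇒> ¬p))) N)
  where
  short : ∀ L → length L ≤ 3 → Nb G v L → ⊥
  short [] _ N = v₄ v v v λ e → case N e of λ ()
  short (a ∷ []) _ N = v₄ a a a λ e → case N e of λ { 0th → 0th }
  short (a ∷ b ∷ []) _ N = v₄ a b b λ e → case N e of λ { 0th → 0th ; 1st → 1st }
  short (a ∷ b ∷ c ∷ []) _ N = v₄ a b c N
  short (_ ∷ _ ∷ _ ∷ _ ∷ _) (s≤s (s≤s (s≤s ()))) _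

degree≥5 : ∀ G v → Deg₅ G v → 5 ≤ degree G v
degree≥5 G v v₅ with 5 ℕ.≤? degree G v
... | yes p = p
... | no ¬p with degree-cover G v
... | L , len , N = ⊥-elim (short L (ℕ.≤-trans (ℕ.≤-reflexive len) (ℕ.≤-pred (ℕ.≰⇒> ¬p))) N)
  where
  short : ∀ L → length L ≤ 4 → Nb G v L → ⊥
  short [] _ N = v₅ v v v v λ e → case N e of λ ()
  short (a ∷ []) _ N = v₅ a a a a λ e → case N e of λ { 0th → 0th }
  short (a ∷ b ∷ []) _ N = v₅ a b b b λ e → case N e of λ { 0th → 0th ; 1st → 1st }
  short (a ∷ b ∷ c ∷ []) _ N = v₅ a b c c λ e → case N e of λ { 0th → 0th ; 1st → 1st ; 2nd → 2nd }
  short (a ∷ b ∷ c ∷ d ∷ []) _ N = v₅ a b c d N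
  short (_ ∷ _ ∷ _ ∷ _ ∷ _ ∷ _) (s≤s (s≤s (s≤s (s≤s ())))) _

delete-minor : ∀ G x y → Delete.del G x y ≼ G
delete-minor G x y = just , (λ h → h , refl) ,
  (λ { h g _ refl refl → Walk.here (dec-true (h ≟ h) refl) }) ,
  λ h h′ e → h , h′ , refl , refl , Delete.del-⊆ G x y {h} {h′} e

flip-del : ∀ {G x y} → DelSep G x y → DelSep G y x
flip-del {G} D =
    let
        open DelSep D
    in record
         { κ = opp ∘ κ ; a = a ; b = b ; c = c ; κx = cong opp κy ; κy = cong opp κx
         ; κa = cong opp κa ; κb = cong opp κb ; κc = cong opp κc ; cov = cov ∘ opp-move
         ; cut = λ p q e → swap (cut (opp-move q) (opp-move p) (On.~sym G e))
         ; los = let v , ne , k = his in v , ne , cong opp k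
         ; his = let v , ne , k = los in v , ne , cong opp k }

-- Regions and cuts in a good graph.

module InGood (G : Graph) (good : Good G) where
  open On G public

  -- By minimum degree three, a triple that covers the neighbourhood consists of actual neighbours;
  -- by `≢₃` they are distinct.
  all₃ : ∀ {v a b c} → Nb G v (a ∷ b ∷ c ∷ []) → v ~ a × v ~ b × v ~ c
  all₃ {v} {a} {b} {c} N = ua , ub , uc
    where
    ua : v ~ a
    ua with nbr good v b c
    ... | w , e , ∉ with N e
    ... | 0th = e
    ... | 1st = ⊥-elim (∉ 0th)
    ... | 2nd = ⊥-elim (∉ 1st)
    ub : v ~ b
    ub with nbr good v a c
    ... | w , e , ∉ with N e
    ... | 0th = ⊥-elim (∉ 0th)
    ... | 1st = e
    ... | 2nd = ⊥-elim (∉ 1st)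
    uc : v ~ c
    uc with nbr good v a b
    ... | w , e , ∉ with N e
    ... | 0th = ⊥-elim (∉ 0th)
    ... | 1st = ⊥-elim (∉ 1st)
    ... | 2nd = e

  few : ∀ {v a b} {A : Set} → Nb G v (a ∷ b ∷ []) → A
  few {v} {a} {b} N with nbr good v a b
  ... | w , e , ∉ = ⊥-elim (∉ (N e))

  ≢₃ : ∀ {v a b c} → Nb G v (a ∷ b ∷ c ∷ []) → a ≢ b × a ≢ c × b ≢ c
  ≢₃ {v} {a} {b} {c} N =
      (λ { refl → few {v} {a} {c} λ e → case N e of λ { 0th → 0th ; 1st → 0th ; 2nd → 1st } })
    , (λ { refl → few {v} {a} {b} λ e → case N e of λ { 0th → 0th ; 1st → 1st ; 2nd → 0th } })
    , (λ { refl → few {v} {a} {b} λ e → case N e of λ { 0th → 0th ; 1st → 1st ; 2nd → 1st } })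

  -- With two further vertices outside, a region bounded by two vertices is empty, and one bounded
  -- by three has at most one vertex, which is then adjacent to exactly these three. Most later
  -- arguments bound a region and apply this.
  module Region {P : V → Set} (P? : Decidable P) where
    noP₂ : ∀ a b → (∀ {u v} → P u → u ~ v → P v ⊎ v ∈ a ∷ b ∷ []) →
           (∀ {v} → P v → v ∉ a ∷ b ∷ []) →
           Two (λ v → ¬ P v × v ∉ a ∷ b ∷ []) → ∀ {p} → ¬ P p
    noP₂ a b cl dis out {p} Pp with nbr good p a b
    ... | w , e , ∉ with cl Pp e
    ... | inj₂ m = ∉ m
    ... | inj₁ Pw =
        let dup : ∀ {v} → v ∈ a ∷ b ∷ [] → v ∈ a ∷ b ∷ b ∷ []
            dup = λ where
              0th → 0th
              1st → 1st
            dup⁻ : ∀ {v} → v ∈ a ∷ b ∷ b ∷ [] → v ∈ a ∷ b ∷ []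
            dup⁻ = λ where
              0th → 0th
              1st → 1st
              2nd → 1st
        in noSep good P? a b b
             (λ Pu uv → Data.Sum.map₂ dup (cl Pu uv))
             (p , w , ~≢ e , (Pp , dis Pp ∘ dup⁻) , (Pw , dis Pw ∘ dup⁻))
             (Two-map (λ (np , nm) → np , nm ∘ dup⁻) out)

    module Three (a b c : V) (cl : ∀ {u v} → P u → u ~ v → P v ⊎ v ∈ a ∷ b ∷ c ∷ [])
                 (dis : ∀ {v} → P v → v ∉ a ∷ b ∷ c ∷ [])
                 (out : Two (λ v → ¬ P v × v ∉ a ∷ b ∷ c ∷ [])) where
      unique : ∀ {p q} → P p → P q → p ≡ q
      unique {p} {q} Pp Pq with p ≟ q
      ... | yes e = e
      ... | no p≢q = ⊥-elim (noSep good P? a b c cl (p , q , p≢q , (Pp , dis Pp) , (Pq , dis Pq)) out)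

      nb : ∀ {p} → P p → Nb G p (a ∷ b ∷ c ∷ [])
      nb Pp e with cl Pp e
      ... | inj₁ Pw = ⊥-elim (~≢ e (unique Pp Pw))
      ... | inj₂ m = m

  module Sep {e f g h : V} (F : Cut₄ G e f g h) where
    open Cut₄ F public

    -- Three vertices covering the cut would violate `noSep`; hence the four cut vertices are
    -- distinct.
    thin : ∀ a b c → (∀ {v} → κ v ≡ mid → v ∈ a ∷ b ∷ c ∷ []) →
           κ a ≡ mid → κ b ≡ mid → κ c ≡ mid → ⊥
    thin a b c cv ka kb kc = noSep good (λ v → κ v ≟ˢ lo) a b c
      (λ {u} {v} ku uv → case-κ v ku uv)
      (Two-map (λ p → p , ∉L p lo≢mid) los)
      (Two-map (λ p → (λ q → clash p q hi≢lo) , ∉L p hi≢mid) his)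
      where
      case-κ : ∀ {u} v → κ u ≡ lo → u ~ v → κ v ≡ lo ⊎ v ∈ a ∷ b ∷ c ∷ []
      case-κ v ku uv with κ v in kv
      ... | lo = inj₁ refl
      ... | mid = inj₂ (cv kv)
      ... | hi = ⊥-elim (cut ku kv uv)
      ∉L : ∀ {v s} → κ v ≡ s → s ≢ mid → v ∉ a ∷ b ∷ c ∷ []
      ∉L p ne 0th = ne (trans (sym p) ka)
      ∉L p ne 1st = ne (trans (sym p) kb)
      ∉L p ne 2nd = ne (trans (sym p) kc)

    e≢f : e ≢ f
    e≢f refl = thin e g h (λ p → case cov p of λ { 0th → 0th ; 1st → 0th ; 2nd → 1st ; 3rd → 2nd }) κe κg κh
    e≢g : e ≢ g
    e≢g refl = thin e f h (λ p → case cov p of λ { 0th → 0th ; 1st → 1st ; 2nd → 0th ; 3rd → 2nd }) κe κf κh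
    e≢h : e ≢ h
    e≢h refl = thin e f g (λ p → case cov p of λ { 0th → 0th ; 1st → 1st ; 2nd → 2nd ; 3rd → 0th }) κe κf κg
    f≢g : f ≢ g
    f≢g refl = thin e f h (λ p → case cov p of λ { 0th → 0th ; 1st → 1st ; 2nd → 1st ; 3rd → 2nd }) κe κf κh
    f≢h : f ≢ h
    f≢h refl = thin e f g (λ p → case cov p of λ { 0th → 0th ; 1st → 1st ; 2nd → 2nd ; 3rd → 1st }) κe κf κg
    g≢h : g ≢ h
    g≢h refl = thin e f g (λ p → case cov p of λ { 0th → 0th ; 1st → 1st ; 2nd → 2nd ; 3rd → 2nd }) κe κf κg

    -- The part of the lo side cut out by Q, with boundary list L.
    module Lo {Q : V → Set} (Q? : Decidable Q) where
      -- Admissible boundary vertices: they are not in the region and not on the `hi` side, so two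
      -- `hi` vertices always remain beyond the boundary.
      Bd : V → Set
      Bd l = κ l ≡ mid ⊎ (κ l ≡ lo × ¬ Q l)

      P : V → Set
      P v = κ v ≡ lo × Q v

      P? : Decidable P
      P? v = (κ v ≟ˢ lo) ×-dec Q? v

      module Given (L : List V) (bd : All Bd L)
        (clm : ∀ {u v} → κ u ≡ lo → Q u → u ~ v → v ∈ e ∷ f ∷ g ∷ h ∷ [] → v ∈ L)
        (cll : ∀ {u v} → κ u ≡ lo → Q u → u ~ v → κ v ≡ lo → Q v ⊎ v ∈ L) where
        cl : ∀ {u v} → P u → u ~ v → P v ⊎ v ∈ L
        cl {u} {v} (ku , qu) uv with κ v in kv
        ... | hi = ⊥-elim (cut ku kv uv)
        ... | mid = inj₂ (clm ku qu uv (cov kv))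
        ... | lo with cll ku qu uv kv
        ... | inj₁ qv = inj₁ (refl , qv)
        ... | inj₂ m = inj₂ m

        dis : ∀ {v} → P v → v ∉ L
        dis (kv , qv) m with All.lookup bd m
        ... | inj₁ p = clash kv p lo≢mid
        ... | inj₂ (_ , nq) = nq qv

        out : Two (λ v → ¬ P v × v ∉ L)
        out = Two-map (λ p → (λ (q , _) → clash p q hi≢lo) , λ m → case All.lookup bd m of λ where
          (inj₁ q) → clash p q hi≢mid
          (inj₂ (q , _)) → clash p q hi≢lo) his

      none : ∀ a b → All Bd (a ∷ b ∷ []) →
        (∀ {u v} → κ u ≡ lo → Q u → u ~ v → v ∈ e ∷ f ∷ g ∷ h ∷ [] → v ∈ a ∷ b ∷ []) →
        (∀ {u v} → κ u ≡ lo → Q u → u ~ v → κ v ≡ lo → Q v ⊎ v ∈ a ∷ b ∷ []) →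
        ∀ {p} → κ p ≡ lo → ¬ Q p
      none a b bd clm cll kp qp =
          let
              open Given (a ∷ b ∷ []) bd clm cll
          in Region.noP₂ P? a b cl dis out (kp , qp)

      module One (a b c : V) (bd : All Bd (a ∷ b ∷ c ∷ []))
        (clm : ∀ {u v} → κ u ≡ lo → Q u → u ~ v → v ∈ e ∷ f ∷ g ∷ h ∷ [] → v ∈ a ∷ b ∷ c ∷ [])
        (cll : ∀ {u v} → κ u ≡ lo → Q u → u ~ v → κ v ≡ lo → Q v ⊎ v ∈ a ∷ b ∷ c ∷ []) where
        open Given (a ∷ b ∷ c ∷ []) bd clm cll
        open Region.Three P? a b c cl dis out public

    -- Otherwise the other three cut vertices would bound the whole `lo` side, which has two
    -- vertices.
    midlo : ∀ {m} → κ m ≡ mid → ∃ λ w → m ~ w × κ w ≡ lo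
    midlo {m} km with any? (λ w → (m ~? w) ×-dec (κ w ≟ˢ lo))
    ... | yes p = p
    ... | no ¬p = ⊥-elim (go (cov km))
      where
      two : Two (Lo.P {λ _ → V} (λ v → yes v))
      two = Two-map (λ {v} p → p , v) los
      bad : ∀ {a b c} → κ a ≡ mid → κ b ≡ mid → κ c ≡ mid →
        (∀ {v} → v ≢ m → v ∈ e ∷ f ∷ g ∷ h ∷ [] → v ∈ a ∷ b ∷ c ∷ []) → ⊥
      bad {a} {b} {c} ka kb kc sub with two
      ... | p , q , p≢q , Pp , Pq = p≢q (Lo.One.unique (λ v → yes v) a b c
        (inj₁ ka ∷ inj₁ kb ∷ inj₁ kc ∷ [])
        (λ ku _ uv → sub λ { refl → ¬p (_ , ~sym uv , ku) })
        (λ _ _ _ _ → inj₁ m) Pp Pq)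
      go : m ∈ e ∷ f ∷ g ∷ h ∷ [] → ⊥
      go 0th = bad κf κg κh λ { ne 0th → ⊥-elim (ne refl) ; _ 1st → 0th ; _ 2nd → 1st ; _ 3rd → 2nd }
      go 1st = bad κe κg κh λ { _ 0th → 0th ; ne 1st → ⊥-elim (ne refl) ; _ 2nd → 1st ; _ 3rd → 2nd }
      go 2nd = bad κe κf κh λ { _ 0th → 0th ; _ 1st → 1st ; ne 2nd → ⊥-elim (ne refl) ; _ 3rd → 2nd }
      go 3rd = bad κe κf κg λ { _ 0th → 0th ; _ 1st → 1st ; _ 2nd → 2nd ; ne 3rd → ⊥-elim (ne refl) }

    other-lo : ∀ p → ∃ λ c → c ≢ p × κ c ≡ lo
    other-lo p with los
    ... | a , b , a≢b , ka , kb with a ≟ p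
    ... | no a≢p = a , a≢p , ka
    ... | yes refl = b , a≢b ∘ sym , kb

    cut′ : ∀ {u v} → κ u ≡ hi → κ v ≡ lo → ¬ u ~ v
    cut′ ku kv uv = cut kv ku (~sym uv)

    not-hi : ∀ {u v} → κ u ≡ lo → u ~ v → κ v ≢ hi
    not-hi ku uv kv = cut ku kv uv

    not-lo : ∀ {u v} → κ u ≡ hi → u ~ v → κ v ≢ lo
    not-lo ku uv kv = cut′ ku kv uv

    between : ∀ {u v w} → κ u ≡ lo → κ v ≡ hi → u ~ w → v ~ w → κ w ≡ mid
    between {w = w} ku kv uw vw with κ w in kw
    ... | lo = ⊥-elim (cut′ kv kw vw)
    ... | mid = refl
    ... | hi = ⊥-elim (cut ku kw uw)

  midhi : ∀ {e f g h} (F : Cut₄ G e f g h) → ∀ {m} → Cut₄.κ F m ≡ mid → ∃ λ w → m ~ w × Cut₄.κ F w ≡ hi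
  midhi F km with Sep.midlo (flip F) (cong opp km)
  ... | w , e , kw = w , e , opp-move kw

  -- The two remaining neighbours of a cubic vertex of the cut lie on opposite sides.
  split : ∀ {e f g h} (F : Cut₄ G e f g h) → ∀ {m f′ a b} → Cut₄.κ F m ≡ mid → Cut₄.κ F f′ ≡ mid →
    Nb G m (f′ ∷ a ∷ b ∷ []) →
    (Cut₄.κ F a ≡ lo × Cut₄.κ F b ≡ hi) ⊎ (Cut₄.κ F a ≡ hi × Cut₄.κ F b ≡ lo)
  split F km kf N with Sep.midlo F km | midhi F km
  ... | w , mw , kw | z , mz , kz with N mw | N mz
  ... | 0th | _ = clash kf kw mid≢lo
  ... | _ | 0th = clash kf kz mid≢hi
  ... | 1st | 1st = clash kw kz lo≢hi
  ... | 2nd | 2nd = clash kw kz lo≢hi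
  ... | 1st | 2nd = inj₁ (kw , kz)
  ... | 2nd | 1st = inj₂ (kz , kw)

  beyond : ∀ {v} → Deg₄ G v → ∀ a b c → ∃ λ w → v ~ w × w ∉ a ∷ b ∷ c ∷ []
  beyond {v} v₄ a b c with covers? v (a ∷ b ∷ c ∷ [])
  ... | inj₁ N = ⊥-elim (v₄ a b c N)
  ... | inj₂ found = found

  pair-fresh : (L : List V) → suc (length L) < n G → Two (_∉ L)
  pair-fresh L l< with fresh L (ℕ.<-trans (ℕ.n<1+n _) l<)
  ... | a , a∉ with fresh (a ∷ L) l<
  ... | b , b∉ = a , b , (λ { refl → b∉ 0th }) , a∉ , b∉ ∘ there

  -- Degrees drop only at the two ends, which have degree four to spare. A new forbidden separation
  -- must have `xy` as its only crossing edge, which makes it a `DelSep`.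
  module Deletion (x y : V) (xy : x ~ y) (x₄ : Deg₄ G x) (y₄ : Deg₄ G y)
    (no-sep : ¬ DelSep G x y) (no-sep′ : ¬ DelSep G y x) where
    open Delete G x y

    del-nbr : ∀ v a b → ∃ λ w → Adj del v w × w ∉ a ∷ b ∷ []
    del-nbr v a b = go (v ≟ x) (v ≟ y)
      where
      go : Dec (v ≡ x) → Dec (v ≡ y) → ∃ λ w → Adj del v w × w ∉ a ∷ b ∷ []
      go (yes refl) _ with beyond x₄ y a b
      ... | w , e , new = w , del-keeps e (λ { (inj₁ (_ , refl)) → new 0th ; (inj₂ (refl , _)) → ~≢ xy refl }) , new ∘ there
      go (no _) (yes refl) with beyond y₄ x a b
      ... | w , e , new = w , del-keeps e (λ { (inj₁ (refl , _)) → ~≢ xy refl ; (inj₂ (_ , refl)) → new 0th }) , new ∘ there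
      go (no v≢x) (no v≢y) with nbr good v a b
      ... | w , e , new = w , del-keeps e (λ { (inj₁ (p , _)) → v≢x p ; (inj₂ (p , _)) → v≢y p }) , new

    del-noSep : ∀ {P : V → Set} → Decidable P → ∀ a b c →
      (∀ {u v} → P u → Adj del u v → P v ⊎ v ∈ a ∷ b ∷ c ∷ []) →
      Two (λ v → P v × v ∉ a ∷ b ∷ c ∷ []) → Two (λ v → ¬ P v × v ∉ a ∷ b ∷ c ∷ []) → ⊥
    del-noSep {P} P? a b c cl ps qs = split-at ((colour x ≟ˢ lo) ×-dec (colour y ≟ˢ hi)) ((colour x ≟ˢ hi) ×-dec (colour y ≟ˢ lo))
      where
      open Colouring P (_∈ a ∷ b ∷ c ∷ []) P? (_∈? (a ∷ b ∷ c ∷ []))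
      cross : ∀ {u v} → colour u ≡ lo → colour v ≡ hi → u ~ v → (u ≡ x × v ≡ y) ⊎ (u ≡ y × v ≡ x)
      cross {u} {v} ku kv e with hit u v in h
      ... | true = hit-sound h
      ... | false with cl (proj₁ (colour-lo⁻ ku)) (cong₂ _∧_ e (cong not h))
      ... | inj₁ p = ⊥-elim (proj₁ (colour-hi⁻ kv) p)
      ... | inj₂ m = ⊥-elim (proj₂ (colour-hi⁻ kv) m)
      other : ∀ {s} → Two (λ v → colour v ≡ s) → ∀ z → ∃ λ v → v ≢ z × colour v ≡ s
      other (p , q , p≢q , kp , kq) z with p ≟ z
      ... | no ne = p , ne , kp
      ... | yes refl = q , p≢q ∘ sym , kq
      los : Two (λ v → colour v ≡ lo)
      los = Two-map (λ (p , m) → colour-lo p m) ps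
      his : Two (λ v → colour v ≡ hi)
      his = Two-map (λ (p , m) → colour-hi p m) qs
      sep : ∀ {s t} → colour s ≡ lo → colour t ≡ hi → (∀ {u v} → colour u ≡ lo → colour v ≡ hi → u ~ v → u ≡ s × v ≡ t) → DelSep G s t
      sep {s} {t} ks kt ct = record
        { κ = colour ; a = a ; b = b ; c = c ; κx = ks ; κy = kt
        ; κa = colour-mid 0th ; κb = colour-mid 1st ; κc = colour-mid 2nd ; cov = colour-mid⁻ ; cut = ct
        ; los = other los s ; his = other his t }
      old : (∀ {u v} → colour u ≡ lo → colour v ≡ hi → ¬ u ~ v) → ⊥
      old ct = noSep good (λ v → colour v ≟ˢ lo) a b c (λ {u} {v} ku e → step ku e)
        (Two-map (λ p → p , λ m → clash p (colour-mid m) lo≢mid) los)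
        (Two-map (λ p → (λ q → clash p q hi≢lo) , λ m → clash p (colour-mid m) hi≢mid) his)
        where
        step : ∀ {u v} → colour u ≡ lo → u ~ v → colour v ≡ lo ⊎ v ∈ a ∷ b ∷ c ∷ []
        step {v = v} ku e with colour v in kv
        ... | lo = inj₁ refl
        ... | mid = inj₂ (colour-mid⁻ kv)
        ... | hi = ⊥-elim (ct ku kv e)
      split-at : Dec (colour x ≡ lo × colour y ≡ hi) → Dec (colour x ≡ hi × colour y ≡ lo) → ⊥
      split-at (yes (kx , ky)) _ = no-sep (sep kx ky λ ku kv e → case cross ku kv e of λ where
        (inj₁ r) → r
        (inj₂ (refl , _)) → clash ku ky lo≢hi)
      split-at (no _) (yes (kx , ky)) = no-sep′ (sep ky kx λ ku kv e → case cross ku kv e of λ where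
        (inj₂ r) → r
        (inj₁ (refl , _)) → clash ku kx lo≢hi)
      split-at (no ¬a) (no ¬b) = old λ ku kv e → case cross ku kv e of λ where
        (inj₁ (refl , refl)) → ¬a (ku , kv)
        (inj₂ (refl , refl)) → ¬b (kv , ku)

    del-good : Good del
    del-good = record { big = big good ; nbr = del-nbr ; noSep = del-noSep }

  -- Ladders in a finite graph close up and give members of 𝒜.

  module Large (8≤n : 8 ≤ n G) where
    -- An infinite walk along a ladder, which must repeat vertices; `P` and `Q` precede the first
    -- rung.
    record Rails (X Y : ℕ → V) (P Q : V) : Set where
      field
        NX₀ : Nb G (X 0) (P ∷ X 1 ∷ Y 0 ∷ [])
        NY₀ : Nb G (Y 0) (Q ∷ Y 1 ∷ X 0 ∷ [])
        NXₛ : ∀ i → Nb G (X (suc i)) (X i ∷ X (suc (suc i)) ∷ Y (suc i) ∷ [])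
        NYₛ : ∀ i → Nb G (Y (suc i)) (Y i ∷ Y (suc (suc i)) ∷ X (suc i) ∷ [])

    swap-rails : ∀ {X Y P Q} → Rails X Y P Q → Rails Y X Q P
    swap-rails R =
        let
            open Rails R
        in record { NX₀ = NY₀ ; NY₀ = NX₀ ; NXₛ = NYₛ ; NYₛ = NXₛ }

    record Distinct (X Y : ℕ → V) (m : ℕ) : Set where
      field
        XX : ∀ {i j} → i < m → j < m → X i ≡ X j → i ≡ j
        YY : ∀ {i j} → i < m → j < m → Y i ≡ Y j → i ≡ j
        XY : ∀ {i j} → i < m → j < m → X i ≢ Y j

    swap-distinct : ∀ {X Y m} → Distinct X Y m → Distinct Y X m
    swap-distinct D =
        let
            open Distinct D
        in record { XX = YY ; YY = XX ; XY = λ p q e → XY q p (sym e) }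

    module Rail {X Y : ℕ → V} {P Q : V} (R : Rails X Y P Q) where
      open Rails R
      X~X : ∀ i → X i ~ X (suc i)
      X~X zero = proj₁ (proj₂ (all₃ NX₀))
      X~X (suc i) = proj₁ (proj₂ (all₃ (NXₛ i)))
      X~Y : ∀ i → X i ~ Y i
      X~Y zero = proj₂ (proj₂ (all₃ NX₀))
      X~Y (suc i) = proj₂ (proj₂ (all₃ (NXₛ i)))
      next≢Y : ∀ i → X (suc i) ≢ Y i
      next≢Y zero = proj₂ (proj₂ (≢₃ NX₀))
      next≢Y (suc i) = proj₂ (proj₂ (≢₃ (NXₛ i)))

      -- `X m` is the next vertex after `m` distinct rungs. It is adjacent to `X k`, while the
      -- neighbours of a vertex of a later rung are prescribed; so it can repeat a vertex of the
      -- first rung only.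
      module At {k : ℕ} (D : Distinct X Y (suc k)) where
        open Distinct D
        m : ℕ
        m = suc k

        k< : k < m
        k< = ℕ.≤-refl

        not-X : ∀ {i} → suc i < m → X m ≢ X (suc i)
        not-X {i} i< eq with NXₛ i (subst (_~ X k) eq (~sym (X~X k)))
        ... | here e = ℕ.<-irrefl (cong suc (sym (XX k< (ℕ.<-trans (ℕ.n<1+n _) i<) e))) i<
        ... | there (there (here e)) = XY k< i< e
        ... | there (here e) with ℕ.m≤n⇒m<n∨m≡n i<
        ... | inj₁ 2+i< with XX k< 2+i< e
        ... | refl = proj₁ (≢₃ (NXₛ (suc i))) (sym eq)
        not-X {i} i< eq | there (here e) | inj₂ refl = ~≢ (X~X k) e

        not-Y : ∀ {i} → suc i < m → X m ≢ Y (suc i)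
        not-Y {i} i< eq with NYₛ i (subst (_~ X k) eq (~sym (X~X k)))
        ... | here e = XY k< (ℕ.<-trans (ℕ.n<1+n _) i<) e
        ... | there (there (here e)) with XX k< i< e
        ... | refl = next≢Y k eq
        not-Y {i} i< eq | there (here e) with ℕ.m≤n⇒m<n∨m≡n i<
        ... | inj₁ 2+i< = XY k< 2+i< e
        ... | inj₂ refl = proj₁ (proj₂ (≢₃ (NXₛ k))) e

        1<m-X : X m ≡ X 0 → 1 < m
        1<m-X eq = s≤s (ℕ.n≢0⇒n>0 λ { refl → ~≢ (X~X 0) (sym eq) })

        1<m-Y : X m ≡ Y 0 → 1 < m
        1<m-Y eq = s≤s (ℕ.n≢0⇒n>0 λ { refl → next≢Y 0 eq })

        back-X : X m ≡ X 0 → X k ≡ P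
        back-X eq with NX₀ (subst (_~ X k) eq (~sym (X~X k)))
        ... | here e = e
        ... | there (there (here e)) = ⊥-elim (XY k< (s≤s z≤n) e)
        ... | there (here e) with XX k< (1<m-X eq) e
        ... | refl = ⊥-elim (proj₁ (≢₃ (NXₛ 0)) (sym eq))

        back-Y : X m ≡ Y 0 → X k ≡ Q
        back-Y eq with NY₀ (subst (_~ X k) eq (~sym (X~X k)))
        ... | here e = e
        ... | there (here e) = ⊥-elim (XY k< (1<m-Y eq) e)
        ... | there (there (here e)) with XX k< (s≤s z≤n) e
        ... | refl = ⊥-elim (next≢Y 0 eq)

    -- When one rail reaches an end of the first rung again, the other rail reaches the other end at
    -- the same time.
    module Period {X Y : ℕ → V} {P Q : V} (R : Rails X Y P Q) {k : ℕ} (D : Distinct X Y (suc k)) where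
      private
        module R = Rail R
        module R′ = Rail (swap-rails R)
        module A = R.At D
        module A′ = R′.At (swap-distinct D)
      open Rails R

      also-X : X (suc k) ≡ X 0 → Y (suc k) ≡ Y 0
      also-X eq with NX₀ (subst (_~ Y (suc k)) eq (R.X~Y (suc k)))
      ... | here e = ⊥-elim (proj₁ (proj₂ (≢₃ (NXₛ k))) (trans (A.back-X eq) (sym e)))
      ... | there (here e) = ⊥-elim (A′.not-Y (A.1<m-X eq) e)
      ... | there (there (here e)) = e

      also-Y : X (suc k) ≡ Y 0 → Y (suc k) ≡ X 0
      also-Y eq with NY₀ (subst (_~ Y (suc k)) eq (R.X~Y (suc k)))
      ... | here e = ⊥-elim (proj₁ (proj₂ (≢₃ (NXₛ k))) (trans (A.back-Y eq) (sym e)))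
      ... | there (here e) = ⊥-elim (A′.not-X (A.1<m-Y eq) e)
      ... | there (there (here e)) = e

    -- The walk along the two rails returns to its start, straight or with the rails exchanged.
    data Closed (X Y : ℕ → V) (P Q : V) (k : ℕ) : Set where
      straight : X (suc k) ≡ X 0 → Y (suc k) ≡ Y 0 → X k ≡ P → Y k ≡ Q → Closed X Y P Q k
      twisted  : X (suc k) ≡ Y 0 → Y (suc k) ≡ X 0 → X k ≡ Q → Y k ≡ P → Closed X Y P Q k

    bounded? : ∀ {P : ℕ → Set} (P? : Decidable P) m → Dec (∃ λ i → i < m × P i)
    bounded? P? m = ℕ.anyUpTo? P? m

    module Return {X Y : ℕ → V} {P Q : V} (R : Rails X Y P Q) where
      closes : ∀ {k} → Distinct X Y (suc k) → Closed X Y P Q k ⊎ Distinct X Y (suc (suc k))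
      closes {k} D with bounded? (λ j → (X (suc k) ≟ X j) ⊎-dec (X (suc k) ≟ Y j)) (suc k)
                      | bounded? (λ j → (Y (suc k) ≟ Y j) ⊎-dec (Y (suc k) ≟ X j)) (suc k)
      ... | no ¬x | no ¬y = inj₂ record
          { XX = λ p q e → ext (λ lt e → ⊥-elim (¬x (_ , lt , inj₁ e))) XX p q e
          ; YY = λ p q e → ext (λ lt e → ⊥-elim (¬y (_ , lt , inj₁ e))) YY p q e
          ; XY = xy }
        where
        open Distinct D
        ext : ∀ {Z : ℕ → V} → (∀ {j} → j < suc k → Z (suc k) ≡ Z j → ⊥) →
              (∀ {i j} → i < suc k → j < suc k → Z i ≡ Z j → i ≡ j) →
              ∀ {i j} → i < suc (suc k) → j < suc (suc k) → Z i ≡ Z j → i ≡ j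
        ext new old (s≤s p) (s≤s q) e with ℕ.m≤n⇒m<n∨m≡n p | ℕ.m≤n⇒m<n∨m≡n q
        ... | inj₁ a | inj₁ b = old a b e
        ... | inj₁ a | inj₂ refl = ⊥-elim (new a (sym e))
        ... | inj₂ refl | inj₁ b = ⊥-elim (new b e)
        ... | inj₂ refl | inj₂ refl = refl
        xy : ∀ {i j} → i < suc (suc k) → j < suc (suc k) → X i ≢ Y j
        xy (s≤s p) (s≤s q) e with ℕ.m≤n⇒m<n∨m≡n p | ℕ.m≤n⇒m<n∨m≡n q
        ... | inj₁ a | inj₁ b = XY a b e
        ... | inj₁ a | inj₂ refl = ¬y (_ , a , inj₂ (sym e))
        ... | inj₂ refl | inj₁ b = ¬x (_ , b , inj₂ e)
        ... | inj₂ refl | inj₂ refl = ~≢ (Rail.X~Y R (suc k)) e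
      ... | yes (zero , _ , inj₁ e) | _ =
          let e′ = Period.also-X R D e
          in inj₁ (straight e e′ (Rail.At.back-X R D e) (Rail.At.back-X (swap-rails R) (swap-distinct D) e′))
      ... | yes (zero , _ , inj₂ e) | _ =
          let e′ = Period.also-Y R D e
          in inj₁ (twisted e e′ (Rail.At.back-Y R D e) (Rail.At.back-Y (swap-rails R) (swap-distinct D) e′))
      ... | yes (suc i , lt , inj₁ e) | _ = ⊥-elim (Rail.At.not-X R D lt e)
      ... | yes (suc i , lt , inj₂ e) | _ = ⊥-elim (Rail.At.not-Y R D lt e)
      ... | no _ | yes (zero , _ , inj₁ e) =
          let e′ = Period.also-X (swap-rails R) (swap-distinct D) e
          in inj₁ (straight e′ e (Rail.At.back-X R D e′) (Rail.At.back-X (swap-rails R) (swap-distinct D) e))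
      ... | no _ | yes (zero , _ , inj₂ e) =
          let e′ = Period.also-Y (swap-rails R) (swap-distinct D) e
          in inj₁ (twisted e′ e (Rail.At.back-Y R D e′) (Rail.At.back-Y (swap-rails R) (swap-distinct D) e))
      ... | no _ | yes (suc i , lt , inj₁ e) = ⊥-elim (Rail.At.not-X (swap-rails R) (swap-distinct D) lt e)
      ... | no _ | yes (suc i , lt , inj₂ e) = ⊥-elim (Rail.At.not-Y (swap-rails R) (swap-distinct D) lt e)

      distinct₁ : Distinct X Y 1
      distinct₁ = record
        { XX = λ { (s≤s z≤n) (s≤s z≤n) _ → refl } ; YY = λ { (s≤s z≤n) (s≤s z≤n) _ → refl }
        ; XY = λ { (s≤s z≤n) (s≤s z≤n) → ~≢ (Rail.X~Y R 0) } }

      -- Without a return, more vertices of one rail than `n G` would be distinct.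
      period : ∃ λ k → Distinct X Y (suc k) × Closed X Y P Q k
      period with walk-on (n G)
        where
        walk-on : ∀ m → (∃ λ k → Distinct X Y (suc k) × Closed X Y P Q k) ⊎ Distinct X Y (suc m)
        walk-on zero = inj₂ distinct₁
        walk-on (suc m) with walk-on m
        ... | inj₁ found = inj₁ found
        ... | inj₂ D with closes D
        ... | inj₁ c = inj₁ (m , D , c)
        ... | inj₂ D′ = inj₂ D′
      ... | inj₁ found = found
      ... | inj₂ D = ⊥-elim (ℕ.<⇒≱ (ℕ.n<1+n (n G)) (injective⇒≤ {f = λ (i : Fin (suc (n G))) → X (toℕ i)}
              (λ {i} {j} e → FinP.toℕ-injective (Distinct.XX D (FinP.toℕ<n i) (FinP.toℕ<n j) e))))

    module Whole {X Y : ℕ → V} {P Q : V} (R : Rails X Y P Q) {k : ℕ} (D : Distinct X Y (suc k)) (C : Closed X Y P Q k) where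
      open Rails R
      open Rail R
      Y~Y : ∀ i → Y i ~ Y (suc i)
      Y~Y = Rail.X~X (swap-rails R)
      m : ℕ
      m = suc k

      On-rails : V → Set
      On-rails v = ∃ λ i → i < m × (v ≡ X i ⊎ v ≡ Y i)

      On-rails? : Decidable On-rails
      On-rails? v = bounded? (λ i → (v ≟ X i) ⊎-dec (v ≟ Y i)) m

      X-on : ∀ {i} → i < suc m → On-rails (X i)
      X-on {i} (s≤s lt) with ℕ.m≤n⇒m<n∨m≡n lt
      ... | inj₁ i< = i , i< , inj₁ refl
      ... | inj₂ refl = case C of λ where
        (straight e _ _ _) → 0 , s≤s z≤n , inj₁ e
        (twisted e _ _ _) → 0 , s≤s z≤n , inj₂ e

      Y-on : ∀ {i} → i < suc m → On-rails (Y i)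
      Y-on {i} (s≤s lt) with ℕ.m≤n⇒m<n∨m≡n lt
      ... | inj₁ i< = i , i< , inj₂ refl
      ... | inj₂ refl = case C of λ where
        (straight _ e _ _) → 0 , s≤s z≤n , inj₂ e
        (twisted _ e _ _) → 0 , s≤s z≤n , inj₁ e

      P-on : On-rails P
      P-on = case C of λ where
        (straight _ _ e _) → k , ℕ.≤-refl , inj₁ (sym e)
        (twisted _ _ _ e) → k , ℕ.≤-refl , inj₂ (sym e)

      Q-on : On-rails Q
      Q-on = case C of λ where
        (straight _ _ _ e) → k , ℕ.≤-refl , inj₂ (sym e)
        (twisted _ _ e _) → k , ℕ.≤-refl , inj₁ (sym e)

      closed : ∀ {u v} → On-rails u → u ~ v → On-rails v
      closed (zero , _ , inj₁ refl) e with NX₀ e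
      ... | 0th = P-on
      ... | 1st = X-on (s≤s (s≤s z≤n))
      ... | 2nd = Y-on (s≤s z≤n)
      closed (zero , _ , inj₂ refl) e with NY₀ e
      ... | 0th = Q-on
      ... | 1st = Y-on (s≤s (s≤s z≤n))
      ... | 2nd = X-on (s≤s z≤n)
      closed (suc i , lt , inj₁ refl) e with NXₛ i e
      ... | 0th = X-on (ℕ.m≤n⇒m≤1+n (ℕ.<-trans (ℕ.n<1+n i) lt))
      ... | 1st = X-on (s≤s lt)
      ... | 2nd = Y-on (ℕ.m≤n⇒m≤1+n lt)
      closed (suc i , lt , inj₂ refl) e with NYₛ i e
      ... | 0th = Y-on (ℕ.m≤n⇒m≤1+n (ℕ.<-trans (ℕ.n<1+n i) lt))
      ... | 1st = Y-on (s≤s lt)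
      ... | 2nd = X-on (ℕ.m≤n⇒m≤1+n lt)

      -- The rails are closed under adjacency. A vertex off the rails and a neighbour of it would be
      -- cut off from two rail vertices by `X 0` alone, contrary to `noSep`.
      everything : ∀ v → On-rails v
      everything v with On-rails? v
      ... | yes p = p
      ... | no ¬v with nbr good v v v
      ... | w , vw , _ =
          let only : ∀ {z} → z ≢ X 0 → z ∉ X 0 ∷ X 0 ∷ X 0 ∷ []
              only = λ where
                ne 0th → ne refl
                ne 1st → ne refl
                ne 2nd → ne refl
          in ⊥-elim (noSep good On-rails? (X 0) (X 0) (X 0) (λ p e → inj₁ (closed p e))
               (X 1 , Y 0 , proj₂ (proj₂ (≢₃ NX₀)) ,
                 (X-on (s≤s (s≤s z≤n)) , only (~≢ (X~X 0) ∘ sym)) , (Y-on (s≤s z≤n) , only (~≢ (X~Y 0) ∘ sym)))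
               (v , w , ~≢ vw , (¬v , only (λ { refl → ¬v (X-on (s≤s z≤n)) })) ,
                 ((λ p → ¬v (closed p (~sym vw))) , only (λ { refl → ¬v (closed (X-on (s≤s z≤n)) (~sym vw)) }))))

      cubic : ∀ v → ∃ λ a → ∃ λ b → ∃ λ c → Nb G v (a ∷ b ∷ c ∷ [])
      cubic v with everything v
      ... | zero , _ , inj₁ refl = _ , _ , _ , NX₀
      ... | zero , _ , inj₂ refl = _ , _ , _ , NY₀
      ... | suc i , _ , inj₁ refl = _ , _ , _ , NXₛ i
      ... | suc i , _ , inj₂ refl = _ , _ , _ , NYₛ i

    module _ {X Y : ℕ → V} {P Q : V} (R : Rails X Y P Q) {k : ℕ} (D : Distinct X Y (suc k)) (C : Closed X Y P Q k) where
      open Rails R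
      open Whole R D C
      open Rail R using (X~X; X~Y)
      open Distinct D

      2≤m : 2 ≤ m
      2≤m = s≤s (ℕ.n≢0⇒n>0 λ { refl → case C of λ where
        (straight e _ _ _) → ~≢ (X~X 0) (sym e)
        (twisted e _ _ _) → proj₂ (proj₂ (≢₃ NX₀)) e })

      abstract
        -- The numbering used by `Aₙ` and `A′ₙ`: first the vertices of one rail, then those of the
        -- other, shifted by `m`.
        vertex : ℕ → V
        vertex j with j ℕ.<? m
        ... | yes _ = X j
        ... | no _ = Y (j ∸ m)

        vertex-lo : ∀ {j} → j < m → vertex j ≡ X j
        vertex-lo {j} lt with j ℕ.<? m
        ... | yes _ = refl
        ... | no ≥ = ⊥-elim (≥ lt)

        vertex-hi : ∀ i → vertex (m + i) ≡ Y i
        vertex-hi i with (m + i) ℕ.<? m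
        ... | yes lt = ⊥-elim (ℕ.<⇒≱ lt (ℕ.m≤m+n m i))
        ... | no _ = cong Y (ℕ.m+n∸m≡n m i)

      vertex-m : vertex m ≡ Y 0
      vertex-m = trans (cong vertex (sym (ℕ.+-identityʳ m))) (vertex-hi 0)

      data Half (j : ℕ) : Set where
        first  : j < m → Half j
        second : ∀ i → i < m → j ≡ m + i → Half j

      half : ∀ {j} → j < m + m → Half j
      half {j} lt with j ℕ.<? m
      ... | yes p = first p
      ... | no ≥ =
          let eq : m + (j ∸ m) ≡ j
              eq = ℕ.m+[n∸m]≡n (ℕ.≮⇒≥ ≥)
          in second (j ∸ m) (ℕ.+-cancelˡ-< m (j ∸ m) m (subst (_< m + m) (sym eq) lt)) (sym eq)

      vertex-injective : ∀ {i j} → i < m + m → j < m + m → vertex i ≡ vertex j → i ≡ j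
      vertex-injective p q e with half p | half q
      ... | first a | first b = XX a b (trans (sym (vertex-lo a)) (trans e (vertex-lo b)))
      ... | first a | second j b refl = ⊥-elim (XY a b (trans (sym (vertex-lo a)) (trans e (vertex-hi j))))
      ... | second i a refl | first b = ⊥-elim (XY b a (trans (sym (vertex-lo b)) (trans (sym e) (vertex-hi i))))
      ... | second i a refl | second j b refl = cong (m +_) (YY a b (trans (sym (vertex-hi i)) (trans e (vertex-hi j))))

      index : ∀ v → ∃ λ j → j < m + m × vertex j ≡ v
      index v with everything v
      ... | i , lt , inj₁ refl = i , ℕ.<-≤-trans lt (ℕ.m≤m+n m m) , vertex-lo lt
      ... | i , lt , inj₂ refl = m + i , ℕ.+-monoʳ-< m lt , vertex-hi i

      -- The two rails contain all of the at least eight vertices, so `m + m` is at least eight.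
      4≤m : 4 ≤ m
      4≤m with 4 ℕ.≤? m
      ... | yes p = p
      ... | no ¬p =
          let m≤3 : m ≤ 3
              m≤3 = ℕ.≤-pred (ℕ.≰⇒> ¬p)
              n≤ : n G ≤ m + m
              n≤ = injective⇒≤ {f = λ v → Data.Fin.fromℕ< (proj₁ (proj₂ (index v)))} λ {u} {v} e →
                trans (sym (proj₂ (proj₂ (index u)))) (trans (cong vertex (FinP.fromℕ<-injective _ _ (proj₁ (proj₂ (index u))) (proj₁ (proj₂ (index v))) e)) (proj₂ (proj₂ (index v))))
          in ⊥-elim (ℕ.<⇒≱ (ℕ.≤-<-trans (ℕ.+-mono-≤ m≤3 m≤3) (s≤s (ℕ.n≤1+n 6))) (ℕ.≤-trans 8≤n n≤))

      rungs : List (ℕ × ℕ)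
      rungs = ladderEdges m

      -- Common to both ways of closing: `α` and `β` are the numbers of the vertices before the
      -- first rung, and `wrapX` and `wrapY` lead from the last rung back to the first.
      module Isomorphic (α β : ℕ) (α< : α < m + m) (β< : β < m + m) (vα : vertex α ≡ P) (vβ : vertex β ≡ Q)
        (wrapX : ∃ λ γ → γ < m + m × vertex γ ≡ X m × Linked ((0 , α) ∷ (m , β) ∷ rungs) k γ)
        (wrapY : ∃ λ γ → γ < m + m × vertex γ ≡ Y m × Linked ((0 , α) ∷ (m , β) ∷ rungs) (m + k) γ) where
        es : List (ℕ × ℕ)
        es = (0 , α) ∷ (m , β) ∷ rungs

        H : Graph
        H = fromEdges (m + m) es

        rail-edge : ∀ {i} → i < k → (i , suc i) ∈ es
        rail-edge lt = there (there (ListP.∈-++⁺ˡ (ListP.∈-map⁺ _ (ListP.∈-upTo⁺ lt))))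
        rail′-edge : ∀ {i} → i < k → (m + i , m + suc i) ∈ es
        rail′-edge lt = there (there (ListP.∈-++⁺ʳ (map (λ i → (i , suc i)) (upTo k)) (ListP.∈-++⁺ˡ (ListP.∈-map⁺ _ (ListP.∈-upTo⁺ lt)))))
        rung-edge : ∀ {i} → i < m → (i , m + i) ∈ es
        rung-edge lt = there (there (ListP.∈-++⁺ʳ (map (λ i → (i , suc i)) (upTo k)) (ListP.∈-++⁺ʳ (map (λ i → (m + i , m + suc i)) (upTo k)) (ListP.∈-map⁺ _ (ListP.∈-upTo⁺ lt)))))

        at : ∀ {a b u v} → vertex a ≡ u → vertex b ≡ v → u ~ v → vertex a ~ vertex b
        at refl refl e = e

        sound : ∀ {a b} → (a , b) ∈ es → vertex a ~ vertex b
        sound 0th = at (vertex-lo (s≤s z≤n)) vα (proj₁ (all₃ NX₀))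
        sound 1st = at vertex-m vβ (proj₁ (all₃ NY₀))
        sound (there (there p)) with ListP.∈-++⁻ (map (λ i → (i , suc i)) (upTo k)) p
        ... | inj₁ q with ListP.∈-map⁻ _ q
        ... | i , r , refl =
            let lt : i < k
                lt = ListP.∈-upTo⁻ r
            in at (vertex-lo (ℕ.m≤n⇒m≤1+n lt)) (vertex-lo (s≤s lt)) (X~X i)
        sound (there (there p)) | inj₂ q with ListP.∈-++⁻ (map (λ i → (m + i , m + suc i)) (upTo k)) q
        ... | inj₁ q with ListP.∈-map⁻ _ q
        ... | i , r , refl = at (vertex-hi i) (vertex-hi (suc i)) (Y~Y i)
        sound (there (there p)) | inj₂ q | inj₂ q′ with ListP.∈-map⁻ _ q′
        ... | i , r , refl = at (vertex-lo (ListP.∈-upTo⁻ r)) (vertex-hi i) (X~Y i)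

        k≤ : ∀ {i} → suc i < m → i < k
        k≤ (s≤s p) = p

        lo< : ∀ {i} → i < m → i < m + m
        lo< p = ℕ.<-≤-trans p (ℕ.m≤m+n m m)
        hi< : ∀ {i} → i < m → m + i < m + m
        hi< p = ℕ.+-monoʳ-< m p

        1<m : 1 < m
        1<m = 2≤m

        Reach : ℕ → V → Set
        Reach a v = ∃ λ b → b < m + m × vertex b ≡ v × Linked es a b

        next-X : ∀ {i} → i < m → Reach i (X (suc i))
        next-X {i} (s≤s p) with ℕ.m≤n⇒m<n∨m≡n p
        ... | inj₁ lt = suc i , lo< (s≤s lt) , vertex-lo (s≤s lt) , inj₁ (rail-edge lt)
        ... | inj₂ refl = wrapX

        next-Y : ∀ {i} → i < m → Reach (m + i) (Y (suc i))
        next-Y {i} (s≤s p) with ℕ.m≤n⇒m<n∨m≡n p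
        ... | inj₁ lt = m + suc i , hi< (s≤s lt) , vertex-hi (suc i) , inj₁ (rail′-edge lt)
        ... | inj₂ refl = wrapY

        reach-X : ∀ {i} → i < m → ∀ {v} → X i ~ v → Reach i v
        reach-X {zero} lt e with NX₀ e
        ... | 0th = α , α< , vα , inj₁ 0th
        ... | 1st = next-X lt
        ... | 2nd = m + 0 , hi< lt , vertex-hi 0 , inj₁ (rung-edge lt)
        reach-X {suc i} lt e with NXₛ i e
        ... | 0th = i , lo< (ℕ.<-trans (ℕ.n<1+n i) lt) , vertex-lo (ℕ.<-trans (ℕ.n<1+n i) lt) , inj₂ (rail-edge (k≤ lt))
        ... | 1st = next-X lt
        ... | 2nd = m + suc i , hi< lt , vertex-hi (suc i) , inj₁ (rung-edge lt)

        reach-Y : ∀ {i} → i < m → ∀ {v} → Y i ~ v → Reach (m + i) v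
        reach-Y {zero} lt e with NY₀ e
        ... | 0th = β , β< , vβ , subst (λ z → Linked es z β) (sym (ℕ.+-identityʳ m)) (inj₁ 1st)
        ... | 1st = next-Y lt
        ... | 2nd = 0 , lo< lt , vertex-lo lt , inj₂ (rung-edge lt)
        reach-Y {suc i} lt e with NYₛ i e
        ... | 0th = m + i , hi< (ℕ.<-trans (ℕ.n<1+n i) lt) , vertex-hi i , inj₂ (rail′-edge (k≤ lt))
        ... | 1st = next-Y lt
        ... | 2nd = suc i , lo< lt , vertex-lo lt , inj₂ (rung-edge lt)

        reach : ∀ {a} → a < m + m → ∀ {v} → vertex a ~ v → Reach a v
        reach p {v} e with half p
        ... | first lt = reach-X lt (subst (_~ v) (vertex-lo lt) e)
        ... | second i lt refl = reach-Y lt (subst (_~ v) (vertex-hi i) e)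

        to : V → Fin (m + m)
        to v = Data.Fin.fromℕ< (proj₁ (proj₂ (index v)))

        vertex-to : ∀ v → vertex (toℕ (to v)) ≡ v
        vertex-to v = trans (cong vertex (FinP.toℕ-fromℕ< (proj₁ (proj₂ (index v))))) (proj₂ (proj₂ (index v)))

        iso : G ≅ H
        iso = mk↔ₛ′ to (λ j → vertex (toℕ j))
                (λ j → FinP.toℕ-injective (vertex-injective (FinP.toℕ<n _) (FinP.toℕ<n j) (vertex-to _)))
                vertex-to
            , λ u v → iff-≡
                (λ e → subst₂ _~_ (vertex-to u) (vertex-to v) (case fromEdges-sound {es = es} (to u) (to v) e of λ where
                  (inj₁ p) → sound p
                  (inj₂ p) → ~sym (sound p)))
                (λ e → fromEdges-complete {es = es} (to u) (to v)
                  (λ eq → ~≢ e (trans (sym (vertex-to u)) (trans (cong (vertex ∘ toℕ) eq) (vertex-to v))))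
                  (case reach (FinP.toℕ<n (to u)) (subst₂ _~_ (sym (vertex-to u)) (sym (vertex-to v)) e) of λ
                    { (b , b< , vb , l) → subst (Linked es (toℕ (to u))) (vertex-injective b< (FinP.toℕ<n (to v)) vb) l }))

      k<m : k < m
      k<m = ℕ.≤-refl

      in𝒜 : In𝒜 G
      in𝒜 = m , 4≤m , (case C of λ where
        (straight eX eY eP eQ) → inj₁ (Isomorphic.iso k (m + k) (ℕ.<-≤-trans k<m (ℕ.m≤m+n m m)) (ℕ.+-monoʳ-< m k<m)
          (trans (vertex-lo k<m) eP) (trans (vertex-hi k) eQ)
          (0 , s≤s z≤n , trans (vertex-lo (s≤s z≤n)) (sym eX) , inj₂ 0th)
          (m , ℕ.m<m+n m (s≤s z≤n) , trans vertex-m (sym eY) , inj₂ 1st))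
        (twisted eX eY eP eQ) → inj₂ (Isomorphic.iso (m + k) k (ℕ.+-monoʳ-< m k<m) (ℕ.<-≤-trans k<m (ℕ.m≤m+n m m))
          (trans (vertex-hi k) eQ) (trans (vertex-lo k<m) eP)
          (m , ℕ.m<m+n m (s≤s z≤n) , trans vertex-m (sym eX) , inj₂ 1st)
          (0 , s≤s z≤n , trans (vertex-lo (s≤s z≤n)) (sym eY) , inj₂ 0th)))


    -- Triangle-free graphs in which every edge lies in a 4-cut: squares with two adjacent cubic
    -- vertices.

    module Irreducible (tf : ∀ {a b c : V} → a ~ b → b ~ c → ¬ a ~ c) (fs : ∀ {e f : V} → e ~ f → FourSep G e f) where
      Nb-213 : ∀ {v a b c} → Nb G v (a ∷ b ∷ c ∷ []) → Nb G v (b ∷ a ∷ c ∷ [])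
      Nb-213 N e = case N e of λ { 0th → 1st ; 1st → 0th ; 2nd → 2nd }

      Nb-132 : ∀ {v a b c} → Nb G v (a ∷ b ∷ c ∷ []) → Nb G v (a ∷ c ∷ b ∷ [])
      Nb-132 N e = case N e of λ { 0th → 0th ; 1st → 2nd ; 2nd → 1st }

      Nb-312 : ∀ {v a b c} → Nb G v (a ∷ b ∷ c ∷ []) → Nb G v (c ∷ a ∷ b ∷ [])
      Nb-312 N = Nb-213 (Nb-132 N)

      Nb-231 : ∀ {v a b c} → Nb G v (a ∷ b ∷ c ∷ []) → Nb G v (b ∷ c ∷ a ∷ [])
      Nb-231 N = Nb-132 (Nb-213 N)

      Nb-321 : ∀ {v a b c} → Nb G v (a ∷ b ∷ c ∷ []) → Nb G v (c ∷ b ∷ a ∷ [])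
      Nb-321 N = Nb-213 (Nb-231 N)

      -- A square x u v y with u and v cubic and third neighbours s and t.
      record TypeP (x y u v s t : V) : Set where
        field
          xy : x ~ y
          uv : u ~ v
          ux : u ~ x
          vy : v ~ y
          Nu : Nb G u (x ∷ v ∷ s ∷ [])
          Nv : Nb G v (y ∷ u ∷ t ∷ [])

      mirror : ∀ {x y u v s t} → TypeP x y u v s t → TypeP y x v u t s
      mirror P =
          let
              open TypeP P
          in record { xy = ~sym xy ; uv = ~sym uv ; ux = vy ; vy = ux ; Nu = Nv ; Nv = Nu }

      -- For a square of type P this gives a second square `u v t s`, in which `t` is cubic.
      Cubic-end : V → V → V → Set
      Cubic-end s v t = ∃ λ w → Nb G t (s ∷ v ∷ w ∷ [])

      -- For a square of type P this gives a second square `u x x₀ s`, in which `x` and `x₀` are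
      -- cubic.
      Cubic-pair : V → V → V → V → Set
      Cubic-pair x y u s = ∃₂ λ x₀ r → Nb G x (u ∷ y ∷ x₀ ∷ []) × Nb G x₀ (x ∷ s ∷ r ∷ [])

      -- `C` is a cut through `us` and `D` one through `uv`. Their sides intersect in four regions;
      -- wherever at most three vertices bound one of these, it is empty or a single vertex, and
      -- triangle-freeness restricts it further.
      module Crossing {x y u v s t r r₁ r₂ : V} (P : TypeP x y u v s t)
        (C : Cut₄ G u s y r) (D : Cut₄ G u v r₁ r₂)
        (κx : Cut₄.κ C x ≡ lo) (κv : Cut₄.κ C v ≡ hi)
        (μx : Cut₄.κ D x ≡ lo) (μs : Cut₄.κ D s ≡ hi)
        (μy : Cut₄.κ D y ≡ lo) (μt : Cut₄.κ D t ≡ hi) where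
        open TypeP P
        open Cut₄ C using (κ)
        open Cut₄ D using () renaming (κ to μ)

        us : u ~ s
        us = proj₂ (proj₂ (all₃ Nu))

        vt : v ~ t
        vt = proj₂ (proj₂ (all₃ Nv))

        κs : κ s ≡ mid
        κs = (Cut₄.κf C)
        κy : κ y ≡ mid
        κy = (Cut₄.κg C)
        κr : κ r ≡ mid
        κr = (Cut₄.κh C)
        κu : κ u ≡ mid
        κu = (Cut₄.κe C)

        Q₁ : V → Set
        Q₁ w = μ w ≡ lo × w ≢ x
        Q₁? : Decidable Q₁
        Q₁? w = (μ w ≟ˢ lo) ×-dec ¬? (w ≟ x)

        -- A further vertex would be the only one of its region, adjacent to both `x` and `y`: a
        -- triangle.
        lo-lo : ∀ z → (Sep.Lo.Bd C) Q₁? z →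
          (μ r ≢ hi → r ∈ x ∷ y ∷ z ∷ []) →
          (μ r₁ ≡ mid → κ r₁ ≡ lo → r₁ ∈ x ∷ y ∷ z ∷ []) →
          (μ r₂ ≡ mid → κ r₂ ≡ lo → r₂ ∈ x ∷ y ∷ z ∷ []) →
          ∀ {p} → κ p ≡ lo → μ p ≡ lo → p ≡ x
        lo-lo z bz r∈ r₁∈ r₂∈ {p} kp mp with p ≟ x
        ... | yes e = e
        ... | no p≢x with all₃ (nb (kp , mp , p≢x))
          where
          clm : ∀ {a b} → κ a ≡ lo → Q₁ a → a ~ b → b ∈ u ∷ s ∷ y ∷ r ∷ [] → b ∈ x ∷ y ∷ z ∷ []
          clm ka (ma , a≢x) ab 0th = case Nu (~sym ab) of λ where
            0th → ⊥-elim (a≢x refl)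
            1st → clash ka κv lo≢hi
            2nd → clash ka κs lo≢mid
          clm ka (ma , a≢x) ab 1st = ⊥-elim ((Cut₄.cut D) ma μs ab)
          clm ka (ma , a≢x) ab 2nd = 1st
          clm ka (ma , a≢x) ab 3rd = r∈ ((Sep.not-hi D) ma ab)
          cll : ∀ {a b} → κ a ≡ lo → Q₁ a → a ~ b → κ b ≡ lo → Q₁ b ⊎ b ∈ x ∷ y ∷ z ∷ []
          cll {b = b} ka (ma , a≢x) ab kb with μ b in mb
          ... | hi = ⊥-elim ((Cut₄.cut D) ma mb ab)
          ... | mid = case (Cut₄.cov D) mb of λ where
            0th → clash kb κu lo≢mid
            1st → clash kb κv lo≢hi
            2nd → inj₂ (r₁∈ mb kb)
            3rd → inj₂ (r₂∈ mb kb)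
          ... | lo with b ≟ x
          ... | yes refl = inj₂ 0th
          ... | no b≢x = inj₁ (refl , b≢x)
          open Sep.Lo.One C Q₁? x y z (inj₂ (κx , λ (_ , ne) → ne refl) ∷ inj₁ κy ∷ bz ∷ []) clm cll
        ... | px , py , _ = ⊥-elim (tf px xy py)

        Q₂ : V → Set
        Q₂ w = μ w ≡ hi
        Q₂? : Decidable Q₂
        Q₂? w = μ w ≟ˢ hi

        module LoHi (L : List V) (s∈ : s ∈ L) (r∈ : μ r ≢ lo → r ∈ L)
          (r₁∈ : μ r₁ ≡ mid → κ r₁ ≡ lo → r₁ ∈ L) (r₂∈ : μ r₂ ≡ mid → κ r₂ ≡ lo → r₂ ∈ L) where
          clm : ∀ {a b} → κ a ≡ lo → Q₂ a → a ~ b → b ∈ u ∷ s ∷ y ∷ r ∷ [] → b ∈ L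
          clm ka ma ab 0th = case Nu (~sym ab) of λ where
            0th → clash ma μx hi≢lo
            1st → clash ka κv lo≢hi
            2nd → clash ka κs lo≢mid
          clm ka ma ab 1st = s∈
          clm ka ma ab 2nd = ⊥-elim ((Sep.cut′ D) ma μy ab)
          clm ka ma ab 3rd = r∈ ((Sep.not-lo D) ma ab)
          cll : ∀ {a b} → κ a ≡ lo → Q₂ a → a ~ b → κ b ≡ lo → Q₂ b ⊎ b ∈ L
          cll {b = b} ka ma ab kb with μ b in mb
          ... | lo = ⊥-elim ((Sep.cut′ D) ma mb ab)
          ... | hi = inj₁ refl
          ... | mid = case (Cut₄.cov D) mb of λ where
            0th → clash kb κu lo≢mid
            1st → clash kb κv lo≢hi
            2nd → inj₂ (r₁∈ mb kb)
            3rd → inj₂ (r₂∈ mb kb)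

        hi⇒lo : ∀ {w} → κ w ≡ hi → (Cut₄.κ (flip C)) w ≡ lo
        hi⇒lo = cong opp
        lo⇒hi : ∀ {w} → (Cut₄.κ (flip C)) w ≡ lo → κ w ≡ hi
        lo⇒hi = opp-move

        module HiHi (L : List V) (s∈ : s ∈ L) (v∈ : v ∈ L) (r∈ : μ r ≢ lo → r ∈ L)
          (r₁∈ : μ r₁ ≡ mid → κ r₁ ≡ hi → r₁ ∈ L) (r₂∈ : μ r₂ ≡ mid → κ r₂ ≡ hi → r₂ ∈ L) where
          clm : ∀ {a b} → (Cut₄.κ (flip C)) a ≡ lo → Q₂ a → a ~ b → b ∈ u ∷ s ∷ y ∷ r ∷ [] → b ∈ L
          clm ka ma ab 0th = case Nu (~sym ab) of λ where
            0th → clash ma μx hi≢lo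
            1st → clash ma (Cut₄.κf D) hi≢mid
            2nd → clash (lo⇒hi ka) κs hi≢mid
          clm ka ma ab 1st = s∈
          clm ka ma ab 2nd = ⊥-elim ((Sep.cut′ D) ma μy ab)
          clm ka ma ab 3rd = r∈ ((Sep.not-lo D) ma ab)
          cll : ∀ {a b} → (Cut₄.κ (flip C)) a ≡ lo → Q₂ a → a ~ b → (Cut₄.κ (flip C)) b ≡ lo → Q₂ b ⊎ b ∈ L
          cll {b = b} ka ma ab kb with μ b in mb
          ... | lo = ⊥-elim ((Sep.cut′ D) ma mb ab)
          ... | hi = inj₁ refl
          ... | mid = case (Cut₄.cov D) mb of λ where
            0th → clash (lo⇒hi kb) κu hi≢mid
            1st → inj₂ v∈
            2nd → inj₂ (r₁∈ mb (lo⇒hi kb))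
            3rd → inj₂ (r₂∈ mb (lo⇒hi kb))

        Q₃ : V → Set
        Q₃ w = μ w ≡ lo
        Q₃? : Decidable Q₃
        Q₃? w = μ w ≟ˢ lo

        -- The cubic cut vertices `u` and `v` have no neighbours in this region, so `y` and `z`
        -- alone bound it.
        hi-lo : ∀ z → (Sep.Lo.Bd (flip C)) Q₃? z → (μ r ≢ hi → r ∈ y ∷ z ∷ []) →
          (κ r₁ ≢ hi) → (κ r₂ ≢ hi) → ∀ {p} → κ p ≡ hi → μ p ≢ lo
        hi-lo z bz r∈ r₁∉ r₂∉ kp = (Sep.Lo.none (flip C)) Q₃? y z (inj₁ (cong opp κy) ∷ bz ∷ []) clm cll (hi⇒lo kp)
          where
          clm : ∀ {a b} → (Cut₄.κ (flip C)) a ≡ lo → Q₃ a → a ~ b → b ∈ u ∷ s ∷ y ∷ r ∷ [] → b ∈ y ∷ z ∷ []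
          clm ka ma ab 0th = case Nu (~sym ab) of λ where
            0th → clash (lo⇒hi ka) κx hi≢lo
            1st → clash ma (Cut₄.κf D) lo≢mid
            2nd → clash (lo⇒hi ka) κs hi≢mid
          clm ka ma ab 1st = ⊥-elim ((Cut₄.cut D) ma μs ab)
          clm ka ma ab 2nd = 0th
          clm ka ma ab 3rd = r∈ ((Sep.not-hi D) ma ab)
          cll : ∀ {a b} → (Cut₄.κ (flip C)) a ≡ lo → Q₃ a → a ~ b → (Cut₄.κ (flip C)) b ≡ lo → Q₃ b ⊎ b ∈ y ∷ z ∷ []
          cll {b = b} ka ma ab kb with μ b in mb
          ... | lo = inj₁ refl
          ... | hi = ⊥-elim ((Cut₄.cut D) ma mb ab)
          ... | mid = case (Cut₄.cov D) mb of λ where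
            0th → clash (lo⇒hi kb) κu hi≢mid
            1st → case Nv (~sym ab) of λ where
              0th → clash (lo⇒hi ka) κy hi≢mid
              1st → clash (lo⇒hi ka) κu hi≢mid
              2nd → clash ma μt lo≢hi
            2nd → ⊥-elim (r₁∉ (lo⇒hi kb))
            3rd → ⊥-elim (r₂∉ (lo⇒hi kb))

        Result : Set
        Result = Cubic-end s v t ⊎ Cubic-pair x y u s

        -- If hi ∩ hi has three boundary vertices s, v, z, it consists of t alone.
        module AtT (z : V) (bz : (Sep.Lo.Bd (flip C)) Q₂? z) (r∈ : μ r ≢ lo → r ∈ s ∷ v ∷ z ∷ [])
          (r₁∈ : μ r₁ ≡ mid → κ r₁ ≡ hi → r₁ ∈ s ∷ v ∷ z ∷ []) (r₂∈ : μ r₂ ≡ mid → κ r₂ ≡ hi → r₂ ∈ s ∷ v ∷ z ∷ []) where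
          open HiHi (s ∷ v ∷ z ∷ []) 0th 1st r∈ r₁∈ r₂∈
          open Sep.Lo.One (flip C) Q₂? s v z
            (inj₁ (cong opp κs) ∷ inj₂ (hi⇒lo κv , λ q → clash q (Cut₄.κf D) hi≢mid) ∷ bz ∷ []) clm cll

          member : ∀ {d} → κ d ≡ hi → μ d ≡ hi → Nb G d (s ∷ v ∷ z ∷ [])
          member kd md = nb (hi⇒lo kd , md)

          found : ∀ {d} → κ d ≡ hi → μ d ≡ hi → Result
          found {d} kd md with all₃ (member kd md)
          ... | _ , dv , _ with Nv (~sym dv)
          ... | 0th = clash md μy hi≢lo
          ... | 1st = clash kd κu hi≢mid
          ... | 2nd = inj₁ (z , member kd md)

        not-t : ∀ {w} → μ w ≡ lo → t ≢ w
        not-t mw refl = clash mw μt lo≢hi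

        κt : μ r ≡ lo → κ t ≡ hi
        κt mr with κ t in kt
        ... | lo = ⊥-elim ((Sep.cut′ C) κv kt vt)
        ... | hi = refl
        ... | mid with (Cut₄.cov C) kt
        ... | 0th = clash μt (Cut₄.κe D) hi≢mid
        ... | 1st = ⊥-elim (tf (~sym us) (TypeP.uv P) (~sym vt))
        ... | 2nd = clash μt μy hi≢lo
        ... | 3rd = clash μt mr hi≢lo

        -- The region lo-lo is `x` alone, so `x` is cubic with third neighbour `r₁`. A neighbour of
        -- `r₁` in the region lo-hi would be adjacent to `s` and `r` as well; then triangles are
        -- avoided only if `r₁` has no neighbour besides it and `x`, which is too few.
        module LoLoHi (mr : μ r ≡ hi) (k₁ : κ r₁ ≡ lo) (k₂ : κ r₂ ≡ hi) where
          μ₁ : μ r₁ ≡ mid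
          μ₁ = (Cut₄.κg D)
          lone : ∀ {p} → κ p ≡ lo → μ p ≡ lo → p ≡ x
          lone = lo-lo r₁ (inj₂ (k₁ , λ (q , _) → clash q μ₁ lo≢mid)) (λ ne → ⊥-elim (ne mr))
            (λ _ _ → 2nd) (λ _ k → clash k k₂ lo≢hi)
          open LoHi (s ∷ r ∷ r₁ ∷ []) 0th (λ _ → 1st) (λ _ _ → 2nd) (λ _ k → clash k k₂ lo≢hi)
          module E = Sep.Lo.One C Q₂? s r r₁ (inj₁ κs ∷ inj₁ κr ∷ inj₂ (k₁ , λ q → clash q μ₁ hi≢mid) ∷ []) clm cll

          Nx : Nb G x (u ∷ y ∷ r₁ ∷ [])
          Nx {w} e with κ w in kw | μ w in mw
          ... | hi | _ = ⊥-elim ((Cut₄.cut C) κx kw e)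
          ... | _ | hi = ⊥-elim ((Cut₄.cut D) μx mw e)
          ... | mid | lo = case (Cut₄.cov C) kw of λ where
            0th → 0th
            1st → clash mw μs lo≢hi
            2nd → 1st
            3rd → clash mr mw hi≢lo
          ... | lo | lo = ⊥-elim (~≢ e (sym (lone kw mw)))
          ... | lo | mid = case (Cut₄.cov D) mw of λ where
            0th → 0th
            1st → clash kw κv lo≢hi
            2nd → 2nd
            3rd → clash kw k₂ lo≢hi
          ... | mid | mid = case (Cut₄.cov D) mw of λ where
            0th → 0th
            1st → clash kw κv mid≢hi
            2nd → 2nd
            3rd → clash kw k₂ mid≢hi

          xr₁ : x ~ r₁
          xr₁ = proj₂ (proj₂ (all₃ Nx))

          near : ∀ {w} → r₁ ~ w → w ∈ x ∷ s ∷ r ∷ [] ⊎ (κ w ≡ lo × μ w ≡ hi)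
          near {w} e with κ w in kw
          ... | hi = ⊥-elim ((Cut₄.cut C) k₁ kw e)
          ... | mid = case (Cut₄.cov C) kw of λ where
            0th → case Nu (~sym e) of λ where
              0th → clash μx μ₁ lo≢mid
              1st → clash k₁ κv lo≢hi
              2nd → clash k₁ κs lo≢mid
            1st → inj₁ 1st
            2nd → ⊥-elim (tf (~sym xr₁) xy e)
            3rd → inj₁ 2nd
          ... | lo with μ w in mw
          ... | lo = case lone kw mw of λ { refl → inj₁ 0th }
          ... | hi = inj₂ (refl , refl)
          ... | mid = case (Cut₄.cov D) mw of λ where
            0th → clash kw κu lo≢mid
            1st → clash kw κv lo≢hi
            2nd → ⊥-elim (~≢ e refl)
            3rd → clash kw k₂ lo≢hi

          Nr₁ : Nb G r₁ (x ∷ s ∷ r ∷ [])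
          Nr₁ {c} e with near e
          ... | inj₁ m = m
          ... | inj₂ (kc , mc) with all₃ (E.nb (kc , mc)) | nbr good r₁ x c
          ... | cs , cr , cr₁ | w , e′ , ∉ with near e′
          ... | inj₁ 0th = ⊥-elim (∉ 0th)
          ... | inj₁ 1st = ⊥-elim (tf cr₁ e′ cs)
          ... | inj₁ 2nd = ⊥-elim (tf cr₁ e′ cr)
          ... | inj₂ (kw , mw) = ⊥-elim (∉ (there (here (E.unique (kw , mw) (kc , mc)))))

        -- The `lo` side of `C` has a second vertex besides `x`, for which no place remains.
        only-x : (∀ {p} → κ p ≡ lo → μ p ≡ lo → p ≡ x) → (∀ {p} → κ p ≡ lo → μ p ≢ hi) →
          (κ r₁ ≢ lo) → (κ r₂ ≢ lo) → ⊥
        only-x a b n₁ n₂ with (Sep.other-lo C) x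
        ... | c , c≢x , kc with μ c in mc
        ... | lo = c≢x (a kc mc)
        ... | hi = b kc mc
        ... | mid = case (Cut₄.cov D) mc of λ where
          0th → clash kc κu lo≢mid
          1st → clash kc κv lo≢hi
          2nd → n₁ kc
          3rd → n₂ kc

        not-mid : ∀ {w} → w ≢ r → μ w ≡ mid → w ≢ u → κ w ≢ mid
        not-mid w≢r mw w≢u kw = case (Cut₄.cov C) kw of λ where
          0th → w≢u refl
          1st → clash mw μs mid≢hi
          2nd → clash mw μy mid≢lo
          3rd → w≢r refl

        at-r₁ : r ≡ r₁ → Result
        at-r₁ refl with κ r₂ in k₂
        ... | mid = ⊥-elim (not-mid ((Sep.g≢h D) ∘ sym) (Cut₄.κh D) ((Sep.e≢h D) ∘ sym) k₂)
        ... | hi =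
            let
                open LoHi (s ∷ r ∷ []) 0th (λ _ → 1st) (λ _ _ → 1st) (λ _ k → clash k k₂ lo≢hi)
            in ⊥-elim (only-x
                 (lo-lo r (inj₁ κr) (λ _ → 2nd) (λ _ _ → 2nd) (λ _ k → clash k k₂ lo≢hi))
                 (λ kp mp → (Sep.Lo.none C) Q₂? s r (inj₁ κs ∷ inj₁ κr ∷ []) clm cll kp mp)
                 (λ q → clash q κr lo≢mid) (λ q → clash q k₂ lo≢hi))
        ... | lo with (Sep.other-lo (flip C)) v
        ... | d , d≢v , kd with μ d in md
        ... | hi = AtT.found r (inj₁ (cong opp κr)) (λ _ → 2nd) (λ _ _ → 2nd) (λ _ k → clash k k₂ hi≢lo) (lo⇒hi kd) md
        ... | lo = ⊥-elim (hi-lo r (inj₁ (cong opp κr)) (λ _ → 1st) (λ k → clash k κr hi≢mid) (λ k → clash k k₂ hi≢lo) (lo⇒hi kd) md)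
        ... | mid = case (Cut₄.cov D) md of λ where
          0th → clash (lo⇒hi kd) κu hi≢mid
          1st → ⊥-elim (d≢v refl)
          2nd → clash (lo⇒hi kd) κr hi≢mid
          3rd → clash (lo⇒hi kd) k₂ hi≢lo

        at-lo : μ r ≡ lo → κ r₁ ≢ mid → κ r₂ ≢ mid → Result
        at-lo mr n₁ n₂ with κ r₁ in k₁ | κ r₂ in k₂
        ... | mid | _ = ⊥-elim (n₁ refl)
        ... | _ | mid = ⊥-elim (n₂ refl)
        ... | lo | hi = AtT.found r₂ (inj₂ (hi⇒lo k₂ , λ q → clash q (Cut₄.κh D) hi≢mid)) (λ ne → ⊥-elim (ne mr))
            (λ _ k → clash k k₁ hi≢lo) (λ _ _ → 2nd) (κt mr) μt
        ... | hi | lo = AtT.found r₁ (inj₂ (hi⇒lo k₁ , λ q → clash q (Cut₄.κg D) hi≢mid)) (λ ne → ⊥-elim (ne mr))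
            (λ _ _ → 2nd) (λ _ k → clash k k₂ hi≢lo) (κt mr) μt
        ... | lo | lo =
            let
                open HiHi (s ∷ v ∷ []) 0th 1st (λ ne → ⊥-elim (ne mr)) (λ _ k → clash k k₁ hi≢lo) (λ _ k → clash k k₂ hi≢lo)
            in ⊥-elim ((Sep.Lo.none (flip C)) Q₂? s v
                 (inj₁ (cong opp κs) ∷ inj₂ (hi⇒lo κv , λ q → clash q (Cut₄.κf D) hi≢mid) ∷ []) clm cll (hi⇒lo (κt mr)) μt)
        ... | hi | hi =
            let
                open LoHi (s ∷ s ∷ []) 0th (λ ne → ⊥-elim (ne mr)) (λ _ k → clash k k₁ lo≢hi) (λ _ k → clash k k₂ lo≢hi)
            in ⊥-elim (only-x
                 (lo-lo r (inj₁ κr) (λ _ → 2nd) (λ _ k → clash k k₁ lo≢hi) (λ _ k → clash k k₂ lo≢hi))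
                 (λ kp mp → (Sep.Lo.none C) Q₂? s s (inj₁ κs ∷ inj₁ κs ∷ []) clm cll kp mp)
                 (λ q → clash q k₁ lo≢hi) (λ q → clash q k₂ lo≢hi))

        -- The first alternative returned is the mirror image of the case settled by `LoLoHi`; the
        -- caller exchanges `r₁` and `r₂`.
        at-hi : μ r ≡ hi → κ r₁ ≡ lo ⊎ κ r₁ ≡ hi → κ r₂ ≡ lo ⊎ κ r₂ ≡ hi → κ r₁ ≡ hi × κ r₂ ≡ lo ⊎ Result
        at-hi mr (inj₂ k₁) (inj₁ k₂) = inj₁ (k₁ , k₂)
        at-hi mr (inj₁ k₁) (inj₂ k₂) = inj₂ (inj₂ (r₁ , r , LoLoHi.Nx mr k₁ k₂ , LoLoHi.Nr₁ mr k₁ k₂))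
        at-hi mr (inj₂ k₁) (inj₂ k₂) =
            let
                open LoHi (s ∷ r ∷ []) 0th (λ _ → 1st) (λ _ k → clash k k₁ lo≢hi) (λ _ k → clash k k₂ lo≢hi)
            in ⊥-elim (only-x
                 (lo-lo y (inj₁ κy) (λ ne → ⊥-elim (ne mr)) (λ _ k → clash k k₁ lo≢hi) (λ _ k → clash k k₂ lo≢hi))
                 (λ kp mp → (Sep.Lo.none C) Q₂? s r (inj₁ κs ∷ inj₁ κr ∷ []) clm cll kp mp)
                 (λ q → clash q k₁ lo≢hi) (λ q → clash q k₂ lo≢hi))
        at-hi mr (inj₁ k₁) (inj₁ k₂) with (Sep.other-lo (flip C)) v
        ... | d , d≢v , kd with μ d in md
        ... | hi = inj₂ (AtT.found r (inj₁ (cong opp κr)) (λ _ → 2nd) (λ _ k → clash k k₁ hi≢lo) (λ _ k → clash k k₂ hi≢lo) (lo⇒hi kd) md)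
        ... | lo = ⊥-elim (hi-lo y (inj₁ (cong opp κy)) (λ ne → ⊥-elim (ne mr)) (λ k → clash k k₁ hi≢lo) (λ k → clash k k₂ hi≢lo) (lo⇒hi kd) md)
        ... | mid = case (Cut₄.cov D) md of λ where
          0th → clash (lo⇒hi kd) κu hi≢mid
          1st → ⊥-elim (d≢v refl)
          2nd → clash (lo⇒hi kd) k₁ hi≢lo
          3rd → clash (lo⇒hi kd) k₂ hi≢lo

        side : ∀ {w} → κ w ≢ mid → κ w ≡ lo ⊎ κ w ≡ hi
        side {w} ne with κ w
        ... | lo = inj₁ refl
        ... | hi = inj₂ refl
        ... | mid = ⊥-elim (ne refl)

        r≢r₁ : μ r ≢ mid → r₁ ≢ r
        r≢r₁ ne refl = ne (Cut₄.κg D)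
        r≢r₂ : μ r ≢ mid → r₂ ≢ r
        r≢r₂ ne refl = ne (Cut₄.κh D)

        n₁ : μ r ≢ mid → κ r₁ ≢ mid
        n₁ ne = not-mid (r≢r₁ ne) (Cut₄.κg D) ((Sep.e≢g D) ∘ sym)
        n₂ : μ r ≢ mid → κ r₂ ≢ mid
        n₂ ne = not-mid (r≢r₂ ne) (Cut₄.κh D) ((Sep.e≢h D) ∘ sym)

      -- Cubic cut vertices have neighbours on both sides. Hence a cut through `uv` has `x`, `y` on
      -- one side and `s`, `t` on the other, and a cut through `us` separates `x` from `v`, so that
      -- their common neighbour `y` belongs to it.
      p1 : ∀ {x y u v s t} → TypeP x y u v s t → Cubic-end s v t ⊎ Cubic-pair x y u s
      p1 {x} {y} {u} {v} {s} {t} P = start (fs uv) (fs us)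
        where
        open TypeP P
        us : u ~ s
        us = proj₂ (proj₂ (all₃ Nu))

        go : ∀ {r r₁ r₂} (C : Cut₄ G u s y r) (D : Cut₄ G u v r₁ r₂)
          (κx : Cut₄.κ C x ≡ lo) (κv : Cut₄.κ C v ≡ hi)
          (μx : Cut₄.κ D x ≡ lo) (μs : Cut₄.κ D s ≡ hi)
          (μy : Cut₄.κ D y ≡ lo) (μt : Cut₄.κ D t ≡ hi) → Cubic-end s v t ⊎ Cubic-pair x y u s
        go {r} C D κx κv μx μs μy μt with Cut₄.κ D r in mr
        ... | lo =
            let ne = λ q → clash q mr mid≢lo
            in Crossing.at-lo P C D κx κv μx μs μy μt mr (Crossing.n₁ P C D κx κv μx μs μy μt ne) (Crossing.n₂ P C D κx κv μx μs μy μt ne)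
        ... | hi =
            let ne = λ q → clash q mr mid≢hi
                at-hi = Crossing.at-hi P C D κx κv μx μs μy μt
                at-hi′ = Crossing.at-hi P C (swap-gh D) κx κv μx μs μy μt
                c₁ = Crossing.side P C D κx κv μx μs μy μt (Crossing.n₁ P C D κx κv μx μs μy μt ne)
                c₂ = Crossing.side P C D κx κv μx μs μy μt (Crossing.n₂ P C D κx κv μx μs μy μt ne)
            in [ (λ (k₁ , k₂) → [ (λ (q , _) → clash q k₂ hi≢lo) , id ]′
                     (at-hi′ mr c₂ c₁)) , id ]′
                 (at-hi mr c₁ c₂)
        ... | mid with Cut₄.cov D mr
        ... | 0th = ⊥-elim (Sep.e≢h C refl)
        ... | 1st = clash κv (Cut₄.κh C) hi≢mid
        ... | 2nd = Crossing.at-r₁ P C D κx κv μx μs μy μt refl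
        ... | 3rd = Crossing.at-r₁ P C (swap-gh D) κx κv μx μs μy μt refl

        orient-C : ∀ {r r′ r₁ r₂} (C : Cut₄ G u s r r′) (D : Cut₄ G u v r₁ r₂)
          (κx : Cut₄.κ C x ≡ lo) (κv : Cut₄.κ C v ≡ hi)
          (μx : Cut₄.κ D x ≡ lo) (μs : Cut₄.κ D s ≡ hi)
          (μy : Cut₄.κ D y ≡ lo) (μt : Cut₄.κ D t ≡ hi) → Cubic-end s v t ⊎ Cubic-pair x y u s
        orient-C C D κx κv μx μs μy μt with Cut₄.cov C (Sep.between C κx κv xy vy)
        ... | 0th = clash μy (Cut₄.κe D) lo≢mid
        ... | 1st = clash μy μs lo≢hi
        ... | 2nd = go C D κx κv μx μs μy μt
        ... | 3rd = go (swap-gh C) D κx κv μx μs μy μt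

        orient-D : ∀ {r₁ r₂} (D : Cut₄ G u v r₁ r₂) → FourSep G u s →
          (μx : Cut₄.κ D x ≡ lo) (μs : Cut₄.κ D s ≡ hi) → Cubic-end s v t ⊎ Cubic-pair x y u s
        orient-D D (_ , _ , C) μx μs with split D (Cut₄.κf D) (Cut₄.κe D) (Nb-213 Nv)
          | split C (Cut₄.κe C) (Cut₄.κf C) (Nb-312 Nu)
        ... | inj₂ (μy , _) | _ = ⊥-elim (Sep.cut D μx μy xy)
        ... | inj₁ (μy , μt) | inj₁ (κx , κv) = orient-C C D κx κv μx μs μy μt
        ... | inj₁ (μy , μt) | inj₂ (κx , κv) = orient-C (flip C) D (cong opp κx) (cong opp κv) μx μs μy μt

        start : FourSep G u v → FourSep G u s → Cubic-end s v t ⊎ Cubic-pair x y u s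
        start (_ , _ , D) S with split D (Cut₄.κe D) (Cut₄.κf D) (Nb-213 Nu)
        ... | inj₁ (μx , μs) = orient-D D S μx μs
        ... | inj₂ (μx , μs) = orient-D (flip D) S (cong opp μx) (cong opp μs)

      -- The side lo without the vertex z.
      module LoMinus {e f g h : V} (F : Cut₄ G e f g h) (z : V) (κz : Cut₄.κ F z ≡ lo) where
        open Sep F
        ≢z? : Decidable (_≢ z)
        ≢z? v = ¬? (v ≟ z)

        none-left : ∀ a b → κ a ≡ mid → κ b ≡ mid →
          (∀ {w v} → κ w ≡ lo → w ≢ z → w ~ v → v ∈ e ∷ f ∷ g ∷ h ∷ [] → v ∈ a ∷ b ∷ []) →
          (∀ {w} → z ~ w → κ w ≡ mid) → ⊥
        none-left a b ka kb clm zmid with other-lo z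
        ... | c , c≢z , kc = Lo.none ≢z? a b (inj₁ ka ∷ inj₁ kb ∷ []) clm
          (λ {w} {v} kw w≢z wv kv → inj₁ λ { refl → clash kw (zmid (~sym wv)) lo≢mid }) kc c≢z

        module Through (a b : V) (ka : κ a ≡ mid) (kb : κ b ≡ mid)
          (clm : ∀ {w v} → κ w ≡ lo → w ≢ z → w ~ v → v ∈ e ∷ f ∷ g ∷ h ∷ [] → v ∈ a ∷ b ∷ z ∷ []) where
          cll : ∀ {w v} → κ w ≡ lo → w ≢ z → w ~ v → κ v ≡ lo → v ≢ z ⊎ v ∈ a ∷ b ∷ z ∷ []
          cll {v = v} _ _ _ _ with v ≟ z
          ... | yes refl = inj₂ 2nd
          ... | no ne = inj₁ ne
          open Lo.One ≢z? a b z (inj₁ ka ∷ inj₁ kb ∷ inj₂ (κz , λ ne → ne refl) ∷ []) clm cll public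

      -- Strips: four consecutive rungs of a ladder, the two inner ones with cubic ends.

      record Strip (p₀ p₁ p₂ p₃ q₀ q₁ q₂ q₃ : V) : Set where
        field
          r₀  : p₀ ~ q₀
          r₃  : p₃ ~ q₃
          Np₁ : Nb G p₁ (p₀ ∷ p₂ ∷ q₁ ∷ [])
          Np₂ : Nb G p₂ (p₁ ∷ p₃ ∷ q₂ ∷ [])
          Nq₁ : Nb G q₁ (q₀ ∷ q₂ ∷ p₁ ∷ [])
          Nq₂ : Nb G q₂ (q₁ ∷ q₃ ∷ p₂ ∷ [])

      record SomeStrip : Set where
        constructor strip
        field
          {p₀ p₁ p₂ p₃ q₀ q₁ q₂ q₃} : V
          isStrip : Strip p₀ p₁ p₂ p₃ q₀ q₁ q₂ q₃

      -- `y₀` is a neighbour of the cubic vertex `t`. If it were `s`, then `x`, `v`, `s` would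
      -- separate `u` and `y` from the rest; so it is `w`, and the square `t w y v` is again of type
      -- P.
      mixed : ∀ {x y u v s t} → TypeP x y u v s t → Cubic-end s v t → Cubic-pair y x v t → SomeStrip
      mixed {x} {y} {u} {v} {s} {t} P (w , Nt) (y₀ , r , Ny , Ny₀) = go (Nt (~sym (proj₁ (proj₂ (all₃ Ny₀)))))
        where
        open TypeP P
        go : y₀ ∈ s ∷ v ∷ w ∷ [] → SomeStrip
        go 1st = ⊥-elim (proj₁ (proj₂ (≢₃ Ny)) refl)
        go 0th =
            let back : ∀ {a b c d z} → z ∈ a ∷ b ∷ c ∷ [] → Nb G d (a ∷ b ∷ c ∷ []) → d ~ z
                back = λ where
                  0th N → proj₁ (all₃ N)
                  1st N → proj₁ (proj₂ (all₃ N))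
                  2nd N → proj₂ (proj₂ (all₃ N))
            in ⊥-elim (noSep good (λ a → a ∈? (u ∷ y ∷ [])) x v s
                 (λ { 0th e → inj₂ (Nu e) ; 1st e → inj₂ (Nb-213 Ny e) })
                 (u , y , proj₁ (≢₃ Nv) ∘ sym , (0th , λ m → ~≢ (back m Nu) refl) , (1st , λ m → ~≢ (back m (Nb-213 Ny)) refl))
                 (Two-map (λ ∉ → (λ { 0th → ∉ 0th ; 1st → ∉ 1st }) , (λ m → ∉ (there (there m))))
                   (pair-fresh (u ∷ y ∷ x ∷ v ∷ s ∷ []) (ℕ.≤-trans (ℕ.n≤1+n _) 8≤n))))
        go 2nd = last (p1 P″)
          where
          y≁ : y ~ v × y ~ x × y ~ w
          y≁ = all₃ Ny
          P″ : TypeP t v w y r x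
          P″ = record { xy = proj₁ (proj₂ (all₃ Nt)) ; uv = proj₁ (all₃ Ny₀) ; ux = proj₁ (proj₂ (all₃ Ny₀)) ; vy = proj₁ y≁
                      ; Nu = Nb-213 Ny₀ ; Nv = Nb-132 Ny }
          last : Cubic-end r y x ⊎ Cubic-pair t v w r → SomeStrip
          last (inj₁ (_ , Nx)) = strip record
            { r₀ = proj₂ (proj₂ (all₃ Nu)) ; r₃ = proj₁ (all₃ Nx)
            ; Np₁ = Nb-213 Nv ; Np₂ = Ny ; Nq₁ = Nb-132 Nt ; Nq₂ = Nb-231 Ny₀ }
          last (inj₂ (x₀ , r″ , Nt′ , Nx₀)) with Nt′ (proj₁ (all₃ Nt))
          ... | 0th = ⊥-elim (proj₁ (proj₂ (≢₃ Nt)) refl)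
          ... | 1st = ⊥-elim (proj₁ (≢₃ Nt) refl)
          ... | 2nd with Nx₀ (~sym (proj₂ (proj₂ (all₃ Nu))))
          ... | 0th = ⊥-elim (proj₂ (proj₂ (≢₃ Nv)) refl)
          ... | 2nd = strip record
            { r₀ = xy ; r₃ = ~sym (proj₂ (proj₂ (all₃ Ny₀))) ; Np₁ = Nb-132 Nu ; Np₂ = Nb-321 Nx₀
            ; Nq₁ = Nb-132 Nv ; Nq₂ = Nb-231 Nt }
          ... | 1st with Nu (~sym (proj₂ (proj₂ (all₃ Ny₀))))
          ... | 0th = ⊥-elim (proj₂ (proj₂ (≢₃ Ny)) refl)
          ... | 1st = ⊥-elim (proj₁ (proj₂ (≢₃ Ny)) refl)
          ... | 2nd = ⊥-elim (proj₁ (proj₂ (≢₃ Nt)) refl)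

      -- The square `u s t v` is again of type P. Either `w` and `w′` are adjacent and give a
      -- further rung beyond `st`, or the edges `x w′` and `y w` close squares on both sides of it.
      straighten : ∀ {x y u v s t} → TypeP x y u v s t → Cubic-end s v t → Cubic-end t u s → SomeStrip
      straighten {x} {y} {u} {v} {s} {t} P (w , Nt) (w′ , Ns) = go (p1 P′) (p1 (mirror P′))
        where
        open TypeP P
        P′ : TypeP u v s t w′ w
        P′ = record { xy = uv ; uv = proj₁ (all₃ Ns) ; ux = proj₁ (proj₂ (all₃ Ns)) ; vy = proj₁ (proj₂ (all₃ Nt))
                    ; Nu = Nb-213 Ns ; Nv = Nb-213 Nt }
        long : w ~ w′ → SomeStrip
        long e = strip record { r₀ = xy ; r₃ = ~sym e ; Np₁ = Nb-132 Nu ; Np₂ = Nb-231 Ns ; Nq₁ = Nb-132 Nv ; Nq₂ = Nb-231 Nt }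
        go : Cubic-end w′ t w ⊎ Cubic-pair u v s w′ → Cubic-end w s w′ ⊎ Cubic-pair v u t w → SomeStrip
        go (inj₁ (_ , Nw)) _ = long (proj₁ (all₃ Nw))
        go _ (inj₁ (_ , Nw′)) = long (~sym (proj₁ (all₃ Nw′)))
        go (inj₂ (x₀ , _ , Nu′ , Nx₀)) (inj₂ (y₀ , _ , Nv′ , Ny₀)) with Nu′ ux | Nv′ vy
        ... | 0th | _ = ⊥-elim (proj₁ (proj₂ (≢₃ Nu)) refl)
        ... | 1st | _ = ⊥-elim (proj₁ (≢₃ Nu) refl)
        ... | _ | 0th = ⊥-elim (proj₁ (proj₂ (≢₃ Nv)) refl)
        ... | _ | 1st = ⊥-elim (proj₁ (≢₃ Nv) refl)
        ... | 2nd | 2nd = strip record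
          { r₀ = proj₁ (proj₂ (all₃ Nx₀)) ; r₃ = proj₁ (proj₂ (all₃ Ny₀))
          ; Np₁ = Nu ; Np₂ = Nb-213 Nv ; Nq₁ = Nb-312 Ns ; Nq₂ = Nb-132 Nt }

      P⇒strip : ∀ {x y u v s t} → TypeP x y u v s t → SomeStrip
      P⇒strip P with p1 P | p1 (mirror P)
      ... | inj₁ a | inj₁ b = straighten P a b
      ... | inj₁ a | inj₂ b = mixed P a b
      ... | inj₂ a | inj₁ b = mixed (mirror P) b a
      ... | inj₂ (x₀ , _ , Nx , Nx₀) | inj₂ (y₀ , _ , Ny , Ny₀) =
          let
              open TypeP P
          in strip record
               { r₀ = proj₁ (proj₂ (all₃ Nx₀)) ; r₃ = proj₁ (proj₂ (all₃ Ny₀))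
               ; Np₁ = Nb-321 Nx ; Np₂ = Nb-231 Ny ; Nq₁ = Nb-321 Nu ; Nq₂ = Nb-231 Nv }

      -- A square u s v t with u and v cubic and third neighbours x and y.
      record TypeQ (x y u v s t : V) : Set where
        field
          xy : x ~ y
          Nu : Nb G u (x ∷ s ∷ t ∷ [])
          Nv : Nb G v (y ∷ s ∷ t ∷ [])

      -- A cut through `ux` separates `s` from `t` and so contains `v`. Up to symmetry `y` is not on
      -- the side of `t`; there `t` has one companion `d`, and the square `x u t d` is of type P.
      Q⇒strip : ∀ {x y u v s t} → TypeQ x y u v s t → SomeStrip
      Q⇒strip {x} {y} {u} {v} Q = start Q
        where
        open TypeQ Q using (xy)
        module _ {s t : V} (Q : TypeQ x y u v s t) where
          open TypeQ Q using (Nu; Nv)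
          ux : u ~ x
          ux = proj₁ (all₃ Nu)
          us : u ~ s
          us = proj₁ (proj₂ (all₃ Nu))
          ut : u ~ t
          ut = proj₂ (proj₂ (all₃ Nu))
          vy : v ~ y
          vy = proj₁ (all₃ Nv)
          vs : v ~ s
          vs = proj₁ (proj₂ (all₃ Nv))
          vt : v ~ t
          vt = proj₂ (proj₂ (all₃ Nv))

          go : ∀ {h} (F : Cut₄ G u x v h) → Cut₄.κ F s ≡ lo → Cut₄.κ F t ≡ hi → Cut₄.κ F y ≢ hi → SomeStrip
          go {h} F κs κt κy with Sep.other-lo (flip F) t
          ... | d , d≢t , kd = P⇒strip (record
                { xy = ~sym (proj₁ Nd) ; uv = ut ; ux = ux ; vy = ~sym (proj₂ (proj₂ Nd)) ; Nu = Nb-132 Nu ; Nv = Nb-312 Nt })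
            where
            open Cut₄ F
            clm : ∀ {a b} → opp (κ a) ≡ lo → a ≢ t → a ~ b → b ∈ u ∷ x ∷ v ∷ h ∷ [] → b ∈ x ∷ h ∷ t ∷ []
            clm ka a≢t ab 0th = case Nu (~sym ab) of λ where
              0th → clash (opp-move ka) κf hi≢mid
              1st → clash (opp-move ka) κs hi≢lo
              2nd → ⊥-elim (a≢t refl)
            clm ka a≢t ab 1st = 0th
            clm ka a≢t ab 2nd = case Nv (~sym ab) of λ where
              0th → ⊥-elim (κy (opp-move ka))
              1st → clash (opp-move ka) κs hi≢lo
              2nd → ⊥-elim (a≢t refl)
            clm ka a≢t ab 3rd = 1st
            open LoMinus.Through (flip F) t (cong opp κt) x h (cong opp κf) (cong opp κh) clm
            Nd : d ~ x × d ~ h × d ~ t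
            Nd = all₃ (nb (kd , d≢t))
            Nt : Nb G t (u ∷ v ∷ d ∷ [])
            Nt {w} e with κ w in kw
            ... | lo = ⊥-elim (cut kw κt (~sym e))
            ... | hi = there (there (here (unique (cong opp kw , (λ { refl → ~≢ e refl })) (kd , d≢t))))
            ... | mid with cov kw
            ... | 0th = 0th
            ... | 1st = ⊥-elim (tf ut e ux)
            ... | 2nd = 1st
            ... | 3rd = ⊥-elim (tf (proj₂ (proj₂ Nd)) e (proj₁ (proj₂ Nd)))

        swapQ : ∀ {s t} → TypeQ x y u v s t → TypeQ x y u v t s
        swapQ Q = record { xy = xy ; Nu = Nb-132 (TypeQ.Nu Q) ; Nv = Nb-132 (TypeQ.Nv Q) }

        either : ∀ {s t} (Q : TypeQ x y u v s t) → ∀ {h} (F : Cut₄ G u x v h) → Cut₄.κ F s ≡ lo → Cut₄.κ F t ≡ hi → SomeStrip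
        either Q F κs κt with Cut₄.κ F y in κy
        ... | lo = go Q F κs κt λ q → clash κy q lo≢hi
        ... | mid = go Q F κs κt λ q → clash κy q mid≢hi
        ... | hi = go (swapQ Q) (flip F) (cong opp κt) (cong opp κs) λ q → clash (opp-move q) κy lo≢hi

        orient : ∀ {s t} (Q : TypeQ x y u v s t) → ∀ {g h} (F : Cut₄ G u x g h) → Cut₄.κ F s ≡ lo → Cut₄.κ F t ≡ hi → SomeStrip
        orient Q F κs κt with Cut₄.cov F (Sep.between F κs κt (~sym (us Q)) (~sym (ut Q))) | Cut₄.cov F (Sep.between F κs κt (~sym (vs Q)) (~sym (vt Q)))
        ... | _ | 0th = ⊥-elim (tf (ux Q) xy (vy Q))
        ... | _ | 1st = ⊥-elim (tf (ux Q) (vs Q) (us Q))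
        ... | _ | 2nd = either Q F κs κt
        ... | _ | 3rd = either Q (swap-gh F) κs κt

        start : ∀ {s t} → TypeQ x y u v s t → SomeStrip
        start Q with fs (ux Q)
        ... | _ , _ , F with split F (Cut₄.κe F) (Cut₄.κf F) (TypeQ.Nu Q)
        ... | inj₁ (κs , κt) = orient Q F κs κt
        ... | inj₂ (κs , κt) = orient Q (flip F) (cong opp κs) (cong opp κt)

      mirror-strip : ∀ {p₀ p₁ p₂ p₃ q₀ q₁ q₂ q₃} → Strip p₀ p₁ p₂ p₃ q₀ q₁ q₂ q₃ → Strip q₀ q₁ q₂ q₃ p₀ p₁ p₂ p₃
      mirror-strip S =
          let
              open Strip S
          in record { r₀ = ~sym r₀ ; r₃ = ~sym r₃ ; Np₁ = Nq₁ ; Np₂ = Nq₂ ; Nq₁ = Np₁ ; Nq₂ = Np₂ }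

      module Extend {p₀ p₁ p₂ p₃ q₀ q₁ q₂ q₃ : V} (S : Strip p₀ p₁ p₂ p₃ q₀ q₁ q₂ q₃) where
        open Strip S
        p₁p₀ : p₁ ~ p₀
        p₁p₀ = proj₁ (all₃ Np₁)
        p₁p₂ : p₁ ~ p₂
        p₁p₂ = proj₁ (proj₂ (all₃ Np₁))
        p₁q₁ : p₁ ~ q₁
        p₁q₁ = proj₂ (proj₂ (all₃ Np₁))
        p₂p₃ : p₂ ~ p₃
        p₂p₃ = proj₁ (proj₂ (all₃ Np₂))
        p₂q₂ : p₂ ~ q₂
        p₂q₂ = proj₂ (proj₂ (all₃ Np₂))
        q₂q₁ : q₂ ~ q₁
        q₂q₁ = proj₁ (all₃ Nq₂)
        q₂q₃ : q₂ ~ q₃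
        q₂q₃ = proj₁ (proj₂ (all₃ Nq₂))

        p₀≢p₃ : p₀ ≢ p₃
        p₀≢p₃ refl = tf (~sym p₁p₀) p₁p₂ (~sym p₂p₃)

        Cubic-q₃ : Set
        Cubic-q₃ = ∃ λ r → Nb G q₃ (q₂ ∷ p₃ ∷ r ∷ [])

        module End {h : V} (F : Cut₄ G p₂ p₃ q₁ h) (κq₂ : Cut₄.κ F q₂ ≡ lo) (κp₁ : Cut₄.κ F p₁ ≡ hi) where
          open Cut₄ F

          no-p₂ : ∀ {a} {A : Set} → κ a ≡ lo → a ≢ q₂ → ¬ a ~ p₂
          no-p₂ ka ne e = case Np₂ (~sym e) of λ where
            0th → clash ka κp₁ lo≢hi
            1st → clash ka κf lo≢mid
            2nd → ne refl

          mid-case : h ≡ q₃ → Cubic-q₃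
          mid-case refl with Sep.other-lo F q₂
          ... | c , c≢ , kc with all₃ (Lo.One.nb (λ v → ¬? (v ≟ q₂)) p₃ q₁ q₃ (inj₁ κf ∷ inj₁ κg ∷ inj₁ κh ∷ []) clm cll (kc , c≢))
            where
            open Sep F using (module Lo)
            clm : ∀ {a b} → κ a ≡ lo → a ≢ q₂ → a ~ b → b ∈ p₂ ∷ p₃ ∷ q₁ ∷ q₃ ∷ [] → b ∈ p₃ ∷ q₁ ∷ q₃ ∷ []
            clm ka ne ab 0th = ⊥-elim (no-p₂ {A = V} ka ne ab)
            clm ka ne ab 1st = 0th
            clm ka ne ab 2nd = 1st
            clm ka ne ab 3rd = 2nd
            cll : ∀ {a b} → κ a ≡ lo → a ≢ q₂ → a ~ b → κ b ≡ lo → b ≢ q₂ ⊎ b ∈ p₃ ∷ q₁ ∷ q₃ ∷ []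
            cll ka ne ab kb = inj₁ λ { refl → case Nq₂ (~sym ab) of λ where
              0th → clash ka κg lo≢mid
              1st → clash ka κh lo≢mid
              2nd → clash ka κe lo≢mid }
          ... | cp₃ , _ , cq₃ = ⊥-elim (tf cp₃ r₃ cq₃)

          q₀-lo : κ q₀ ≡ lo → h ≡ p₀ → ⊥
          q₀-lo κq₀ refl =
              let clm : ∀ {a b} → opp (κ a) ≡ lo → a ≢ p₁ → a ~ b → b ∈ p₂ ∷ p₃ ∷ q₁ ∷ p₀ ∷ [] → b ∈ p₃ ∷ p₀ ∷ []
                  clm = λ where
                    ka ne ab 0th → case Np₂ (~sym ab) of λ where
                      0th → ⊥-elim (ne refl)
                      1st → clash (opp-move ka) κf hi≢mid
                      2nd → clash (opp-move ka) κq₂ hi≢lo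
                    ka ne ab 1st → 0th
                    ka ne ab 2nd → case Nq₁ (~sym ab) of λ where
                      0th → clash (opp-move ka) κq₀ hi≢lo
                      1st → clash (opp-move ka) κq₂ hi≢lo
                      2nd → ⊥-elim (ne refl)
                    ka ne ab 3rd → 1st
                  zmid : ∀ {w} → p₁ ~ w → opp (κ w) ≡ mid
                  zmid e = case Np₁ e of λ { 0th → cong opp κh ; 1st → cong opp κe ; 2nd → cong opp κg }
              in LoMinus.none-left (flip F) p₁ (cong opp κp₁) p₃ p₀ (cong opp κf) (cong opp κh) clm zmid

          q₀-not-lo : κ q₀ ≢ lo → κ q₃ ≡ lo → Cubic-q₃
          q₀-not-lo ne₀ κq₃ =
              let
                  clm : ∀ {a b} → κ a ≡ lo → a ≢ q₂ → a ~ b → b ∈ p₂ ∷ p₃ ∷ q₁ ∷ h ∷ [] → b ∈ p₃ ∷ h ∷ q₂ ∷ []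
                  clm = λ where
                    ka ne ab 0th → ⊥-elim (no-p₂ {A = V} ka ne ab)
                    ka ne ab 1st → 0th
                    ka ne ab 2nd → case Nq₁ (~sym ab) of λ where
                      0th → ⊥-elim (ne₀ ka)
                      1st → ⊥-elim (ne refl)
                      2nd → clash ka κp₁ lo≢hi
                    ka ne ab 3rd → 1st
                  open LoMinus.Through F q₂ κq₂ p₃ h κf κh clm
              in h , Nb-312 (nb (κq₃ , ~≢ q₂q₃ ∘ sym))

          done : Cubic-q₃
          done with κ q₃ in κq₃
          ... | hi = ⊥-elim (cut κq₂ κq₃ q₂q₃)
          ... | mid = case cov κq₃ of λ where
            0th → ⊥-elim (proj₂ (proj₂ (≢₃ Nq₂)) refl)
            1st → ⊥-elim (~≢ r₃ refl)
            2nd → ⊥-elim (proj₁ (≢₃ Nq₂) refl)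
            3rd → mid-case refl
          ... | lo with κ q₀ in κq₀
          ... | mid = q₀-not-lo (λ q → clash κq₀ q mid≢lo) κq₃
          ... | hi = q₀-not-lo (λ q → clash κq₀ q hi≢lo) κq₃
          ... | lo = ⊥-elim (case cov (Sep.between F κq₀ κp₁ (~sym r₀) p₁p₀) of λ where
            0th → proj₁ (≢₃ Np₁) refl
            1st → p₀≢p₃ refl
            2nd → proj₁ (proj₂ (≢₃ Np₁)) refl
            3rd → q₀-lo κq₀ refl)

        -- A cut through `p₂p₃` separates `p₁` from `q₂` and so contains `q₁`. Three vertices bound
        -- the rest of the side of `q₂`, which turns out to be `q₃` alone.
        cubic-q₃ : Cubic-q₃
        cubic-q₃ with fs p₂p₃
        ... | _ , _ , F = start
          where
          orient : ∀ {g h} (F : Cut₄ G p₂ p₃ g h) → Cut₄.κ F q₂ ≡ lo → Cut₄.κ F p₁ ≡ hi → Cubic-q₃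
          orient F κq₂ κp₁ = case Cut₄.cov F (Sep.between F κq₂ κp₁ q₂q₁ p₁q₁) of λ where
            0th → ⊥-elim (proj₂ (proj₂ (≢₃ Np₁)) refl)
            1st → ⊥-elim (tf p₁p₂ p₂p₃ p₁q₁)
            2nd → End.done F κq₂ κp₁
            3rd → End.done (swap-gh F) κq₂ κp₁
          start : Cubic-q₃
          start with split F (Cut₄.κe F) (Cut₄.κf F) (Nb-213 Np₂)
          ... | inj₂ (κp₁ , κq₂) = orient F κq₂ κp₁
          ... | inj₁ (κp₁ , κq₂) = orient (flip F) (cong opp κq₂) (cong opp κp₁)

        module Rung {p₄ q₄ : V} (Np₃ : Nb G p₃ (p₂ ∷ q₃ ∷ p₄ ∷ [])) (Nq₃ : Nb G q₃ (q₂ ∷ p₃ ∷ q₄ ∷ [])) where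
          p₃p₄ : p₃ ~ p₄
          p₃p₄ = proj₂ (proj₂ (all₃ Np₃))

          module With {h : V} (F : Cut₄ G p₃ p₄ q₂ h) (κp₂ : Cut₄.κ F p₂ ≡ lo) (κq₃ : Cut₄.κ F q₃ ≡ hi) where
            open Cut₄ F

            q₁-not-hi : κ q₁ ≢ hi → p₄ ~ q₄
            q₁-not-hi ne₁ with Sep.other-lo (flip F) q₃
            ... | d , d≢ , kd with all₃ (LoMinus.Through.nb (flip F) q₃ (cong opp κq₃) p₄ h (cong opp κf) (cong opp κh) clm (kd , d≢))
              where
              clm : ∀ {a b} → opp (κ a) ≡ lo → a ≢ q₃ → a ~ b → b ∈ p₃ ∷ p₄ ∷ q₂ ∷ h ∷ [] → b ∈ p₄ ∷ h ∷ q₃ ∷ []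
              clm ka ne ab 0th = case Np₃ (~sym ab) of λ where
                0th → clash (opp-move ka) κp₂ hi≢lo
                1st → ⊥-elim (ne refl)
                2nd → clash (opp-move ka) κf hi≢mid
              clm ka ne ab 1st = 0th
              clm ka ne ab 2nd = case Nq₂ (~sym ab) of λ where
                0th → ⊥-elim (ne₁ (opp-move ka))
                1st → ⊥-elim (ne refl)
                2nd → clash (opp-move ka) κp₂ hi≢lo
              clm ka ne ab 3rd = 1st
            ... | dp₄ , _ , dq₃ with Nq₃ (~sym dq₃)
            ... | 0th = clash (opp-move kd) κg hi≢mid
            ... | 1st = clash (opp-move kd) κe hi≢mid
            ... | 2nd = ~sym dp₄

            q₁-hi : κ q₁ ≡ hi → h ≡ p₁ → ⊥
            q₁-hi κq₁ refl =
                let clm : ∀ {a b} → κ a ≡ lo → a ≢ p₂ → a ~ b → b ∈ p₃ ∷ p₄ ∷ q₂ ∷ p₁ ∷ [] → b ∈ p₄ ∷ p₁ ∷ []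
                    clm = λ where
                      ka ne ab 0th → case Np₃ (~sym ab) of λ where
                        0th → ⊥-elim (ne refl)
                        1st → clash ka κq₃ lo≢hi
                        2nd → clash ka κf lo≢mid
                      ka ne ab 1st → 0th
                      ka ne ab 2nd → case Nq₂ (~sym ab) of λ where
                        0th → clash ka κq₁ lo≢hi
                        1st → clash ka κq₃ lo≢hi
                        2nd → ⊥-elim (ne refl)
                      ka ne ab 3rd → 1st
                    zmid : ∀ {w} → p₂ ~ w → κ w ≡ mid
                    zmid e = case Np₂ e of λ { 0th → κh ; 1st → κe ; 2nd → κg }
                in LoMinus.none-left F p₂ κp₂ p₄ p₁ κf κh clm zmid

            done : p₄ ~ q₄
            done with κ q₁ in κq₁
            ... | lo = q₁-not-hi λ q → clash κq₁ q lo≢hi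
            ... | mid = q₁-not-hi λ q → clash κq₁ q mid≢hi
            ... | hi = ⊥-elim (case cov (Sep.between F κp₂ κq₁ (~sym p₁p₂) (~sym p₁q₁)) of λ where
              0th → proj₁ (≢₃ Np₂) refl
              1st → case Np₁ (~sym p₃p₄) of λ where
                0th → p₀≢p₃ refl
                1st → ~≢ p₂p₃ refl
                2nd → clash κq₁ κe hi≢mid
              2nd → proj₁ (proj₂ (≢₃ Np₂)) refl
              3rd → q₁-hi κq₁ refl)

          -- A cut through `p₃p₄` separates `p₂` from `q₃` and so contains `q₂`. The one further
          -- vertex on the side of `q₃` is `q₄`, and it is adjacent to `p₄`.
          rung : p₄ ~ q₄
          rung with fs p₃p₄
          ... | _ , _ , F = start
            where
            orient : ∀ {g h} (F : Cut₄ G p₃ p₄ g h) → Cut₄.κ F p₂ ≡ lo → Cut₄.κ F q₃ ≡ hi → p₄ ~ q₄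
            orient F κp₂ κq₃ = case Cut₄.cov F (Sep.between F κp₂ κq₃ p₂q₂ (~sym q₂q₃)) of λ where
              0th → ⊥-elim (proj₂ (proj₂ (≢₃ Np₂)) refl)
              1st → ⊥-elim (tf p₂p₃ p₃p₄ p₂q₂)
              2nd → With.done F κp₂ κq₃
              3rd → With.done (swap-gh F) κp₂ κq₃
            start : p₄ ~ q₄
            start with split F (Cut₄.κe F) (Cut₄.κf F) (Nb-312 Np₃)
            ... | inj₁ (κp₂ , κq₃) = orient F κp₂ κq₃
            ... | inj₂ (κp₂ , κq₃) = orient (flip F) (cong opp κp₂) (cong opp κq₃)

      extend : ∀ {p₀ p₁ p₂ p₃ q₀ q₁ q₂ q₃} → Strip p₀ p₁ p₂ p₃ q₀ q₁ q₂ q₃ →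
        ∃₂ λ p₄ q₄ → Strip p₁ p₂ p₃ p₄ q₁ q₂ q₃ q₄
      extend S with Extend.cubic-q₃ S | Extend.cubic-q₃ (mirror-strip S)
      ... | q₄ , Nq₃ | p₄ , Np₃ =
          let
              open Strip S
          in p₄ , q₄ , record
               { r₀ = Extend.p₁q₁ S ; r₃ = Extend.Rung.rung S Np₃ Nq₃
               ; Np₁ = Np₂ ; Np₂ = Nb-132 Np₃ ; Nq₁ = Nq₂ ; Nq₂ = Nb-132 Nq₃ }

      -- In a cut through `uv` the vertex `v` has a neighbour on the side that does not contain `x`,
      -- and this neighbour cannot be adjacent to `x`.
      K₂₃ : ∀ {u v x s} → Nb G u (v ∷ x ∷ s ∷ []) → (∀ {w} → v ~ w → w ≢ u → w ~ x) → ⊥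
      K₂₃ {u} {v} {x} N close with fs (proj₁ (all₃ N))
      ... | _ , _ , F with split F (Cut₄.κe F) (Cut₄.κf F) N
      ... | inj₁ (κx , _) with midhi F (Cut₄.κf F)
      ... | w , vw , kw = Sep.cut′ F kw κx (close vw λ { refl → clash kw (Cut₄.κe F) hi≢mid })
      K₂₃ {u} {v} {x} N close | _ , _ , F | inj₂ (κx , _) with Sep.midlo F (Cut₄.κf F)
      ... | w , vw , kw = Sep.cut F kw κx (close vw λ { refl → clash kw (Cut₄.κe F) lo≢mid })

      -- Two vertices with only four outside neighbours, two of which are adjacent.
      record Pair (p q e₁ e₂ f g : V) : Set where
        field
          p≢q : p ≢ q
          e₁e₂ : e₁ ~ e₂
          Np : Nb G p (q ∷ e₁ ∷ e₂ ∷ f ∷ g ∷ [])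
          Nq : Nb G q (p ∷ e₁ ∷ e₂ ∷ f ∷ g ∷ [])

      swap-pq : ∀ {p q e₁ e₂ f g} → Pair p q e₁ e₂ f g → Pair q p e₁ e₂ f g
      swap-pq T =
          let
              open Pair T
          in record { p≢q = p≢q ∘ sym ; e₁e₂ = e₁e₂ ; Np = Nq ; Nq = Np }

      swap-e : ∀ {p q e₁ e₂ f g} → Pair p q e₁ e₂ f g → Pair p q e₂ e₁ f g
      swap-e T =
          let
              open Pair T
              σ : ∀ {w a b c d e : V} → w ∈ a ∷ b ∷ c ∷ d ∷ e ∷ [] → w ∈ a ∷ c ∷ b ∷ d ∷ e ∷ []
              σ = λ { 0th → 0th ; 1st → 2nd ; 2nd → 1st ; 3rd → 3rd ; 4th → 4th }
          in record { p≢q = p≢q ; e₁e₂ = ~sym e₁e₂ ; Np = σ ∘ Np ; Nq = σ ∘ Nq }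

      swap-f : ∀ {p q e₁ e₂ f g} → Pair p q e₁ e₂ f g → Pair p q e₁ e₂ g f
      swap-f T =
          let
              open Pair T
              σ : ∀ {w a b c d e : V} → w ∈ a ∷ b ∷ c ∷ d ∷ e ∷ [] → w ∈ a ∷ b ∷ c ∷ e ∷ d ∷ []
              σ = λ { 0th → 0th ; 1st → 1st ; 2nd → 2nd ; 3rd → 4th ; 4th → 3rd }
          in record { p≢q = p≢q ; e₁e₂ = e₁e₂ ; Np = σ ∘ Np ; Nq = σ ∘ Nq }

      -- Two vertices with four outside neighbours yield a strip.

      module Adjacent where
        touches : ∀ {p q e₁ e₂ f g} → Pair p q e₁ e₂ f g → p ~ q → p ~ e₁ ⊎ p ~ e₂
        touches {p} {q} {e₁} {e₂} {f} {g} T pq with p ~? e₁ | p ~? e₂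
        ... | yes a | _ = inj₁ a
        ... | no _ | yes a = inj₂ a
        ... | no ¬1 | no ¬2 =
            let
                open Pair T
                Np′ : Nb G p (q ∷ f ∷ g ∷ [])
                Np′ e = case Np e of λ { 0th → 0th ; 1st → ⊥-elim (¬1 e) ; 2nd → ⊥-elim (¬2 e) ; 3rd → 1st ; 4th → 2nd }
                Nq′ : Nb G q (p ∷ e₁ ∷ e₂ ∷ [])
                Nq′ e = case Nq e of λ
                  { 0th → 0th ; 1st → 1st ; 2nd → 2nd
                  ; 3rd → ⊥-elim (tf pq e (proj₁ (proj₂ (all₃ Np′))))
                  ; 4th → ⊥-elim (tf pq e (proj₂ (proj₂ (all₃ Np′)))) }
            in ⊥-elim (tf (proj₁ (proj₂ (all₃ Nq′))) e₁e₂ (proj₂ (proj₂ (all₃ Nq′))))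

        -- Triangle-freeness makes `p` and `q` cubic, and the square `e₁ p q e₂` is of type P.
        final : ∀ {p q e₁ e₂ f g} → Pair p q e₁ e₂ f g → p ~ q → p ~ e₁ → q ~ e₂ → p ~ f → SomeStrip
        final {p} {q} {e₁} {e₂} {f} {g} T pq pe qe pf =
            let
                open Pair T
                Nq′ : Nb G q (e₂ ∷ p ∷ g ∷ [])
                Nq′ e = case Nq e of λ
                  { 0th → 1st ; 1st → ⊥-elim (tf pq e pe) ; 2nd → 0th ; 3rd → ⊥-elim (tf pq e pf) ; 4th → 2nd }
                Np′ : Nb G p (e₁ ∷ q ∷ f ∷ [])
                Np′ e = case Np e of λ
                  { 0th → 1st ; 1st → 0th ; 2nd → ⊥-elim (tf pe e₁e₂ e) ; 3rd → 2nd
                  ; 4th → ⊥-elim (tf pq (proj₂ (proj₂ (all₃ Nq′))) e) }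
            in P⇒strip record
                 { xy = e₁e₂ ; uv = pq ; ux = pe ; vy = qe ; Nu = Np′ ; Nv = Nq′ }

        oriented : ∀ {p q e₁ e₂ f g} → Pair p q e₁ e₂ f g → p ~ q → p ~ e₁ → SomeStrip
        oriented {p} {q} {e₁} T pq pe with touches (swap-pq T) (~sym pq) | nbr good p q e₁
        ... | inj₁ qe | _ = ⊥-elim (tf pq qe pe)
        ... | inj₂ qe | w , pw , ∉ with Pair.Np T pw
        ... | 0th = ⊥-elim (∉ 0th)
        ... | 1st = ⊥-elim (∉ 1st)
        ... | 2nd = ⊥-elim (tf pe (Pair.e₁e₂ T) pw)
        ... | 3rd = final T pq pe qe pw
        ... | 4th = final (swap-f T) pq pe qe pw

        result : ∀ {p q e₁ e₂ f g} → Pair p q e₁ e₂ f g → p ~ q → SomeStrip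
        result T pq with touches T pq
        ... | inj₁ a = oriented T pq a
        ... | inj₂ a = oriented (swap-e T) pq a

      module Apart where
        touches : ∀ {p q e₁ e₂ f g} → Pair p q e₁ e₂ f g → ¬ p ~ q → p ~ e₁ ⊎ p ~ e₂
        touches {p} {q} {e₁} {e₂} {f} {g} T p≁q with p ~? e₁ | p ~? e₂
        ... | yes a | _ = inj₁ a
        ... | no _ | yes a = inj₂ a
        ... | no ¬1 | no ¬2 = few {p} {f} {g} λ e → case Pair.Np T e of λ
          { 0th → ⊥-elim (p≁q e) ; 1st → ⊥-elim (¬1 e) ; 2nd → ⊥-elim (¬2 e) ; 3rd → 0th ; 4th → 1st }

        cubic : ∀ {p q e₁ e₂ f g} → Pair p q e₁ e₂ f g → ¬ p ~ q → p ~ e₁ → Nb G p (e₁ ∷ f ∷ g ∷ [])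
        cubic T p≁q pe e = case Pair.Np T e of λ
          { 0th → ⊥-elim (p≁q e) ; 1st → 0th ; 2nd → ⊥-elim (tf pe (Pair.e₁e₂ T) e) ; 3rd → 1st ; 4th → 2nd }

        -- Both vertices are cubic. If they see different ends of the edge `e₁e₂`, there is a square
        -- of type Q; if the same end, three vertices separate the two from the rest.
        oriented : ∀ {p q e₁ e₂ f g} → Pair p q e₁ e₂ f g → ¬ p ~ q → p ~ e₁ → SomeStrip
        oriented {p} {q} {e₁} {e₂} {f} {g} T p≁q pe with touches (swap-pq T) (p≁q ∘ ~sym)
        ... | inj₂ qe = Q⇒strip record
          { xy = Pair.e₁e₂ T ; Nu = cubic T p≁q pe ; Nv = cubic (swap-e (swap-pq T)) (p≁q ∘ ~sym) qe }
        ... | inj₁ qe =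
            let Np : Nb G p (e₁ ∷ f ∷ g ∷ [])
                Np = cubic T p≁q pe
                Nq : Nb G q (e₁ ∷ f ∷ g ∷ [])
                Nq = cubic (swap-pq T) (p≁q ∘ ~sym) qe
                back : ∀ {d} → Nb G d (e₁ ∷ f ∷ g ∷ []) → d ∉ e₁ ∷ f ∷ g ∷ []
                back = λ where
                  N 0th → ~≢ (proj₁ (all₃ N)) refl
                  N 1st → ~≢ (proj₁ (proj₂ (all₃ N))) refl
                  N 2nd → ~≢ (proj₂ (proj₂ (all₃ N))) refl
            in ⊥-elim (noSep good (_∈? (p ∷ q ∷ [])) e₁ f g
                 (λ { 0th e → inj₂ (Np e) ; 1st e → inj₂ (Nq e) })
                 (p , q , Pair.p≢q T , (0th , back Np) , (1st , back Nq))
                 (Two-map (λ ∉ → (λ { 0th → ∉ 0th ; 1st → ∉ 1st }) , (λ m → ∉ (there (there m))))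
                   (pair-fresh (p ∷ q ∷ e₁ ∷ f ∷ g ∷ []) (ℕ.≤-trans (ℕ.n≤1+n _) 8≤n))))

        result : ∀ {p q e₁ e₂ f g} → Pair p q e₁ e₂ f g → ¬ p ~ q → SomeStrip
        result T p≁q with touches T p≁q
        ... | inj₁ a = oriented T p≁q a
        ... | inj₂ a = oriented (swap-e T) p≁q a

      pair⇒strip : ∀ {p q e₁ e₂ f g} → Pair p q e₁ e₂ f g → SomeStrip
      pair⇒strip {p} {q} T with p ~? q
      ... | yes a = Adjacent.result T a
      ... | no a = Apart.result T a

      -- The corner lo ∩ lo of two cuts sharing x.
      module Corner {x t₁ t₂ t₃ x′ r₁ r₂ : V} (A : Cut₄ G x t₁ t₂ t₃) (F : Cut₄ G x x′ r₁ r₂) where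
        open Cut₄ A using (κ)
        open Cut₄ F using () renaming (κ to μ)

        Q : V → Set
        Q w = μ w ≡ lo
        Q? : Decidable Q
        Q? w = μ w ≟ˢ lo

        record Boundary (L : List V) : Set where
          field
            bd  : All ((Sep.Lo.Bd A) Q?) L
            x∈  : x ∈ L
            x′∈ : κ x′ ≡ lo → x′ ∈ L
            t₁∈ : μ t₁ ≢ hi → t₁ ∈ L
            t₂∈ : μ t₂ ≢ hi → t₂ ∈ L
            t₃∈ : μ t₃ ≢ hi → t₃ ∈ L
            r₁∈ : κ r₁ ≡ lo → r₁ ∈ L
            r₂∈ : κ r₂ ≡ lo → r₂ ∈ L

        module Bounded {L : List V} (B : Boundary L) where
          open Boundary B
          clm : ∀ {u v} → κ u ≡ lo → Q u → u ~ v → v ∈ x ∷ t₁ ∷ t₂ ∷ t₃ ∷ [] → v ∈ L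
          clm ku mu uv 0th = x∈
          clm ku mu uv 1st = t₁∈ ((Sep.not-hi F) mu uv)
          clm ku mu uv 2nd = t₂∈ ((Sep.not-hi F) mu uv)
          clm ku mu uv 3rd = t₃∈ ((Sep.not-hi F) mu uv)
          cll : ∀ {u v} → κ u ≡ lo → Q u → u ~ v → κ v ≡ lo → Q v ⊎ v ∈ L
          cll {v = v} ku mu uv kv with μ v in mv
          ... | lo = inj₁ refl
          ... | hi = ⊥-elim ((Cut₄.cut F) mu mv uv)
          ... | mid = case (Cut₄.cov F) mv of λ where
            0th → inj₂ x∈
            1st → inj₂ (x′∈ kv)
            2nd → inj₂ (r₁∈ kv)
            3rd → inj₂ (r₂∈ kv)
          open Sep.Lo.Given A Q? L bd clm cll public

        empty : ∀ {a b} → Boundary (a ∷ b ∷ []) → ∀ {p} → κ p ≡ lo → μ p ≢ lo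
        empty {a} {b} B = (Sep.Lo.none A) Q? a b (Boundary.bd B) (Bounded.clm B) (Bounded.cll B)

        module Single {a b c : V} (B : Boundary (a ∷ b ∷ c ∷ [])) =
          Sep.Lo.One A Q? a b c (Boundary.bd B) (Bounded.clm B) (Bounded.cll B)

        InCorner : V → Set
        InCorner v = κ v ≡ lo × μ v ≡ lo

        InCorner? : Decidable InCorner
        InCorner? v = (κ v ≟ˢ lo) ×-dec (μ v ≟ˢ lo)

        count : (∃ λ p → InCorner p × (∀ {q} → InCorner q → q ≡ p)) ⊎ (∀ {p} → ¬ InCorner p) ⊎ Two InCorner
        count with any? InCorner?
        ... | no ¬p = inj₂ (inj₁ λ c → ¬p (_ , c))
        ... | yes (p , c) with any? (λ q → InCorner? q ×-dec ¬? (q ≟ p))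
        ... | yes (q , c′ , q≢p) = inj₂ (inj₂ (p , q , q≢p ∘ sym , c , c′))
        ... | no ¬q = inj₁ (p , c , λ {q} c′ → case q ≟ p of λ where
          (yes e) → e
          (no ne) → ⊥-elim (¬q (q , c′ , ne)))

        -- A corner with two vertices whose boundary contains `x` and `x′` is the `lo` side of a new
        -- cut through both, to which the induction applies.
        module Subcut {a b : V} (B : Boundary (x ∷ x′ ∷ a ∷ b ∷ [])) where
          open Bounded B
          L : List V
          L = x ∷ x′ ∷ a ∷ b ∷ []

          ν : V → Side
          ν v with v ∈? L | InCorner? v
          ... | yes _ | _ = mid
          ... | no _ | yes _ = lo
          ... | no _ | no _ = hi

          ν-mid : ∀ {v} → v ∈ L → ν v ≡ mid
          ν-mid {v} m with v ∈? L | InCorner? v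
          ... | yes _ | _ = refl
          ... | no ¬m | _ = ⊥-elim (¬m m)

          ν-mid⁻ : ∀ {v} → ν v ≡ mid → v ∈ L
          ν-mid⁻ {v} eq with v ∈? L | InCorner? v
          ... | yes m | _ = m
          ν-mid⁻ {v} () | no _ | yes _
          ν-mid⁻ {v} () | no _ | no _

          ν-lo : ∀ {v} → InCorner v → ν v ≡ lo
          ν-lo {v} c with v ∈? L | InCorner? v
          ... | yes m | _ = ⊥-elim (dis c m)
          ... | no _ | yes _ = refl
          ... | no _ | no ¬c = ⊥-elim (¬c c)

          ν-lo⁻ : ∀ {v} → ν v ≡ lo → InCorner v
          ν-lo⁻ {v} eq with v ∈? L | InCorner? v
          ν-lo⁻ {v} () | yes m | _
          ... | no _ | yes c = c
          ν-lo⁻ {v} () | no _ | no _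

          ν-hi : ∀ {v} → ¬ InCorner v × v ∉ L → ν v ≡ hi
          ν-hi {v} (¬c , ¬m) with v ∈? L | InCorner? v
          ... | yes m | _ = ⊥-elim (¬m m)
          ... | no _ | yes c = ⊥-elim (¬c c)
          ... | no _ | no _ = refl

          cut : Two InCorner → Cut₄ G x x′ a b
          cut two = record
            { κ = ν ; κe = ν-mid 0th ; κf = ν-mid 1st ; κg = ν-mid 2nd ; κh = ν-mid 3rd
            ; cov = ν-mid⁻
            ; cut = λ p q uv → case cl (ν-lo⁻ p) uv of λ where
                (inj₁ c) → clash (ν-lo c) q lo≢hi
                (inj₂ m) → clash (ν-mid m) q mid≢hi
            ; los = Two-map ν-lo two
            ; his = Two-map ν-hi out }

      -- Induction on a side of a 4-cut.

      lo-size : ∀ {e f g h} → Cut₄ G e f g h → ℕ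
      lo-size A = ∣ Vec.tabulate (λ v → does (Cut₄.κ A v ≟ˢ lo)) ∣

      Smaller : ∀ {e f g h e′ f′ g′ h′} → Cut₄ G e′ f′ g′ h′ → Cut₄ G e f g h → Set
      Smaller B A = (∀ {v} → Cut₄.κ B v ≡ lo → Cut₄.κ A v ≡ lo) × (∃ λ v → Cut₄.κ A v ≡ lo × Cut₄.κ B v ≢ lo)

      smaller-size : ∀ {e f g h e′ f′ g′ h′} (B : Cut₄ G e′ f′ g′ h′) (A : Cut₄ G e f g h) → Smaller B A → lo-size B < lo-size A
      smaller-size B A (sub , v , kv , nv) = Sub.p⊂q⇒∣p∣<∣q∣
        ((λ m → to A (sub (from B m))) , v , to A kv , λ m → nv (from B m))
        where
        to : ∀ {e f g h} (A : Cut₄ G e f g h) → ∀ {v} → Cut₄.κ A v ≡ lo → v ∈ˢ Vec.tabulate (λ v → does (Cut₄.κ A v ≟ˢ lo))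
        to A {v} p = VecP.lookup⇒[]= v _ (trans (VecP.lookup∘tabulate _ v) (dec-true (Cut₄.κ A v ≟ˢ lo) p))
        from : ∀ {e f g h} (A : Cut₄ G e f g h) → ∀ {v} → v ∈ˢ Vec.tabulate (λ v → does (Cut₄.κ A v ≟ˢ lo)) → Cut₄.κ A v ≡ lo
        from A {v} m with Cut₄.κ A v ≟ˢ lo | trans (sym (VecP.lookup∘tabulate (λ v → does (Cut₄.κ A v ≟ˢ lo)) v)) (VecP.[]=⇒lookup m)
        ... | yes p | _ = p
        ... | no _ | ()

      -- The end of the induction: a side with exactly two vertices has no outside neighbours but
      -- the four cut vertices, two of which are adjacent.
      lo-pair : ∀ {e f g h a b} (A : Cut₄ G e f g h) → e ~ f → Cut₄.κ A a ≡ lo → Cut₄.κ A b ≡ lo → a ≢ b →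
        (∀ {v} → Cut₄.κ A v ≡ lo → v ≡ a ⊎ v ≡ b) → SomeStrip
      lo-pair {e} {f} {g} {h} {a} {b} A ef ka kb a≢b all = pair⇒strip {a} {b} {e} {f} {g} {h} record
        { p≢q = a≢b ; e₁e₂ = ef ; Np = nb ka (λ k ne → [ (λ q → ⊥-elim (ne q)) , id ]′ (all k))
        ; Nq = nb kb (λ k ne → [ id , (λ q → ⊥-elim (ne q)) ]′ (all k)) }
        where
        open Cut₄ A
        nb : ∀ {c d} → κ c ≡ lo → (∀ {v} → κ v ≡ lo → v ≢ c → v ≡ d) → Nb G c (d ∷ e ∷ f ∷ g ∷ h ∷ [])
        nb kc rest {w} cw with κ w in kw
        ... | lo = here (rest kw (~≢ cw ∘ sym))
        ... | mid = there (cov kw)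
        ... | hi = ⊥-elim (cut kc kw cw)

      AdjTo : V → List V → Set
      AdjTo x L = ∃ λ y → y ∈ L × x ~ y

      lo-pair′ : ∀ {x t₁ t₂ t₃ a b} (A : Cut₄ G x t₁ t₂ t₃) → AdjTo x (t₁ ∷ t₂ ∷ t₃ ∷ []) →
        Cut₄.κ A a ≡ lo → Cut₄.κ A b ≡ lo → a ≢ b →
        (∀ {v} → Cut₄.κ A v ≡ lo → v ≡ a ⊎ v ≡ b) → SomeStrip
      lo-pair′ A (_ , 0th , e) = lo-pair A e
      lo-pair′ A (_ , 1st , e) = lo-pair (swap-fg A) e
      lo-pair′ A (_ , 2nd , e) = lo-pair (swap-fg (swap-gh A)) e

      Rec : ∀ {e f g h} → Cut₄ G e f g h → Set
      Rec A = ∀ {e f g h} (B : Cut₄ G e f g h) → e ~ f → Smaller B A → SomeStrip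

      -- `A` is the current cut and `F` a cut through the edge from `x` to a neighbour `x′` on the
      -- `lo` side of `A`. Any cut through `x x′` whose `lo` side stays inside that of `A` is
      -- smaller, as it loses `x′`.
      module Crossed {x t₁ t₂ t₃ x′ r₁ r₂ : V} (A : Cut₄ G x t₁ t₂ t₃) (F : Cut₄ G x x′ r₁ r₂)
        (xx′ : x ~ x′) (κx′ : Cut₄.κ A x′ ≡ lo) (rec : Rec A) where
        open Cut₄ A using (κ)
        open Cut₄ F using () renaming (κ to μ)

        κx : κ x ≡ mid
        κx = (Cut₄.κe A)
        μx : μ x ≡ mid
        μx = (Cut₄.κe F)
        μx′ : μ x′ ≡ mid
        μx′ = (Cut₄.κf F)

        opp-clash : ∀ {X : Set} {s t : Side} {c : Side} → c ≡ s → opp c ≡ t → opp s ≢ t → X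
        opp-clash p q ne = clash (cong opp p) q ne

        rec-F : (∀ {v} → μ v ≡ lo → κ v ≡ lo) → SomeStrip
        rec-F sub = rec F xx′ (sub , x′ , κx′ , λ q → clash q μx′ lo≢mid)

        rec-AC : ∀ {a b} → (Corner.Boundary A F) (x ∷ x′ ∷ a ∷ b ∷ []) → Two (Corner.InCorner A F) → SomeStrip
        rec-AC B two =
            let
                open Corner.Subcut A F B
            in rec (cut two) xx′ (proj₁ ∘ ν-lo⁻ , x′ , κx′ , λ q → clash (ν-mid 1st) q mid≢lo)

        rec-AD : ∀ {a b} → (Corner.Boundary A (flip F)) (x ∷ x′ ∷ a ∷ b ∷ []) → Two (Corner.InCorner A (flip F)) → SomeStrip
        rec-AD B two =
            let
                open Corner.Subcut A (flip F) B
            in rec (cut two) xx′ (proj₁ ∘ ν-lo⁻ , x′ , κx′ , λ q → clash (ν-mid 1st) q mid≢lo)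

        -- A single vertex in this corner would be adjacent to both ends of the edge `x x′`.
        AC-triangle : ∀ {c} → (Corner.Boundary A F) (x ∷ x′ ∷ c ∷ []) → ∀ {p} → κ p ≡ lo → μ p ≢ lo
        AC-triangle B kp mp with all₃ ((Corner.Single.nb A F) B (kp , mp))
        ... | px , px′ , _ = tf px xx′ px′

        bx : ∀ {Q : V → Set} {Q? : Decidable Q} → (Sep.Lo.Bd A) Q? x
        bx = inj₁ κx
        bx′ : (Sep.Lo.Bd A) (Corner.Q? A F) x′
        bx′ = inj₂ (κx′ , λ q → clash q μx′ lo≢mid)
        bx′⁻ : (Sep.Lo.Bd A) (Corner.Q? A (flip F)) x′
        bx′⁻ = inj₂ (κx′ , λ q → opp-clash μx′ q mid≢lo)

        notB : ∀ {X : Set} → opp (κ x′) ≡ lo → X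
        notB q = opp-clash κx′ q hi≢lo

        -- Every vertex of the lo side of F lies in a corner or among the tᵢ.
        F-lo : ∀ {X : V → Set} → (∀ {v} → κ v ≡ lo → μ v ≡ lo → X v) → (∀ {v} → opp (κ v) ≡ lo → μ v ≡ lo → X v) →
          (μ t₁ ≡ lo → X t₁) → (μ t₂ ≡ lo → X t₂) → (μ t₃ ≡ lo → X t₃) → ∀ {v} → μ v ≡ lo → X v
        F-lo a b c₁ c₂ c₃ {v} mv with κ v in kv
        ... | lo = a kv mv
        ... | hi = b (cong opp kv) mv
        ... | mid = case (Cut₄.cov A) kv of λ where
          0th → clash mv μx lo≢mid
          1st → c₁ mv
          2nd → c₂ mv
          3rd → c₃ mv

        A-lo : ∀ {X : V → Set} → (∀ {v} → κ v ≡ lo → μ v ≡ lo → X v) → (∀ {v} → κ v ≡ lo → opp (μ v) ≡ lo → X v) →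
          X x′ → (κ r₁ ≡ lo → X r₁) → (κ r₂ ≡ lo → X r₂) → ∀ {v} → κ v ≡ lo → X v
        A-lo a b c c₁ c₂ {v} kv with μ v in mv
        ... | lo = a kv mv
        ... | hi = b kv (cong opp mv)
        ... | mid = case (Cut₄.cov F) mv of λ where
          0th → clash kv κx lo≢mid
          1st → c
          2nd → c₁ kv
          3rd → c₂ kv

        A-hi : ∀ {X : V → Set} → (∀ {v} → opp (κ v) ≡ lo → μ v ≡ lo → X v) → (∀ {v} → opp (κ v) ≡ lo → opp (μ v) ≡ lo → X v) →
          (κ r₁ ≡ hi → X r₁) → (κ r₂ ≡ hi → X r₂) → ∀ {v} → κ v ≡ hi → X v
        A-hi a b c₁ c₂ {v} kv with μ v in mv
        ... | lo = a (cong opp kv) mv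
        ... | hi = b (cong opp kv) (cong opp mv)
        ... | mid = case (Cut₄.cov F) mv of λ where
          0th → clash kv κx hi≢mid
          1st → clash kv κx′ hi≢lo
          2nd → c₁ kv
          3rd → c₂ kv

        two-⊥ : ∀ {P : V → Set} → (∀ {u v} → P u → P v → u ≡ v) → Two P → ⊥
        two-⊥ u (p , q , p≢q , a , b) = p≢q (u a b)

        -- The `lo` side of `F` misses the cut `A`. Either it lies within the `lo` side of `A`,
        -- which gives a smaller cut, or the corners are too small for its two vertices.
        module AllHi (m₁ : μ t₁ ≡ hi) (m₂ : μ t₂ ≡ hi) (m₃ : μ t₃ ≡ hi) where
          t-lo : ∀ {X : Set} {t} → μ t ≡ hi → μ t ≡ lo → X
          t-lo p q = clash p q hi≢lo

          hh : κ r₁ ≡ hi → κ r₂ ≡ hi → SomeStrip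
          hh k₁ k₂ =
              let B : (Corner.Boundary (flip A) F) (x ∷ r₁ ∷ r₂ ∷ [])
                  B = record
                    { bd = inj₁ (cong opp κx) ∷ inj₂ (cong opp k₁ , λ q → clash q (Cut₄.κg F) lo≢mid) ∷ inj₂ (cong opp k₂ , λ q → clash q (Cut₄.κh F) lo≢mid) ∷ []
                    ; x∈ = 0th ; x′∈ = notB ; t₁∈ = λ ne → ⊥-elim (ne m₁) ; t₂∈ = λ ne → ⊥-elim (ne m₂) ; t₃∈ = λ ne → ⊥-elim (ne m₃)
                    ; r₁∈ = λ _ → 1st ; r₂∈ = λ _ → 2nd }
                  uniq : ∀ {u v} → (Corner.InCorner (flip A) F) u → (Corner.InCorner (flip A) F) v → u ≡ v
                  uniq = (Corner.Single.unique (flip A) F) B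
                  B′ : (Corner.Boundary A F) (x ∷ x′ ∷ [])
                  B′ = record
                    { bd = bx {Q? = (Corner.Q? A F)} ∷ bx′ ∷ []
                    ; x∈ = 0th ; x′∈ = λ _ → 1st ; t₁∈ = λ ne → ⊥-elim (ne m₁) ; t₂∈ = λ ne → ⊥-elim (ne m₂) ; t₃∈ = λ ne → ⊥-elim (ne m₃)
                    ; r₁∈ = λ q → clash k₁ q hi≢lo ; r₂∈ = λ q → clash k₂ q hi≢lo }
                  in-B : ∀ {v} → μ v ≡ lo → (Corner.InCorner (flip A) F) v
                  in-B = F-lo {(Corner.InCorner (flip A) F)} (λ k m → ⊥-elim ((Corner.empty A F) B′ k m)) _,_ (t-lo m₁) (t-lo m₂) (t-lo m₃)
              in ⊥-elim (two-⊥ (λ a b → uniq (in-B a) (in-B b)) (Cut₄.los F))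

          lh : κ r₁ ≡ lo → κ r₂ ≡ hi → SomeStrip
          lh k₁ k₂ =
              let B : (Corner.Boundary (flip A) F) (x ∷ r₂ ∷ [])
                  B = record
                    { bd = inj₁ (cong opp κx) ∷ inj₂ (cong opp k₂ , λ q → clash q (Cut₄.κh F) lo≢mid) ∷ []
                    ; x∈ = 0th ; x′∈ = notB ; t₁∈ = λ ne → ⊥-elim (ne m₁) ; t₂∈ = λ ne → ⊥-elim (ne m₂) ; t₃∈ = λ ne → ⊥-elim (ne m₃)
                    ; r₁∈ = λ q → opp-clash k₁ q hi≢lo ; r₂∈ = λ _ → 1st }
                  B′ : (Corner.Boundary A F) (x ∷ x′ ∷ r₁ ∷ [])
                  B′ = record
                    { bd = bx {Q? = (Corner.Q? A F)} ∷ bx′ ∷ inj₂ (k₁ , λ q → clash q (Cut₄.κg F) lo≢mid) ∷ []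
                    ; x∈ = 0th ; x′∈ = λ _ → 1st ; t₁∈ = λ ne → ⊥-elim (ne m₁) ; t₂∈ = λ ne → ⊥-elim (ne m₂) ; t₃∈ = λ ne → ⊥-elim (ne m₃)
                    ; r₁∈ = λ _ → 2nd ; r₂∈ = λ q → clash k₂ q hi≢lo }
              in ⊥-elim (F-lo {λ _ → ⊥} (AC-triangle B′) ((Corner.empty (flip A) F) B) (t-lo m₁) (t-lo m₂) (t-lo m₃)
                   (proj₁ (proj₂ (proj₂ (proj₂ (Cut₄.los F))))))

          ll : κ r₁ ≡ lo → κ r₂ ≡ lo → SomeStrip
          ll k₁ k₂ =
              let B : (Corner.Boundary (flip A) F) (x ∷ x ∷ [])
                  B = record
                    { bd = inj₁ (cong opp κx) ∷ inj₁ (cong opp κx) ∷ []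
                    ; x∈ = 0th ; x′∈ = notB ; t₁∈ = λ ne → ⊥-elim (ne m₁) ; t₂∈ = λ ne → ⊥-elim (ne m₂) ; t₃∈ = λ ne → ⊥-elim (ne m₃)
                    ; r₁∈ = λ q → opp-clash k₁ q hi≢lo ; r₂∈ = λ q → opp-clash k₂ q hi≢lo }
              in rec-F (F-lo {λ v → κ v ≡ lo} (λ k _ → k) (λ k m → ⊥-elim ((Corner.empty (flip A) F) B k m)) (t-lo m₁) (t-lo m₂) (t-lo m₃))

        module OneLo (xT : AdjTo x (t₁ ∷ t₂ ∷ t₃ ∷ [])) (m₁ : μ t₁ ≡ lo) (m₂ : μ t₂ ≡ hi) (m₃ : μ t₃ ≡ hi) where
          t-lo : ∀ {X : Set} {t} → μ t ≡ hi → μ t ≡ lo → X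
          t-lo p q = clash p q hi≢lo

          hh : κ r₁ ≡ hi → κ r₂ ≡ hi → SomeStrip
          hh k₁ k₂ = go (Corner.count A (flip F))
            where
            B : (Corner.Boundary A (flip F)) (x ∷ x′ ∷ t₂ ∷ t₃ ∷ [])
            B = record
              { bd = bx {Q? = (Corner.Q? A (flip F))} ∷ bx′⁻ ∷ inj₁ (Cut₄.κg A) ∷ inj₁ (Cut₄.κh A) ∷ []
              ; x∈ = 0th ; x′∈ = λ _ → 1st ; t₁∈ = λ ne → ⊥-elim (ne (cong opp m₁)) ; t₂∈ = λ _ → 2nd ; t₃∈ = λ _ → 3rd
              ; r₁∈ = λ q → clash k₁ q hi≢lo ; r₂∈ = λ q → clash k₂ q hi≢lo }
            B′ : (Corner.Boundary A F) (x ∷ x′ ∷ t₁ ∷ [])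
            B′ = record
              { bd = bx {Q? = (Corner.Q? A F)} ∷ bx′ ∷ inj₁ (Cut₄.κf A) ∷ []
              ; x∈ = 0th ; x′∈ = λ _ → 1st ; t₁∈ = λ _ → 2nd ; t₂∈ = λ ne → ⊥-elim (ne m₂) ; t₃∈ = λ ne → ⊥-elim (ne m₃)
              ; r₁∈ = λ q → clash k₁ q hi≢lo ; r₂∈ = λ q → clash k₂ q hi≢lo }
            in-A : ∀ {X : V → Set} → (∀ {v} → (Corner.InCorner A (flip F)) v → X v) → X x′ → ∀ {v} → κ v ≡ lo → X v
            in-A {X} f c = A-lo {X} (λ k m → ⊥-elim (AC-triangle B′ k m)) (λ k m → f (k , m)) c
              (λ q → clash k₁ q hi≢lo) (λ q → clash k₂ q hi≢lo)
            go : (∃ λ p → (Corner.InCorner A (flip F)) p × (∀ {q} → (Corner.InCorner A (flip F)) q → q ≡ p)) ⊎ (∀ {p} → ¬ (Corner.InCorner A (flip F)) p) ⊎ Two (Corner.InCorner A (flip F)) → SomeStrip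
            go (inj₁ (p , (kp , mp) , uniq)) = lo-pair′ A xT κx′ kp (λ { refl → opp-clash μx′ mp mid≢lo })
              (in-A {λ v → v ≡ x′ ⊎ v ≡ p} (inj₂ ∘ uniq) (inj₁ refl))
            go (inj₂ (inj₁ no-AD)) with (Sep.other-lo A) x′
            ... | c , c≢ , kc = ⊥-elim (in-A {λ v → v ≢ x′ → ⊥} (λ m _ → no-AD m) (λ ne → ne refl) kc c≢)
            go (inj₂ (inj₂ two)) = rec-AD B two

          lh : κ r₁ ≡ lo → κ r₂ ≡ hi → SomeStrip
          lh k₁ k₂ = go (Corner.count A F)
            where
            B : (Corner.Boundary A F) (x ∷ x′ ∷ t₁ ∷ r₁ ∷ [])
            B = record
              { bd = bx {Q? = (Corner.Q? A F)} ∷ bx′ ∷ inj₁ (Cut₄.κf A) ∷ inj₂ (k₁ , λ q → clash q (Cut₄.κg F) lo≢mid) ∷ []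
              ; x∈ = 0th ; x′∈ = λ _ → 1st ; t₁∈ = λ _ → 2nd ; t₂∈ = λ ne → ⊥-elim (ne m₂) ; t₃∈ = λ ne → ⊥-elim (ne m₃)
              ; r₁∈ = λ _ → 3rd ; r₂∈ = λ q → clash k₂ q hi≢lo }
            B′ : (Corner.Boundary (flip A) F) (x ∷ t₁ ∷ r₂ ∷ [])
            B′ = record
              { bd = inj₁ (cong opp κx) ∷ inj₁ (cong opp (Cut₄.κf A)) ∷ inj₂ (cong opp k₂ , λ q → clash q (Cut₄.κh F) lo≢mid) ∷ []
              ; x∈ = 0th ; x′∈ = notB ; t₁∈ = λ _ → 1st ; t₂∈ = λ ne → ⊥-elim (ne m₂) ; t₃∈ = λ ne → ⊥-elim (ne m₃)
              ; r₁∈ = λ q → opp-clash k₁ q hi≢lo ; r₂∈ = λ _ → 2nd }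
            module S = Corner.Single (flip A) F B′
            in-F : ∀ {X : V → Set} → (∀ {v} → (Corner.InCorner A F) v → X v) → (∀ {v} → (Corner.InCorner (flip A) F) v → X v) → X t₁ → ∀ {v} → μ v ≡ lo → X v
            in-F {X} f g c = F-lo {X} (λ k m → f (k , m)) (λ k m → g (k , m)) (λ _ → c) (t-lo m₂) (t-lo m₃)

            -- Two corners are single vertices `p` and `q`, and `t₁` is cubic with neighbours `p`,
            -- `q`, `x′`. The neighbours other than `q` are adjacent to `x`, contrary to `K₂₃`.
            three : ∀ {p q} → (Corner.InCorner A F) p → (∀ {q} → (Corner.InCorner A F) q → q ≡ p) → (Corner.InCorner (flip A) F) q → SomeStrip
            three {p} {q} cp uniq cq = ⊥-elim (K₂₃ (Nb-213 Nq) close)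
              where
              Nq : Nb G q (x ∷ t₁ ∷ r₂ ∷ [])
              Nq = S.nb cq
              Np : Nb G p (x ∷ x′ ∷ t₁ ∷ r₁ ∷ [])
              Np e with (Corner.Bounded.cl A F) B cp e
              ... | inj₁ c = ⊥-elim (~≢ e (sym (uniq c)))
              ... | inj₂ m = m
              pt₁ : p ~ t₁
              pt₁ with p ~? t₁
              ... | yes e = e
              ... | no ¬e with all₃ {p} {x} {x′} {r₁} (λ e → case Np e of λ { 0th → 0th ; 1st → 1st ; 2nd → ⊥-elim (¬e e) ; 3rd → 2nd })
              ... | px , px′ , _ = ⊥-elim (tf px xx′ px′)
              pr₁ : p ~ r₁
              pr₁ with p ~? r₁
              ... | yes e = e
              ... | no ¬e with all₃ {p} {x} {x′} {t₁} (λ e → case Np e of λ { 0th → 0th ; 1st → 1st ; 2nd → 2nd ; 3rd → ⊥-elim (¬e e) })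
              ... | px , px′ , _ = ⊥-elim (tf px xx′ px′)
              Nt₁ : Nb G t₁ (p ∷ q ∷ x′ ∷ [])
              Nt₁ {w} e with μ w in mw
              ... | hi = ⊥-elim ((Cut₄.cut F) m₁ mw e)
              ... | lo = in-F {λ v → t₁ ~ v → v ∈ p ∷ q ∷ x′ ∷ []} (λ c _ → here (uniq c)) (λ c _ → there (here (S.unique c cq)))
                    (λ e → ⊥-elim (~≢ e refl)) mw e
              ... | mid = case (Cut₄.cov F) mw of λ where
                0th → ⊥-elim (tf (proj₁ (proj₂ (all₃ Nq))) e (proj₁ (all₃ Nq)))
                1st → 2nd
                2nd → ⊥-elim (tf pt₁ e pr₁)
                3rd → ⊥-elim (tf (proj₁ (proj₂ (all₃ Nq))) e (proj₂ (proj₂ (all₃ Nq))))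
              Np′ : Nb G p (x ∷ t₁ ∷ r₁ ∷ [])
              Np′ e = case Np e of λ
                { 0th → 0th ; 1st → ⊥-elim (tf pt₁ (proj₂ (proj₂ (all₃ Nt₁))) e) ; 2nd → 1st ; 3rd → 2nd }
              close : ∀ {w} → t₁ ~ w → w ≢ q → w ~ x
              close e ne = case Nt₁ e of λ
                { 0th → proj₁ (all₃ Np′) ; 1st → ⊥-elim (ne refl) ; 2nd → ~sym xx′ }

            t≢ : ∀ {p} → κ p ≢ mid → t₁ ≢ p
            t≢ ne refl = ne (Cut₄.κf A)

            go : (∃ λ p → (Corner.InCorner A F) p × (∀ {q} → (Corner.InCorner A F) q → q ≡ p)) ⊎ (∀ {p} → ¬ (Corner.InCorner A F) p) ⊎ Two (Corner.InCorner A F) → SomeStrip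
            go (inj₂ (inj₂ two)) = rec-AC B two
            go (inj₂ (inj₁ no-AC)) with (Sep.other-lo F) t₁
            ... | c , c≢ , mc =
                let c∈ : (Corner.InCorner (flip A) F) c
                    c∈ = in-F {λ v → v ≢ t₁ → (Corner.InCorner (flip A) F) v} (⊥-elim ∘ no-AC) (λ d _ → d) (λ ne → ⊥-elim (ne refl)) mc c≢
                in lo-pair F xx′ m₁ mc (c≢ ∘ sym)
                     (in-F {λ v → v ≡ t₁ ⊎ v ≡ c} (⊥-elim ∘ no-AC) (λ d → inj₂ (S.unique d c∈)) (inj₁ refl))
            go (inj₁ (p , cp , uniq)) with any? (Corner.InCorner? (flip A) F)
            ... | yes (q , cq) = three cp uniq cq
            ... | no no-BC = lo-pair F xx′ m₁ (proj₂ cp) (t≢ λ q → clash (proj₁ cp) q lo≢mid)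
              (in-F {λ v → v ≡ t₁ ⊎ v ≡ p} (inj₂ ∘ uniq) (λ d → ⊥-elim (no-BC (_ , d))) (inj₁ refl))

          ll : κ r₁ ≡ lo → κ r₂ ≡ lo → SomeStrip
          ll k₁ k₂ =
              let B : (Corner.Boundary (flip A) (flip F)) (x ∷ t₂ ∷ t₃ ∷ [])
                  B = record
                    { bd = inj₁ (cong opp κx) ∷ inj₁ (cong opp (Cut₄.κg A)) ∷ inj₁ (cong opp (Cut₄.κh A)) ∷ []
                    ; x∈ = 0th ; x′∈ = notB ; t₁∈ = λ ne → ⊥-elim (ne (cong opp m₁)) ; t₂∈ = λ _ → 1st ; t₃∈ = λ _ → 2nd
                    ; r₁∈ = λ q → opp-clash k₁ q hi≢lo ; r₂∈ = λ q → opp-clash k₂ q hi≢lo }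
                  B′ : (Corner.Boundary (flip A) F) (x ∷ t₁ ∷ [])
                  B′ = record
                    { bd = inj₁ (cong opp κx) ∷ inj₁ (cong opp (Cut₄.κf A)) ∷ []
                    ; x∈ = 0th ; x′∈ = notB ; t₁∈ = λ _ → 1st ; t₂∈ = λ ne → ⊥-elim (ne m₂) ; t₃∈ = λ ne → ⊥-elim (ne m₃)
                    ; r₁∈ = λ q → opp-clash k₁ q hi≢lo ; r₂∈ = λ q → opp-clash k₂ q hi≢lo }
                  in-B : ∀ {v} → κ v ≡ hi → (Corner.InCorner (flip A) (flip F)) v
                  in-B = A-hi {(Corner.InCorner (flip A) (flip F))} (λ k m → ⊥-elim ((Corner.empty (flip A) F) B′ k m)) _,_ (λ q → clash k₁ q lo≢hi) (λ q → clash k₂ q lo≢hi)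
              in ⊥-elim (two-⊥ (λ a b → (Corner.Single.unique (flip A) (flip F)) B (in-B a) (in-B b)) (Cut₄.his A))

      near-y : ∀ {x x′ z a b c d} → x ~ x′ → x′ ≢ c → Nb G c (x ∷ x′ ∷ z ∷ a ∷ []) →
        Nb G x′ (c ∷ d ∷ x ∷ z ∷ a ∷ b ∷ []) → d ~ b → x ~ a → SomeStrip
      near-y {x} {x′} {z} {a} {b} {c} {d} xx′ x′≢c Nc Nx′ db xa = go (x′ ~? d)
        where
        Nc′ : Nb G c (x′ ∷ z ∷ a ∷ [])
        Nc′ e with Nc e
        ... | 1st = 0th
        ... | 2nd = 1st
        ... | 3rd = 2nd
        ... | 0th with c ~? a
        ... | yes ca = ⊥-elim (tf e xa ca)
        ... | no ¬ca with all₃ {c} {x} {x′} {z} (λ e → case Nc e of λ { 0th → 0th ; 1st → 1st ; 2nd → 2nd ; 3rd → ⊥-elim (¬ca e) })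
        ... | cx , cx′ , _ = ⊥-elim (tf cx xx′ cx′)
        cx′ : c ~ x′
        cx′ = proj₁ (all₃ Nc′)
        pr : ∀ {w} → Nb G x′ (c ∷ x ∷ w ∷ []) → SomeStrip
        pr {w} N = pair⇒strip {x′} {c} {x} {a} {z} {w} record
          { p≢q = x′≢c ; e₁e₂ = xa
          ; Np = λ e → case N e of λ { 0th → 0th ; 1st → 1st ; 2nd → 4th }
          ; Nq = λ e → case Nc′ e of λ { 0th → 0th ; 1st → 3rd ; 2nd → 2nd } }
        go : Dec (x′ ~ d) → SomeStrip
        go (yes x′d) = pr {d} λ e → case Nx′ e of λ
          { 0th → 0th ; 1st → 2nd ; 2nd → 1st ; 3rd → ⊥-elim (tf cx′ e (proj₁ (proj₂ (all₃ Nc′))))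
          ; 4th → ⊥-elim (tf cx′ e (proj₂ (proj₂ (all₃ Nc′)))) ; 5th → ⊥-elim (tf x′d db e) }
        go (no ¬x′d) = pr {b} λ e → case Nx′ e of λ
          { 0th → 0th ; 1st → ⊥-elim (¬x′d e) ; 2nd → 1st ; 3rd → ⊥-elim (tf cx′ e (proj₁ (proj₂ (all₃ Nc′))))
          ; 4th → ⊥-elim (tf cx′ e (proj₂ (proj₂ (all₃ Nc′)))) ; 5th → 2nd }

      -- Here `x′` and two corner vertices `c`, `d` make up the side. If `x` is adjacent to `a` or
      -- to `b`, then `x′` and one of `c`, `d` form a `Pair`; if `x` is adjacent to `z`, every other
      -- neighbour of `x′` is adjacent to `z`, contrary to `K₂₃`.
      double : ∀ {x x′ z a b c d} → x ~ x′ → x′ ≢ c → x′ ≢ d → Nb G c (x ∷ x′ ∷ z ∷ a ∷ []) → Nb G d (x ∷ x′ ∷ z ∷ b ∷ []) →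
        Nb G x′ (c ∷ d ∷ x ∷ z ∷ a ∷ b ∷ []) → AdjTo x (z ∷ a ∷ b ∷ []) → SomeStrip
      double {x} {x′} {z} {a} {b} {c} {d} xx′ x′≢c x′≢d Nc Nd Nx′ = go
        where
        last : ∀ {c a} → Nb G c (x ∷ x′ ∷ z ∷ a ∷ []) → c ~ a
        last {c} {a} Nc with c ~? a
        ... | yes ca = ca
        ... | no ¬ca with all₃ {c} {x} {x′} {z} (λ e → case Nc e of λ { 0th → 0th ; 1st → 1st ; 2nd → 2nd ; 3rd → ⊥-elim (¬ca e) })
        ... | cx , cx′ , _ = ⊥-elim (tf cx xx′ cx′)
        go : AdjTo x (z ∷ a ∷ b ∷ []) → SomeStrip
        go (_ , 1st , xa) = near-y xx′ x′≢c Nc Nx′ (last Nd) xa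
        go (_ , 2nd , xb) = near-y xx′ x′≢d Nd
          (λ e → case Nx′ e of λ { 0th → 1st ; 1st → 0th ; 2nd → 2nd ; 3rd → 3rd ; 4th → 5th ; 5th → 4th }) (last Nc) xb
        go (_ , 0th , xz) = ⊥-elim (K₂₃ Nc″ close)
          where
          trim : ∀ {c a} → Nb G c (x ∷ x′ ∷ z ∷ a ∷ []) → Nb G c (x′ ∷ z ∷ a ∷ [])
          trim {c} {a} Nc e with Nc e
          ... | 1st = 0th
          ... | 2nd = 1st
          ... | 3rd = 2nd
          ... | 0th with c ~? z
          ... | yes cz = ⊥-elim (tf e xz cz)
          ... | no ¬cz with all₃ {c} {x} {x′} {a} (λ e → case Nc e of λ { 0th → 0th ; 1st → 1st ; 2nd → ⊥-elim (¬cz e) ; 3rd → 2nd })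
          ... | cx , cx′ , _ = ⊥-elim (tf cx xx′ cx′)
          Nc″ : Nb G c (x′ ∷ z ∷ a ∷ [])
          Nc″ = trim Nc
          Nd″ : Nb G d (x′ ∷ z ∷ b ∷ [])
          Nd″ = trim Nd
          close : ∀ {w} → x′ ~ w → w ≢ c → w ~ z
          close e ne = case Nx′ e of λ
            { 0th → ⊥-elim (ne refl)
            ; 1st → proj₁ (proj₂ (all₃ Nd″))
            ; 2nd → xz
            ; 3rd → ⊥-elim (tf (proj₁ (all₃ Nc″)) e (proj₁ (proj₂ (all₃ Nc″))))
            ; 4th → ⊥-elim (tf (proj₁ (all₃ Nc″)) e (proj₂ (proj₂ (all₃ Nc″))))
            ; 5th → ⊥-elim (tf (proj₁ (all₃ Nd″)) e (proj₂ (proj₂ (all₃ Nd″)))) }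

      module Shared₁ {x z t₂ t₃ x′ r₂ : V} (A : Cut₄ G x z t₂ t₃) (F : Cut₄ G x x′ z r₂)
        (xx′ : x ~ x′) (κx′ : Cut₄.κ A x′ ≡ lo) (rec : Rec A) where
        open Crossed A F xx′ κx′ rec using (κx; μx; μx′; opp-clash; rec-F; rec-AC; rec-AD; AC-triangle; bx; bx′; bx′⁻; notB; F-lo; A-lo; A-hi; two-⊥)
        open Cut₄ A using (κ)
        open Cut₄ F using () renaming (κ to μ)

        κz : κ z ≡ mid
        κz = (Cut₄.κf A)
        μz : μ z ≡ mid
        μz = (Cut₄.κg F)

        module Hi (m₂ : μ t₂ ≡ hi) (m₃ : μ t₃ ≡ hi) where
          h : κ r₂ ≡ hi → SomeStrip
          h k₂ =
              let B : (Corner.Boundary (flip A) F) (x ∷ z ∷ r₂ ∷ [])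
                  B = record
                    { bd = inj₁ (cong opp κx) ∷ inj₁ (cong opp κz) ∷ inj₂ (cong opp k₂ , λ q → clash q (Cut₄.κh F) lo≢mid) ∷ []
                    ; x∈ = 0th ; x′∈ = notB ; t₁∈ = λ _ → 1st ; t₂∈ = λ ne → ⊥-elim (ne m₂) ; t₃∈ = λ ne → ⊥-elim (ne m₃)
                    ; r₁∈ = λ _ → 1st ; r₂∈ = λ _ → 2nd }
                  B′ : (Corner.Boundary A F) (x ∷ x′ ∷ z ∷ [])
                  B′ = record
                    { bd = bx {Q? = (Corner.Q? A F)} ∷ bx′ ∷ inj₁ κz ∷ []
                    ; x∈ = 0th ; x′∈ = λ _ → 1st ; t₁∈ = λ _ → 2nd ; t₂∈ = λ ne → ⊥-elim (ne m₂) ; t₃∈ = λ ne → ⊥-elim (ne m₃)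
                    ; r₁∈ = λ _ → 2nd ; r₂∈ = λ q → clash k₂ q hi≢lo }
                  in-B : ∀ {v} → μ v ≡ lo → (Corner.InCorner (flip A) F) v
                  in-B = F-lo {(Corner.InCorner (flip A) F)} (λ k m → ⊥-elim (AC-triangle B′ k m)) _,_ (λ q → clash q μz lo≢mid) (λ q → clash m₂ q hi≢lo) (λ q → clash m₃ q hi≢lo)
              in ⊥-elim (two-⊥ (λ a b → (Corner.Single.unique (flip A) F) B (in-B a) (in-B b)) (Cut₄.los F))

          l : κ r₂ ≡ lo → SomeStrip
          l k₂ =
              let B : (Corner.Boundary (flip A) F) (x ∷ z ∷ [])
                  B = record
                    { bd = inj₁ (cong opp κx) ∷ inj₁ (cong opp κz) ∷ []
                    ; x∈ = 0th ; x′∈ = notB ; t₁∈ = λ _ → 1st ; t₂∈ = λ ne → ⊥-elim (ne m₂) ; t₃∈ = λ ne → ⊥-elim (ne m₃)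
                    ; r₁∈ = λ _ → 1st ; r₂∈ = λ q → opp-clash k₂ q hi≢lo }
              in rec-F (F-lo {λ v → κ v ≡ lo} (λ k _ → k) (λ k m → ⊥-elim ((Corner.empty (flip A) F) B k m))
                   (λ q → clash q μz lo≢mid) (λ q → clash m₂ q hi≢lo) (λ q → clash m₃ q hi≢lo))

        module LoHi (xT : AdjTo x (z ∷ t₂ ∷ t₃ ∷ [])) (m₂ : μ t₂ ≡ lo) (m₃ : μ t₃ ≡ hi) where
          h : κ r₂ ≡ hi → SomeStrip
          h k₂ = go (Corner.count A F) (Corner.count A (flip F))
            where
            B : (Corner.Boundary A F) (x ∷ x′ ∷ z ∷ t₂ ∷ [])
            B = record
              { bd = bx {Q? = (Corner.Q? A F)} ∷ bx′ ∷ inj₁ κz ∷ inj₁ (Cut₄.κg A) ∷ []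
              ; x∈ = 0th ; x′∈ = λ _ → 1st ; t₁∈ = λ _ → 2nd ; t₂∈ = λ _ → 3rd ; t₃∈ = λ ne → ⊥-elim (ne m₃)
              ; r₁∈ = λ _ → 2nd ; r₂∈ = λ q → clash k₂ q hi≢lo }
            B′ : (Corner.Boundary A (flip F)) (x ∷ x′ ∷ z ∷ t₃ ∷ [])
            B′ = record
              { bd = bx {Q? = (Corner.Q? A (flip F))} ∷ bx′⁻ ∷ inj₁ κz ∷ inj₁ (Cut₄.κh A) ∷ []
              ; x∈ = 0th ; x′∈ = λ _ → 1st ; t₁∈ = λ _ → 2nd ; t₂∈ = λ ne → ⊥-elim (ne (cong opp m₂)) ; t₃∈ = λ _ → 3rd
              ; r₁∈ = λ _ → 2nd ; r₂∈ = λ q → clash k₂ q hi≢lo }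
            in-A : ∀ {X : V → Set} → (∀ {v} → (Corner.InCorner A F) v → X v) → (∀ {v} → (Corner.InCorner A (flip F)) v → X v) → X x′ → ∀ {v} → κ v ≡ lo → X v
            in-A {X} f g c = A-lo {X} (λ k m → f (k , m)) (λ k m → g (k , m)) c
              (λ q → clash q κz lo≢mid) (λ q → clash k₂ q hi≢lo)
            Alone : (V → Set) → Set
            Alone P = ∃ λ p → P p × (∀ {q} → P q → q ≡ p)
            go : Alone (Corner.InCorner A F) ⊎ (∀ {p} → ¬ (Corner.InCorner A F) p) ⊎ Two (Corner.InCorner A F) →
                 Alone (Corner.InCorner A (flip F)) ⊎ (∀ {p} → ¬ (Corner.InCorner A (flip F)) p) ⊎ Two (Corner.InCorner A (flip F)) → SomeStrip
            go (inj₂ (inj₂ two)) _ = rec-AC B two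
            go _ (inj₂ (inj₂ two)) = rec-AD B′ two
            go (inj₂ (inj₁ no-AC)) (inj₂ (inj₁ no-AD)) with (Sep.other-lo A) x′
            ... | c , c≢ , kc = ⊥-elim (in-A {λ v → v ≢ x′ → ⊥} (λ m _ → no-AC m) (λ m _ → no-AD m) (λ ne → ne refl) kc c≢)
            go (inj₁ (c , cc , uniq)) (inj₂ (inj₁ no-AD)) = lo-pair′ A xT κx′ (proj₁ cc) (λ { refl → clash (proj₂ cc) μx′ lo≢mid })
              (in-A {λ v → v ≡ x′ ⊎ v ≡ c} (inj₂ ∘ uniq) (⊥-elim ∘ no-AD) (inj₁ refl))
            go (inj₂ (inj₁ no-AC)) (inj₁ (d , cd , uniq)) = lo-pair′ A xT κx′ (proj₁ cd) (λ { refl → opp-clash μx′ (proj₂ cd) mid≢lo })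
              (in-A {λ v → v ≡ x′ ⊎ v ≡ d} (⊥-elim ∘ no-AC) (inj₂ ∘ uniq) (inj₁ refl))
            go (inj₁ (c , cc , uc)) (inj₁ (d , cd , ud)) = double xx′
              (λ { refl → clash (proj₂ cc) μx′ lo≢mid }) (λ { refl → opp-clash μx′ (proj₂ cd) mid≢lo }) Nc Nd Nx′ xT
              where
              Nc : Nb G c (x ∷ x′ ∷ z ∷ t₂ ∷ [])
              Nc e with (Corner.Bounded.cl A F) B cc e
              ... | inj₁ q = ⊥-elim (~≢ e (sym (uc q)))
              ... | inj₂ m = m
              Nd : Nb G d (x ∷ x′ ∷ z ∷ t₃ ∷ [])
              Nd e with (Corner.Bounded.cl A (flip F)) B′ cd e
              ... | inj₁ q = ⊥-elim (~≢ e (sym (ud q)))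
              ... | inj₂ m = m
              Nx′ : Nb G x′ (c ∷ d ∷ x ∷ z ∷ t₂ ∷ t₃ ∷ [])
              Nx′ {w} e with κ w in kw
              ... | hi = ⊥-elim ((Cut₄.cut A) κx′ kw e)
              ... | mid = there (there ((Cut₄.cov A) kw))
              ... | lo = in-A {λ v → x′ ~ v → v ∈ c ∷ d ∷ x ∷ z ∷ t₂ ∷ t₃ ∷ []} (λ q _ → here (uc q)) (λ q _ → there (here (ud q)))
                    (λ e → ⊥-elim (~≢ e refl)) kw e

          -- The `hi` side of `A` would be one vertex in each corner. Every cut vertex adjacent to
          -- `x` would then close a triangle with `x` and one of them.
          l : κ r₂ ≡ lo → SomeStrip
          l k₂ = ⊥-elim (go (Cut₄.his A) xT)
            where
            B : (Corner.Boundary (flip A) F) (x ∷ z ∷ t₂ ∷ [])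
            B = record
              { bd = inj₁ (cong opp κx) ∷ inj₁ (cong opp κz) ∷ inj₁ (cong opp (Cut₄.κg A)) ∷ []
              ; x∈ = 0th ; x′∈ = notB ; t₁∈ = λ _ → 1st ; t₂∈ = λ _ → 2nd ; t₃∈ = λ ne → ⊥-elim (ne m₃)
              ; r₁∈ = λ _ → 1st ; r₂∈ = λ q → opp-clash k₂ q hi≢lo }
            B′ : (Corner.Boundary (flip A) (flip F)) (x ∷ z ∷ t₃ ∷ [])
            B′ = record
              { bd = inj₁ (cong opp κx) ∷ inj₁ (cong opp κz) ∷ inj₁ (cong opp (Cut₄.κh A)) ∷ []
              ; x∈ = 0th ; x′∈ = notB ; t₁∈ = λ _ → 1st ; t₂∈ = λ ne → ⊥-elim (ne (cong opp m₂)) ; t₃∈ = λ _ → 2nd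
              ; r₁∈ = λ _ → 1st ; r₂∈ = λ q → opp-clash k₂ q hi≢lo }
            in-B : ∀ {v} → κ v ≡ hi → (Corner.InCorner (flip A) F) v ⊎ (Corner.InCorner (flip A) (flip F)) v
            in-B = A-hi {λ v → (Corner.InCorner (flip A) F) v ⊎ (Corner.InCorner (flip A) (flip F)) v} (λ k m → inj₁ (k , m)) (λ k m → inj₂ (k , m))
              (λ q → clash q κz hi≢mid) (λ q → clash k₂ q lo≢hi)
            fin : ∀ {c d} → (Corner.InCorner (flip A) F) c → (Corner.InCorner (flip A) (flip F)) d → AdjTo x (z ∷ t₂ ∷ t₃ ∷ []) → ⊥
            fin cc cd (y , m , xy) with all₃ ((Corner.Single.nb (flip A) F) B cc) | all₃ ((Corner.Single.nb (flip A) (flip F)) B′ cd)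
            fin cc cd (y , 0th , xy) | cx , cz , _ | _ = tf cx xy cz
            fin cc cd (y , 1st , xy) | cx , _ , ct | _ = tf cx xy ct
            fin cc cd (y , 2nd , xy) | _ | dx , _ , dt = tf dx xy dt
            go : Two (λ v → κ v ≡ hi) → AdjTo x (z ∷ t₂ ∷ t₃ ∷ []) → ⊥
            go (p , q , p≢q , kp , kq) xy with in-B kp | in-B kq
            ... | inj₁ a | inj₁ b = p≢q ((Corner.Single.unique (flip A) F) B a b)
            ... | inj₂ a | inj₂ b = p≢q ((Corner.Single.unique (flip A) (flip F)) B′ a b)
            ... | inj₁ a | inj₂ b = fin a b xy
            ... | inj₂ a | inj₁ b = fin b a xy

      module Shared₂ {x z z′ t₃ x′ : V} (A : Cut₄ G x z z′ t₃) (F : Cut₄ G x x′ z z′)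
        (xx′ : x ~ x′) (κx′ : Cut₄.κ A x′ ≡ lo) (rec : Rec A) where
        open Crossed A F xx′ κx′ rec using (κx; μx; μx′; opp-clash; rec-F; rec-AC; rec-AD; AC-triangle; bx; bx′; bx′⁻; notB; F-lo; A-lo; A-hi; two-⊥)
        open Cut₄ A using (κ)
        open Cut₄ F using () renaming (κ to μ)

        h : μ t₃ ≡ hi → SomeStrip
        h m₃ = go (Corner.count A F)
          where
          B : (Corner.Boundary A F) (x ∷ x′ ∷ z ∷ z′ ∷ [])
          B = record
            { bd = bx {Q? = (Corner.Q? A F)} ∷ bx′ ∷ inj₁ (Cut₄.κf A) ∷ inj₁ (Cut₄.κg A) ∷ []
            ; x∈ = 0th ; x′∈ = λ _ → 1st ; t₁∈ = λ _ → 2nd ; t₂∈ = λ _ → 3rd ; t₃∈ = λ ne → ⊥-elim (ne m₃)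
            ; r₁∈ = λ _ → 2nd ; r₂∈ = λ _ → 3rd }
          B′ : (Corner.Boundary (flip A) F) (x ∷ z ∷ z′ ∷ [])
          B′ = record
            { bd = inj₁ (cong opp κx) ∷ inj₁ (cong opp (Cut₄.κf A)) ∷ inj₁ (cong opp (Cut₄.κg A)) ∷ []
            ; x∈ = 0th ; x′∈ = notB ; t₁∈ = λ _ → 1st ; t₂∈ = λ _ → 2nd ; t₃∈ = λ ne → ⊥-elim (ne m₃)
            ; r₁∈ = λ _ → 1st ; r₂∈ = λ _ → 2nd }
          in-F : ∀ {X : V → Set} → (∀ {v} → (Corner.InCorner A F) v → X v) → (∀ {v} → (Corner.InCorner (flip A) F) v → X v) → ∀ {v} → μ v ≡ lo → X v
          in-F {X} f g = F-lo {X} (λ k m → f (k , m)) (λ k m → g (k , m))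
            (λ q → clash q (Cut₄.κg F) lo≢mid) (λ q → clash q (Cut₄.κh F) lo≢mid) (λ q → clash m₃ q hi≢lo)
          go : (∃ λ p → (Corner.InCorner A F) p × (∀ {q} → (Corner.InCorner A F) q → q ≡ p)) ⊎ (∀ {p} → ¬ (Corner.InCorner A F) p) ⊎ Two (Corner.InCorner A F) → SomeStrip
          go (inj₂ (inj₂ two)) = rec-AC B two
          go (inj₂ (inj₁ no-AC)) =
              let in-B : ∀ {v} → μ v ≡ lo → (Corner.InCorner (flip A) F) v
                  in-B = in-F {(Corner.InCorner (flip A) F)} (⊥-elim ∘ no-AC) id
              in ⊥-elim (two-⊥ (λ a b → (Corner.Single.unique (flip A) F) B′ (in-B a) (in-B b)) (Cut₄.los F))
          go (inj₁ (p , cp , uniq)) with (Sep.other-lo F) p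
          ... | q , q≢p , mq =
              let q∈ : (Corner.InCorner (flip A) F) q
                  q∈ = in-F {λ v → v ≢ p → (Corner.InCorner (flip A) F) v} (λ c ne → ⊥-elim (ne (uniq c))) (λ d _ → d) mq q≢p
              in lo-pair F xx′ (proj₂ cp) mq (q≢p ∘ sym)
                   (in-F {λ v → v ≡ p ⊎ v ≡ q} (inj₁ ∘ uniq) (λ d → inj₂ ((Corner.Single.unique (flip A) F) B′ d q∈)))

      side : ∀ {s} → s ≢ mid → s ≡ lo ⊎ s ≡ hi
      side {lo} _ = inj₁ refl
      side {hi} _ = inj₂ refl
      side {mid} ne = ⊥-elim (ne refl)

      AdjTo-213 : ∀ {x a b c} → AdjTo x (a ∷ b ∷ c ∷ []) → AdjTo x (b ∷ a ∷ c ∷ [])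
      AdjTo-213 (y , m , e) = y , (case m of λ { 0th → 1st ; 1st → 0th ; 2nd → 2nd }) , e

      AdjTo-132 : ∀ {x a b c} → AdjTo x (a ∷ b ∷ c ∷ []) → AdjTo x (a ∷ c ∷ b ∷ [])
      AdjTo-132 (y , m , e) = y , (case m of λ { 0th → 0th ; 1st → 2nd ; 2nd → 1st }) , e

      Setting : ∀ {x t₁ t₂ t₃ x′ r₁ r₂} → Cut₄ G x t₁ t₂ t₃ → Cut₄ G x x′ r₁ r₂ → Set
      Setting {x} {t₁} {t₂} {t₃} {x′} A F = AdjTo x (t₁ ∷ t₂ ∷ t₃ ∷ []) × x ~ x′ × Cut₄.κ A x′ ≡ lo × Rec A

      -- Up to exchanging the sides of `F` and reordering the `tᵢ`, either all three lie on its `hi`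
      -- side or exactly one lies on its `lo` side.
      disjoint : ∀ {x t₁ t₂ t₃ x′ r₁ r₂} (A : Cut₄ G x t₁ t₂ t₃) (F : Cut₄ G x x′ r₁ r₂) → Setting A F →
        Cut₄.κ F t₁ ≢ mid → Cut₄.κ F t₂ ≢ mid → Cut₄.κ F t₃ ≢ mid → SomeStrip
      disjoint {t₁ = t₁} {t₂} {t₃} {r₁ = r₁} {r₂} A F (xT , xx′ , κx′ , rec) n₁ n₂ n₃ =
          let not-mid : ∀ {r} → Cut₄.κ F r ≡ mid → _ ≢ r → Cut₄.κ A r ≢ mid
              not-mid m ne k = case Cut₄.cov A k of λ { 0th → ne refl ; 1st → n₁ m ; 2nd → n₂ m ; 3rd → n₃ m }
              k₁ : Cut₄.κ A r₁ ≡ lo ⊎ Cut₄.κ A r₁ ≡ hi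
              k₁ = side (not-mid (Cut₄.κg F) (Sep.e≢g F))
              k₂ : Cut₄.κ A r₂ ≡ lo ⊎ Cut₄.κ A r₂ ≡ hi
              k₂ = side (not-mid (Cut₄.κh F) (Sep.e≢h F))
              hhh : ∀ {x t₁ t₂ t₃ x′ r₁ r₂} (A : Cut₄ G x t₁ t₂ t₃) (F : Cut₄ G x x′ r₁ r₂) → Setting A F →
                Cut₄.κ F t₁ ≡ hi → Cut₄.κ F t₂ ≡ hi → Cut₄.κ F t₃ ≡ hi →
                Cut₄.κ A r₁ ≡ lo ⊎ Cut₄.κ A r₁ ≡ hi → Cut₄.κ A r₂ ≡ lo ⊎ Cut₄.κ A r₂ ≡ hi → SomeStrip
              hhh = λ where
                A F (xT , xx′ , κx′ , rec) a b c → λ where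
                  (inj₂ p) (inj₂ q) → Crossed.AllHi.hh A F xx′ κx′ rec a b c p q
                  (inj₁ p) (inj₂ q) → Crossed.AllHi.lh A F xx′ κx′ rec a b c p q
                  (inj₁ p) (inj₁ q) → Crossed.AllHi.ll A F xx′ κx′ rec a b c p q
                  (inj₂ p) (inj₁ q) → Crossed.AllHi.lh A (swap-gh F) xx′ κx′ rec a b c q p
              lhh : ∀ {x t₁ t₂ t₃ x′ r₁ r₂} (A : Cut₄ G x t₁ t₂ t₃) (F : Cut₄ G x x′ r₁ r₂) → Setting A F →
                Cut₄.κ F t₁ ≡ lo → Cut₄.κ F t₂ ≡ hi → Cut₄.κ F t₃ ≡ hi →
                Cut₄.κ A r₁ ≡ lo ⊎ Cut₄.κ A r₁ ≡ hi → Cut₄.κ A r₂ ≡ lo ⊎ Cut₄.κ A r₂ ≡ hi → SomeStrip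
              lhh = λ where
                A F (xT , xx′ , κx′ , rec) a b c → λ where
                  (inj₂ p) (inj₂ q) → Crossed.OneLo.hh A F xx′ κx′ rec xT a b c p q
                  (inj₁ p) (inj₂ q) → Crossed.OneLo.lh A F xx′ κx′ rec xT a b c p q
                  (inj₁ p) (inj₁ q) → Crossed.OneLo.ll A F xx′ κx′ rec xT a b c p q
                  (inj₂ p) (inj₁ q) → Crossed.OneLo.lh A (swap-gh F) xx′ κx′ rec xT a b c q p
              Colour : V → Set
              Colour t = Cut₄.κ F t ≡ lo ⊎ Cut₄.κ F t ≡ hi
              go : Colour t₁ → Colour t₂ → Colour t₃ → SomeStrip
              go = λ where
                (inj₂ a) (inj₂ b) (inj₂ c) → hhh A F (xT , xx′ , κx′ , rec) a b c k₁ k₂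
                (inj₁ a) (inj₂ b) (inj₂ c) → lhh A F (xT , xx′ , κx′ , rec) a b c k₁ k₂
                (inj₂ a) (inj₁ b) (inj₂ c) → lhh (swap-fg A) F (AdjTo-213 xT , xx′ , κx′ , rec) b a c k₁ k₂
                (inj₂ a) (inj₂ b) (inj₁ c) → lhh (swap-fg (swap-gh A)) F (AdjTo-213 (AdjTo-132 xT) , xx′ , κx′ , rec) c a b k₁ k₂
                (inj₁ a) (inj₁ b) (inj₁ c) → hhh A (flip F) (xT , xx′ , κx′ , rec) (cong opp a) (cong opp b) (cong opp c) k₁ k₂
                (inj₂ a) (inj₁ b) (inj₁ c) → lhh A (flip F) (xT , xx′ , κx′ , rec) (cong opp a) (cong opp b) (cong opp c) k₁ k₂
                (inj₁ a) (inj₂ b) (inj₁ c) → lhh (swap-fg A) (flip F) (AdjTo-213 xT , xx′ , κx′ , rec) (cong opp b) (cong opp a) (cong opp c) k₁ k₂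
                (inj₁ a) (inj₁ b) (inj₂ c) → lhh (swap-fg (swap-gh A)) (flip F) (AdjTo-213 (AdjTo-132 xT) , xx′ , κx′ , rec) (cong opp c) (cong opp a) (cong opp b) k₁ k₂
          in go (side n₁) (side n₂) (side n₃)

      shared₂ : ∀ {x z z′ t₃ x′} (A : Cut₄ G x z z′ t₃) (F : Cut₄ G x x′ z z′) → Setting A F → SomeStrip
      shared₂ {t₃ = t₃} A F (xT , xx′ , κx′ , rec) with Cut₄.κ F t₃ in m₃
      ... | hi = Shared₂.h A F xx′ κx′ rec m₃
      ... | lo = Shared₂.h A (flip F) xx′ κx′ rec (cong opp m₃)
      ... | mid = ⊥-elim (case Cut₄.cov F m₃ of λ where
        0th → Sep.e≢h A refl
        1st → clash κx′ (Cut₄.κh A) lo≢mid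
        2nd → Sep.f≢h A refl
        3rd → Sep.g≢h A refl)

      meet : ∀ {x z t₂ t₃ x′ r₂} (A : Cut₄ G x z t₂ t₃) (F : Cut₄ G x x′ z r₂) → Setting A F →
        Cut₄.κ F t₂ ≡ mid → SomeStrip
      meet A F S m₂ with Cut₄.cov F m₂
      ... | 0th = ⊥-elim (Sep.e≢g A refl)
      ... | 1st = clash (proj₁ (proj₂ (proj₂ S))) (Cut₄.κg A) lo≢mid
      ... | 2nd = ⊥-elim (Sep.f≢g A refl)
      ... | 3rd = shared₂ A F S

      shared₁ : ∀ {x z t₂ t₃ x′ r₂} (A : Cut₄ G x z t₂ t₃) (F : Cut₄ G x x′ z r₂) → Setting A F → SomeStrip
      shared₁ {t₂ = t₂} {t₃} {r₂ = r₂} A F (xT , xx′ , κx′ , rec) with Cut₄.κ F t₂ ≟ˢ mid | Cut₄.κ F t₃ ≟ˢ mid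
      ... | yes m | _ = meet A F (xT , xx′ , κx′ , rec) m
      ... | _ | yes m = meet (swap-gh A) F (AdjTo-132 xT , xx′ , κx′ , rec) m
      ... | no n₂ | no n₃ =
          let k₂ : Cut₄.κ A r₂ ≢ mid
              k₂ k = case Cut₄.cov A k of λ
                { 0th → Sep.e≢h F refl ; 1st → Sep.g≢h F refl ; 2nd → n₂ (Cut₄.κh F) ; 3rd → n₃ (Cut₄.κh F) }
              Colour : V → Set
              Colour t = Cut₄.κ F t ≡ lo ⊎ Cut₄.κ F t ≡ hi
              go : Colour t₂ → Colour t₃ → Cut₄.κ A r₂ ≡ lo ⊎ Cut₄.κ A r₂ ≡ hi → SomeStrip
              go = λ where
                (inj₂ a) (inj₂ b) (inj₁ k) → Shared₁.Hi.l A F xx′ κx′ rec a b k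
                (inj₂ a) (inj₂ b) (inj₂ k) → Shared₁.Hi.h A F xx′ κx′ rec a b k
                (inj₁ a) (inj₁ b) (inj₁ k) → Shared₁.Hi.l A (flip F) xx′ κx′ rec (cong opp a) (cong opp b) k
                (inj₁ a) (inj₁ b) (inj₂ k) → Shared₁.Hi.h A (flip F) xx′ κx′ rec (cong opp a) (cong opp b) k
                (inj₁ a) (inj₂ b) (inj₁ k) → Shared₁.LoHi.l A F xx′ κx′ rec xT a b k
                (inj₁ a) (inj₂ b) (inj₂ k) → Shared₁.LoHi.h A F xx′ κx′ rec xT a b k
                (inj₂ a) (inj₁ b) (inj₁ k) → Shared₁.LoHi.l A (flip F) xx′ κx′ rec xT (cong opp a) (cong opp b) k
                (inj₂ a) (inj₁ b) (inj₂ k) → Shared₁.LoHi.h A (flip F) xx′ κx′ rec xT (cong opp a) (cong opp b) k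
          in go (side n₂) (side n₃) (side k₂)

      at-mid : ∀ {x t₁ t₂ t₃ x′ r₁ r₂} (A : Cut₄ G x t₁ t₂ t₃) (F : Cut₄ G x x′ r₁ r₂) → Setting A F →
        Cut₄.κ F t₁ ≡ mid → SomeStrip
      at-mid A F S m₁ with Cut₄.cov F m₁
      ... | 0th = ⊥-elim (Sep.e≢f A refl)
      ... | 1st = clash (proj₁ (proj₂ (proj₂ S))) (Cut₄.κf A) lo≢mid
      ... | 2nd = shared₁ A F S
      ... | 3rd = shared₁ A (swap-gh F) S

      crossed : ∀ {x t₁ t₂ t₃ x′ r₁ r₂} (A : Cut₄ G x t₁ t₂ t₃) (F : Cut₄ G x x′ r₁ r₂) → Setting A F → SomeStrip
      crossed {t₁ = t₁} {t₂} {t₃} A F S@(xT , rest) with Cut₄.κ F t₁ ≟ˢ mid | Cut₄.κ F t₂ ≟ˢ mid | Cut₄.κ F t₃ ≟ˢ mid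
      ... | yes m | _ | _ = at-mid A F S m
      ... | no _ | yes m | _ = at-mid (swap-fg A) F (AdjTo-213 xT , rest) m
      ... | no _ | no _ | yes m = at-mid (swap-fg (swap-gh A)) F (AdjTo-213 (AdjTo-132 xT) , rest) m
      ... | no a | no b | no c = disjoint A F S a b c

      -- Induction on the size of a side of a 4-cut that contains an edge.
      descend : ∀ k {x y s t} (A : Cut₄ G x y s t) → x ~ y → lo-size A < k → SomeStrip
      -- The vertex `x` has a neighbour `x′` on the `lo` side. The edge `x x′` also lies in a 4-cut,
      -- which crosses `A` at `x`.
      descend (suc k) {y = y} A xy (s≤s size) with Sep.midlo A (Cut₄.κe A)
      ... | x′ , xx′ , κx′ with fs xx′
      ... | _ , _ , F = crossed A F ((y , 0th , xy) , xx′ , κx′ ,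
        λ B e sm → descend k B e (ℕ.≤-trans (smaller-size B A sm) size))

      some-strip : V → SomeStrip
      some-strip v with nbr good v v v
      ... | w , vw , _ with fs vw
      ... | _ , _ , A = descend (suc (lo-size A)) A vw ℕ.≤-refl

      next : SomeStrip → SomeStrip
      next (strip S) = strip (proj₂ (proj₂ (extend S)))

      walk : SomeStrip → ℕ → SomeStrip
      walk S zero = S
      walk S (suc i) = next (walk S i)

      rails : (S : SomeStrip) → Rails (λ i → SomeStrip.p₁ (walk S i)) (λ i → SomeStrip.q₁ (walk S i)) (SomeStrip.p₀ S) (SomeStrip.q₀ S)
      rails S = record
        { NX₀ = Strip.Np₁ (SomeStrip.isStrip S) ; NY₀ = Strip.Nq₁ (SomeStrip.isStrip S)
        ; NXₛ = λ i → Strip.Np₂ (SomeStrip.isStrip (walk S i)) ; NYₛ = λ i → Strip.Nq₂ (SomeStrip.isStrip (walk S i)) }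

      -- One strip, extended again and again, gives infinite rails; these close up and contain every
      -- vertex.
      ladder : V → In𝒜 G × (∀ v → ∃ λ a → ∃ λ b → ∃ λ c → Nb G v (a ∷ b ∷ c ∷ []))
      ladder v with some-strip v
      ... | S with Return.period (rails S)
      ... | k , D , C = in𝒜 (rails S) D C , Whole.cubic (rails S) D C

    -- Contraction of an edge that lies in no 4-cut.

    module Contracting (x w : V) (xw : x ~ w) (C : Contraction G x w) where
      open Contraction C

      W : Set
      W = Fin (n H)

      f : V → W
      f = proj₁ contract
      f-onto : ∀ a → ∃ λ u → f u ≡ a
      f-onto = proj₁ (proj₂ contract)
      fx≡fw : f x ≡ f w
      fx≡fw = proj₁ (proj₂ (proj₂ contract))
      fibre : ∀ {u v} → f u ≡ f v → u ≡ v ⊎ ((u ≡ x ⊎ u ≡ w) × (v ≡ x ⊎ v ≡ w))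
      fibre = proj₁ (proj₂ (proj₂ (proj₂ contract))) _ _
      H-sound : ∀ {a b} → Adj H a b → a ≢ b × (Σ V λ u → Σ V λ v → f u ≡ a × f v ≡ b × u ~ v)
      H-sound = proj₁ (proj₂ (proj₂ (proj₂ (proj₂ contract)))) _ _
      H-edge : ∀ {u v} → f u ≢ f v → u ~ v → Adj H (f u) (f v)
      H-edge {u} {v} ne e = proj₂ (proj₂ (proj₂ (proj₂ (proj₂ contract)))) _ _ ne (u , v , refl , refl , e)

      f-xw : ∀ {u} → u ≡ x ⊎ u ≡ w → f u ≡ f x
      f-xw (inj₁ refl) = refl
      f-xw (inj₂ refl) = sym fx≡fw

      at-x : ∀ {u} → f u ≡ f x → u ≡ x ⊎ u ≡ w
      at-x e with fibre e
      ... | inj₁ p = inj₁ p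
      ... | inj₂ (p , _) = p

      pre : W → V
      pre a = proj₁ (f-onto a)

      f-pre : ∀ a → f (pre a) ≡ a
      f-pre a = proj₂ (f-onto a)

      unique : ∀ {u a} → u ≢ x → u ≢ w → f u ≡ a → u ≡ pre a
      unique {u} {a} u≢x u≢w e with fibre (trans e (sym (f-pre a)))
      ... | inj₁ p = p
      ... | inj₂ (inj₁ p , _) = ⊥-elim (u≢x p)
      ... | inj₂ (inj₂ p , _) = ⊥-elim (u≢w p)

      away : ∀ {u} → u ≢ x → u ≢ w → f u ≢ f x
      away u≢x u≢w e = [ u≢x , u≢w ]′ (at-x e)

      away⁻ : ∀ {u} → f u ≢ f x → u ≢ x × u ≢ w
      away⁻ ne = (λ { refl → ne refl }) , (λ { refl → ne (sym fx≡fw) })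

      -- The conditions that keep degrees at least three: `merged` for the new vertex, and `common`
      -- for a common neighbour of `x` and `w`, which loses one neighbour.
      module _ (no-sep : ¬ FourSep G x w)
        (merged : ∀ b c → ∃ λ v → v ≢ x × v ≢ w × (x ~ v ⊎ w ~ v) × v ∉ b ∷ c ∷ [])
        (common : ∀ {u} → u ~ x → u ~ w → ∀ c → ∃ λ v → u ~ v × v ∉ x ∷ w ∷ c ∷ []) where

        beside : ∀ {u} → f u ≢ f x → ∀ c → ∃ λ v → u ~ v × v ∉ x ∷ w ∷ c ∷ []
        beside {u} ne c with u ~? x | u ~? w
        ... | yes p | yes q = common p q c
        ... | _ | no ¬q with nbr good u x c
        ... | v , e , new = v , e , λ { 0th → new 0th ; 1st → ¬q e ; 2nd → new 1st }
        beside {u} ne c | no ¬p | yes _ with nbr good u w c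
        ... | v , e , new = v , e , λ { 0th → ¬p e ; 1st → new 0th ; 2nd → new 1st }

        nbr-H : ∀ a b c → ∃ λ d → Adj H a d × d ∉ b ∷ c ∷ []
        nbr-H a b c with a ≟ f x
        ... | yes refl with merged (pre b) (pre c)
        ... | v , v≢x , v≢w , inj₁ e , new = f v , H-edge (away v≢x v≢w ∘ sym) e ,
          λ { (here p) → new (here (unique v≢x v≢w p)) ; (there (here p)) → new (there (here (unique v≢x v≢w p))) }
        ... | v , v≢x , v≢w , inj₂ e , new = f v , subst (λ t → Adj H t (f v)) (sym fx≡fw) (H-edge (λ p → away v≢x v≢w (trans (sym p) (sym fx≡fw))) e) ,
          λ { (here p) → new (here (unique v≢x v≢w p)) ; (there (here p)) → new (there (here (unique v≢x v≢w p))) }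
        nbr-H a b c | no a≢ = go (b ≟ f x) (c ≟ f x)
          where
          u : V
          u = pre a
          fu≢ : f u ≢ f x
          fu≢ e = a≢ (trans (sym (f-pre a)) e)
          lift-edge : ∀ {v} → u ~ v → Adj H a (f v)
          lift-edge {v} e = subst (λ t → Adj H t (f v)) (f-pre a) (H-edge ne e)
            where
            ne : f u ≢ f v
            ne p with fibre p
            ... | inj₁ q = ~≢ e q
            ... | inj₂ (q , _) = fu≢ (f-xw q)
          hit-other : ∀ {v d} → d ≢ f x → f v ≡ d → v ≡ pre d
          hit-other {v} d≢ p = let (p₁ , p₂) = away⁻ {v} (λ q → d≢ (trans (sym p) q)) in unique p₁ p₂ p
          go : Dec (b ≡ f x) → Dec (c ≡ f x) → ∃ λ d → Adj H a d × d ∉ b ∷ c ∷ []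
          go (no p) (no q) with nbr good u (pre b) (pre c)
          ... | v , e , new = f v , lift-edge e , λ
            { (here r) → new (here (hit-other p r)) ; (there (here r)) → new (there (here (hit-other q r))) }
          go (yes p) (no q) with beside fu≢ (pre c)
          ... | v , e , new = f v , lift-edge e , λ
            { (here r) → [ (λ s → new (here s)) , (λ s → new (there (here s))) ]′ (at-x (trans r p))
            ; (there (here r)) → new (there (there (here (hit-other q r)))) }
          go (no p) (yes q) with beside fu≢ (pre b)
          ... | v , e , new = f v , lift-edge e , λ
            { (here r) → new (there (there (here (hit-other p r))))
            ; (there (here r)) → [ (λ s → new (here s)) , (λ s → new (there (here s))) ]′ (at-x (trans r q)) }
          go (yes p) (yes q) with beside fu≢ x
          ... | v , e , new = f v , lift-edge e , λ
            { (here r) → [ (λ s → new (here s)) , (λ s → new (there (here s))) ]′ (at-x (trans r p))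
            ; (there (here r)) → [ (λ s → new (here s)) , (λ s → new (there (here s))) ]′ (at-x (trans r q)) }

        module NoSep {P : W → Set} (P? : Decidable P) where
          Ok : List W → Set
          Ok L = ∀ {a b} → P a → Adj H a b → P b ⊎ b ∈ L

          closed : ∀ {L} → Ok L → ∀ {u v} → P (f u) → u ~ v → P (f v) ⊎ f v ∈ L
          closed cl {u} {v} p e with f u ≟ f v
          ... | yes q = inj₁ (subst P q p)
          ... | no ne = cl p (H-edge ne e)

          lift-two : ∀ {R : W → Set} → Two R → Two (λ v → R (f v))
          lift-two {R} (p , q , p≢q , rp , rq) = pre p , pre q , (λ e → p≢q (trans (sym (f-pre p)) (trans (cong f e) (f-pre q)))) ,
            subst R (sym (f-pre p)) rp , subst R (sym (f-pre q)) rq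

          avoiding : ∀ a b c → Ok (a ∷ b ∷ c ∷ []) → f x ∉ a ∷ b ∷ c ∷ [] →
            Two (λ v → P v × v ∉ a ∷ b ∷ c ∷ []) → Two (λ v → ¬ P v × v ∉ a ∷ b ∷ c ∷ []) → ⊥
          avoiding a b c cl new ps qs = noSep good (P? ∘ f) (pre a) (pre b) (pre c)
            (λ p e → Data.Sum.map₂ down (closed cl p e))
            (Two-map (λ (p , m) → p , m ∘ up) (lift-two ps)) (Two-map (λ (p , m) → p , m ∘ up) (lift-two qs))
            where
            down : ∀ {v} → f v ∈ a ∷ b ∷ c ∷ [] → v ∈ pre a ∷ pre b ∷ pre c ∷ []
            down {v} m with away⁻ {v} (λ e → new (subst (_∈ a ∷ b ∷ c ∷ []) e m))
            down (here e) | p , q = here (unique p q e)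
            down (there (here e)) | p , q = there (here (unique p q e))
            down (there (there (here e))) | p , q = there (there (here (unique p q e)))
            up : ∀ {v} → v ∈ pre a ∷ pre b ∷ pre c ∷ [] → f v ∈ a ∷ b ∷ c ∷ []
            up 0th = here (f-pre a)
            up 1st = there (here (f-pre b))
            up 2nd = there (there (here (f-pre c)))

          -- A separator through the merged vertex pulls back to `x`, `w` and two more vertices, a
          -- 4-cut through the contracted edge. Separators that miss the merged vertex pull back to
          -- three vertices (`avoiding`).
          through : ∀ b c → Ok (f x ∷ b ∷ c ∷ []) →
            Two (λ v → P v × v ∉ f x ∷ b ∷ c ∷ []) → Two (λ v → ¬ P v × v ∉ f x ∷ b ∷ c ∷ []) → ⊥
          through b c cl ps qs = no-sep (pre b , pre c , record
            { κ = colour ; κe = colour-mid (here refl) ; κf = colour-mid (here (sym fx≡fw))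
            ; κg = colour-mid (there (here (f-pre b))) ; κh = colour-mid (there (there (here (f-pre c))))
            ; cov = λ k → down (colour-mid⁻ k)
            ; cut = λ p q e → case closed cl (proj₁ (colour-lo⁻ p)) e of λ where
                (inj₁ r) → proj₁ (colour-hi⁻ q) r
                (inj₂ m) → proj₂ (colour-hi⁻ q) m
            ; los = Two-map (λ (p , m) → colour-lo p m) (lift-two ps)
            ; his = Two-map (λ (p , m) → colour-hi p m) (lift-two qs) })
            where
            open Colouring (P ∘ f) (λ v → f v ∈ f x ∷ b ∷ c ∷ []) (P? ∘ f) (λ v → On._∈?_ H (f v) (f x ∷ b ∷ c ∷ []))
            down : ∀ {v} → f v ∈ f x ∷ b ∷ c ∷ [] → v ∈ x ∷ w ∷ pre b ∷ pre c ∷ []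
            down {v} m with v ≟ x | v ≟ w
            ... | yes p | _ = here p
            ... | no _ | yes p = there (here p)
            down (here e) | no p | no q = ⊥-elim (away p q e)
            down (there (here e)) | no p | no q = there (there (here (unique p q e)))
            down (there (there (here e))) | no p | no q = there (there (there (here (unique p q e))))

          noSep-H : ∀ a b c → Ok (a ∷ b ∷ c ∷ []) →
            Two (λ v → P v × v ∉ a ∷ b ∷ c ∷ []) → Two (λ v → ¬ P v × v ∉ a ∷ b ∷ c ∷ []) → ⊥
          noSep-H a b c cl ps qs with f x ≟ a | f x ≟ b | f x ≟ c
          ... | yes refl | _ | _ = through b c cl ps qs
          ... | no _ | yes refl | _ =
              let σ : ∀ {v} → v ∈ a ∷ f x ∷ c ∷ [] → v ∈ f x ∷ a ∷ c ∷ []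
                  σ = λ { 0th → 1st ; 1st → 0th ; 2nd → 2nd }
                  σ′ : ∀ {v} → v ∈ f x ∷ a ∷ c ∷ [] → v ∈ a ∷ f x ∷ c ∷ []
                  σ′ = λ { 0th → 1st ; 1st → 0th ; 2nd → 2nd }
              in through a c (λ p e → Data.Sum.map₂ σ (cl p e)) (Two-map (λ (p , m) → p , m ∘ σ′) ps) (Two-map (λ (p , m) → p , m ∘ σ′) qs)
          ... | no _ | no _ | yes refl =
              let σ : ∀ {v} → v ∈ a ∷ b ∷ f x ∷ [] → v ∈ f x ∷ a ∷ b ∷ []
                  σ = λ { 0th → 1st ; 1st → 2nd ; 2nd → 0th }
                  σ′ : ∀ {v} → v ∈ f x ∷ a ∷ b ∷ [] → v ∈ a ∷ b ∷ f x ∷ []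
                  σ′ = λ { 0th → 2nd ; 1st → 0th ; 2nd → 1st }
              in through a b (λ p e → Data.Sum.map₂ σ (cl p e)) (Two-map (λ (p , m) → p , m ∘ σ′) ps) (Two-map (λ (p , m) → p , m ∘ σ′) qs)
          ... | no p | no q | no r = avoiding a b c cl (λ { (here e) → p e ; (there (here e)) → q e ; (there (there (here e))) → r e }) ps qs

        good-H : Good H
        good-H = record
          { big = ℕ.≤-pred (ℕ.≤-trans 8≤n (ℕ.≤-reflexive (sym size))) ; nbr = nbr-H
          ; noSep = λ P? a b c cl ps qs → NoSep.noSep-H P? a b c cl ps qs }

      minor : H ≼ G
      minor = (just ∘ f) , (λ a → pre a , cong just (f-pre a)) , walks , λ a b e → case proj₂ (H-sound e) of λ
        { (u , v , p , q , r) → u , v , cong just p , cong just q , r }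
        where
        walks : ∀ a u v → just (f u) ≡ just a → just (f v) ≡ just a → Walk G (λ g → does (f g ≟ a)) u v
        walks a u v refl e with fibre {u} {v} (sym (just-injective e))
          where
          just-injective : ∀ {a b : W} → just a ≡ just b → a ≡ b
          just-injective refl = refl
        ... | inj₁ refl = Walk.here (dec-true (f u ≟ f u) refl)
        ... | inj₂ (inj₁ refl , inj₁ refl) = Walk.here (dec-true (f u ≟ f u) refl)
        ... | inj₂ (inj₂ refl , inj₂ refl) = Walk.here (dec-true (f u ≟ f u) refl)
        ... | inj₂ (inj₁ refl , inj₂ refl) = Walk.step (dec-true (f u ≟ f u) refl) xw (Walk.here (dec-true (f v ≟ f u) (sym fx≡fw)))
        ... | inj₂ (inj₂ refl , inj₁ refl) = Walk.step (dec-true (f u ≟ f u) refl) (~sym xw) (Walk.here (dec-true (f v ≟ f u) fx≡fw))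

      four-in-three : ∀ {p q r s a b c : V} → q ≢ p → r ≢ p → s ≢ p → r ≢ q → s ≢ q → s ≢ r →
        p ∈ a ∷ b ∷ c ∷ [] → q ∈ a ∷ b ∷ c ∷ [] → r ∈ a ∷ b ∷ c ∷ [] → s ∈ a ∷ b ∷ c ∷ [] → ⊥
      four-in-three qp rp sp rq sq sr p∈ q∈ r∈ s∈ with drop₃ p∈
      ... | _ , _ , k , _ with drop₂ (k q∈ qp)
      ... | _ , k′ with k′ (k r∈ rp) rq | k′ (k s∈ sp) sq
      ... | 0th | 0th = sr refl

      rich-H : ∀ {p q r s} → (∀ {v} → v ∈ p ∷ q ∷ r ∷ s ∷ [] → v ≢ x × v ≢ w × (x ~ v ⊎ w ~ v)) →
        q ≢ p → r ≢ p → s ≢ p → r ≢ q → s ≢ q → s ≢ r → Rich H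
      rich-H near qp rp sp rq sq sr = f x , λ a b c N → four-in-three qp rp sp rq sq sr
        (into N (near 0th)) (into N (near 1st)) (into N (near 2nd)) (into N (near 3rd))
        where
        into : ∀ {a b c} → Nb H (f x) (a ∷ b ∷ c ∷ []) → ∀ {v} → v ≢ x × v ≢ w × (x ~ v ⊎ w ~ v) → v ∈ pre a ∷ pre b ∷ pre c ∷ []
        into N {v} (v≢x , v≢w , e) with N (edge e)
          where
          edge : x ~ v ⊎ w ~ v → Adj H (f x) (f v)
          edge (inj₁ e) = H-edge (away v≢x v≢w ∘ sym) e
          edge (inj₂ e) = subst (λ t → Adj H t (f v)) (sym fx≡fw) (H-edge (λ p → away v≢x v≢w (trans (sym p) (sym fx≡fw))) e)
        ... | here p = here (unique v≢x v≢w p)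
        ... | there (here p) = there (here (unique v≢x v≢w p))
        ... | there (there (here p)) = there (there (here (unique v≢x v≢w p)))

    -- Separations that appear when an edge of a triangle is deleted.

    record Cut₃ (x y a b c : V) : Set where
      field
        κ   : V → Side
        κx  : κ x ≡ lo
        κy  : κ y ≡ hi
        κa  : κ a ≡ mid
        κb  : κ b ≡ mid
        κc  : κ c ≡ mid
        cov : ∀ {v} → κ v ≡ mid → v ∈ a ∷ b ∷ c ∷ []
        cut : ∀ {u v} → κ u ≡ lo → κ v ≡ hi → u ~ v → u ≡ x × v ≡ y
        los : ∃ λ v → v ≢ x × κ v ≡ lo
        his : ∃ λ v → v ≢ y × κ v ≡ hi

    flip₃ : ∀ {x y a b c} → Cut₃ x y a b c → Cut₃ y x a b c
    flip₃ D =
        let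
            open Cut₃ D
        in record
             { κ = opp ∘ κ ; κx = cong opp κy ; κy = cong opp κx ; κa = cong opp κa ; κb = cong opp κb ; κc = cong opp κc
             ; cov = cov ∘ opp-move
             ; cut = λ p q e → swap (cut (opp-move q) (opp-move p) (~sym e))
             ; los = let v , ne , k = his in v , ne , cong opp k
             ; his = let v , ne , k = los in v , ne , cong opp k }

    swap-bc : ∀ {x y a b c} → Cut₃ x y a b c → Cut₃ x y a c b
    swap-bc D =
        let
            open Cut₃ D
        in record
             { κ = κ ; κx = κx ; κy = κy ; κa = κa ; κb = κc ; κc = κb
             ; cov = λ p → case cov p of λ { 0th → 0th ; 1st → 2nd ; 2nd → 1st }
             ; cut = cut ; los = los ; his = his }

    module InCut₃ {x y a b c : V} (D : Cut₃ x y a b c) where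
      open Cut₃ D
      x≢y : x ≢ y
      x≢y = ≢-by κ κx κy lo≢hi

      two-lo : Two (λ v → κ v ≡ lo)
      two-lo = let v , ne , k = los in v , x , ne , k , κx
      two-hi : Two (λ v → κ v ≡ hi)
      two-hi = let v , ne , k = his in v , y , ne , k , κy

      -- If vertices of lo other than x see only two vertices of the separator, there is just one of them.
      lo-unique : ∀ m₁ m₂ → κ m₁ ≡ mid → κ m₂ ≡ mid →
        (∀ {u v} → κ u ≡ lo → u ≢ x → u ~ v → κ v ≡ mid → v ∈ m₁ ∷ m₂ ∷ []) →
        ∀ {u v} → κ u ≡ lo → u ≢ x → κ v ≡ lo → v ≢ x → u ≡ v
      lo-unique m₁ m₂ k₁ k₂ see {u} {v} ku u≢ kv v≢ = Region.Three.unique (λ v → (κ v ≟ˢ lo) ×-dec ¬? (v ≟ x)) x m₁ m₂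
        closed (λ (k , ne) → λ { 0th → ne refl ; 1st → clash k k₁ lo≢mid ; 2nd → clash k k₂ lo≢mid })
        (Two-map (λ k → (λ (k′ , _) → clash k k′ hi≢lo) ,
          λ { 0th → clash k κx hi≢lo ; 1st → clash k k₁ hi≢mid ; 2nd → clash k k₂ hi≢mid }) two-hi)
        (ku , u≢) (kv , v≢)
        where
        closed : ∀ {u v} → κ u ≡ lo × u ≢ x → u ~ v → (κ v ≡ lo × v ≢ x) ⊎ v ∈ x ∷ m₁ ∷ m₂ ∷ []
        closed {v = v} (k , ne) e with κ v in kv
        ... | hi = ⊥-elim (ne (proj₁ (cut k kv e)))
        ... | mid = inj₂ (there (see k ne e kv))
        ... | lo with v ≟ x
        ... | yes p = inj₂ (here p)
        ... | no p = inj₁ (refl , p)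

      -- Three separator vertices and at most two vertices on each side make at most seven.
      cramped : (∀ {u v} → κ u ≡ lo → u ≢ x → κ v ≡ lo → v ≢ x → u ≡ v) →
        (∀ {u v} → κ u ≡ hi → u ≢ y → κ v ≡ hi → v ≢ y → u ≡ v) → ⊥
      cramped lu hu with los | his
      ... | x′ , x′≢ , kx′ | y′ , y′≢ , ky′ with fresh (x ∷ x′ ∷ y ∷ y′ ∷ a ∷ b ∷ c ∷ []) 8≤n
      ... | v , v∉ with κ v in kv
      ... | mid = v∉ (there (there (there (there (cov kv)))))
      ... | lo = v∉ (there (here (lu kv (λ { refl → v∉ 0th }) kx′ x′≢)))
      ... | hi = v∉ (there (there (there (here (hu kv (λ { refl → v∉ 2nd }) ky′ y′≢)))))

    -- With only two vertices in the separator both sides would have two vertices.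
    thin₃ : ∀ {x y a b c} (D : Cut₃ x y a b c) m₁ m₂ → Cut₃.κ D m₁ ≡ mid → Cut₃.κ D m₂ ≡ mid →
      (∀ {v} → Cut₃.κ D v ≡ mid → v ∈ m₁ ∷ m₂ ∷ []) → ⊥
    thin₃ D m₁ m₂ k₁ k₂ cv = InCut₃.cramped D (InCut₃.lo-unique D m₁ m₂ k₁ k₂ λ _ _ _ → cv)
      (λ p p′ q q′ → InCut₃.lo-unique (flip₃ D) m₁ m₂ (cong opp k₁) (cong opp k₂) (λ _ _ _ k → cv (opp-move k)) (cong opp p) p′ (cong opp q) q′)

    a≢b : ∀ {x y a b c} → Cut₃ x y a b c → a ≢ b
    a≢b {a = a} {c = c} D refl =
        let
            open Cut₃ D
        in thin₃ D a c κa κc (λ k → case cov k of λ { 0th → 0th ; 1st → 0th ; 2nd → 1st })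
    b≢c : ∀ {x y a b c} → Cut₃ x y a b c → b ≢ c
    b≢c {a = a} {b} D refl =
        let
            open Cut₃ D
        in thin₃ D a b κa κb (λ k → case cov k of λ { 0th → 0th ; 1st → 1st ; 2nd → 1st })

    -- A common neighbour of x and y lies in the separator.
    towards : ∀ {x y} (D : DelSep G x y) → ∀ {z} → x ~ z → y ~ z → DelSep.κ D z ≡ mid
    towards {x} {y} D {z} xz yz with DelSep.κ D z in kz
    ... | mid = refl
    ... | lo = ⊥-elim (~≢ xz (sym (proj₁ (DelSep.cut D kz (DelSep.κy D) (~sym yz)))))
    ... | hi = ⊥-elim (~≢ yz (sym (proj₂ (DelSep.cut D (DelSep.κx D) kz xz))))

    -- Reorders the separator so that a chosen vertex, in practice a common neighbour of `x` and
    -- `y`, comes first.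
    through : ∀ {x y} (D : DelSep G x y) → ∀ {z} → DelSep.κ D z ≡ mid → ∃₂ λ s t → Cut₃ x y z s t
    through {x} {y} D {z} kz with drop₃ (DelSep.cov D kz)
    ... | s , t , keep , sub =
        let
            open DelSep D
            mids : ∀ {v} → v ∈ a ∷ b ∷ c ∷ [] → κ v ≡ mid
            mids = λ where
              0th → κa
              1st → κb
              2nd → κc
        in s , t , record
             { κ = κ ; κx = κx ; κy = κy ; κa = kz ; κb = mids (sub 0th) ; κc = mids (sub 1st)
             ; cov = λ {v} k → case v ≟ z of λ where
                 (yes p) → here p
                 (no ne) → there (keep (cov k) ne)
             ; cut = cut ; los = los ; his = his }

    -- The separations obtained from two edges xy and xz of a triangle, of whose vertices none is cubic.
    module Cross (nct : ∀ {p a b c u v} → Nb G p (a ∷ b ∷ c ∷ []) → p ~ u → p ~ v → ¬ u ~ v)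
      {x y z : V} (xy : x ~ y) (xz : x ~ z) (yz : y ~ z) where

      deg₄ : ∀ {v u w} → v ~ u → v ~ w → u ~ w → Deg₄ G v
      deg₄ vu vw uw a b c N = nct N vu vw uw

      x₄ : Deg₄ G x
      x₄ = deg₄ xy xz yz
      y₄ : Deg₄ G y
      y₄ = deg₄ (~sym xy) yz xz

      -- `D` arises from deleting `xy` and has `z` in its separator, `D′` from deleting `xz` and has
      -- `y`. The exceptional crossing edges start at `x`, which is therefore left out of the four
      -- regions `In i j`.
      module Two-cuts {s t s′ t′ : V} (D : Cut₃ x y z s t) (D′ : Cut₃ x z y s′ t′) where
        module D = Cut₃ D
        module D′ = Cut₃ D′
        open D using (κ) public
        open D′ using () renaming (κ to μ) public

        κx : κ x ≡ lo
        κx = D.κx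
        κy : κ y ≡ hi
        κy = D.κy
        κz : κ z ≡ mid
        κz = D.κa
        μx : μ x ≡ lo
        μx = D′.κx
        μy : μ y ≡ mid
        μy = D′.κa
        μz : μ z ≡ hi
        μz = D′.κy

        Goal : Set
        Goal = ∀ {u v} → κ u ≡ lo → u ≢ x → κ v ≡ lo → v ≢ x → u ≡ v

        In : Side → Side → V → Set
        In i j v = κ v ≡ i × μ v ≡ j × v ≢ x

        In? : ∀ i j → Decidable (In i j)
        In? i j v = (κ v ≟ˢ i) ×-dec ((μ v ≟ˢ j) ×-dec ¬? (v ≟ x))

        Proper : Side → Set
        Proper i = i ≡ lo ⊎ i ≡ hi

        pl : Proper lo
        pl = inj₁ refl
        ph : Proper hi
        ph = inj₂ refl

        Edge : Side → Side → V → Set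
        Edge i j l = κ l ≢ opp i × ¬ In i j l

        record Boundary (i j : Side) (L : List V) : Set where
          field
            bd  : All (Edge i j) L
            x∈  : κ x ≡ i → μ x ≡ j → x ∈ L
            z∈  : μ z ≢ opp j → z ∈ L
            s∈  : μ s ≢ opp j → s ∈ L
            t∈  : μ t ≢ opp j → t ∈ L
            y∈  : κ y ≡ i → y ∈ L
            s′∈ : κ s′ ≡ i → s′ ∈ L
            t′∈ : κ t′ ≡ i → t′ ∈ L

        remaining : ∀ {i s} → Proper i → s ≢ opp i → s ≢ mid → s ≡ i
        remaining {s = lo} (inj₁ refl) _ _ = refl
        remaining {s = hi} (inj₁ refl) ne _ = ⊥-elim (ne refl)
        remaining {s = lo} (inj₂ refl) ne _ = ⊥-elim (ne refl)
        remaining {s = hi} (inj₂ refl) _ _ = refl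
        remaining {s = mid} _ _ ne = ⊥-elim (ne refl)

        proper≢mid : ∀ {i} → Proper i → i ≢ mid
        proper≢mid (inj₁ refl) ()
        proper≢mid (inj₂ refl) ()

        opp≢ : ∀ {i} → Proper i → opp i ≢ i
        opp≢ (inj₁ refl) ()
        opp≢ (inj₂ refl) ()

        place : ∀ {i j L} → Proper i → Proper j → Boundary i j L → ∀ {v} → κ v ≢ opp i → μ v ≢ opp j → In i j v ⊎ v ∈ L
        place {i} {j} {L} pi pj B {v} nk nm =
            let
                open Boundary B
                go : Dec (κ v ≡ mid) → Dec (μ v ≡ mid) → Dec (v ≡ x) → In i j v ⊎ v ∈ L
                go = λ where
                  (yes k) _ _ → inj₂ (case D.cov k of λ { 0th → z∈ nm ; 1st → s∈ nm ; 2nd → t∈ nm })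
                  (no k) (yes m) _ → inj₂ (case D′.cov m of λ
                    { 0th → y∈ (remaining pi nk k) ; 1st → s′∈ (remaining pi nk k) ; 2nd → t′∈ (remaining pi nk k) })
                  (no k) (no m) (yes refl) → inj₂ (x∈ (remaining pi nk k) (remaining pj nm m))
                  (no k) (no m) (no v≢x) → inj₁ (remaining pi nk k , remaining pj nm m , v≢x)
            in go (κ v ≟ˢ mid) (μ v ≟ˢ mid) (v ≟ x)

        κ-near : ∀ {i u v} → Proper i → κ u ≡ i → u ≢ x → u ≢ y → u ~ v → κ v ≢ opp i
        κ-near (inj₁ refl) ku u≢ _ e kv = u≢ (proj₁ (D.cut ku kv e))
        κ-near (inj₂ refl) ku _ u≢ e kv = u≢ (proj₂ (D.cut kv ku (~sym e)))

        μ-near : ∀ {j u v} → Proper j → μ u ≡ j → u ≢ x → u ≢ z → u ~ v → μ v ≢ opp j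
        μ-near (inj₁ refl) ku u≢ _ e kv = u≢ (proj₁ (D′.cut ku kv e))
        μ-near (inj₂ refl) ku _ u≢ e kv = u≢ (proj₂ (D′.cut kv ku (~sym e)))

        facing : ∀ {i} → Proper i → Two (λ v → κ v ≡ opp i)
        facing (inj₁ refl) = InCut₃.two-hi D
        facing (inj₂ refl) = InCut₃.two-lo D

        module Use {i j : Side} (pi : Proper i) (pj : Proper j) {L : List V} (B : Boundary i j L) where
          open Boundary B
          closed : ∀ {u v} → In i j u → u ~ v → In i j v ⊎ v ∈ L
          closed (k , m , u≢) e = place pi pj B
            (κ-near pi k u≢ (λ { refl → clash m μy (proper≢mid pj) }) e)
            (μ-near pj m u≢ (λ { refl → clash k κz (proper≢mid pi) }) e)
          dis : ∀ {v} → In i j v → v ∉ L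
          dis p m = proj₂ (All.lookup bd m) p
          out : Two (λ v → ¬ In i j v × v ∉ L)
          out = Two-map (λ k → (λ (k′ , _) → clash k k′ (opp≢ pi)) , λ m → proj₁ (All.lookup bd m) k) (facing pi)

        none : ∀ {i j a b} → Proper i → Proper j → Boundary i j (a ∷ b ∷ []) → ∀ {p} → ¬ In i j p
        none {i} {j} {a} {b} pi pj B =
            let
                open Use pi pj B
            in Region.noP₂ (In? i j) a b closed dis out

        module Single {i j a b c} (pi : Proper i) (pj : Proper j) (B : Boundary i j (a ∷ b ∷ c ∷ [])) where
          open Use pi pj B
          open Region.Three (In? i j) a b c closed dis out public

        b-mid : ∀ {i j v} → Proper i → κ v ≡ mid → Edge i j v
        b-mid (inj₁ refl) k = (λ q → clash q k hi≢mid) , λ (q , _) → clash q k lo≢mid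
        b-mid (inj₂ refl) k = (λ q → clash q k lo≢mid) , λ (q , _) → clash q k hi≢mid

        b-side : ∀ {i j v} → Proper i → Proper j → κ v ≡ i → μ v ≡ mid → Edge i j v
        b-side pi pj k m = (λ q → clash q k (opp≢ pi)) , λ (_ , q , _) → clash q m (proper≢mid pj)

        ll : ∀ {L} → All (Edge lo lo) L → (μ s ≢ hi → s ∈ x ∷ L) → (μ t ≢ hi → t ∈ x ∷ L) →
          (κ s′ ≡ lo → s′ ∈ x ∷ L) → (κ t′ ≡ lo → t′ ∈ x ∷ L) → Boundary lo lo (x ∷ L)
        ll bd a b c d = record
          { bd = ((λ q → clash q κx hi≢lo) , λ (_ , _ , ne) → ne refl) ∷ bd ; x∈ = λ _ _ → 0th
          ; z∈ = λ ne → ⊥-elim (ne μz) ; s∈ = a ; t∈ = b ; y∈ = λ q → clash κy q hi≢lo ; s′∈ = c ; t′∈ = d }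

        lh : ∀ {L} → All (Edge lo hi) L → (μ s ≢ lo → s ∈ z ∷ L) → (μ t ≢ lo → t ∈ z ∷ L) →
          (κ s′ ≡ lo → s′ ∈ z ∷ L) → (κ t′ ≡ lo → t′ ∈ z ∷ L) → Boundary lo hi (z ∷ L)
        lh bd a b c d = record
          { bd = b-mid pl κz ∷ bd ; x∈ = λ _ q → clash μx q lo≢hi
          ; z∈ = λ _ → 0th ; s∈ = a ; t∈ = b ; y∈ = λ q → clash κy q hi≢lo ; s′∈ = c ; t′∈ = d }

        hl : ∀ {L} → All (Edge hi lo) L → (μ s ≢ hi → s ∈ y ∷ L) → (μ t ≢ hi → t ∈ y ∷ L) →
          (κ s′ ≡ hi → s′ ∈ y ∷ L) → (κ t′ ≡ hi → t′ ∈ y ∷ L) → Boundary hi lo (y ∷ L)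
        hl bd a b c d = record
          { bd = b-side ph pl κy μy ∷ bd ; x∈ = λ q _ → clash κx q lo≢hi
          ; z∈ = λ ne → ⊥-elim (ne μz) ; s∈ = a ; t∈ = b ; y∈ = λ _ → 0th ; s′∈ = c ; t′∈ = d }

        hh : ∀ {L} → All (Edge hi hi) L → (μ s ≢ lo → s ∈ z ∷ y ∷ L) → (μ t ≢ lo → t ∈ z ∷ y ∷ L) →
          (κ s′ ≡ hi → s′ ∈ z ∷ y ∷ L) → (κ t′ ≡ hi → t′ ∈ z ∷ y ∷ L) → Boundary hi hi (z ∷ y ∷ L)
        hh bd a b c d = record
          { bd = b-mid ph κz ∷ b-side ph ph κy μy ∷ bd ; x∈ = λ q _ → clash κx q lo≢hi
          ; z∈ = λ _ → 0th ; s∈ = a ; t∈ = b ; y∈ = λ _ → 1st ; s′∈ = c ; t′∈ = d }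

        at-x : ∀ {L} → Boundary lo lo L → ∀ {v} → x ~ v → v ≢ y → v ≢ z → In lo lo v ⊎ v ∈ L
        at-x B e v≢y v≢z = place pl pl B (λ k → v≢y (proj₂ (D.cut κx k e))) (λ k → v≢z (proj₂ (D′.cut μx k e)))

        -- Such a vertex `p` would be cubic with neighbours `x`, `a`, `b`. As `x` has degree four,
        -- it has a neighbour besides `y`, `z`, `p`; this must be `a` or `b`, which puts `p` in a
        -- triangle.
        no-ll : ∀ {a b} → Boundary lo lo (x ∷ a ∷ b ∷ []) → ∀ {p} → ¬ In lo lo p
        no-ll {a} {b} B {p} c with beyond x₄ y z p | all₃ (Single.nb pl pl B c)
        ... | v , e , new | px , pa , pb with at-x B e (λ { refl → new 0th }) (λ { refl → new 1st })
        ... | inj₁ c′ = new (there (there (here (Single.unique pl pl B c′ c))))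
        ... | inj₂ 0th = ~≢ e refl
        ... | inj₂ 1st = nct (Single.nb pl pl B c) px pa e
        ... | inj₂ 2nd = nct (Single.nb pl pl B c) px pb e

        -- The region is empty, so there is no place for a neighbour of `x` other than `y`, `z` and
        -- `a`, although `x` has degree four.
        thin-ll : ∀ {a} → Boundary lo lo (x ∷ a ∷ []) → ⊥
        thin-ll {a} B with beyond x₄ y z a
        ... | v , e , new with at-x B e (λ { refl → new 0th }) (λ { refl → new 1st })
        ... | inj₁ c = none pl pl B c
        ... | inj₂ 0th = ~≢ e refl
        ... | inj₂ 1st = new 2nd

        -- A single vertex there would be cubic and adjacent to both ends of the edge `yz`.
        no-hh : ∀ {a} → Boundary hi hi (z ∷ y ∷ a ∷ []) → ∀ {p} → ¬ In hi hi p
        no-hh B c with all₃ (Single.nb ph ph B c)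
        ... | pz , py , _ = nct (Single.nb ph ph B c) pz py (~sym yz)

        hi-side : ∀ {X : V → Set} → (∀ {v} → In hi lo v → X v) → (∀ {v} → In hi hi v → X v) →
          (κ s′ ≡ hi → X s′) → (κ t′ ≡ hi → X t′) → ∀ {v} → κ v ≡ hi → v ≢ y → X v
        hi-side f g a b {v} kv v≢ with μ v in mv
        ... | lo = f (kv , mv , λ { refl → clash kv κx hi≢lo })
        ... | hi = g (kv , mv , λ { refl → clash kv κx hi≢lo })
        ... | mid = case D′.cov mv of λ { 0th → ⊥-elim (v≢ refl) ; 1st → a kv ; 2nd → b kv }

        lo-side : ∀ {X : V → Set} → (∀ {v} → In lo lo v → X v) → (∀ {v} → In lo hi v → X v) →
          (κ s′ ≡ lo → X s′) → (κ t′ ≡ lo → X t′) → ∀ {v} → κ v ≡ lo → v ≢ x → X v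
        lo-side f g a b {v} kv v≢ with μ v in mv
        ... | lo = f (kv , mv , v≢)
        ... | hi = g (kv , mv , v≢)
        ... | mid = case D′.cov mv of λ { 0th → clash kv κy lo≢hi ; 1st → a kv ; 2nd → b kv }

        μ-lo-side : (∀ {v} → ¬ In lo lo v) → (∀ {v} → ¬ In hi lo v) → μ s ≢ lo → μ t ≢ lo → ⊥
        μ-lo-side f g a b with D′.los
        ... | v , v≢ , mv with κ v in kv
        ... | lo = f (kv , mv , v≢)
        ... | hi = g (kv , mv , v≢)
        ... | mid = case D.cov kv of λ { 0th → clash mv μz lo≢hi ; 1st → a mv ; 2nd → b mv }

        μ-hi-side : (∀ {v} → ¬ In lo hi v) → (∀ {v} → ¬ In hi hi v) → μ s ≢ hi → μ t ≢ hi → ⊥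
        μ-hi-side f g a b with D′.his
        ... | v , v≢ , mv with κ v in kv
        ... | lo = f (kv , mv , λ { refl → clash mv μx hi≢lo })
        ... | hi = g (kv , mv , λ { refl → clash mv μx hi≢lo })
        ... | mid = case D.cov kv of λ { 0th → v≢ refl ; 1st → a mv ; 2nd → b mv }

        κ-lo-empty : (∀ {v} → ¬ In lo lo v) → (∀ {v} → ¬ In lo hi v) → κ s′ ≢ lo → κ t′ ≢ lo → ⊥
        κ-lo-empty f g a b = let v , ne , k = D.los in lo-side {λ _ → ⊥} f g a b k ne

        κ-hi-empty : (∀ {v} → ¬ In hi lo v) → (∀ {v} → ¬ In hi hi v) → κ s′ ≢ hi → κ t′ ≢ hi → ⊥
        κ-hi-empty f g a b = let v , ne , k = D.his in hi-side {λ _ → ⊥} f g a b k ne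

        -- Besides `y` the `hi` side of `D` would be one cubic vertex `p` adjacent to `y`, `s`, `t`.
        -- A neighbour of `y` other than `x`, `z`, `p` is then `s` or `t`, which puts `p` in a
        -- triangle.
        small-y : Boundary hi lo (y ∷ s ∷ t ∷ []) → (∀ {v} → ¬ In hi hi v) → κ s′ ≢ hi → κ t′ ≢ hi → ⊥
        small-y B ¬hh a b with D.his
        ... | p , p≢ , kp with in-hl kp p≢
          where
          in-hl : ∀ {v} → κ v ≡ hi → v ≢ y → In hi lo v
          in-hl = hi-side {In hi lo} id (⊥-elim ∘ ¬hh) (⊥-elim ∘ a) (⊥-elim ∘ b)
        ... | c with beyond y₄ x z p | all₃ (Single.nb ph pl B c)
        ... | v , e , new | py , ps , pt =
            let go : ∀ k → κ v ≡ k → ⊥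
                go = λ where
                  lo kv → new (here (proj₁ (D.cut kv κy (~sym e))))
                  hi kv → new (there (there (here (Single.unique ph pl B
                    (hi-side {In hi lo} id (⊥-elim ∘ ¬hh) (⊥-elim ∘ a) (⊥-elim ∘ b) kv (~≢ e ∘ sym)) c))))
                  mid kv → case D.cov kv of λ
                    { 0th → new 1st ; 1st → nct (Single.nb ph pl B c) py ps e ; 2nd → nct (Single.nb ph pl B c) py pt e }
            in go (κ v) refl

      SideSmall : ∀ {s t} → Cut₃ x y z s t → Set
      SideSmall D = ∀ {u v} → Cut₃.κ D u ≡ lo → u ≢ x → Cut₃.κ D v ≡ lo → v ≢ x → u ≡ v

      both-shared : ∀ {s t} (D : Cut₃ x y z s t) (D′ : Cut₃ x z y s t) → SideSmall D
      both-shared {s} {t} D D′ ku u≢ kv v≢ =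
          let
              open Two-cuts D D′
              B : Boundary lo lo (x ∷ s ∷ t ∷ [])
              B = ll (b-mid pl D.κb ∷ b-mid pl D.κc ∷ []) (λ _ → 1st) (λ _ → 2nd) (λ q → clash q D.κb lo≢mid) (λ q → clash q D.κc lo≢mid)
              B′ : Boundary lo hi (z ∷ s ∷ t ∷ [])
              B′ = lh (b-mid pl D.κb ∷ b-mid pl D.κc ∷ []) (λ _ → 1st) (λ _ → 2nd) (λ q → clash q D.κb lo≢mid) (λ q → clash q D.κc lo≢mid)
              in-lh : ∀ {v} → κ v ≡ lo → v ≢ x → In lo hi v
              in-lh = lo-side {In lo hi} (⊥-elim ∘ no-ll B) id (λ q → clash q D.κb lo≢mid) (λ q → clash q D.κc lo≢mid)
          in Single.unique pl ph B′ (in-lh ku u≢) (in-lh kv v≢)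

      module One-shared {s t t′ : V} (D : Cut₃ x y z s t) (D′ : Cut₃ x z y s t′) where
        open Two-cuts D D′
        κs : κ s ≡ mid
        κs = D.κb
        μs : μ s ≡ mid
        μs = D′.κb
        κt : κ t ≡ mid
        κt = D.κc
        μt′ : μ t′ ≡ mid
        μt′ = D′.κc
        s∉ : ∀ {i} {X : Set} → Proper i → κ s ≡ i → X
        s∉ p q = clash q κs (proper≢mid p)

        lo-lo : μ t ≡ lo → κ t′ ≡ lo → ⊥
        lo-lo mt kt′ =
            let B : Boundary hi lo (y ∷ s ∷ t ∷ [])
                B = hl (b-mid ph κs ∷ b-mid ph κt ∷ []) (λ _ → 1st) (λ _ → 2nd) (s∉ ph) (λ q → clash q kt′ hi≢lo)
                B′ : Boundary hi hi (z ∷ y ∷ s ∷ [])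
                B′ = hh (b-mid ph κs ∷ []) (λ _ → 2nd) (λ ne → ⊥-elim (ne mt)) (s∉ ph) (λ q → clash q kt′ hi≢lo)
            in small-y B (no-hh B′) (s∉ ph) (λ q → clash q kt′ hi≢lo)

        lo-hi : μ t ≡ lo → κ t′ ≡ hi → ⊥
        lo-hi mt kt′ =
            let B : Boundary lo lo (x ∷ s ∷ t ∷ [])
                B = ll (b-mid pl κs ∷ b-mid pl κt ∷ []) (λ _ → 1st) (λ _ → 2nd) (s∉ pl) (λ q → clash q kt′ lo≢hi)
                B′ : Boundary lo hi (z ∷ s ∷ [])
                B′ = lh (b-mid pl κs ∷ []) (λ _ → 1st) (λ ne → ⊥-elim (ne mt)) (s∉ pl) (λ q → clash q kt′ lo≢hi)
            in κ-lo-empty (no-ll B) (none pl ph B′) (s∉ pl) (λ q → clash q kt′ lo≢hi)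

        hi-lo : μ t ≡ hi → κ t′ ≡ lo → ⊥
        hi-lo mt kt′ =
            let B : Boundary lo lo (x ∷ s ∷ t′ ∷ [])
                B = ll (b-mid pl κs ∷ b-side pl pl kt′ μt′ ∷ []) (λ _ → 1st) (λ ne → ⊥-elim (ne mt)) (s∉ pl) (λ _ → 2nd)
                B′ : Boundary hi lo (y ∷ s ∷ [])
                B′ = hl (b-mid ph κs ∷ []) (λ _ → 1st) (λ ne → ⊥-elim (ne mt)) (s∉ ph) (λ q → clash q kt′ hi≢lo)
            in μ-lo-side (no-ll B) (none ph pl B′) (λ q → clash q μs lo≢mid) (λ q → clash q mt lo≢hi)

        hi-hi : μ t ≡ hi → κ t′ ≡ hi → ⊥
        hi-hi mt kt′ = thin-ll (ll {s ∷ []} (b-mid pl κs ∷ []) (λ _ → 1st) (λ ne → ⊥-elim (ne mt)) (s∉ pl) (λ q → clash q kt′ lo≢hi))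

      module Disjoint {s t s′ t′ : V} (D : Cut₃ x y z s t) (D′ : Cut₃ x z y s′ t′) where
        open Two-cuts D D′
        κs : κ s ≡ mid
        κs = D.κb
        κt : κ t ≡ mid
        κt = D.κc
        μs′ : μ s′ ≡ mid
        μs′ = D′.κb
        μt′ : μ t′ ≡ mid
        μt′ = D′.κc
        no! : ∀ {v k} {X : Set} → μ v ≡ k → μ v ≢ k → X
        no! p q = ⊥-elim (q p)
        hi! : ∀ {v} {X : Set} → κ v ≡ hi → κ v ≡ lo → X
        hi! p q = clash p q hi≢lo
        lo! : ∀ {v} {X : Set} → κ v ≡ lo → κ v ≡ hi → X
        lo! p q = clash p q lo≢hi

        hh-hh : μ s ≡ hi → μ t ≡ hi → κ s′ ≡ hi → κ t′ ≡ hi → ⊥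
        hh-hh a b c d = thin-ll (ll {x ∷ []} (((λ q → clash q κx hi≢lo) , λ (_ , _ , ne) → ne refl) ∷ []) (no! a) (no! b) (hi! c) (hi! d))

        lh-hh : μ s ≡ lo → μ t ≡ hi → κ s′ ≡ hi → κ t′ ≡ hi → ⊥
        lh-hh a b c d = thin-ll (ll {s ∷ []} (b-mid pl κs ∷ []) (λ _ → 1st) (no! b) (hi! c) (hi! d))

        hh-lh : μ s ≡ hi → μ t ≡ hi → κ s′ ≡ lo → κ t′ ≡ hi → ⊥
        hh-lh a b c d = thin-ll (ll {s′ ∷ []} (b-side pl pl c μs′ ∷ []) (no! a) (no! b) (λ _ → 1st) (hi! d))

        ll-hh : μ s ≡ lo → μ t ≡ lo → κ s′ ≡ hi → κ t′ ≡ hi → ⊥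
        ll-hh a b c d = κ-lo-empty
          (no-ll (ll (b-mid pl κs ∷ b-mid pl κt ∷ []) (λ _ → 1st) (λ _ → 2nd) (hi! c) (hi! d)))
          (none pl ph (lh (b-mid pl κz ∷ []) (no! a) (no! b) (hi! c) (hi! d))) (hi! c) (hi! d)

        hh-ll : μ s ≡ hi → μ t ≡ hi → κ s′ ≡ lo → κ t′ ≡ lo → ⊥
        hh-ll a b c d = μ-lo-side
          (no-ll (ll (b-side pl pl c μs′ ∷ b-side pl pl d μt′ ∷ []) (no! a) (no! b) (λ _ → 1st) (λ _ → 2nd)))
          (none ph pl (hl (b-side ph pl κy μy ∷ []) (no! a) (no! b) (lo! c) (lo! d)))
          (λ q → clash q a lo≢hi) (λ q → clash q b lo≢hi)

        lh-ll : μ s ≡ lo → μ t ≡ hi → κ s′ ≡ lo → κ t′ ≡ lo → ⊥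
        lh-ll a b c d = κ-hi-empty
          (none ph pl (hl (b-mid ph κs ∷ []) (λ _ → 1st) (no! b) (lo! c) (lo! d)))
          (no-hh (hh (b-mid ph κt ∷ []) (no! a) (λ _ → 2nd) (lo! c) (lo! d))) (lo! c) (lo! d)

        ll-lh : μ s ≡ lo → μ t ≡ lo → κ s′ ≡ lo → κ t′ ≡ hi → ⊥
        ll-lh a b c d = μ-hi-side
          (none pl ph (lh (b-side pl ph c μs′ ∷ []) (no! a) (no! b) (λ _ → 1st) (hi! d)))
          (no-hh (hh (b-side ph ph d μt′ ∷ []) (no! a) (no! b) (lo! c) (λ _ → 2nd)))
          (λ q → clash q a hi≢lo) (λ q → clash q b hi≢lo)

        ll-ll : μ s ≡ lo → μ t ≡ lo → κ s′ ≡ lo → κ t′ ≡ lo → ⊥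
        ll-ll a b c d = small-y (hl (b-mid ph κs ∷ b-mid ph κt ∷ []) (λ _ → 1st) (λ _ → 2nd) (lo! c) (lo! d))
          (none ph ph (hh [] (no! a) (no! b) (lo! c) (lo! d))) (lo! c) (lo! d)

        lh-lh : μ s ≡ lo → μ t ≡ hi → κ s′ ≡ lo → κ t′ ≡ hi → SideSmall D
        lh-lh a b c d ku u≢ kv v≢ = trans (only ku u≢) (sym (only kv v≢))
          where
          B : Boundary lo lo (x ∷ s ∷ s′ ∷ [])
          B = ll (b-mid pl κs ∷ b-side pl pl c μs′ ∷ []) (λ _ → 1st) (no! b) (λ _ → 2nd) (hi! d)
          B′ : Boundary lo hi (z ∷ t ∷ s′ ∷ [])
          B′ = lh (b-mid pl κt ∷ b-side pl ph c μs′ ∷ []) (no! a) (λ _ → 1st) (λ _ → 2nd) (hi! d)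
          module S = Single pl ph B′
          empty : ∀ {q} → ¬ In lo hi q
          empty {q} cq with all₃ (S.nb cq)
          ... | qz , qt , qs′ = nct Ns′ (proj₁ (all₃ Ns′)) (proj₂ (proj₂ (all₃ Ns′))) xs
            where
            Ns′ : Nb G s′ (x ∷ q ∷ s ∷ [])
            Ns′ {v} e with κ v in kv
            ... | hi = case D.cut c kv e of λ { (refl , _) → clash μs′ μx mid≢lo }
            ... | lo = case v ≟ x of λ where
              (yes p) → here p
              (no ne) → lo-side {λ v → s′ ~ v → v ∈ x ∷ q ∷ s ∷ []} (λ i _ → ⊥-elim (no-ll B i)) (λ i _ → there (here (S.unique i cq)))
                (λ _ e → ⊥-elim (~≢ e refl)) (hi! d) kv ne e
            ... | mid = case D.cov kv of λ
              { 0th → ⊥-elim (nct (S.nb cq) qs′ qz e) ; 1st → 2nd ; 2nd → ⊥-elim (nct (S.nb cq) qs′ qt e) }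
            xs : x ~ s
            xs with x ~? s
            ... | yes e = e
            ... | no ¬e with beyond x₄ y z s′
            ... | v , e , new with at-x B e (λ { refl → new 0th }) (λ { refl → new 1st })
            ... | inj₁ i = ⊥-elim (no-ll B i)
            ... | inj₂ 0th = ⊥-elim (~≢ e refl)
            ... | inj₂ 1st = ⊥-elim (¬e e)
            ... | inj₂ 2nd = ⊥-elim (new 2nd)
          only : ∀ {v} → κ v ≡ lo → v ≢ x → v ≡ s′
          only = lo-side {_≡ s′} (⊥-elim ∘ no-ll B) (⊥-elim ∘ empty) (λ _ → refl) (hi! d)

      Opposite : Side → Set
      Opposite k = k ≡ lo ⊎ k ≡ hi

      opposite : ∀ {k} → k ≢ mid → Opposite k
      opposite {lo} _ = inj₁ refl
      opposite {hi} _ = inj₂ refl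
      opposite {mid} ne = ⊥-elim (ne refl)

      disjoint : ∀ {s t s′ t′} (D : Cut₃ x y z s t) (D′ : Cut₃ x z y s′ t′) →
        Opposite (Cut₃.κ D′ s) → Opposite (Cut₃.κ D′ t) → Opposite (Cut₃.κ D s′) → Opposite (Cut₃.κ D t′) → SideSmall D
      disjoint D D′ (inj₁ a) (inj₁ b) (inj₁ c) (inj₁ d) = ⊥-elim (Disjoint.ll-ll D D′ a b c d)
      disjoint D D′ (inj₁ a) (inj₁ b) (inj₁ c) (inj₂ d) = ⊥-elim (Disjoint.ll-lh D D′ a b c d)
      disjoint D D′ (inj₁ a) (inj₁ b) (inj₂ c) (inj₁ d) = ⊥-elim (Disjoint.ll-lh D (swap-bc D′) a b d c)
      disjoint D D′ (inj₁ a) (inj₁ b) (inj₂ c) (inj₂ d) = ⊥-elim (Disjoint.ll-hh D D′ a b c d)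
      disjoint D D′ (inj₁ a) (inj₂ b) (inj₁ c) (inj₁ d) = ⊥-elim (Disjoint.lh-ll D D′ a b c d)
      disjoint D D′ (inj₁ a) (inj₂ b) (inj₁ c) (inj₂ d) = Disjoint.lh-lh D D′ a b c d
      disjoint D D′ (inj₁ a) (inj₂ b) (inj₂ c) (inj₁ d) = Disjoint.lh-lh D (swap-bc D′) a b d c
      disjoint D D′ (inj₁ a) (inj₂ b) (inj₂ c) (inj₂ d) = ⊥-elim (Disjoint.lh-hh D D′ a b c d)
      disjoint D D′ (inj₂ a) (inj₁ b) (inj₁ c) (inj₁ d) = ⊥-elim (Disjoint.lh-ll (swap-bc D) D′ b a c d)
      disjoint D D′ (inj₂ a) (inj₁ b) (inj₁ c) (inj₂ d) = Disjoint.lh-lh (swap-bc D) D′ b a c d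
      disjoint D D′ (inj₂ a) (inj₁ b) (inj₂ c) (inj₁ d) = Disjoint.lh-lh (swap-bc D) (swap-bc D′) b a d c
      disjoint D D′ (inj₂ a) (inj₁ b) (inj₂ c) (inj₂ d) = ⊥-elim (Disjoint.lh-hh (swap-bc D) D′ b a c d)
      disjoint D D′ (inj₂ a) (inj₂ b) (inj₁ c) (inj₁ d) = ⊥-elim (Disjoint.hh-ll D D′ a b c d)
      disjoint D D′ (inj₂ a) (inj₂ b) (inj₁ c) (inj₂ d) = ⊥-elim (Disjoint.hh-lh D D′ a b c d)
      disjoint D D′ (inj₂ a) (inj₂ b) (inj₂ c) (inj₁ d) = ⊥-elim (Disjoint.hh-lh D (swap-bc D′) a b d c)
      disjoint D D′ (inj₂ a) (inj₂ b) (inj₂ c) (inj₂ d) = ⊥-elim (Disjoint.hh-hh D D′ a b c d)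

      one-shared : ∀ {s t t′} (D : Cut₃ x y z s t) (D′ : Cut₃ x z y s t′) → SideSmall D
      one-shared {s} {t} {t′} D D′ = go (Cut₃.κ D′ t ≟ˢ mid)
        where
        go : Dec (Cut₃.κ D′ t ≡ mid) → SideSmall D
        go (yes m) with Cut₃.cov D′ m
        ... | 0th = clash (Cut₃.κy D) (Cut₃.κc D) hi≢mid
        ... | 1st = ⊥-elim (b≢c D refl)
        ... | 2nd = both-shared D D′
        go (no n) with opposite n | opposite n′
          where
          n′ : Cut₃.κ D t′ ≢ mid
          n′ k = case Cut₃.cov D k of λ where
            0th → clash (Cut₃.κy D′) (Cut₃.κc D′) hi≢mid
            1st → b≢c D′ refl
            2nd → n (Cut₃.κc D′)
        ... | inj₁ a | inj₁ b = ⊥-elim (One-shared.lo-lo D D′ a b)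
        ... | inj₁ a | inj₂ b = ⊥-elim (One-shared.lo-hi D D′ a b)
        ... | inj₂ a | inj₁ b = ⊥-elim (One-shared.hi-lo D D′ a b)
        ... | inj₂ a | inj₂ b = ⊥-elim (One-shared.hi-hi D D′ a b)

      meet : ∀ {s t s′ t′} (D : Cut₃ x y z s t) (D′ : Cut₃ x z y s′ t′) → Cut₃.κ D′ s ≡ mid → SideSmall D
      meet D D′ m with Cut₃.cov D′ m
      ... | 0th = clash (Cut₃.κy D) (Cut₃.κb D) hi≢mid
      ... | 1st = one-shared D D′
      ... | 2nd = one-shared D (swap-bc D′)

      -- Two patterns survive: both `s` and `t` belong to the other separator as well, or neither
      -- does and each separator has one vertex on each side of the other. All remaining positions
      -- are contradictory.
      side-small : ∀ {s t s′ t′} (D : Cut₃ x y z s t) (D′ : Cut₃ x z y s′ t′) → SideSmall D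
      side-small {s} {t} {s′} {t′} D D′ =
          let go : Dec (Cut₃.κ D′ s ≡ mid) → Dec (Cut₃.κ D′ t ≡ mid) → SideSmall D
              go = λ where
                (yes m) _ → meet D D′ m
                (no _) (yes m) → meet (swap-bc D) D′ m
                (no n₁) (no n₂) →
                    let other : ∀ {v} → Cut₃.κ D′ v ≡ mid → Cut₃.κ D v ≢ mid
                        other m k = case Cut₃.cov D k of λ where
                          0th → clash (Cut₃.κy D′) m hi≢mid
                          1st → n₁ m
                          2nd → n₂ m
                    in disjoint D D′ (opposite n₁) (opposite n₂) (opposite (other (Cut₃.κb D′))) (opposite (other (Cut₃.κc D′)))
          in go (Cut₃.κ D′ s ≟ˢ mid) (Cut₃.κ D′ t ≟ˢ mid)

    -- Some edge of a triangle without cubic vertices can be deleted.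
    triangle : (nct : ∀ {p a b c u v} → Nb G p (a ∷ b ∷ c ∷ []) → p ~ u → p ~ v → ¬ u ~ v) →
      ∀ {x y z} → x ~ y → x ~ z → y ~ z → DelSep G x y → DelSep G x z → DelSep G y z → ⊥
    triangle nct {x} {y} {z} xy xz yz Dxy Dxz Dyz
      with through Dxy (towards Dxy xz yz) | through Dxz (towards Dxz xy (~sym yz)) | through Dyz (towards Dyz (~sym xy) (~sym xz))
    ... | _ , _ , A | _ , _ , B | _ , _ , C = InCut₃.cramped A (Cross.side-small nct xy xz yz A B)
      (λ p p′ q q′ → Cross.side-small nct (~sym xy) yz xz (flip₃ A) C (cong opp p) p′ (cong opp q) q′)

    -- In a K₄ with a cubic vertex w the edges not at w can be deleted.
    module K₄ {w x y z : V} (Nw : Nb G w (x ∷ y ∷ z ∷ [])) (xy : x ~ y) (xz : x ~ z) (yz : y ~ z) where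
      -- The cubic vertex `w` has no neighbours but `x`, `y`, `z`, so the `lo` vertices other than
      -- `x` see only `z` and `t` in the separator.
      one : ∀ {x y t} (D : Cut₃ x y w z t) → Nb G w (x ∷ y ∷ z ∷ []) → ∀ {u v} → Cut₃.κ D u ≡ lo → u ≢ x → Cut₃.κ D v ≡ lo → v ≢ x → u ≡ v
      one {t = t} D Nw = InCut₃.lo-unique D z t (Cut₃.κb D) (Cut₃.κc D) λ ku u≢ e kv → case Cut₃.cov D kv of λ where
        0th → case Nw (~sym e) of λ where
          0th → ⊥-elim (u≢ refl)
          1st → clash ku (Cut₃.κy D) lo≢hi
          2nd → clash ku (Cut₃.κb D) lo≢mid
        1st → 0th
        2nd → 1st

      no-cut : ∀ {t} → Cut₃ x y w z t → ⊥
      no-cut D = InCut₃.cramped D (one D Nw)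
        (λ p p′ q q′ → one (flip₃ D) (λ e → case Nw e of λ { 0th → 1st ; 1st → 0th ; 2nd → 2nd }) (cong opp p) p′ (cong opp q) q′)

      deletable : ¬ DelSep G x y
      deletable D₀ with through D₀ (towards D₀ (~sym (proj₁ (all₃ Nw))) (~sym (proj₁ (proj₂ (all₃ Nw)))))
      ... | s , t , D =
          let go : ∀ k → Cut₃.κ D z ≡ k → ⊥
              go = λ where
                lo k → ~≢ xz (sym (proj₁ (Cut₃.cut D k (Cut₃.κy D) (~sym yz))))
                hi k → ~≢ yz (sym (proj₂ (Cut₃.cut D (Cut₃.κx D) k xz)))
                mid k → case Cut₃.cov D k of λ where
                  0th → ~≢ (proj₂ (proj₂ (all₃ Nw))) refl
                  1st → no-cut D
                  2nd → no-cut (swap-bc D)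
          in go (Cut₃.κ D z) refl

    -- Choosing the reduction on at least eight vertices.

    7≤n : 7 ≤ n G
    7≤n = ℕ.≤-trans (ℕ.n≤1+n 7) 8≤n

    -- The vertex `z` is no end of the deleted edge, so it keeps degree four and witnesses `Rich`.
    delete : ∀ {x y z} → x ~ y → Deg₄ G x → Deg₄ G y → Deg₄ G z → z ≢ x → z ≢ y → ¬ DelSep G x y → Reduction G
    delete {x} {y} {z} xy x₄ y₄ z₄ z≢x z≢y no-sep =
        let
            open Delete G x y
        in record
             { H = del ; good-H = Deletion.del-good x y xy x₄ y₄ no-sep (no-sep ∘ flip-del)
             ; rich-H = z , λ a b c N → z₄ a b c λ {w} e → N {w} (del-keeps {z} {w} e λ { (inj₁ (p , _)) → z≢x p ; (inj₂ (p , _)) → z≢y p })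
             ; minor = delete-minor G x y ; step = inj₁ (del-edges xy) ; smaller = inj₂ (refl , del-edges xy) }

    -- Each end has two further neighbours, and none is common; so the merged vertex has degree at
    -- least four.
    contract : ∀ {x w} → x ~ w → (∀ {v} → x ~ v → ¬ w ~ v) → ¬ FourSep G x w → Reduction G
    contract {x} {w} xw none no-sep with nbr good x w w | nbr good w x x
    ... | p , xp , p∉ | q , wq , q∉ with nbr good x w p | nbr good w x q
    ... | p′ , xp′ , p′∉ | q′ , wq′ , q′∉ = record
      { H = H ; good-H = C.good-H no-sep merged (λ ux uw → ⊥-elim (none (~sym ux) (~sym uw)))
      ; rich-H = C.rich-H near (λ { refl → p′∉ 1st }) (λ { refl → none xp wq }) (λ { refl → none xp wq′ })
          (λ { refl → none xp′ wq }) (λ { refl → none xp′ wq′ }) (λ { refl → q′∉ 1st })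
      ; minor = C.minor ; step = inj₁ (edges-1 xw none) ; smaller = inj₁ size }
      where
      K : Contraction G x w
      K = contraction G x w (~≢ xw)
      open Contraction K
      module C = Contracting x w xw K using (good-H; rich-H; minor)
      near : ∀ {v} → v ∈ p ∷ p′ ∷ q ∷ q′ ∷ [] → v ≢ x × v ≢ w × (x ~ v ⊎ w ~ v)
      near 0th = ~≢ xp ∘ sym , (λ { refl → p∉ 0th }) , inj₁ xp
      near 1st = ~≢ xp′ ∘ sym , (λ { refl → p′∉ 0th }) , inj₁ xp′
      near 2nd = (λ { refl → q∉ 0th }) , ~≢ wq ∘ sym , inj₂ wq
      near 3rd = (λ { refl → q′∉ 0th }) , ~≢ wq′ ∘ sym , inj₂ wq′
      merged : ∀ b c → ∃ λ v → v ≢ x × v ≢ w × (x ~ v ⊎ w ~ v) × v ∉ b ∷ c ∷ []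
      merged b c with nbr good x w b | nbr good w x b
      ... | r , xr , r∉ | s , ws , s∉ with r ≟ c
      ... | no r≢c = r , ~≢ xr ∘ sym , (λ { refl → r∉ 0th }) , inj₁ xr , λ { 0th → r∉ 1st ; 1st → r≢c refl }
      ... | yes refl = s , (λ { refl → s∉ 0th }) , ~≢ ws ∘ sym , inj₂ ws , λ { 0th → s∉ 1st ; 1st → none xr ws }

    -- With a single neighbour `u` besides `w` and `z`, the pair `w`, `x` would be separated from
    -- the rest by `y`, `z`, `u`.
    adjacent-deg₄ : ∀ {w x y z} → Nb G w (x ∷ y ∷ z ∷ []) → x ~ z → Deg₄ G x
    adjacent-deg₄ {w} {x} {y} {z} Nw xz a b c Nx with drop₃ (Nx (~sym (proj₁ (all₃ Nw))))
    ... | s , t , k₁ , _ with drop₂ (k₁ (Nx xz) (λ { refl → ~≢ (proj₂ (proj₂ (all₃ Nw))) refl }))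
    ... | u , k₂ = noSep good (_∈? (w ∷ x ∷ [])) y z u
        (λ { 0th e → case Nw e of λ { 0th → inj₁ 1st ; 1st → inj₂ 0th ; 2nd → inj₂ 1st }
           ; 1st e → case Nx′ e of λ { 0th → inj₁ 0th ; 1st → inj₂ 1st ; 2nd → inj₂ 2nd } })
        (w , x , ~≢ wx , (0th , λ { 0th → ~≢ (proj₁ (proj₂ (all₃ Nw))) refl ; 1st → ~≢ (proj₂ (proj₂ (all₃ Nw))) refl ; 2nd → u≢w refl })
          , (1st , λ { 0th → proj₁ (≢₃ Nw) refl ; 1st → proj₁ (proj₂ (≢₃ Nw)) refl ; 2nd → u≢x refl }))
        (Two-map (λ ∉ → (λ { 0th → ∉ 0th ; 1st → ∉ 1st }) , λ m → ∉ (there (there m)))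
          (pair-fresh (w ∷ x ∷ y ∷ z ∷ u ∷ []) 7≤n))
      where
      wx : w ~ x
      wx = proj₁ (all₃ Nw)
      Nx′ : Nb G x (w ∷ z ∷ u ∷ [])
      Nx′ {v} e with v ≟ w | v ≟ z
      ... | yes p | _ = here p
      ... | no _ | yes q = there (here q)
      ... | no p | no q = there (there (k₂ (k₁ (Nx e) p) q))
      u≢w : u ≢ w
      u≢w = proj₁ (proj₂ (≢₃ Nx′)) ∘ sym
      u≢x : u ≢ x
      u≢x refl = ~≢ (proj₂ (proj₂ (all₃ Nx′))) refl

    -- With a single neighbour `u` besides `w`, `x`, `y`, the pair `w`, `z` would be separated from
    -- the rest by `x`, `y`, `u`.
    centre-deg₅ : ∀ {w x y z} → Nb G w (x ∷ y ∷ z ∷ []) → x ~ z → y ~ z → Deg₅ G z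
    centre-deg₅ {w} {x} {y} {z} Nw xz yz a b c d Nz with drop₄ (Nz (~sym (proj₂ (proj₂ (all₃ Nw)))))
    ... | _ , _ , _ , k₁ with drop₃ (k₁ (Nz (~sym xz)) (λ { refl → ~≢ (proj₁ (all₃ Nw)) refl }))
    ... | _ , _ , k₂ , _ with drop₂ (k₂ (k₁ (Nz (~sym yz)) (λ { refl → ~≢ (proj₁ (proj₂ (all₃ Nw))) refl })) (λ { refl → proj₁ (≢₃ Nw) refl }))
    ... | u , k₃ = noSep good (_∈? (w ∷ z ∷ [])) x y u
        (λ { 0th e → case Nw e of λ { 0th → inj₂ 0th ; 1st → inj₂ 1st ; 2nd → inj₁ 1st }
           ; 1st e → case Nz′ e of λ { 0th → inj₁ 0th ; 1st → inj₂ 0th ; 2nd → inj₂ 1st ; 3rd → inj₂ 2nd } })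
        (w , z , ~≢ wz , (0th , λ { 0th → ~≢ (proj₁ (all₃ Nw)) refl ; 1st → ~≢ (proj₁ (proj₂ (all₃ Nw))) refl ; 2nd → u≢w refl })
          , (1st , λ { 0th → ~≢ xz refl ; 1st → ~≢ yz refl ; 2nd → u≢z refl }))
        (Two-map (λ ∉ → (λ { 0th → ∉ 0th ; 1st → ∉ 1st }) , λ m → ∉ (there (there m)))
          (pair-fresh (w ∷ z ∷ x ∷ y ∷ u ∷ []) 7≤n))
      where
      wz : w ~ z
      wz = proj₂ (proj₂ (all₃ Nw))
      Nz′ : Nb G z (w ∷ x ∷ y ∷ u ∷ [])
      Nz′ {v} e with v ≟ w | v ≟ x | v ≟ y
      ... | yes p | _ | _ = here p
      ... | no _ | yes q | _ = there (here q)
      ... | no _ | no _ | yes r = there (there (here r))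
      ... | no p | no q | no r = there (there (there (k₃ (k₂ (k₁ (Nz e) p) q) r)))
      z₄ : Deg₄ G z
      z₄ = adjacent-deg₄ {w} {z} {y} {x} (λ e → case Nw e of λ { 0th → 2nd ; 1st → 1st ; 2nd → 0th }) (~sym xz)
      u≢w : u ≢ w
      u≢w refl = z₄ w x y λ e → case Nz′ e of λ { 0th → 0th ; 1st → 1st ; 2nd → 2nd ; 3rd → 0th }
      u≢z : u ≢ z
      u≢z refl = z₄ w x y λ e → case Nz′ e of λ { 0th → 0th ; 1st → 1st ; 2nd → 2nd ; 3rd → ⊥-elim (~≢ e refl) }

    -- A 4-cut through `xw` would have the other two neighbours of the cubic vertex `w` on opposite
    -- sides, but these are adjacent.
    no-cut-at : ∀ {w x y z} → Nb G w (x ∷ y ∷ z ∷ []) → y ~ z → ¬ FourSep G x w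
    no-cut-at Nw yz (_ , _ , F) with split F (Cut₄.κf F) (Cut₄.κe F) Nw
    ... | inj₁ (ky , kz) = Cut₄.cut F ky kz yz
    ... | inj₂ (ky , kz) = Cut₄.cut F kz ky (~sym yz)

    -- The merged vertex keeps three neighbours of `x` and gains `y`, hence has degree four. The
    -- only common neighbour of `x` and `w` is `z`, whose degree leaves room for the loss of one
    -- edge.
    O₃ : ∀ {w x y z} → Nb G w (x ∷ y ∷ z ∷ []) → x ~ z → y ~ z → ¬ x ~ y → Reduction G
    O₃ {w} {x} {y} {z} Nw xz yz x≁y with beyond x₄ w w w
      where
      x₄ : Deg₄ G x
      x₄ = adjacent-deg₄ Nw xz
    ... | p , xp , p∉ with beyond (adjacent-deg₄ Nw xz) w p p
    ... | q , xq , q∉ with beyond (adjacent-deg₄ Nw xz) w p q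
    ... | r , xr , r∉ = record
      { H = H ; good-H = C.good-H (no-cut-at Nw yz) merged common
      ; rich-H = C.rich-H near (λ { refl → q∉ 1st }) (λ { refl → r∉ 1st }) (λ { refl → x≁y xp }) (λ { refl → r∉ 2nd })
          (λ { refl → x≁y xq }) (λ { refl → x≁y xr })
      ; minor = C.minor
      ; step = inj₂ (w , x , y , z , proj₁ (≢₃ Nw) , proj₁ (proj₂ (≢₃ Nw)) , proj₂ (proj₂ (≢₃ Nw)) ,
          (λ v e → case Nw e of λ { (here a) → inj₁ a ; (there (here a)) → inj₂ (inj₁ a) ; (there (there (here a))) → inj₂ (inj₂ a) }) ,
          wx , wy , proj₂ (proj₂ (all₃ Nw)) , xz , yz , xy-false ,
          degree≥4 G x x₄ , degree≥4 G y y₄ , degree≥5 G z (centre-deg₅ Nw xz yz) , Contraction.contract K)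
      ; smaller = inj₁ size }
      where
      wx : w ~ x
      wx = proj₁ (all₃ Nw)
      wy : w ~ y
      wy = proj₁ (proj₂ (all₃ Nw))
      x₄ : Deg₄ G x
      x₄ = adjacent-deg₄ Nw xz
      y₄ : Deg₄ G y
      y₄ = adjacent-deg₄ {w} {y} {x} {z} (λ e → case Nw e of λ { 0th → 1st ; 1st → 0th ; 2nd → 2nd }) yz
      z₄ : Deg₄ G z
      z₄ a b c N = centre-deg₅ Nw xz yz a b c c λ e → case N e of λ { 0th → 0th ; 1st → 1st ; 2nd → 2nd }
      xy-false : adj G x y ≡ false
      xy-false with adj G x y
      ... | false = refl
      ... | true = ⊥-elim (x≁y refl)
      K : Contraction G x w
      K = contraction G x w (~≢ (~sym wx))
      open Contraction K using (H; size)
      module C = Contracting x w (~sym wx) K using (good-H; rich-H; minor)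
      near : ∀ {v} → v ∈ p ∷ q ∷ r ∷ y ∷ [] → v ≢ x × v ≢ w × (x ~ v ⊎ w ~ v)
      near 0th = ~≢ xp ∘ sym , (λ { refl → p∉ 0th }) , inj₁ xp
      near 1st = ~≢ xq ∘ sym , (λ { refl → q∉ 0th }) , inj₁ xq
      near 2nd = ~≢ xr ∘ sym , (λ { refl → r∉ 0th }) , inj₁ xr
      near 3rd = proj₁ (≢₃ Nw) ∘ sym , ~≢ wy ∘ sym , inj₂ wy
      merged : ∀ b c → ∃ λ v → v ≢ x × v ≢ w × (x ~ v ⊎ w ~ v) × v ∉ b ∷ c ∷ []
      merged b c with beyond x₄ w b c
      ... | v , e , v∉ = v , ~≢ e ∘ sym , (λ { refl → v∉ 0th }) , inj₁ e , v∉ ∘ there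
      common : ∀ {u} → u ~ x → u ~ w → ∀ c → ∃ λ v → u ~ v × v ∉ x ∷ w ∷ c ∷ []
      common ux uw c with Nw (~sym uw)
      ... | 0th = ⊥-elim (~≢ ux refl)
      ... | 1st = ⊥-elim (x≁y (~sym ux))
      ... | 2nd = beyond z₄ x w c

    -- The case is decided by the edges among the neighbours of `w`: contraction for one edge, `O₃`
    -- for two, deletion in a K₄ for three.
    cubic-triangle : ∀ {w x y z} → Nb G w (x ∷ y ∷ z ∷ []) → x ~ y → Reduction G
    cubic-triangle {w} {x} {y} {z} Nw xy with x ~? z | y ~? z
    ... | no x≁z | no y≁z =
        let wz : w ~ z
            wz = proj₂ (proj₂ (all₃ Nw))
        in contract (~sym wz)
             (λ zv wv → case Nw wv of λ { 0th → x≁z (~sym zv) ; 1st → y≁z (~sym zv) ; 2nd → ~≢ zv refl })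
             (no-cut-at (λ e → case Nw e of λ { 0th → 1st ; 1st → 2nd ; 2nd → 0th }) xy)
    ... | yes xz | no y≁z = O₃ {w} {y} {z} {x} (λ e → case Nw e of λ { 0th → 2nd ; 1st → 0th ; 2nd → 1st }) (~sym xy) (~sym xz) y≁z
    ... | no x≁z | yes yz = O₃ {w} {x} {z} {y} (λ e → case Nw e of λ { 0th → 0th ; 1st → 2nd ; 2nd → 1st }) xy (~sym yz) x≁z
    ... | yes xz | yes yz = delete xy (adjacent-deg₄ Nw xz)
      (adjacent-deg₄ {w} {y} {x} {z} (λ e → case Nw e of λ { 0th → 1st ; 1st → 0th ; 2nd → 2nd }) yz)
      (adjacent-deg₄ {w} {z} {y} {x} (λ e → case Nw e of λ { 0th → 2nd ; 1st → 1st ; 2nd → 0th }) (~sym xz))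
      (~≢ xz ∘ sym) (~≢ yz ∘ sym) (K₄.deletable Nw xy xz yz)

    Cubic-triangle : Set
    Cubic-triangle = ∃ λ w → ∃ λ x → ∃ λ y → ∃ λ z → (∀ v → w ~ v → v ∈ x ∷ y ∷ z ∷ []) × x ~ y

    cubic-triangle? : Dec Cubic-triangle
    cubic-triangle? = any? λ w → any? λ x → any? λ y → any? λ z →
      all? (λ v → (w ~? v) →-dec (v ∈? (x ∷ y ∷ z ∷ []))) ×-dec (x ~? y)

    Triangle : Set
    Triangle = ∃ λ x → ∃ λ y → ∃ λ z → x ~ y × x ~ z × y ~ z

    triangle? : Dec Triangle
    triangle? = any? λ x → any? λ y → any? λ z → (x ~? y) ×-dec ((x ~? z) ×-dec (y ~? z))

    module _ (¬ct : ¬ Cubic-triangle) where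
      nct : ∀ {p a b c u v} → Nb G p (a ∷ b ∷ c ∷ []) → p ~ u → p ~ v → ¬ u ~ v
      nct {p} {a} {b} {c} N pu pv uv with N pu | N pv
      ... | 0th | 0th = ~≢ uv refl
      ... | 1st | 1st = ~≢ uv refl
      ... | 2nd | 2nd = ~≢ uv refl
      ... | 0th | 1st = ¬ct (p , a , b , c , (λ _ → N) , uv)
      ... | 1st | 0th = ¬ct (p , a , b , c , (λ _ → N) , ~sym uv)
      ... | 0th | 2nd = ¬ct (p , a , c , b , (λ _ e → case N e of λ { 0th → 0th ; 1st → 2nd ; 2nd → 1st }) , uv)
      ... | 2nd | 0th = ¬ct (p , a , c , b , (λ _ e → case N e of λ { 0th → 0th ; 1st → 2nd ; 2nd → 1st }) , ~sym uv)
      ... | 1st | 2nd = ¬ct (p , b , c , a , (λ _ e → case N e of λ { 0th → 2nd ; 1st → 0th ; 2nd → 1st }) , uv)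
      ... | 2nd | 1st = ¬ct (p , b , c , a , (λ _ e → case N e of λ { 0th → 2nd ; 1st → 0th ; 2nd → 1st }) , ~sym uv)

      deg₄ : ∀ {v u w} → v ~ u → v ~ w → u ~ w → Deg₄ G v
      deg₄ vu vw uw a b c N = nct N vu vw uw

      from-triangle : ∀ {x y z} → x ~ y → x ~ z → y ~ z → Reduction G
      from-triangle {x} {y} {z} xy xz yz with Decide.delSep? G x y | Decide.delSep? G x z | Decide.delSep? G y z
      ... | no a | _ | _ =
          let x₄ = deg₄ xy xz yz
              y₄ = deg₄ (~sym xy) yz xz
              z₄ = deg₄ (~sym xz) (~sym yz) xy
          in delete xy x₄ y₄ z₄ (~≢ xz ∘ sym) (~≢ yz ∘ sym) a
      ... | yes _ | no a | _ = delete xz (deg₄ xy xz yz) (deg₄ (~sym xz) (~sym yz) xy) (deg₄ (~sym xy) yz xz) (~≢ xy ∘ sym) (~≢ yz) a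
      ... | yes _ | yes _ | no a = delete yz (deg₄ (~sym xy) yz xz) (deg₄ (~sym xz) (~sym yz) xy) (deg₄ xy xz yz) (~≢ xy) (~≢ xz) a
      ... | yes a | yes b | yes c = ⊥-elim (triangle nct xy xz yz a b c)

    Uncut : Set
    Uncut = ∃ λ x → ∃ λ w → x ~ w × ¬ FourSep G x w

    uncut? : Dec Uncut
    uncut? = any? λ x → any? λ w → (x ~? w) ×-dec ¬? (Decide.fourSep? G x w)

    AllCubic : Set
    AllCubic = ∀ v → ∃ λ a → ∃ λ b → ∃ λ c → Nb G v (a ∷ b ∷ c ∷ [])

    -- If no reduction applies, the graph is triangle-free and every edge lies in a 4-cut, so it is
    -- a closed ladder.
    reduce : V → Reduction G ⊎ (In𝒜 G × AllCubic)
    reduce v₀ with cubic-triangle?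
    ... | yes (_ , _ , _ , _ , N , xy) = inj₁ (cubic-triangle (λ {v} → N v) xy)
    ... | no ¬ct with triangle?
    ... | yes (_ , _ , _ , xy , xz , yz) = inj₁ (from-triangle ¬ct xy xz yz)
    ... | no ¬t with uncut?
    ... | yes (x , w , xw , ¬s) = inj₁ (contract xw (λ {v} xv wv → ¬t (x , w , v , xw , xv , wv)) ¬s)
    ... | no ¬u = inj₂ (Irreducible.ladder (λ {a} {b} {c} ab bc ac → ¬t (a , b , c , ab , ac , bc)) fs v₀)
      where
      fs : ∀ {e f} → e ~ f → FourSep G e f
      fs {e} {f} ef with Decide.fourSep? G e f
      ... | yes s = s
      ... | no ¬s = ⊥-elim (¬u (e , f , ef , ¬s))

  -- Seven vertices.

  module Seven (n≡7 : n G ≡ 7) where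

    new : (L : List V) → suc (length L) ≤ 7 → ∃ λ v → v ∉ L
    new L le = fresh L (ℕ.≤-trans le (ℕ.≤-reflexive (sym n≡7)))

    all-seven : ∀ {L} → Fresh L → length L ≡ 7 → ∀ v → v ∈ L
    all-seven fr len = fresh-covers fr (trans len (sym n≡7))

    -- The other three vertices would separate the two pairs.
    no-bad₄ : ∀ {p q r s} → Distinct₄ p q r s → ¬ p ~ r → ¬ p ~ s → ¬ q ~ r → ¬ q ~ s → ⊥
    no-bad₄ {p} {q} {r} {s} (pq , rs , pr , ps , qr , qs) ¬pr ¬ps ¬qr ¬qs
      with new (p ∷ q ∷ r ∷ s ∷ []) (ℕ.m≤m+n 5 2)
    ... | a , a∉ with new (a ∷ p ∷ q ∷ r ∷ s ∷ []) (ℕ.m≤m+n 6 1)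
    ... | b , b∉ with new (b ∷ a ∷ p ∷ q ∷ r ∷ s ∷ []) ℕ.≤-refl
    ... | c , c∉ = noSep good (_∈? (p ∷ q ∷ [])) c b a closed
        (p , q , pq , (0th , λ { 0th → c∉ 2nd ; 1st → b∉ 1st ; 2nd → a∉ 0th })
                    , (1st , λ { 0th → c∉ 3rd ; 1st → b∉ 2nd ; 2nd → a∉ 1st }))
        (r , s , rs , ((λ { 0th → pr refl ; 1st → qr refl }) , λ { 0th → c∉ 4th ; 1st → b∉ 3rd ; 2nd → a∉ 2nd })
                    , ((λ { 0th → ps refl ; 1st → qs refl }) , λ { 0th → c∉ 5th ; 1st → b∉ 4th ; 2nd → a∉ 3rd }))
      where
      everything : ∀ v → v ∈ c ∷ b ∷ a ∷ p ∷ q ∷ r ∷ s ∷ []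
      everything = all-seven (c∉ ∷ b∉ ∷ a∉ ∷ (pq ,, pr ,, ps ,, ∉[]) ∷ (qr ,, qs ,, ∉[]) ∷ (rs ,, ∉[]) ∷ ∉[] ∷ []) refl
      closed : ∀ {u v} → u ∈ p ∷ q ∷ [] → u ~ v → v ∈ p ∷ q ∷ [] ⊎ v ∈ c ∷ b ∷ a ∷ []
      closed {u} {v} m e with everything v
      ... | 0th = inj₂ 0th
      ... | 1st = inj₂ 1st
      ... | 2nd = inj₂ 2nd
      ... | 3rd = inj₁ 0th
      ... | 4th = inj₁ 1st
      ... | 5th = ⊥-elim (case m of λ { 0th → ¬pr e ; 1st → ¬qr e })
      ... | there 5th = ⊥-elim (case m of λ { 0th → ¬ps e ; 1st → ¬qs e })

    no-bad₅ : ∀ {v p q r s} → Distinct₅ v p q r s → ¬ v ~ p → ¬ v ~ q → ¬ v ~ r → ¬ v ~ s → ⊥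
    no-bad₅ {v} {p} {q} {r} {s} ((vp , vq , vr , vs) , pq , rs , pr , ps , qr , qs) ¬p ¬q ¬r ¬s
      with new (v ∷ p ∷ q ∷ r ∷ s ∷ []) (ℕ.m≤m+n 6 1)
    ... | a , a∉ with new (a ∷ v ∷ p ∷ q ∷ r ∷ s ∷ []) ℕ.≤-refl
    ... | b , b∉ =
        let everything : ∀ w → w ∈ b ∷ a ∷ v ∷ p ∷ q ∷ r ∷ s ∷ []
            everything = all-seven (b∉ ∷ a∉ ∷ (vp ,, vq ,, vr ,, vs ,, ∉[]) ∷ (pq ,, pr ,, ps ,, ∉[]) ∷ (qr ,, qs ,, ∉[]) ∷ (rs ,, ∉[]) ∷ ∉[] ∷ []) refl
        in few {v} {b} {a} λ {w} e → case everything w of λ where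
             0th → 0th
             1st → 1st
             2nd → ⊥-elim (~≢ e refl)
             3rd → ⊥-elim (¬p e)
             4th → ⊥-elim (¬q e)
             5th → ⊥-elim (¬r e)
             (there 5th) → ⊥-elim (¬s e)

    module AtCubic {v a b c : V} (Nv : Nb G v (a ∷ b ∷ c ∷ [])) where
      v∉ : v ∉ a ∷ b ∷ c ∷ []
      v∉ 0th = ~≢ (proj₁ (all₃ Nv)) refl
      v∉ 1st = ~≢ (proj₁ (proj₂ (all₃ Nv))) refl
      v∉ 2nd = ~≢ (proj₂ (proj₂ (all₃ Nv))) refl
      dd : ∃ λ d → d ∉ v ∷ a ∷ b ∷ c ∷ []
      dd = new (v ∷ a ∷ b ∷ c ∷ []) (ℕ.m≤m+n 5 2)
      d : V
      d = proj₁ dd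
      ee : ∃ λ e → e ∉ d ∷ v ∷ a ∷ b ∷ c ∷ []
      ee = new (d ∷ v ∷ a ∷ b ∷ c ∷ []) (ℕ.m≤m+n 6 1)
      e : V
      e = proj₁ ee
      ff : ∃ λ f → f ∉ e ∷ d ∷ v ∷ a ∷ b ∷ c ∷ []
      ff = new (e ∷ d ∷ v ∷ a ∷ b ∷ c ∷ []) ℕ.≤-refl
      f : V
      f = proj₁ ff

      listing : List V
      listing = f ∷ e ∷ d ∷ v ∷ a ∷ b ∷ c ∷ []
      listing-fresh : Fresh listing
      listing-fresh = proj₂ ff ∷ proj₂ ee ∷ proj₂ dd ∷ v∉ ∷
        (proj₁ (≢₃ Nv) ,, proj₁ (proj₂ (≢₃ Nv)) ,, ∉[]) ∷ (proj₂ (proj₂ (≢₃ Nv)) ,, ∉[]) ∷ ∉[] ∷ []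

      -- Reorders the listing as `v`, then its non-neighbours `d`, `e`, `f`, then its neighbours
      -- `a`, `b`, `c`: the labelling that the search assumes.
      ρ : Map₇
      ρ = 3F ∷ 2F ∷ 1F ∷ 0F ∷ 4F ∷ 5F ∷ 6F ∷ []

      ℓ : Fin 7 → V
      ℓ i = Data.List.lookup listing (lookup ρ i)

      ℓ-inj : ∀ {i j} → ℓ i ≡ ℓ j → i ≡ j
      ℓ-inj {i} {j} p = from-yes (injective₇? ρ) i j (fresh-injective listing-fresh p)

      t : Fin 7 → Fin 7 → Bool
      t i j = adj G (ℓ i) (ℓ j)

      M : Tri 7
      M = triangular t

      M-entry : ∀ i j → entry M i j ≡ t i j
      M-entry = entry-triangular t (λ i j → adj-sym G (ℓ i) (ℓ j)) (λ i → irref G (ℓ i))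

      apart : ∀ {w} → w ∉ a ∷ b ∷ c ∷ [] → adj G v w ≡ false
      apart {w} w∉ with adj G v w in k
      ... | false = refl
      ... | true = ⊥-elim (w∉ (Nv k))

      row₀ : Vec.tabulate (λ j → t 0F (suc j)) ≡ false ∷ false ∷ false ∷ true ∷ true ∷ true ∷ []
      row₀ = cong₂ _∷_ (apart (proj₂ dd ∘ there)) (cong₂ _∷_ (apart (λ m → proj₂ ee (there (there m))))
        (cong₂ _∷_ (apart (λ m → proj₂ ff (there (there (there m))))) (cong₂ _∷_ (proj₁ (all₃ Nv))
        (cong₂ _∷_ (proj₁ (proj₂ (all₃ Nv))) (cong₂ _∷_ (proj₂ (proj₂ (all₃ Nv))) refl)))))

      off : ∀ {i j} → entry M i j ≡ false → ¬ ℓ i ~ ℓ j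
      off {i} {j} p q = true≢false (trans (sym (trans (M-entry i j) q)) p)

      Copies : Set
      Copies = Copy G pyramid-edges ⊎ Copy G kite-edges

      from-outcome : Outcome M → Copies
      from-outcome (four i j k l (x₁ , x₂ , x₃ , x₄ , x₅ , x₆) ik il jk jl) = ⊥-elim (no-bad₄ {ℓ i} {ℓ j} {ℓ k} {ℓ l}
        (x₁ ∘ ℓ-inj , x₂ ∘ ℓ-inj , x₃ ∘ ℓ-inj , x₄ ∘ ℓ-inj , x₅ ∘ ℓ-inj , x₆ ∘ ℓ-inj)
        (off {i} {k} ik) (off {i} {l} il) (off {j} {k} jk) (off {j} {l} jl))
      from-outcome (five i j k l o ((x₁ , x₂ , x₃ , x₄) , y₁ , y₂ , y₃ , y₄ , y₅ , y₆) ij ik il io) = ⊥-elim (no-bad₅ {ℓ i} {ℓ j} {ℓ k} {ℓ l} {ℓ o}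
        ((x₁ ∘ ℓ-inj , x₂ ∘ ℓ-inj , x₃ ∘ ℓ-inj , x₄ ∘ ℓ-inj) ,
          y₁ ∘ ℓ-inj , y₂ ∘ ℓ-inj , y₃ ∘ ℓ-inj , y₄ ∘ ℓ-inj , y₅ ∘ ℓ-inj , y₆ ∘ ℓ-inj)
        (off {i} {j} ij) (off {i} {k} ik) (off {i} {l} il) (off {i} {o} io))
      from-outcome (copied {E} which π injective on) =
          let copy : Copy G E
              copy = record
                { h = λ i → ℓ (lookup π i) ; inj = λ r → injective _ _ (ℓ-inj r)
                ; onE = λ {i} {j} m → trans (sym (M-entry (lookup π i) (lookup π j))) (on m) }
          in [ (λ p → inj₁ (subst (Copy G) p copy)) , (λ p → inj₂ (subst (Copy G) p copy)) ]′ which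

      copies : Copies
      copies = from-outcome (outcome₇ M row₀)

    -- When all degrees are at least 4, the complement has maximum degree 2; an edge uv can be
    -- deleted unless the complement has a path of length 3 from u to v.
    module NoCubic (all₄ : ∀ v → Deg₄ G v) where
      abstract
        -- Besides `u` and four of its neighbours only two vertices remain.
        two-non : ∀ u → ∃₂ λ p q → ∀ {w} → w ≢ u → ¬ u ~ w → w ∈ p ∷ q ∷ []
        two-non u with beyond (all₄ u) u u u
        ... | a , ua , a∉ with beyond (all₄ u) a a a
        ... | b , ub , b∉ with beyond (all₄ u) a b b
        ... | c , uc , c∉ with beyond (all₄ u) a b c
        ... | d , ud , d∉ with new (d ∷ c ∷ b ∷ a ∷ u ∷ []) (ℕ.m≤m+n 6 1)
        ... | p , p∉ with new (p ∷ d ∷ c ∷ b ∷ a ∷ u ∷ []) ℕ.≤-refl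
        ... | q , q∉ =
            let ne : ∀ {x} → u ~ x → x ≢ u
                ne e = ~≢ e ∘ sym
                everything : ∀ w → w ∈ q ∷ p ∷ d ∷ c ∷ b ∷ a ∷ u ∷ []
                everything = all-seven (q∉ ∷ p∉ ∷ ((d∉ ∘ λ { refl → 2nd }) ,, (d∉ ∘ λ { refl → 1st }) ,, (d∉ ∘ λ { refl → 0th }) ,, ne ud ,, ∉[])
                  ∷ ((c∉ ∘ λ { refl → 1st }) ,, (c∉ ∘ λ { refl → 0th }) ,, ne uc ,, ∉[])
                  ∷ ((b∉ ∘ λ { refl → 0th }) ,, ne ub ,, ∉[]) ∷ (ne ua ,, ∉[]) ∷ ∉[] ∷ []) refl
            in p , q , λ {w} w≢ ¬e → case everything w of λ where
                 0th → 1st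
                 1st → 0th
                 2nd → ⊥-elim (¬e ud)
                 3rd → ⊥-elim (¬e uc)
                 4th → ⊥-elim (¬e ub)
                 5th → ⊥-elim (¬e ua)
                 (there 5th) → ⊥-elim (w≢ refl)

      the-other : V → V → V → V
      the-other p q z with p ≟ z
      ... | yes _ = q
      ... | no _ = p

      the-other-spec : ∀ {p q y z} → z ∈ p ∷ q ∷ [] → y ∈ p ∷ q ∷ [] → y ≢ z → y ≡ the-other p q z
      the-other-spec {p} {q} {y} {z} z∈ y∈ y≢z with p ≟ z
      the-other-spec z∈ 0th y≢z | yes p≡z = ⊥-elim (y≢z p≡z)
      the-other-spec z∈ 1st y≢z | yes p≡z = refl
      the-other-spec 0th y∈ y≢z | no p≢z = ⊥-elim (p≢z refl)
      the-other-spec 1st 0th y≢z | no p≢z = refl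
      the-other-spec 1st 1st y≢z | no p≢z = ⊥-elim (y≢z refl)

      -- For a non-neighbour `z` of `w`, the only other possible non-neighbour of `w`: one step of a
      -- path in the complement.
      partner : V → V → V
      partner w z = the-other (proj₁ (two-non w)) (proj₁ (proj₂ (two-non w))) z

      partner-spec : ∀ {w z y} → z ≢ w → ¬ w ~ z → y ≢ w → ¬ w ~ y → y ≢ z → y ≡ partner w z
      partner-spec {w} z≢ ¬z y≢ ¬y y≢z = the-other-spec (proj₂ (proj₂ (two-non w)) z≢ ¬z) (proj₂ (proj₂ (two-non w)) y≢ ¬y) y≢z

      deletable : V → Deletable G
      deletable u = u , v , uv , Deletion.del-good u v uv (all₄ u) (all₄ v) no-del (no-del ∘ flip-del)
        where
        p q p′ q′ : V
        p = proj₁ (two-non u)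
        q = proj₁ (proj₂ (two-non u))
        -- `p′` and `q′` are the possible ends of the paths of length three in the complement that
        -- start at `u` through `p` or `q`. With `u`, `p`, `q` there are five vertices to avoid out
        -- of seven.
        p′ = partner (partner p u) p
        q′ = partner (partner q u) q
        vv : ∃ λ v → v ∉ u ∷ p ∷ q ∷ p′ ∷ q′ ∷ []
        vv = new (u ∷ p ∷ q ∷ p′ ∷ q′ ∷ []) (ℕ.m≤m+n 6 1)
        v : V
        v = proj₁ vv
        v∉ : v ∉ u ∷ p ∷ q ∷ p′ ∷ q′ ∷ []
        v∉ = proj₂ vv
        uv : u ~ v
        uv = case u ~? v of λ where
          (yes e) → e
          (no ¬e) → case proj₂ (proj₂ (two-non u)) (λ r → v∉ (here r)) ¬e of λ where
            (here r) → ⊥-elim (v∉ (there (here r)))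
            (there (here r)) → ⊥-elim (v∉ (there (there (here r))))
        no-del : ¬ DelSep G u v
        no-del D with DelSep.los D | DelSep.his D
        ... | b , b≢u , kb | d , d≢v , kd =
            let
                open DelSep D using (κ; κx; κy; cut)
                d≢u : d ≢ u
                d≢u = ≢-by κ kd κx hi≢lo
                ud : ¬ u ~ d
                ud e = d≢v (proj₂ (cut κx kd e))
                bd : ¬ b ~ d
                bd e = b≢u (proj₁ (cut kb kd e))
                bv : ¬ b ~ v
                bv e = b≢u (proj₁ (cut kb κy e))
                -- In the complement `u`, `d`, `b`, `v` is a path of length three, so `v` would be
                -- `p′` or `q′`.
                b≡ : b ≡ partner d u
                b≡ = partner-spec {d} {u} (d≢u ∘ sym) (ud ∘ ~sym) (≢-by κ kb kd lo≢hi) (bd ∘ ~sym) b≢u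
                v≡ : v ≡ partner b d
                v≡ = partner-spec {b} {d} (≢-by κ kd kb hi≢lo) bd (≢-by κ κy kb hi≢lo) bv (d≢v ∘ sym)
                v≡′ : v ≡ partner (partner d u) d
                v≡′ = trans v≡ (cong (λ z → partner z d) b≡)
                path : d ∈ p ∷ q ∷ [] → ⊥
                path = λ where
                  (here r) → v∉ (there (there (there (here (trans v≡′ (cong (λ z → partner (partner z u) z) r))))))
                  (there (here r)) → v∉ (there (there (there (there (here (trans v≡′ (cong (λ z → partner (partner z u) z) r)))))))
            in path (proj₂ (proj₂ (two-non u)) d≢u ud)

    Cubic : Set
    Cubic = ∃ λ v → ∃ λ a → ∃ λ b → ∃ λ c → ∀ w → v ~ w → w ∈ a ∷ b ∷ c ∷ []

    cubic? : Dec Cubic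
    cubic? = any? λ v → any? λ a → any? λ b → any? λ c → all? λ w → (v ~? w) →-dec (w ∈? (a ∷ b ∷ c ∷ []))

    outcome : (G ≅ Pyramid ⊎ G ≅ Kite) ⊎ Deletable G
    outcome = case cubic? of λ where
      (no ¬c) → inj₂ (NoCubic.deletable (λ v a b c N → ¬c (v , a , b , c , λ _ → N)) (proj₁ (new [] (s≤s z≤n))))
      (yes (v , a , b , c , N)) → case AtCubic.copies {v} {a} {b} {c} (λ {w} → N w) of λ where
        (inj₁ C) → Data.Sum.map₁ inj₁ (copy-result pyramid-shape G n≡7 C)
        (inj₂ C) → Data.Sum.map₁ inj₂ (copy-result kite-shape G n≡7 C)

-- Assembling the chain.

data Chain : Graph → Set where
  stop : ∀ {G} → Quasi4Connected G → G ≅ Pyramid ⊎ G ≅ Kite → Chain G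
  link : ∀ {G} H → Quasi4Connected G → H ≼ G → edgeCount H + 1 ≡ edgeCount G ⊎ O3Step G H → Chain H → Chain G

rich-not-cubic : ∀ {G} → Rich G → ¬ (∀ v → ∃ λ a → ∃ λ b → ∃ λ c → Nb G v (a ∷ b ∷ c ∷ []))
rich-not-cubic (v , v₄) cubic = let a , b , c , N = cubic v in v₄ a b c N

-- `N` and `E` bound the numbers of vertices and edges for the lexicographic induction. Richness is
-- asked for from eight vertices on, where `reduce` could otherwise end in 𝒜.
chain : ∀ N E G → n G ≤ N → edgeCount G ≤ E → Good G → (8 ≤ n G → Rich G) → Chain G
chain-after : ∀ N E G → n G ≤ N → edgeCount G ≤ E → Good G → Reduction G → Chain G

chain N E G n≤ e≤ good rich with 8 ℕ.≤? n G
... | yes 8≤n with InGood.Large.reduce G good 8≤n (proj₁ (On.fresh G [] (ℕ.≤-trans (s≤s z≤n) 8≤n)))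
... | inj₁ R = chain-after N E G n≤ e≤ good R
... | inj₂ (_ , cubic) = ⊥-elim (rich-not-cubic {G} (rich 8≤n) cubic)
chain N E G n≤ e≤ good rich | no n<8 with InGood.Seven.outcome G good (ℕ.≤-antisym (ℕ.≤-pred (ℕ.≰⇒> n<8)) (big good))
... | inj₁ iso = stop (good⇒quasi G good) iso
... | inj₂ (x , y , xy , good′) =
    let del-edge : edgeCount (Delete.del G x y) + 1 ≡ edgeCount G
        del-edge = Delete.del-edges G x y xy
        go : ∀ E → edgeCount G ≤ E → Chain G
        go = λ where
          zero e≤ → ⊥-elim (ℕ.<⇒≱ (ℕ.≤-trans (ℕ.m≤n+m 1 _) (ℕ.≤-reflexive del-edge)) e≤)
          (suc E) e≤ → link (Delete.del G x y) (good⇒quasi G good) (delete-minor G x y) (inj₁ del-edge)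
            (chain N E (Delete.del G x y) n≤ (ℕ.≤-pred (ℕ.≤-trans (ℕ.≤-reflexive (trans (ℕ.+-comm 1 _) del-edge)) e≤)) good′
              (λ 8≤n → ⊥-elim (n<8 8≤n)))
    in go E e≤

chain-after N E G n≤ e≤ good R =
    let
        open Reduction R
        rest : ∀ N E → n G ≤ N → edgeCount G ≤ E → suc (n H) ≡ n G ⊎ (n H ≡ n G × edgeCount H + 1 ≡ edgeCount G) → Chain H
        rest = λ where
          zero E n≤ e≤ _ → ⊥-elim (ℕ.<⇒≱ (ℕ.≤-trans (s≤s z≤n) (big good)) n≤)
          -- When a vertex is lost, the edge bound is chosen anew.
          (suc N) E n≤ e≤ (inj₁ eq) → chain N (edgeCount H) H (ℕ.≤-pred (ℕ.≤-trans (ℕ.≤-reflexive eq) n≤)) ℕ.≤-refl good-H (λ _ → rich-H)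
          (suc N) zero n≤ e≤ (inj₂ (_ , eq)) → ⊥-elim (ℕ.<⇒≱ (ℕ.≤-trans (ℕ.m≤n+m 1 _) (ℕ.≤-reflexive eq)) e≤)
          (suc N) (suc E) n≤ e≤ (inj₂ (eq , eq′)) → chain (suc N) E H (ℕ.≤-trans (ℕ.≤-reflexive eq) n≤)
            (ℕ.≤-pred (ℕ.≤-trans (ℕ.≤-reflexive (trans (ℕ.+-comm 1 _) eq′)) e≤)) good-H (λ _ → rich-H)
    in link (Reduction.H R) (good⇒quasi G good) (Reduction.minor R) (Reduction.step R) (rest N E n≤ e≤ (Reduction.smaller R))

Sequence : Graph → Set
Sequence G = Σ ℕ λ t → Σ (ℕ → Graph) λ Gs →
    Gs zero ≡ G
    × (∀ i → i ≤ t → Quasi4Connected (Gs i))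
    × (∀ i → i < t →
    (Gs (suc i) ≼ Gs i)
    × (edgeCount (Gs (suc i)) + 1 ≡ edgeCount (Gs i) ⊎ O3Step (Gs i) (Gs (suc i))))
    × (Gs t ≅ Pyramid ⊎ Gs t ≅ Kite)

sequence : ∀ {G} → Chain G → Sequence G
sequence {G} (stop q iso) = 0 , (λ _ → G) , refl , (λ _ _ → q) , (λ _ ()) , iso
sequence {G} (link H q minor step c) with sequence c
... | t , Gs , refl , quasi , steps , iso =
    let Gs′ : ℕ → Graph
        Gs′ = λ where
          zero → G
          (suc i) → Gs i
        quasi′ : ∀ i → i ≤ suc t → Quasi4Connected (Gs′ i)
        quasi′ = λ where
          zero _ → q
          (suc i) (s≤s le) → quasi i le
        steps′ : ∀ i → i < suc t → (Gs′ (suc i) ≼ Gs′ i) × (edgeCount (Gs′ (suc i)) + 1 ≡ edgeCount (Gs′ i) ⊎ O3Step (Gs′ i) (Gs′ (suc i)))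
        steps′ = λ where
          zero _ → minor , step
          (suc i) (s≤s lt) → steps i lt
    in suc t , Gs′ , refl , quasi′ , steps′ , iso

theorem17 : (G : Graph) → Quasi4Connected G → ¬ In𝒢₆ G → ¬ In𝒜 G →
    Σ ℕ λ t → Σ (ℕ → Graph) λ Gs →
    Gs zero ≡ G
    × (∀ i → i ≤ t → Quasi4Connected (Gs i))
    × (∀ i → i < t →
    (Gs (suc i) ≼ Gs i)
    × (edgeCount (Gs (suc i)) + 1 ≡ edgeCount (Gs i) ⊎ O3Step (Gs i) (Gs (suc i))))
    × (Gs t ≅ Pyramid ⊎ Gs t ≅ Kite)
theorem17 G q ¬6 ¬𝒜 = sequence first
  where
  good : Good G
  good = quasi⇒good G q (ℕ.≰⇒> λ le → ¬6 (proj₁ q , le))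
  first : Chain G
  -- The given graph may be cubic, so at the first step the hypothesis takes the place of richness
  -- in excluding 𝒜.
  first with 8 ℕ.≤? n G
  ... | no n<8 = chain (n G) (edgeCount G) G ℕ.≤-refl ℕ.≤-refl good (λ 8≤n → ⊥-elim (n<8 8≤n))
  ... | yes 8≤n with InGood.Large.reduce G good 8≤n (proj₁ (On.fresh G [] (ℕ.≤-trans (s≤s z≤n) 8≤n)))
  ... | inj₁ R = chain-after (n G) (edgeCount G) G ℕ.≤-refl ℕ.≤-refl good R
  ... | inj₂ (in𝒜 , _) = ⊥-elim (¬𝒜 in𝒜)
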